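{- Let $P,Q\in\mathbb{Z}[x]$ and let $\mathcal{F}_k: P(x)k+Q(x)=y^2$ be the associated family of curves. Then for every prime number $p$ the second moment sum $M_{2,p}(\mathcal{F}_k)$ is motivic, i.e. the power series $$Z(T)=\exp\Big(\sum_{i\ge 1}\frac{M_{2,p^i}(\mathcal{F}_k)}{i}T^i\Big)$$ is a rational function, $Z(T)\in\mathbb{Q}(T)$.
   Context: For a prime power $q=p^r$ the polynomials $P,Q$ are reduced modulo $p$ and regarded over $\mathbb{F}_q$. For $k\in\mathbb{F}_q$ put $a_{k,q}=q+1-\#\mathcal{F}_k(\mathbb{F}_q)$, where $\#\mathcal{F}_k(\mathbb{F}_q)$ counts the affine solutions plus one point at infinity, i.e. $a_{k,q}=q-\#\{(x,y)\in\mathbb{F}_q^2: y^2=P(x)k+Q(x)\}$. The second moment is $M_{2,q}(\mathcal{F}_k)=\sum_{k\in\mathbb{F}_q}a_{k,q}^2$. The sum is called motivic if the associated zeta function $Z(T)$ above is rational. -}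

module Defs where

open import Level using (0ℓ)
open import Algebra.Bundles using (CommutativeRing)
open import Data.Nat as ℕ using (ℕ; zero; suc; _!; _^_)
open import Data.Nat.Properties using (_!≢0)
open import Data.Integer as ℤ using (ℤ; +_; -[1+_])
open import Data.Rational as ℚ using (ℚ)
open import Data.Fin using (Fin)
open import Data.List using (List; []; _∷_)
open import Data.Product using (∃; Σ; _×_)
open import Relation.Nullary using (¬_; does)
open import Relation.Binary.Definitions using (Decidable)
open import Relation.Binary.PropositionalEquality using (_≡_)

record FiniteField (q : ℕ) : Set₁ where
  field
    commRing : CommutativeRing 0ℓ 0ℓ
  open CommutativeRing commRing public
  field
    _≈?_      : Decidable _≈_
    1≉0       : ¬ (1# ≈ 0#)
    inverse   : ∀ x → ¬ (x ≈ 0#) → ∃ λ y → (x * y) ≈ 1#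
    enum      : Fin q → Carrier
    enum-surj : ∀ x → ∃ λ i → enum i ≈ x
    enum-inj  : ∀ i j → enum i ≈ enum j → i ≡ j

sumFinℤ : (n : ℕ) → (Fin n → ℤ) → ℤ
sumFinℤ zero    f = + 0
sumFinℤ (suc n) f = f Fin.zero ℤ.+ sumFinℤ n (λ i → f (Fin.suc i))
  where import Data.Fin as Fin

sumFinℕ : (n : ℕ) → (Fin n → ℕ) → ℕ
sumFinℕ zero    f = 0
sumFinℕ (suc n) f = f Fin.zero ℕ.+ sumFinℕ n (λ i → f (Fin.suc i))
  where import Data.Fin as Fin

-- Integer polynomials: list of coefficients, constant term first.
ZPoly : Set
ZPoly = List ℤ

module _ {q : ℕ} (K : FiniteField q) where
  open FiniteField K

  ℕ→K : ℕ → Carrier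
  ℕ→K zero    = 0#
  ℕ→K (suc n) = 1# + ℕ→K n

  ℤ→K : ℤ → Carrier
  ℤ→K (+ n)      = ℕ→K n
  ℤ→K -[1+ n ]   = - ℕ→K (suc n)

  evalK : ZPoly → Carrier → Carrier
  evalK []       x = 0#
  evalK (c ∷ cs) x = ℤ→K c + x * evalK cs x

  affineCount : ZPoly → ZPoly → Carrier → ℕ
  affineCount P Q k =
    sumFinℕ q λ i → sumFinℕ q λ j →
      let x = enum i ; y = enum j in
      if does ((y * y) ≈? ((evalK P x * k) + evalK Q x)) then 1 else 0
    where open import Data.Bool using (if_then_else_)

  aCoeff : ZPoly → ZPoly → Carrier → ℤ
  aCoeff P Q k = + q ℤ.- + affineCount P Q k

  secondMoment : ZPoly → ZPoly → ℤ
  secondMoment P Q = sumFinℤ q λ i → let a = aCoeff P Q (enum i) in a ℤ.* a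

PowerSeries : Set
PowerSeries = ℕ → ℚ

sumUpTo : ℕ → (ℕ → ℚ) → ℚ
sumUpTo zero    f = f 0
sumUpTo (suc n) f = sumUpTo n f ℚ.+ f (suc n)

_⊛_ : PowerSeries → PowerSeries → PowerSeries
(f ⊛ g) n = sumUpTo n (λ i → f i ℚ.* g (n ℕ.∸ i))

psOne : PowerSeries
psOne zero    = ℚ.1ℚ
psOne (suc n) = ℚ.0ℚ

psPow : PowerSeries → ℕ → PowerSeries
psPow f zero    = psOne
psPow f (suc n) = f ⊛ psPow f n

-- exp(S) = Σ_n S^n / n!  for S with zero constant term; the coefficient
-- of T^m only receives contributions from n ≤ m.
psExp : PowerSeries → PowerSeries
psExp S m = sumUpTo m (λ n → psPow S n m ℚ.* ((+ 1) ℚ./ (n !)) {{n !≢0}})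

coeff : List ℚ → ℕ → ℚ
coeff []       _       = ℚ.0ℚ
coeff (c ∷ cs) zero    = c
coeff (c ∷ cs) (suc n) = coeff cs n

IsRationalSeries : PowerSeries → Set
IsRationalSeries Z =
  Σ (List ℚ) λ N → Σ (List ℚ) λ D →
    (∃ λ i → ¬ (coeff D i ≡ ℚ.0ℚ)) × (∀ m → (coeff D ⊛ Z) m ≡ coeff N m)

-- Z(T) = exp( Σ_{i ≥ 1} M_{2,p^i} / i · T^i ), where K r is a field with p^(r+1)
-- elements, so M i (i ≥ 1) is computed in K (i - 1).
zetaSeries : (p : ℕ) → ((r : ℕ) → FiniteField (p ^ suc r)) → ZPoly → ZPoly → PowerSeries
zetaSeries p K P Q = psExp S
  where
    S : PowerSeries
    S zero    = ℚ.0ℚ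
    S (suc r) = secondMoment (K r) P Q ℚ./ suc r

{-# OPTIONS --safe #-}
-- For p = 2 squaring is a bijection of 𝔽_q, so every a_{k,q} vanishes. For odd p = 2e + 1 and q = p ^ (r + 1) let χ be the
-- quadratic character and f = (P(x) k + Q(x)) (P(x′) k + Q(x′)); then M_{2,q} is the sum of χ(f) over 𝔽_q³.
--
-- Lift to ℤ[𝔽_q]: modulo the (N + 1)-st power of the kernel of ℤ[𝔽_q] → 𝔽_q, which meets ℤ in p ^ (N + 1) ℤ, the value
-- χ(f) is the product over j ≤ r of f(x ^ (p ^ j)) ^ (e p ^ N). Writing f(x) ^ p = f(x ^ p) + p Δ(x) and expanding
-- binomially gives a matrix indexed by pole orders 0, …, m whose row κ is divisible by about p ^ (κ / 2), uniformly in N.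
-- Eliminating columns turns it into a triangular matrix whose corner entry is f ^ (e p ^ N) and whose remaining block does
-- not involve f; so the product above is a difference of two traces. Followed by the operator x ^ (p v) ↦ x ^ v on
-- monomials, the sum over points becomes a difference of traces of (r + 1)-st powers of integer matrices that do not
-- depend on r.
--
-- Hence, modulo every power of p, Z is a quotient of Fredholm determinants det(1 − T A′) / det(1 − T A) whose n-th
-- coefficients are divisible by p ^ (n L) once n exceeds a fixed polynomial in L. By Siegel's lemma some nonzero integral
-- polynomial a of degree at most 2h makes the coefficients of a Z vanish in degrees 2h + 1, …, 3h. The later ones
-- vanish one after the other, being highly divisible by p and, as ∣M_{2,q}∣ ≤ q³, too small to be nonzero. Factorials are
-- cleared by working with n! times the n-th coefficient (Hurwitz series).
module Submission where

open import Defs using (PowerSeries; sumUpTo; _⊛_; psOne; psPow; psExp; coeff; IsRationalSeries; FiniteField; ℕ→K; ℤ→K; ZPoly; evalK; sumFinℕ; sumFinℤ; aCoeff; secondMoment; zetaSeries)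
open import Level using (0ℓ)
open import Algebra.Bundles using (CommutativeRing; CommutativeMonoid)
open import Data.Nat.Base as ℕ using (ℕ; zero; suc; z≤n; s≤s)
import Data.Nat.Properties as ℕₚ
import Data.Nat.Divisibility as ℕD
open import Data.Integer.Base as ℤ using (ℤ; +_; -[1+_])
import Data.Integer.Properties as ℤₚ
import Data.Integer.Divisibility.Signed as ℤD
open import Data.List.Base as List using (List; []; _∷_; _++_; map; concatMap; length; downFrom)
open import Data.List.Membership.Propositional using (_∈_)
open import Data.List.Relation.Unary.Any as Any using (here; there)
open import Data.List.Relation.Unary.All as All using (All; []; _∷_)
open import Data.Vec.Base as Vec using (Vec; []; _∷_)
open import Data.Fin.Base as Fin using (Fin)
open import Data.Bool.Base using (Bool; true; false; if_then_else_)
open import Data.Product.Base using (Σ; ∃; _×_; _,_; proj₁; proj₂)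
open import Data.Sum.Base using (_⊎_; inj₁; inj₂)
open import Data.Empty using (⊥; ⊥-elim)
open import Relation.Nullary using (¬_; Dec; yes; no; does)
open import Relation.Binary.Definitions using (DecidableEquality)
import Relation.Binary.PropositionalEquality as ≡
open ≡ using (_≡_; _≢_)
open import Function.Base using (_∘_; id)
open import Data.Nat.Primality using (Prime; prime⇒nonTrivial; prime⇒irreducible)
open import Data.Unit.Base using (⊤; tt)

-- The obstacle is uniformity in N. The direct expansion of f ^ (e p ^ N) has degree growing with N
-- and no divisible rows, so its determinant has no tail estimate that survives N → ∞. Put m = e (1
-- + p + ... + p ^ N) and let v(f) be the row of the powers f ^ (m - κ), 0 ≤ κ ≤ m. Since p m + e =
-- m + e p ^ (N + 1), expanding f ^ (p m + e - κ) in powers of f′ = f(x ^ p) gives a matrix X with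
-- v(f′) X = f ^ (e p ^ (N + 1)) v(f). So v is a twisted left eigenvector, and X respects the
-- relations f ^ (m - κ) = f · f ^ (m - κ - 1), on which it acts by a matrix built from p and Δ. The
-- wanted power is the difference of the two actions, and the number of rows of bounded weight is
-- bounded independently of N. No p-adic limit is formed: each coefficient of a Z is treated at a
-- precision and with matrices of its own, and only the bounds are shared. The group-like elements
-- of ℤ[𝔽_q] play the role of Teichmüller representatives, and convolution powers of the trace
-- detect the filtration, so Witt vectors are not constructed.

module IntegerSolver (R : CommutativeRing 0ℓ 0ℓ) where
  open CommutativeRing R hiding (zero)
  open import Algebra.Properties.Semiring.Mult.TCOptimised semiring using (1+×; ×-homo-+; ×1-homo-*) renaming (_×_ to _·_)
  open import Algebra.Properties.Ring (CommutativeRing.ring R) using (-‿distribˡ-*; -‿distribʳ-*; -0#≈0#; -‿involutive)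
  open import Algebra.Properties.AbelianGroup +-abelianGroup using () renaming (⁻¹-∙-comm to -‿+-comm)
  open import Algebra.Solver.Ring.AlmostCommutativeRing using (fromCommutativeRing; _-Raw-AlmostCommutative⟶_)
  open import Relation.Binary.Reasoning.Setoid setoid
  open import Data.Maybe.Base using (Maybe; just; nothing)

  fromℤ : ℤ → Carrier
  fromℤ (+ n)    = n · 1#
  fromℤ -[1+ n ] = - (suc n · 1#)

  fromℤ-⊖ : ∀ m n → fromℤ (m ℤ.⊖ n) ≈ m · 1# - n · 1#
  fromℤ-⊖ m zero = begin
    m · 1#       ≈⟨ +-identityʳ _ ⟨
    m · 1# + 0#  ≈⟨ +-congˡ -0#≈0# ⟨
    m · 1# - 0#  ∎
  fromℤ-⊖ zero (suc n) = sym (+-identityˡ _)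
  fromℤ-⊖ (suc m) (suc n) = begin
    fromℤ (suc m ℤ.⊖ suc n)               ≈⟨ reflexive (≡.cong fromℤ (ℤₚ.[1+m]⊖[1+n]≡m⊖n m n)) ⟩
    fromℤ (m ℤ.⊖ n)                       ≈⟨ fromℤ-⊖ m n ⟩
    m · 1# - n · 1#                       ≈⟨ +-congʳ (+-identityˡ _) ⟨
    0# + m · 1# - n · 1#                  ≈⟨ +-congʳ (+-congʳ (-‿inverseʳ 1#)) ⟨
    1# - 1# + m · 1# - n · 1#             ≈⟨ +-congʳ (trans (+-assoc _ _ _) (trans (+-congˡ (+-comm _ _)) (sym (+-assoc _ _ _)))) ⟩
    1# + m · 1# - 1# - n · 1#             ≈⟨ trans (+-assoc _ _ _) (+-congˡ (-‿+-comm _ _)) ⟩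
    1# + m · 1# - (1# + n · 1#)           ≈⟨ +-cong (1+× m 1#) (-‿cong (1+× n 1#)) ⟨
    suc m · 1# - suc n · 1#               ∎

  fromℤ-- : ∀ i → fromℤ (ℤ.- i) ≈ - fromℤ i
  fromℤ-- (+ zero)   = sym -0#≈0#
  fromℤ-- (+ suc n)  = refl
  fromℤ-- -[1+ n ]   = sym (-‿involutive _)

  fromℤ-+ : ∀ i j → fromℤ (i ℤ.+ j) ≈ fromℤ i + fromℤ j
  fromℤ-+ (+ m) (+ n)       = ×-homo-+ 1# m n
  fromℤ-+ (+ m) -[1+ n ]    = fromℤ-⊖ m (suc n)
  fromℤ-+ -[1+ m ] (+ n)    = trans (fromℤ-⊖ n (suc m)) (+-comm _ _)
  fromℤ-+ -[1+ m ] -[1+ n ] = begin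
    - (suc (suc (m ℕ.+ n)) · 1#)         ≈⟨ -‿cong (reflexive (≡.cong (λ k → suc k · 1#) (ℕₚ.+-suc m n))) ⟨
    - ((suc m ℕ.+ suc n) · 1#)           ≈⟨ -‿cong (×-homo-+ 1# (suc m) (suc n)) ⟩
    - (suc m · 1# + suc n · 1#)          ≈⟨ -‿+-comm _ _ ⟨
    - (suc m · 1#) - (suc n · 1#)        ∎

  fromℤ-*⁺ : ∀ m j → fromℤ (+ m ℤ.* j) ≈ m · 1# * fromℤ j
  fromℤ-*⁺ m (+ n) = trans (reflexive (≡.cong fromℤ (≡.sym (ℤₚ.pos-* m n)))) (×1-homo-* m n)
  fromℤ-*⁺ m -[1+ n ] = begin
    fromℤ (+ m ℤ.* -[1+ n ])      ≈⟨ reflexive (≡.cong fromℤ (ℤₚ.neg-distribʳ-* (+ m) (+ suc n))) ⟨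
    fromℤ (ℤ.- (+ m ℤ.* + suc n)) ≈⟨ fromℤ-- (+ m ℤ.* + suc n) ⟩
    - fromℤ (+ m ℤ.* + suc n)     ≈⟨ -‿cong (fromℤ-*⁺ m (+ suc n)) ⟩
    - (m · 1# * (suc n · 1#))     ≈⟨ -‿distribʳ-* _ _ ⟩
    m · 1# * - (suc n · 1#)       ∎

  fromℤ-* : ∀ i j → fromℤ (i ℤ.* j) ≈ fromℤ i * fromℤ j
  fromℤ-* (+ m) j = fromℤ-*⁺ m j
  fromℤ-* -[1+ m ] j = begin
    fromℤ (-[1+ m ] ℤ.* j)        ≈⟨ reflexive (≡.cong fromℤ (ℤₚ.neg-distribˡ-* (+ suc m) j)) ⟨
    fromℤ (ℤ.- (+ suc m ℤ.* j))   ≈⟨ fromℤ-- (+ suc m ℤ.* j) ⟩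
    - fromℤ (+ suc m ℤ.* j)       ≈⟨ -‿cong (fromℤ-*⁺ (suc m) j) ⟩
    - (suc m · 1# * fromℤ j)      ≈⟨ -‿distribˡ-* _ _ ⟩
    - (suc m · 1#) * fromℤ j      ∎

  fromℤ-≟ : ∀ i j → Maybe (fromℤ i ≈ fromℤ j)
  fromℤ-≟ i j with i ℤₚ.≟ j
  ... | yes i≡j = just (reflexive (≡.cong fromℤ i≡j))
  ... | no _    = nothing

  fromℤ-morphism : ℤ.+-*-rawRing -Raw-AlmostCommutative⟶ fromCommutativeRing R
  fromℤ-morphism = record { ⟦_⟧ = fromℤ ; +-homo = fromℤ-+ ; *-homo = fromℤ-* ; -‿homo = fromℤ-- ; 0-homo = refl ; 1-homo = refl }

  open import Algebra.Solver.Ring ℤ.+-*-rawRing (fromCommutativeRing R) fromℤ-morphism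
    fromℤ-≟ public using (solve; _:=_; _:+_; _:*_; _:-_; :-_; con)

-- Finite sums and matrices over commutative rings

module ListSum (R : CommutativeRing 0ℓ 0ℓ) where
  open CommutativeRing R hiding (zero)
  open import Relation.Binary.Reasoning.Setoid setoid
  open IntegerSolver R using (solve; _:=_; _:+_; _:-_; :-_)
  open import Algebra.Properties.Ring (CommutativeRing.ring R) using (-0#≈0#)

  ∑ : {A : Set} → List A → (A → Carrier) → Carrier
  ∑ []       f = 0#
  ∑ (x ∷ xs) f = f x + ∑ xs f

  ∑-cong∈ : {A : Set} (xs : List A) {f g : A → Carrier} → (∀ x → x ∈ xs → f x ≈ g x) → ∑ xs f ≈ ∑ xs g
  ∑-cong∈ []       f≈g = refl
  ∑-cong∈ (x ∷ xs) f≈g = +-cong (f≈g x (here ≡.refl)) (∑-cong∈ xs (λ y y∈ → f≈g y (there y∈)))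

  ∑-cong : {A : Set} (xs : List A) {f g : A → Carrier} → (∀ x → f x ≈ g x) → ∑ xs f ≈ ∑ xs g
  ∑-cong xs f≈g = ∑-cong∈ xs (λ x _ → f≈g x)

  ∑-zero∈ : {A : Set} (xs : List A) {f : A → Carrier} → (∀ x → x ∈ xs → f x ≈ 0#) → ∑ xs f ≈ 0#
  ∑-zero∈ []       f≈0 = refl
  ∑-zero∈ (x ∷ xs) f≈0 = trans (+-cong (f≈0 x (here ≡.refl)) (∑-zero∈ xs (λ y y∈ → f≈0 y (there y∈)))) (+-identityˡ 0#)

  ∑-zero : {A : Set} (xs : List A) {f : A → Carrier} → (∀ x → f x ≈ 0#) → ∑ xs f ≈ 0#
  ∑-zero xs f≈0 = ∑-zero∈ xs (λ x _ → f≈0 x)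

  ∑-+ : {A : Set} (xs : List A) (f g : A → Carrier) → ∑ xs (λ x → f x + g x) ≈ ∑ xs f + ∑ xs g
  ∑-+ []       f g = sym (+-identityˡ 0#)
  ∑-+ (x ∷ xs) f g = trans (+-congˡ (∑-+ xs f g)) (solve 4 (λ a b c d → (a :+ b) :+ (c :+ d) := (a :+ c) :+ (b :+ d)) refl _ _ _ _)

  ∑-*ˡ : {A : Set} (xs : List A) (a : Carrier) (f : A → Carrier) → ∑ xs (λ x → a * f x) ≈ a * ∑ xs f
  ∑-*ˡ []       a f = sym (zeroʳ a)
  ∑-*ˡ (x ∷ xs) a f = trans (+-congˡ (∑-*ˡ xs a f)) (sym (distribˡ a _ _))

  ∑-*ʳ : {A : Set} (xs : List A) (a : Carrier) (f : A → Carrier) → ∑ xs (λ x → f x * a) ≈ ∑ xs f * a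
  ∑-*ʳ xs a f = trans (∑-cong xs (λ x → *-comm (f x) a)) (trans (∑-*ˡ xs a f) (*-comm a _))

  ∑-neg : {A : Set} (xs : List A) (f : A → Carrier) → ∑ xs (λ x → - f x) ≈ - ∑ xs f
  ∑-neg []       f = sym -0#≈0#
  ∑-neg (x ∷ xs) f = trans (+-congˡ (∑-neg xs f)) (solve 2 (λ a b → :- a :+ :- b := :- (a :+ b)) refl _ _)

  ∑-- : {A : Set} (xs : List A) (f g : A → Carrier) → ∑ xs (λ x → f x - g x) ≈ ∑ xs f - ∑ xs g
  ∑-- xs f g = trans (∑-+ xs f (λ x → - g x)) (+-congˡ (∑-neg xs g))

  ∑-++ : {A : Set} (xs ys : List A) (f : A → Carrier) → ∑ (xs ++ ys) f ≈ ∑ xs f + ∑ ys f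
  ∑-++ []       ys f = sym (+-identityˡ _)
  ∑-++ (x ∷ xs) ys f = trans (+-congˡ (∑-++ xs ys f)) (sym (+-assoc _ _ _))

  ∑-map : {A B : Set} (h : A → B) (xs : List A) (f : B → Carrier) → ∑ (map h xs) f ≈ ∑ xs (f ∘ h)
  ∑-map h []       f = refl
  ∑-map h (x ∷ xs) f = +-congˡ (∑-map h xs f)

  ∑-concatMap : {A B : Set} (h : A → List B) (xs : List A) (f : B → Carrier) →
    ∑ (concatMap h xs) f ≈ ∑ xs (λ x → ∑ (h x) f)
  ∑-concatMap h []       f = refl
  ∑-concatMap h (x ∷ xs) f = trans (∑-++ (h x) _ f) (+-congˡ (∑-concatMap h xs f))

  ∑-swap : {A B : Set} (xs : List A) (ys : List B) (f : A → B → Carrier) →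
    ∑ xs (λ x → ∑ ys (f x)) ≈ ∑ ys (λ y → ∑ xs (λ x → f x y))
  ∑-swap []       ys f = sym (∑-zero ys (λ _ → refl))
  ∑-swap (x ∷ xs) ys f = trans (+-congˡ (∑-swap xs ys f)) (sym (∑-+ ys _ _))

  ∑-*∑ : {A B : Set} (xs : List A) (ys : List B) (f : A → Carrier) (g : B → Carrier) →
    ∑ xs f * ∑ ys g ≈ ∑ xs (λ x → ∑ ys (λ y → f x * g y))
  ∑-*∑ xs ys f g = trans (sym (∑-*ʳ xs _ f)) (∑-cong xs (λ x → sym (∑-*ˡ ys (f x) g)))

  ∑-pairs : {A B : Set} (xs : List A) (ys : A → List B) (f : A × B → Carrier) →
    ∑ (concatMap (λ x → map (x ,_) (ys x)) xs) f ≈ ∑ xs (λ x → ∑ (ys x) (λ y → f (x , y)))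
  ∑-pairs xs ys f = trans (∑-concatMap _ xs f) (∑-cong xs (λ x → ∑-map (x ,_) (ys x) f))

  ∑< : ℕ → (ℕ → Carrier) → Carrier
  ∑< n f = ∑ (downFrom n) f

  ∑<-cong : ∀ n {f g : ℕ → Carrier} → (∀ i → i ℕ.< n → f i ≈ g i) → ∑< n f ≈ ∑< n g
  ∑<-cong zero    f≈g = refl
  ∑<-cong (suc n) f≈g = +-cong (f≈g n ℕₚ.≤-refl) (∑<-cong n (λ i i<n → f≈g i (ℕₚ.m≤n⇒m≤1+n i<n)))

  ∑<-zero : ∀ n {f : ℕ → Carrier} → (∀ i → i ℕ.< n → f i ≈ 0#) → ∑< n f ≈ 0#
  ∑<-zero n f≈0 = trans (∑<-cong n f≈0) (∑-zero (downFrom n) (λ _ → refl))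

  ∑<-single : ∀ n j {f : ℕ → Carrier} → j ℕ.< n → (∀ i → i ℕ.< n → i ≢ j → f i ≈ 0#) → ∑< n f ≈ f j
  ∑<-single (suc n) j j<n f≈0 with n ℕₚ.≟ j
  ... | yes ≡.refl = trans (+-congˡ (∑<-zero n (λ i i<n → f≈0 i (ℕₚ.m≤n⇒m≤1+n i<n) (ℕₚ.<⇒≢ i<n)))) (+-identityʳ _)
  ... | no n≢j = trans (+-cong (f≈0 n ℕₚ.≤-refl n≢j)
      (∑<-single n j (ℕₚ.≤∧≢⇒< (ℕₚ.≤-pred j<n) (n≢j ∘ ≡.sym)) (λ i i<n → f≈0 i (ℕₚ.m≤n⇒m≤1+n i<n)))) (+-identityˡ _)

  ∑<-head : ∀ n (f : ℕ → Carrier) → ∑< (suc n) f ≈ ∑< n (f ∘ suc) + f 0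
  ∑<-head zero    f = +-comm _ _
  ∑<-head (suc n) f = trans (+-congˡ (∑<-head n f)) (sym (+-assoc _ _ _))

module Matrices (R : CommutativeRing 0ℓ 0ℓ) where
  open CommutativeRing R hiding (zero)
  open ListSum R

  Matrix : Set → Set
  Matrix I = I → I → Carrier

  mul : {I : Set} → List I → Matrix I → Matrix I → Matrix I
  mul xs X Y i j = ∑ xs (λ k → X i k * Y k j)

  tr : {I : Set} → List I → Matrix I → Carrier
  tr xs X = ∑ xs (λ i → X i i)

  mul-assoc : {I : Set} (xs : List I) (X Y Z : Matrix I) (i j : I) →
    mul xs (mul xs X Y) Z i j ≈ mul xs X (mul xs Y Z) i j
  mul-assoc xs X Y Z i j =
    trans (∑-cong xs (λ k → trans (sym (∑-*ʳ xs _ _)) (∑-cong xs (λ l → *-assoc _ _ _))))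
    (trans (∑-swap xs xs _) (∑-cong xs (λ l → ∑-*ˡ xs _ _)))

  δ : Matrix ℕ
  δ zero    zero    = 1#
  δ zero    (suc j) = 0#
  δ (suc i) zero    = 0#
  δ (suc i) (suc j) = δ i j

  δ-refl : ∀ i → δ i i ≈ 1#
  δ-refl zero    = refl
  δ-refl (suc i) = δ-refl i

  δ-≢ : ∀ i j → i ≢ j → δ i j ≈ 0#
  δ-≢ zero    zero    i≢j = ⊥-elim (i≢j ≡.refl)
  δ-≢ zero    (suc j) i≢j = refl
  δ-≢ (suc i) zero    i≢j = refl
  δ-≢ (suc i) (suc j) i≢j = δ-≢ i j (i≢j ∘ ≡.cong suc)

-- Elimination of poles

-- For p = 2e + 1: k and c are the quotient and p − 1 minus the remainder of κ + e by p.
module PoleOrders (e′ : ℕ) where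
  e p : ℕ
  e = suc e′
  p = suc (e ℕ.+ e)

  next : ℕ × ℕ → ℕ × ℕ
  next (k , zero)  = suc k , e ℕ.+ e
  next (k , suc c) = k , c

  state : ℕ → ℕ × ℕ
  state zero    = 0 , e
  state (suc κ) = next (state κ)

  kOf cOf : ℕ → ℕ
  kOf κ = proj₁ (state κ)
  cOf κ = proj₂ (state κ)

  open import Data.Nat.Tactic.RingSolver using (solve-∀)
  open import Data.Nat.Base using (_+_; _*_; _∸_; _≤_; _<_; _^_)
  open ≡ using (refl; sym; trans; cong)

  state-inv : ∀ κ → p * kOf κ + e ≡ κ + cOf κ
  state-inv zero = cong (_+ e) (ℕₚ.*-zeroʳ p)
  state-inv (suc κ) with state κ | state-inv κ
  ... | k , zero  | eq = trans (lemma e k) (cong (λ x → suc x + (e + e)) (trans eq (ℕₚ.+-identityʳ κ)))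
    where
    lemma : ∀ e k → suc (e + e) * suc k + e ≡ suc (suc (e + e) * k + e) + (e + e)
    lemma = solve-∀
  ... | k , suc c | eq = trans eq (ℕₚ.+-suc κ c)

  cOf≤ : ∀ κ → cOf κ ≤ e + e
  cOf≤ zero = ℕₚ.m≤m+n e e
  cOf≤ (suc κ) with state κ | cOf≤ κ
  ... | k , zero  | c≤ = ℕₚ.≤-refl
  ... | k , suc c | c≤ = ℕₚ.≤-trans (ℕₚ.n≤1+n c) c≤

  -- This is e (1 + p + ... + p ^ (N - 1)) = (p ^ N - 1) / 2. It is the truncation order of the pole
  -- expansion and, at N = r + 1, the exponent (q - 1) / 2 of the quadratic character.
  level : ℕ → ℕ
  level zero    = 0
  level (suc N) = e + p * level N

  level-suc : ∀ N → level (suc N) ≡ level N + e * p ^ N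
  level-suc zero = lemma e
    where
    lemma : ∀ e → e + suc (e + e) * 0 ≡ 0 + e * 1
    lemma = solve-∀
  level-suc (suc N) = trans (cong (λ x → e + p * x) (level-suc N)) (lemma e p (level N) (p ^ N))
    where
    lemma : ∀ e p l x → e + p * (l + e * x) ≡ e + p * l + e * (p * x)
    lemma = solve-∀

  private
    quotient-< : ∀ κ c {k k′} → p * k + e ≡ κ + c → p * k′ + e ≡ κ → c < p → ¬ (k < k′) × ¬ (k′ < k)
    quotient-< κ c {k} {k′} eq eq′ c<p =
      (λ k<k′ → ℕₚ.<-irrefl refl (ℕₚ.<-≤-trans (ℕₚ.+-monoˡ-< e (ℕₚ.*-monoʳ-< p k<k′))
        (≡.subst₂ _≤_ (sym eq′) (sym eq) (ℕₚ.m≤m+n κ c)))) ,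
      (λ k′<k → ℕₚ.<-irrefl refl (ℕₚ.≤-<-trans (high k′<k) (≡.subst (_< κ + p) (sym eq) (ℕₚ.+-monoʳ-< κ c<p))))
      where
      expand : ∀ p k e → p * suc k + e ≡ p * k + e + p
      expand = solve-∀
      high : k′ < k → κ + p ≤ p * k + e
      high k′<k = ℕₚ.≤-trans (ℕₚ.≤-reflexive (trans (cong (_+ p) (sym eq′)) (sym (expand p k′ e))))
        (ℕₚ.+-monoˡ-≤ e (ℕₚ.*-monoʳ-≤ p k′<k))

  kOf-level : ∀ N → kOf (level (suc N)) ≡ level N
  kOf-level N with ℕₚ.<-cmp (kOf (level (suc N))) (level N)
                 | quotient-< (level (suc N)) (cOf (level (suc N))) {k′ = level N}
                     (state-inv (level (suc N))) (ℕₚ.+-comm _ e) (s≤s (cOf≤ (level (suc N))))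
  ... | Relation.Binary.Definitions.tri< k<k′ _ _ | ¬< , _ = ⊥-elim (¬< k<k′)
  ... | Relation.Binary.Definitions.tri≈ _ k≡k′ _ | _ = k≡k′
  ... | Relation.Binary.Definitions.tri> _ _ k′<k | _ , ¬> = ⊥-elim (¬> k′<k)

  -- In the last column κ = m the power f ^ (p m + e - κ) is therefore a pure power of f ^ p, which
  -- is what makes the corner of the triangular matrix a power of f.
  cOf-level : ∀ N → cOf (level (suc N)) ≡ 0
  cOf-level N = ℕₚ.+-cancelˡ-≡ (level (suc N)) _ _ (trans (sym (state-inv (level (suc N))))
    (trans (cong (λ k → p * k + e) (kOf-level N)) (trans (ℕₚ.+-comm _ e) (sym (ℕₚ.+-identityʳ _)))))

  kOf-step : ∀ κ → kOf κ ≤ kOf (suc κ)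
  kOf-step κ with state κ
  ... | k , zero  = ℕₚ.n≤1+n k
  ... | k , suc c = ℕₚ.≤-refl

  kOf-mono : ∀ {κ κ′} → κ ≤ κ′ → kOf κ ≤ kOf κ′
  kOf-mono {κ} {κ′} κ≤κ′ = go (κ′ ∸ κ) (ℕₚ.m∸n+n≡m κ≤κ′)
    where
    go : ∀ d {κ′} → d + κ ≡ κ′ → kOf κ ≤ kOf κ′
    go zero    refl = ℕₚ.≤-refl
    go (suc d) refl = ℕₚ.≤-trans (go d refl) (kOf-step (d + κ))

  level-mono : ∀ N → level N ≤ level (suc N)
  level-mono N = ≡.subst (level N ≤_) (sym (level-suc N)) (ℕₚ.m≤m+n _ _)

  -- From p k + e = κ + c and c ≤ 2 e follows p k ≤ κ + e, and p ≥ 3. Row κ gains p ^ κ while column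
  -- κ costs p ^ k, so about half of the divisibility survives in a principal minor.
  twice-kOf≤ : ∀ κ → 2 * kOf κ ≤ suc κ
  twice-kOf≤ κ with kOf κ | state-inv κ | cOf≤ κ
  ... | zero  | _  | _  = z≤n
  ... | suc j | eq | c≤ = ℕₚ.≤-trans (≡.subst (2 * suc j ≤_) (sym (lemma e′ j)) (ℕₚ.m≤m+n _ _))
      (ℕₚ.+-monoʳ-≤ 1 (ℕₚ.+-cancelʳ-≤ (e + e) _ _ (ℕₚ.≤-trans (ℕₚ.≤-reflexive (trans (lemma′ e′ j) eq)) (ℕₚ.+-monoʳ-≤ κ c≤))))
    where
    bound : ℕ
    bound = 2 * e′ * j + 3 * j + e′ + 2
    lemma : ∀ e′ j → suc (2 * e′ * j + 3 * j + e′ + 2) ≡ 2 * suc j + (2 * e′ * j + j + e′ + 1)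
    lemma = solve-∀
    lemma′ : ∀ e′ j → 2 * e′ * j + 3 * j + e′ + 2 + (suc e′ + suc e′) ≡ suc (suc e′ + suc e′) * suc j + suc e′
    lemma′ = solve-∀

module BinomialExpansion (R : CommutativeRing 0ℓ 0ℓ) (π : CommutativeRing.Carrier R) where
  open CommutativeRing R hiding (zero)
  open import Algebra.Properties.Semiring.Exp semiring using (_^_)
  open import Relation.Binary.Reasoning.Setoid setoid
  open IntegerSolver R using (solve; _:=_; _:+_; _:*_; con)

  shift : ℕ → (ℕ → Carrier) → ℕ → Carrier
  shift zero    g i       = g i
  shift (suc k) g zero    = 0#
  shift (suc k) g (suc i) = shift k g i

  shift-suc : ∀ k g i → shift (suc k) g i ≈ shift 1 (shift k g) i
  shift-suc k g zero    = refl
  shift-suc k g (suc i) = refl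

  -- The coefficients of (1 + Δ z) ^ a.
  binomial : Carrier → ℕ → ℕ → Carrier
  binomial Δ zero    zero    = 1#
  binomial Δ zero    (suc i) = 0#
  binomial Δ (suc a) zero    = binomial Δ a zero
  binomial Δ (suc a) (suc i) = binomial Δ a (suc i) + Δ * binomial Δ a i

  binomial-large : ∀ Δ a i → a ℕ.< i → binomial Δ a i ≈ 0#
  binomial-large Δ zero    (suc i) a<i = refl
  binomial-large Δ (suc a) (suc i) (s≤s a<i) =
    trans (+-cong (binomial-large Δ a (suc i) (ℕₚ.m≤n⇒m≤1+n a<i)) (trans (*-congˡ (binomial-large Δ a i a<i)) (zeroʳ Δ)))
      (+-identityˡ 0#)

  term : Carrier → ℕ → ℕ → Carrier
  term Δ a i = π ^ i * binomial Δ a i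

  -- Evaluation at z = 1 / f of the truncation to degree n, times f ^ n.
  horner : Carrier → (ℕ → Carrier) → ℕ → Carrier
  horner f g zero    = g zero
  horner f g (suc n) = f * horner f g n + g (suc n)

  horner-cong : ∀ f {g g′} → (∀ i → g i ≈ g′ i) → ∀ n → horner f g n ≈ horner f g′ n
  horner-cong f g≈ zero    = g≈ zero
  horner-cong f g≈ (suc n) = +-cong (*-congˡ (horner-cong f g≈ n)) (g≈ (suc n))

  horner-shift : ∀ f k g n → horner f (shift k g) (k ℕ.+ n) ≈ horner f g n
  horner-shift f zero    g n = refl
  horner-shift f (suc k) g n = trans (go (k ℕ.+ n)) (horner-shift f k g n)
    where
    go : ∀ n → horner f (shift (suc k) g) (suc n) ≈ horner f (shift k g) n
    go zero    = trans (+-congʳ (zeroʳ f)) (+-identityˡ _)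
    go (suc n) = +-congʳ (*-congˡ (go n))

  horner-term-suc : ∀ f Δ a n → horner f (term Δ (suc a)) (suc n) ≈ horner f (term Δ a) (suc n) + π * Δ * horner f (term Δ a) n
  horner-term-suc f Δ a zero =
    solve 5 (λ f π x y Δ → f :* (con (+ 1) :* x) :+ (π :* con (+ 1)) :* (y :+ Δ :* x) :=
      f :* (con (+ 1) :* x) :+ (π :* con (+ 1)) :* y :+ π :* Δ :* (con (+ 1) :* x)) refl f π _ _ Δ
  horner-term-suc f Δ a (suc n) = trans (+-congʳ (*-congˡ (horner-term-suc f Δ a n)))
    (solve 8 (λ f π x y Δ P u v → f :* (u :+ π :* Δ :* v) :+ (π :* P) :* (y :+ Δ :* x) :=
      f :* u :+ (π :* P) :* y :+ π :* Δ :* (f :* v :+ P :* x)) refl f π _ _ Δ (π ^ suc n) _ _)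

  horner-term : ∀ f Δ a → horner f (term Δ a) a ≈ (f + π * Δ) ^ a
  horner-term f Δ zero    = *-identityˡ 1#
  horner-term f Δ (suc a) = begin
    horner f (term Δ (suc a)) (suc a)
      ≈⟨ horner-term-suc f Δ a a ⟩
    f * h + π ^ suc a * binomial Δ a (suc a) + π * Δ * h
      ≈⟨ +-congʳ (+-congˡ (trans (*-congˡ (binomial-large Δ a (suc a) ℕₚ.≤-refl)) (zeroʳ _))) ⟩
    f * h + 0# + π * Δ * h
      ≈⟨ solve 4 (λ f h π Δ → f :* h :+ con (+ 0) :+ π :* Δ :* h := (f :+ π :* Δ) :* h) refl f h π Δ ⟩
    (f + π * Δ) * h
      ≈⟨ *-congˡ (horner-term f Δ a) ⟩
    (f + π * Δ) ^ suc a ∎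
    where
    h : Carrier
    h = horner f (term Δ a) a

module KernelElimination (R : CommutativeRing 0ℓ 0ℓ) (e′ : ℕ) (π : CommutativeRing.Carrier R) where
  open PoleOrders e′
  open CommutativeRing R hiding (zero)
  open import Algebra.Properties.Semiring.Exp semiring using (_^_; ^-assocʳ; ^-congˡ)
  open import Relation.Binary.Reasoning.Setoid setoid
  open ListSum R
  open Matrices R
  open IntegerSolver R using (solve; _:=_; _:+_; _:*_; _:-_; :-_; con)
  open BinomialExpansion R π

  -- With c = p k + e − κ, the expansion of f ^ (p m + e − κ) = f ^ c * (f′ + π Δ) ^ (m − k) in powers of f′ = f ^ p − π Δ;
  -- entry i belongs to f′ ^ (m − i).
  column : Carrier → Carrier → ℕ → ℕ → ℕ → Carrier
  column f Δ m κ = shift (kOf κ) (λ i → term Δ (m ℕ.∸ kOf κ) i * f ^ cOf κ)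

  -- The coordinates of the image of the relation e_κ - f e_(κ+1), taken with respect to the
  -- relations e_i - f′ e_(i+1). It is nonzero only where the quotient k jumps, and there it is the
  -- expansion of (f′ + π Δ) ^ (m - k - 1) at offset k.
  kernelColumn′ : Carrier → ℕ → ℕ × ℕ → ℕ → Carrier
  kernelColumn′ Δ m (k , zero)  = shift k (term Δ (m ℕ.∸ suc k))
  kernelColumn′ Δ m (k , suc c) = λ _ → 0#

  kernelColumn : Carrier → ℕ → ℕ → ℕ → Carrier
  kernelColumn Δ m κ = kernelColumn′ Δ m (state κ)

  -- Multiplication from the left and from the right by the same unipotent matrix U(f), whose κ-th
  -- column is e_κ - f e_(κ+1). These columns are the relations among the f ^ (m - κ).
  rowOp colOp : Carrier → Matrix ℕ → Matrix ℕ
  rowOp f X i j = X i j - f * shift 1 (λ k → X k j) i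
  colOp f X i j = X i j - f * X i (suc j)

  -- If κ and κ + 1 share the quotient k, both columns expand the same power of f′ + π Δ and cancel.
  -- If k jumps, then f · f ^ (p - 1) = f ^ p is rewritten as f′ + π Δ, and the binomial recursion
  -- leaves a vector that telescopes along f′.
  column-relation : ∀ f Δ f′ m κ → f′ + π * Δ ≈ f ^ p → kOf (suc κ) ℕ.≤ m → ∀ i →
    column f Δ m κ i - f * column f Δ m (suc κ) i
      ≈ kernelColumn Δ m κ i - f′ * shift 1 (kernelColumn Δ m κ) i
  column-relation f Δ f′ m κ rel k≤m with state κ
  ... | k , suc c = go k
    where
    go : ∀ k i → shift k (λ i → term Δ (m ℕ.∸ k) i * f ^ suc c) i - f * shift k (λ i → term Δ (m ℕ.∸ k) i * f ^ c) i
      ≈ 0# - f′ * shift 1 (λ _ → 0#) i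
    go k i = trans (go′ k (term Δ (m ℕ.∸ k)) i) (sym (zero-side i))
      where
      zero-side : ∀ i → 0# - f′ * shift 1 (λ _ → 0#) i ≈ 0#
      zero-side zero    = solve 1 (λ x → con (+ 0) :- x :* con (+ 0) := con (+ 0)) refl f′
      zero-side (suc i) = solve 1 (λ x → con (+ 0) :- x :* con (+ 0) := con (+ 0)) refl f′
      go′ : ∀ k (t : ℕ → Carrier) i → shift k (λ i → t i * f ^ suc c) i - f * shift k (λ i → t i * f ^ c) i ≈ 0#
      go′ zero    t i       = solve 3 (λ t f g → t :* (f :* g) :- f :* (t :* g) := con (+ 0)) refl (t i) f (f ^ c)
      go′ (suc k) t zero    = solve 1 (λ x → con (+ 0) :- x :* con (+ 0) := con (+ 0)) refl f
      go′ (suc k) t (suc i) = go′ k t i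
  ... | k , zero = shifted k (≡.subst (λ b → ∀ i → term Δ b i * f ^ 0 - f * shift 1 (λ i → t i * F) i ≈ t i - f′ * shift 1 t i)
      (≡.sym (ℕₚ.+-∸-assoc 1 k≤m)) base)
    where
    t : ℕ → Carrier
    t = term Δ (m ℕ.∸ suc k)
    F : Carrier
    F = f ^ (e ℕ.+ e)
    base : ∀ i → term Δ (suc (m ℕ.∸ suc k)) i * f ^ 0 - f * shift 1 (λ i → t i * F) i ≈ t i - f′ * shift 1 t i
    base zero = solve 3 (λ x f f′ → (con (+ 1) :* x) :* con (+ 1) :- f :* con (+ 0) := con (+ 1) :* x :- f′ :* con (+ 0)) refl _ f f′
    base (suc i) = begin
      (π * π ^ i) * (x + Δ * y) * 1# - f * ((π ^ i * y) * F)
        ≈⟨ solve 7 (λ π P x y Δ f F → (π :* P) :* (x :+ Δ :* y) :* con (+ 1) :- f :* ((P :* y) :* F) :=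
             (π :* P) :* x :+ P :* y :* (π :* Δ) :- P :* y :* (f :* F)) refl π (π ^ i) x y Δ f F ⟩
      (π * π ^ i) * x + π ^ i * y * (π * Δ) - π ^ i * y * (f * F)
        ≈⟨ +-congˡ (-‿cong (*-congˡ rel)) ⟨
      (π * π ^ i) * x + π ^ i * y * (π * Δ) - π ^ i * y * (f′ + π * Δ)
        ≈⟨ solve 6 (λ π P x y Δ f′ → (π :* P) :* x :+ P :* y :* (π :* Δ) :- P :* y :* (f′ :+ π :* Δ) :=
             (π :* P) :* x :- f′ :* (P :* y)) refl π (π ^ i) x y Δ f′ ⟩
      (π * π ^ i) * x - f′ * (π ^ i * y) ∎
      where
      x y : Carrier
      x = binomial Δ (m ℕ.∸ suc k) (suc i)
      y = binomial Δ (m ℕ.∸ suc k) i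
    shifted : ∀ k {t⁺} → (∀ i → t⁺ i - f * shift 1 (λ i → t i * F) i ≈ t i - f′ * shift 1 t i) → ∀ i →
      shift k t⁺ i - f * shift (suc k) (λ i → t i * F) i ≈ shift k t i - f′ * shift 1 (shift k t) i
    shifted zero    h i       = h i
    shifted (suc k) h zero    = solve 2 (λ f f′ → con (+ 0) :- f :* con (+ 0) := con (+ 0) :- f′ :* con (+ 0)) refl f f′
    shifted (suc k) h (suc i) = trans (shifted k h i) (+-congˡ (-‿cong (*-congˡ (sym (shift-suc k _ i)))))

  module AtLevel (N : ℕ) where
    m : ℕ
    m = level (suc N)

    full kernel : Carrier → Carrier → Matrix ℕ
    full f Δ i κ with κ ℕₚ.≤? m
    ... | yes _ = column f Δ m κ i
    ... | no _  = 0#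
    kernel f Δ i κ = kernelColumn Δ m κ i

    -- This is U(f′)⁻¹ X U(f). Applying U(f′)⁻¹ to a column forms its running Horner sums at f′,
    -- which explains the entry at κ = m.
    triangular : Carrier → Carrier → Carrier → Matrix ℕ
    triangular f Δ f′ i κ with ℕₚ.<-cmp κ m
    ... | Relation.Binary.Definitions.tri< _ _ _ = kernel f Δ i κ
    ... | Relation.Binary.Definitions.tri≈ _ _ _ = horner f′ (column f Δ m m) i
    ... | Relation.Binary.Definitions.tri> _ _ _ = 0#

    product : (Carrier → Carrier → Matrix ℕ) → ℕ → ℕ → (ℕ → Carrier) → (ℕ → Carrier) → Matrix ℕ
    product X n zero    f Δ = δ
    product X n (suc r) f Δ = mul (downFrom n) (product X n r (f ∘ suc) (Δ ∘ suc)) (X (f 0) (Δ 0))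

    triangularProduct : ℕ → (ℕ → Carrier) → (ℕ → Carrier) → Matrix ℕ
    triangularProduct zero    f Δ = δ
    triangularProduct (suc r) f Δ =
      mul (downFrom (suc m)) (triangularProduct r (f ∘ suc) (Δ ∘ suc)) (triangular (f 0) (Δ 0) (f 1))

    full-≤ : ∀ f Δ i {κ} → κ ℕ.≤ m → full f Δ i κ ≈ column f Δ m κ i
    full-≤ f Δ i {κ} κ≤m with κ ℕₚ.≤? m
    ... | yes _  = refl
    ... | no κ≰m = ⊥-elim (κ≰m κ≤m)

    full-suc : ∀ f Δ i → full f Δ i (suc m) ≈ 0#
    full-suc f Δ i with suc m ℕₚ.≤? m
    ... | yes m<m = ⊥-elim (ℕₚ.<-irrefl ≡.refl m<m)
    ... | no _    = refl

    triangular-< : ∀ f Δ f′ i {κ} → κ ℕ.< m → triangular f Δ f′ i κ ≈ kernel f Δ i κ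
    triangular-< f Δ f′ i {κ} κ<m with ℕₚ.<-cmp κ m
    ... | Relation.Binary.Definitions.tri< _ _ _  = refl
    ... | Relation.Binary.Definitions.tri≈ ¬< _ _ = ⊥-elim (¬< κ<m)
    ... | Relation.Binary.Definitions.tri> ¬< _ _ = ⊥-elim (¬< κ<m)

    triangular-m : ∀ f Δ f′ i → triangular f Δ f′ i m ≈ horner f′ (column f Δ m m) i
    triangular-m f Δ f′ i with ℕₚ.<-cmp m m
    ... | Relation.Binary.Definitions.tri< _ ¬≡ _ = ⊥-elim (¬≡ ≡.refl)
    ... | Relation.Binary.Definitions.tri≈ _ _ _  = refl
    ... | Relation.Binary.Definitions.tri> _ ¬≡ _ = ⊥-elim (¬≡ ≡.refl)

    rowOp-cong : ∀ f {X Y : Matrix ℕ} {i j j′} → (∀ k → X k j ≈ Y k j′) → rowOp f X i j ≈ rowOp f Y i j′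
    rowOp-cong f {i = zero}  h = +-congʳ (h zero)
    rowOp-cong f {i = suc i} h = +-cong (h (suc i)) (-‿cong (*-congˡ (h i)))

    colOp-full : ∀ f Δ f′ → f′ + π * Δ ≈ f ^ p → ∀ i κ → κ ℕ.≤ m →
      colOp f (full f Δ) i κ ≈ rowOp f′ (triangular f Δ f′) i κ
    colOp-full f Δ f′ rel i κ κ≤m with ℕₚ.m≤n⇒m<n∨m≡n κ≤m
    ... | inj₁ κ<m = begin
      colOp f (full f Δ) i κ
        ≈⟨ +-cong (full-≤ f Δ i κ≤m) (-‿cong (*-congˡ (full-≤ f Δ i κ<m))) ⟩
      column f Δ m κ i - f * column f Δ m (suc κ) i
        ≈⟨ column-relation f Δ f′ m κ rel
             (ℕₚ.≤-trans (kOf-mono κ<m) (≡.subst (ℕ._≤ m) (≡.sym (kOf-level N)) (level-mono N))) i ⟩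
      rowOp f′ (kernel f Δ) i κ
        ≈⟨ rowOp-cong f′ {triangular f Δ f′} {kernel f Δ} {i} {κ} {κ} (λ k → triangular-< f Δ f′ k κ<m) ⟨
      rowOp f′ (triangular f Δ f′) i κ ∎
    ... | inj₂ ≡.refl = begin
      colOp f (full f Δ) i m
        ≈⟨ +-cong (full-≤ f Δ i κ≤m) (-‿cong (*-congˡ (full-suc f Δ i))) ⟩
      g i - f * 0#
        ≈⟨ difference i ⟨
      rowOp f′ (λ k _ → horner f′ g k) i m
        ≈⟨ rowOp-cong f′ {triangular f Δ f′} {λ k _ → horner f′ g k} {i} {m} {m} (λ k → triangular-m f Δ f′ k) ⟨
      rowOp f′ (triangular f Δ f′) i m ∎
      where
      g : ℕ → Carrier
      g = column f Δ m m
      difference : ∀ i → rowOp f′ (λ k _ → horner f′ g k) i m ≈ g i - f * 0#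
      difference zero    = solve 3 (λ f f′ x → x :- f′ :* con (+ 0) := x :- f :* con (+ 0)) refl f f′ _
      difference (suc i) = solve 4 (λ f f′ x y → (f′ :* x :+ y) :- f′ :* x := y :- f :* con (+ 0)) refl f f′ _ _

    mulₘ : Matrix ℕ → Matrix ℕ → Matrix ℕ
    mulₘ = mul (downFrom (suc m))

    -- Associativity X (U Y) = (X U) Y. `colOp` reads column m + 1, just outside the summation
    -- range, so this column has to vanish; `full` is extended by zero for this purpose.
    mul-rowOp : ∀ f X Y i j → X i (suc m) ≈ 0# → mulₘ X (rowOp f Y) i j ≈ mulₘ (colOp f X) Y i j
    mul-rowOp f X Y i j X≈0 = begin
      ∑< (suc m) (λ k → X i k * (Y k j - f * Y⁻ k))
        ≈⟨ ∑-cong (downFrom (suc m)) (λ k → solve 4 (λ x y f z → x :* (y :- f :* z) := x :* y :- f :* (x :* z)) refl _ _ f _) ⟩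
      ∑< (suc m) (λ k → X i k * Y k j - f * (X i k * Y⁻ k))
        ≈⟨ ∑-- (downFrom (suc m)) _ _ ⟩
      ∑< (suc m) (λ k → X i k * Y k j) - ∑< (suc m) (λ k → f * (X i k * Y⁻ k))
        ≈⟨ +-congˡ (-‿cong (begin
          ∑< (suc m) (λ k → f * (X i k * Y⁻ k))
            ≈⟨ ∑<-head m _ ⟩
          ∑< m (λ k → f * (X i (suc k) * Y k j)) + f * (X i 0 * 0#)
            ≈⟨ +-cong (∑-cong (downFrom m) (λ k → sym (*-assoc f _ _))) (trans (*-congˡ (zeroʳ _)) (zeroʳ f)) ⟩
          ∑< m (λ k → f * X i (suc k) * Y k j) + 0#
            ≈⟨ +-comm _ _ ⟩
          0# + ∑< m (λ k → f * X i (suc k) * Y k j)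
            ≈⟨ +-congʳ (trans (*-congʳ (trans (*-congˡ X≈0) (zeroʳ f))) (zeroˡ _)) ⟨
          ∑< (suc m) (λ k → f * X i (suc k) * Y k j) ∎)) ⟩
      ∑< (suc m) (λ k → X i k * Y k j) - ∑< (suc m) (λ k → f * X i (suc k) * Y k j)
        ≈⟨ ∑-- (downFrom (suc m)) _ _ ⟨
      ∑< (suc m) (λ k → X i k * Y k j - f * X i (suc k) * Y k j)
        ≈⟨ ∑-cong (downFrom (suc m)) (λ k → solve 3 (λ a b y → a :* y :- b :* y := (a :- b) :* y) refl _ _ _) ⟩
      ∑< (suc m) (λ k → (X i k - f * X i (suc k)) * Y k j) ∎
      where
      Y⁻ : ℕ → Carrier
      Y⁻ = shift 1 (λ k → Y k j)

    colOp-mul : ∀ f X Y i j → colOp f (mulₘ X Y) i j ≈ mulₘ X (colOp f Y) i j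
    colOp-mul f X Y i j = trans (+-congˡ (-‿cong (sym (∑-*ˡ (downFrom (suc m)) f _))))
      (trans (sym (∑-- (downFrom (suc m)) _ _))
        (∑-cong (downFrom (suc m)) (λ k → solve 4 (λ x y z f → x :* y :- f :* (x :* z) := x :* (y :- f :* z)) refl _ _ _ f)))

    rowOp-mul : ∀ f X Y i j → mulₘ (rowOp f X) Y i j ≈ rowOp f (mulₘ X Y) i j
    rowOp-mul f X Y i j = trans (∑-cong (downFrom (suc m)) (λ k → solve 4 (λ x x′ y f → (x :- f :* x′) :* y := x :* y :- f :* (x′ :* y)) refl _ _ _ f))
      (trans (∑-- (downFrom (suc m)) _ _) (+-congˡ (-‿cong (trans (∑-*ˡ (downFrom (suc m)) f _) (*-congˡ (inner i))))))
      where
      inner : ∀ i → ∑< (suc m) (λ k → shift 1 (λ l → X l k) i * Y k j) ≈ shift 1 (λ l → mulₘ X Y l j) i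
      inner zero    = ∑-zero (downFrom (suc m)) (λ k → zeroˡ _)
      inner (suc i) = refl

    product-suc : ∀ r f Δ i → i ℕ.≤ m → product full (suc m) r f Δ i (suc m) ≈ 0#
    product-suc zero    f Δ i i≤m = δ-≢ i (suc m) (ℕₚ.<⇒≢ (s≤s i≤m))
    product-suc (suc r) f Δ i i≤m =
      ∑-zero (downFrom (suc m)) (λ k → trans (*-congˡ (full-suc (f 0) (Δ 0) k)) (zeroʳ _))

    -- Each factor satisfies X U(f_j) = U(f_(j+1)) Y with Y triangular, so the matrices U between
    -- neighbouring factors telescope and only the outermost ones remain.
    conjugation : ∀ r f Δ → (∀ j → f (suc j) + π * Δ j ≈ f j ^ p) → ∀ i κ → i ℕ.≤ m → κ ℕ.≤ m →
      colOp (f 0) (product full (suc m) r f Δ) i κ ≈ rowOp (f r) (triangularProduct r f Δ) i κ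
    conjugation zero f Δ rel zero    κ i≤m κ≤m = refl
    conjugation zero f Δ rel (suc i) κ i≤m κ≤m = refl
    conjugation (suc r) f Δ rel i κ i≤m κ≤m = begin
      colOp (f 0) (mulₘ P (full (f 0) (Δ 0))) i κ
        ≈⟨ colOp-mul (f 0) P (full (f 0) (Δ 0)) i κ ⟩
      mulₘ P (colOp (f 0) (full (f 0) (Δ 0))) i κ
        ≈⟨ ∑-cong (downFrom (suc m)) (λ k → *-congˡ (colOp-full (f 0) (Δ 0) (f 1) (rel 0) k κ κ≤m)) ⟩
      mulₘ P (rowOp (f 1) (triangular (f 0) (Δ 0) (f 1))) i κ
        ≈⟨ mul-rowOp (f 1) P (triangular (f 0) (Δ 0) (f 1)) i κ (product-suc r (f ∘ suc) (Δ ∘ suc) i i≤m) ⟩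
      mulₘ (colOp (f 1) P) (triangular (f 0) (Δ 0) (f 1)) i κ
        ≈⟨ ∑<-cong (suc m) (λ k k≤m → *-congʳ (conjugation r (f ∘ suc) (Δ ∘ suc) (rel ∘ suc) i k i≤m (ℕₚ.≤-pred k≤m))) ⟩
      mulₘ (rowOp (f (suc r)) Q) (triangular (f 0) (Δ 0) (f 1)) i κ
        ≈⟨ rowOp-mul (f (suc r)) Q (triangular (f 0) (Δ 0) (f 1)) i κ ⟩
      rowOp (f (suc r)) (mulₘ Q (triangular (f 0) (Δ 0) (f 1))) i κ ∎
      where
      P Q : Matrix ℕ
      P = product full (suc m) r (f ∘ suc) (Δ ∘ suc)
      Q = triangularProduct r (f ∘ suc) (Δ ∘ suc)

    -- Invariance of the trace under P U = U Q without inverting U. The sums along the j-th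
    -- superdiagonals of P and of Q obey the same recursion from j + 1 to j, and at j = m + 1 both
    -- are empty; the case j = 0 is the trace.
    superdiagonal : ∀ f P Q → (∀ i κ → i ℕ.≤ m → κ ℕ.≤ m → colOp f P i κ ≈ rowOp f Q i κ) →
      (∀ i → i ℕ.≤ m → P i (suc m) ≈ 0#) → ∀ n j → j ℕ.+ n ≡ suc m →
      ∑< n (λ κ → P κ (j ℕ.+ κ)) ≈ ∑< n (λ κ → Q κ (j ℕ.+ κ))
    superdiagonal f P Q rel P≈0 zero    j j+n = refl
    superdiagonal f P Q rel P≈0 (suc n) j j+n = begin
      ∑< (suc n) (λ κ → P κ (j ℕ.+ κ))
        ≈⟨ ∑<-cong (suc n) (λ κ κ<n → trans
             (solve 2 (λ a b → a := (a :- b) :+ b) refl _ (f * P κ (suc j ℕ.+ κ)))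
             (+-congʳ (rel κ (j ℕ.+ κ) (small κ κ<n (ℕₚ.m≤n+m κ j)) (small κ κ<n ℕₚ.≤-refl)))) ⟩
      ∑< (suc n) (λ κ → (Q κ (j ℕ.+ κ) - f * shift 1 (λ k → Q k (j ℕ.+ κ)) κ) + f * P κ (suc j ℕ.+ κ))
        ≈⟨ trans (∑-+ ns _ _) (+-congʳ (∑-- ns _ _)) ⟩
      ∑< (suc n) (λ κ → Q κ (j ℕ.+ κ)) - ∑< (suc n) (λ κ → f * shift 1 (λ k → Q k (j ℕ.+ κ)) κ)
        + ∑< (suc n) (λ κ → f * P κ (suc j ℕ.+ κ))
        ≈⟨ +-cong (+-congˡ (-‿cong (trans (∑-*ˡ ns f _) (*-congˡ (∑<-head n _))))) (∑-*ˡ ns f _) ⟩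
      ∑< (suc n) (λ κ → Q κ (j ℕ.+ κ)) - f * (∑< n (λ κ → Q κ (j ℕ.+ suc κ)) + 0#)
        + f * (P n (suc j ℕ.+ n) + ∑< n (λ κ → P κ (suc j ℕ.+ κ)))
        ≈⟨ +-cong (+-congˡ (-‿cong (*-congˡ (+-congʳ (∑-cong (downFrom n) (λ κ → reflexive (≡.cong (Q κ) (ℕₚ.+-suc j κ))))))))
             (*-congˡ (+-cong (trans (reflexive (≡.cong (P n) (≡.trans (≡.sym (ℕₚ.+-suc j n)) j+n))) (P≈0 n (small n ℕₚ.≤-refl (ℕₚ.m≤n+m n j))))
               (superdiagonal f P Q rel P≈0 n (suc j) (≡.trans (≡.sym (ℕₚ.+-suc j n)) j+n)))) ⟩
      ∑< (suc n) (λ κ → Q κ (j ℕ.+ κ)) - f * (∑< n (λ κ → Q κ (suc j ℕ.+ κ)) + 0#)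
        + f * (0# + ∑< n (λ κ → Q κ (suc j ℕ.+ κ)))
        ≈⟨ solve 3 (λ a f b → a :- f :* (b :+ con (+ 0)) :+ f :* (con (+ 0) :+ b) := a) refl _ f _ ⟩
      ∑< (suc n) (λ κ → Q κ (j ℕ.+ κ)) ∎
      where
      ns : List ℕ
      ns = downFrom (suc n)
      small : ∀ κ {x} → κ ℕ.< suc n → x ℕ.≤ j ℕ.+ κ → x ℕ.≤ m
      small κ κ≤n x≤ = ℕₚ.≤-pred (ℕₚ.≤-trans (s≤s (ℕₚ.≤-trans x≤ (ℕₚ.+-monoʳ-≤ j (ℕₚ.≤-pred κ≤n))))
        (ℕₚ.≤-reflexive (≡.trans (≡.sym (ℕₚ.+-suc j n)) j+n)))

    shift-+ : ∀ k g i → shift k g (k ℕ.+ i) ≈ g i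
    shift-+ zero    g i = refl
    shift-+ (suc k) g i = shift-+ k g i

    -- The expansion of exponent m - k - 1 placed at offset k ends at index m - 1. Row m is thus
    -- zero off the corner, and the products stay block triangular.
    kernelColumn-m : ∀ Δ κ → κ ℕ.< m → kernelColumn Δ m κ m ≈ 0#
    kernelColumn-m Δ κ κ<m with state κ | ≡.subst (kOf (suc κ) ℕ.≤_) (kOf-level N) (kOf-mono κ<m)
    ... | k , suc c | _   = refl
    ... | k , zero  | k<l = begin
      shift k t m                           ≈⟨ reflexive (≡.cong (shift k t) (≡.sym (≡.trans (≡.cong (k ℕ.+_) a≡) (ℕₚ.m+[n∸m]≡n (ℕₚ.<⇒≤ k<m))))) ⟩
      shift k t (k ℕ.+ suc (m ℕ.∸ suc k))   ≈⟨ shift-+ k t _ ⟩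
      t (suc (m ℕ.∸ suc k))                 ≈⟨ trans (*-congˡ (binomial-large Δ (m ℕ.∸ suc k) (suc (m ℕ.∸ suc k)) ℕₚ.≤-refl)) (zeroʳ _) ⟩
      0#                                    ∎
      where
      t : ℕ → Carrier
      t = term Δ (m ℕ.∸ suc k)
      k<m : k ℕ.< m
      k<m = ℕₚ.≤-trans k<l (level-mono N)
      a≡ : suc (m ℕ.∸ suc k) ≡ m ℕ.∸ k
      a≡ = ≡.sym (ℕₚ.+-∸-assoc 1 k<m)

    exponent : ℕ
    exponent = p ℕ.* (e ℕ.* p ℕ.^ N)

    powers : ℕ → (ℕ → Carrier) → Carrier
    powers zero    f = 1#
    powers (suc r) f = powers r (f ∘ suc) * f 0 ^ exponent

    -- The last column sits at offset `level N` and m - `level N` = e p ^ N, so its Horner sum at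
    -- row m is the complete binomial expansion of (f′ + π Δ) ^ (e p ^ N) = (f ^ p) ^ (e p ^ N).
    triangular-corner : ∀ f Δ f′ → f′ + π * Δ ≈ f ^ p → triangular f Δ f′ m m ≈ f ^ exponent
    triangular-corner f Δ f′ rel = begin
      triangular f Δ f′ m m
        ≈⟨ triangular-m f Δ f′ m ⟩
      horner f′ (shift (kOf m) (λ i → term Δ (m ℕ.∸ kOf m) i * f ^ cOf m)) m
        ≈⟨ reflexive (≡.cong₂ (λ k c → horner f′ (shift k (λ i → term Δ (m ℕ.∸ k) i * f ^ c)) m) (kOf-level N) (cOf-level N)) ⟩
      horner f′ (shift (level N) (λ i → term Δ (m ℕ.∸ level N) i * 1#)) m
        ≈⟨ reflexive (≡.cong₂ (λ a n → horner f′ (shift (level N) (λ i → term Δ a i * 1#)) n) m∸ (level-suc N)) ⟩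
      horner f′ (shift (level N) (λ i → term Δ a i * 1#)) (level N ℕ.+ a)
        ≈⟨ horner-shift f′ (level N) _ a ⟩
      horner f′ (λ i → term Δ a i * 1#) a
        ≈⟨ horner-cong f′ (λ i → *-identityʳ _) a ⟩
      horner f′ (term Δ a) a
        ≈⟨ horner-term f′ Δ a ⟩
      (f′ + π * Δ) ^ a
        ≈⟨ ^-congˡ a rel ⟩
      (f ^ p) ^ a
        ≈⟨ ^-assocʳ f p a ⟩
      f ^ exponent ∎
      where
      a : ℕ
      a = e ℕ.* p ℕ.^ N
      m∸ : m ℕ.∸ level N ≡ a
      m∸ = ≡.trans (≡.cong (ℕ._∸ level N) (level-suc N)) (ℕₚ.m+n∸m≡n (level N) a)

    corner-row : ∀ r f Δ κ → κ ℕ.< m → triangularProduct r f Δ m κ ≈ 0#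
    corner-row zero    f Δ κ κ<m = δ-≢ m κ (ℕₚ.>⇒≢ κ<m)
    corner-row (suc r) f Δ κ κ<m = trans
      (+-cong (trans (*-congˡ (trans (triangular-< (f 0) (Δ 0) (f 1) m κ<m) (kernelColumn-m (Δ 0) κ κ<m))) (zeroʳ _))
        (∑<-zero m (λ k k<m → trans (*-congʳ (corner-row r (f ∘ suc) (Δ ∘ suc) k k<m)) (zeroˡ _))))
      (+-identityˡ 0#)

    corner : ∀ r f Δ → (∀ j → f (suc j) + π * Δ j ≈ f j ^ p) → triangularProduct r f Δ m m ≈ powers r f
    corner zero    f Δ rel = δ-refl m
    corner (suc r) f Δ rel = trans
      (+-cong (*-cong (corner r (f ∘ suc) (Δ ∘ suc) (rel ∘ suc)) (triangular-corner (f 0) (Δ 0) (f 1) (rel 0)))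
        (∑<-zero m (λ k k<m → trans (*-congʳ (corner-row r (f ∘ suc) (Δ ∘ suc) k k<m)) (zeroˡ _))))
      (+-identityʳ _)

    block : ∀ r f Δ i κ → i ℕ.< m → κ ℕ.< m → triangularProduct r f Δ i κ ≈ product kernel m r f Δ i κ
    block zero    f Δ i κ i<m κ<m = refl
    block (suc r) f Δ i κ i<m κ<m = trans
      (+-cong (trans (*-congˡ (trans (triangular-< (f 0) (Δ 0) (f 1) m κ<m) (kernelColumn-m (Δ 0) κ κ<m))) (zeroʳ _))
        (∑<-cong m (λ k k<m → *-cong (block r (f ∘ suc) (Δ ∘ suc) i k i<m k<m) (triangular-< (f 0) (Δ 0) (f 1) k κ<m))))
      (+-identityˡ _)

    -- The cyclic condition identifies the two outermost U, which turns `conjugation` into an honest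
    -- conjugation; the trace then splits over the block and the corner.
    trace-reduction : ∀ r f Δ → (∀ j → f (suc j) + π * Δ j ≈ f j ^ p) → f r ≈ f 0 →
      tr (downFrom (suc m)) (product full (suc m) r f Δ)
        ≈ tr (downFrom m) (product kernel m r f Δ) + powers r f
    trace-reduction r f Δ rel cyclic = begin
      tr (downFrom (suc m)) (product full (suc m) r f Δ)
        ≈⟨ superdiagonal (f 0) _ (triangularProduct r f Δ)
             (λ i κ i≤m κ≤m → trans (conjugation r f Δ rel i κ i≤m κ≤m) (+-congˡ (-‿cong (*-congʳ cyclic))))
             (product-suc r f Δ) (suc m) 0 ≡.refl ⟩
      triangularProduct r f Δ m m + ∑< m (λ κ → triangularProduct r f Δ κ κ)
        ≈⟨ +-cong (corner r f Δ rel) (∑<-cong m (λ κ κ<m → block r f Δ κ κ κ<m κ<m)) ⟩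
      powers r f + tr (downFrom m) (product kernel m r f Δ)
        ≈⟨ +-comm _ _ ⟩
      tr (downFrom m) (product kernel m r f Δ) + powers r f ∎

-- Binomial coefficients and p-th powers of sums

module Binomials where
  open import Data.Nat.Base using (_+_; _*_; _<_)
  open import Data.Nat.Primality using (euclidsLemma)
  open import Data.Nat.Tactic.RingSolver using (solve-∀)
  open ≡ using (refl; sym; trans; cong; cong₂)

  choose : ℕ → ℕ → ℕ
  choose n       zero    = 1
  choose zero    (suc k) = 0
  choose (suc n) (suc k) = choose n (suc k) + choose n k

  choose-absorption : ∀ n k → suc k * choose (suc n) (suc k) ≡ suc n * choose n k
  choose-absorption zero zero    = refl
  choose-absorption zero (suc k) = ℕₚ.*-zeroʳ (suc (suc k))
  choose-absorption (suc n) zero = trans (lemma (choose n 1 + 1)) (trans (cong suc (trans (sym (ℕₚ.*-identityˡ _)) (choose-absorption n 0))) (lemma′ n))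
    where
    lemma : ∀ a → 1 * (a + 1) ≡ suc a
    lemma = solve-∀
    lemma′ : ∀ n → suc (suc n * 1) ≡ suc (suc n) * 1
    lemma′ = solve-∀
  choose-absorption (suc n) (suc k) = trans
    (lemma k (choose (suc n) (suc (suc k))) (choose (suc n) (suc k)))
    (trans (cong₂ (λ x y → x + (choose (suc n) (suc k) + y)) (choose-absorption n (suc k)) (choose-absorption n k))
      (lemma′ n (choose n (suc k)) (choose n k)))
    where
    lemma : ∀ k a b → suc (suc k) * (a + b) ≡ suc (suc k) * a + (b + suc k * b)
    lemma = solve-∀
    lemma′ : ∀ n a b → suc n * a + ((a + b) + suc n * b) ≡ suc (suc n) * (a + b)
    lemma′ = solve-∀

  choose-refl : ∀ n → choose n n ≡ 1
  choose-refl n = trans (sym (ℕₚ.+-identityˡ _)) (trans (cong (_+ choose n n) (sym (large n (suc n) ℕₚ.≤-refl))) (go n))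
    where
    large : ∀ n k → n < k → choose n k ≡ 0
    large zero    (suc k) _         = refl
    large (suc n) (suc k) (s≤s n<k) = cong₂ _+_ (large n (suc k) (ℕₚ.m≤n⇒m≤1+n n<k)) (large n k n<k)
    go : ∀ n → choose n (suc n) + choose n n ≡ 1
    go zero    = refl
    go (suc n) = trans (cong₂ _+_ (large (suc n) (suc (suc n)) ℕₚ.≤-refl) refl) (go n)

  prime∣choose : ∀ {p} → Prime p → ∀ k → suc k < p → p ℕD.∣ choose p (suc k)
  prime∣choose {suc n} pp k k<p with euclidsLemma (suc k) (choose (suc n) (suc k)) pp
      (ℕD.divides (choose n k) (trans (choose-absorption n k) (ℕₚ.*-comm (suc n) (choose n k))))
  ... | inj₁ p∣k = ⊥-elim (ℕₚ.<⇒≱ k<p (ℕD.∣⇒≤ p∣k))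
  ... | inj₂ p∣c = p∣c

module FreshmanDream (R : CommutativeRing 0ℓ 0ℓ) (m : ℕ) (coeff : ℕ → ℕ)
  (coeff-eq : ∀ i → i ℕ.< m → Binomials.choose (suc m) (suc i) ≡ suc m ℕ.* coeff i) where
  open CommutativeRing R hiding (zero)
  open Binomials
  open BinomialExpansion R 1#
  open import Algebra.Properties.Semiring.Exp semiring using (_^_; ^-congˡ)
  open import Algebra.Properties.Semiring.Mult semiring renaming (_×_ to _·_)
  open import Relation.Binary.Reasoning.Setoid setoid
  open IntegerSolver R using (solve; _:=_; _:+_)

  private
    p : ℕ
    p = suc m

  quotientTerm : Carrier → ℕ → Carrier
  quotientTerm b zero    = 0#
  quotientTerm b (suc i) = coeff i · (b ^ suc i)

  -- ((a + b) ^ p − a ^ p − b ^ p) / p.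
  quotient : Carrier → Carrier → Carrier
  quotient a b = a * horner a (quotientTerm b) m

  private
    binomial-choose : ∀ b n i → binomial b n i ≈ choose n i · (b ^ i)
    binomial-choose b zero    zero    = sym (+-identityʳ 1#)
    binomial-choose b zero    (suc i) = refl
    binomial-choose b (suc n) zero    = binomial-choose b n zero
    binomial-choose b (suc n) (suc i) = begin
      binomial b n (suc i) + b * binomial b n i
        ≈⟨ +-cong (binomial-choose b n (suc i)) (*-congˡ (binomial-choose b n i)) ⟩
      choose n (suc i) · (b ^ suc i) + b * (choose n i · (b ^ i))
        ≈⟨ +-congˡ (×-comm-* (choose n i) b (b ^ i)) ⟩
      choose n (suc i) · (b ^ suc i) + choose n i · (b ^ suc i)
        ≈⟨ ×-homo-+ (b ^ suc i) (choose n (suc i)) (choose n i) ⟨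
      choose (suc n) (suc i) · (b ^ suc i) ∎

    ·-distrib : ∀ k x y → k · (x + y) ≈ k · x + k · y
    ·-distrib zero    x y = sym (+-identityˡ 0#)
    ·-distrib (suc k) x y = trans (+-congˡ (·-distrib k x y)) (solve 4 (λ a b c d → (a :+ b) :+ (c :+ d) := (a :+ c) :+ (b :+ d)) refl _ _ _ _)

    1^ : ∀ i → 1# ^ i ≈ 1#
    1^ zero    = refl
    1^ (suc i) = trans (*-identityˡ _) (1^ i)

    term-choose : ∀ b n i → term b n i ≈ choose n i · (b ^ i)
    term-choose b n i = trans (*-congʳ (1^ i)) (trans (*-identityˡ _) (binomial-choose b n i))

    partial : ∀ a b j → j ℕ.≤ m → horner a (term b p) j ≈ a ^ j + p · horner a (quotientTerm b) j
    partial a b zero    j≤m = trans (term-choose b p 0) (trans (+-identityʳ 1#) (sym (trans (+-congˡ (×-zero p)) (+-identityʳ 1#))))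
      where
      ×-zero : ∀ k → k · 0# ≈ 0#
      ×-zero zero    = refl
      ×-zero (suc k) = trans (+-identityˡ _) (×-zero k)
    partial a b (suc j) j<m = begin
      a * horner a (term b p) j + term b p (suc j)
        ≈⟨ +-cong (*-congˡ (partial a b j (ℕₚ.<⇒≤ j<m)))
             (trans (term-choose b p (suc j)) (trans (×-congˡ (coeff-eq j j<m)) (sym (×-assocˡ (b ^ suc j) p (coeff j))))) ⟩
      a * (a ^ j + p · H) + p · (coeff j · (b ^ suc j))
        ≈⟨ +-congʳ (trans (distribˡ a _ _) (+-congˡ (×-comm-* p a H))) ⟩
      a * a ^ j + p · (a * H) + p · (coeff j · (b ^ suc j))
        ≈⟨ trans (+-assoc _ _ _) (+-congˡ (sym (·-distrib p (a * H) (coeff j · (b ^ suc j))))) ⟩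
      a ^ suc j + p · (a * H + coeff j · (b ^ suc j)) ∎
      where
      H : Carrier
      H = horner a (quotientTerm b) j

  freshman : ∀ a b → (a + b) ^ p ≈ a ^ p + b ^ p + p · quotient a b
  freshman a b = begin
    (a + b) ^ p
      ≈⟨ ^-congˡ p (+-congˡ (*-identityˡ b)) ⟨
    (a + 1# * b) ^ p
      ≈⟨ horner-term a b p ⟨
    a * horner a (term b p) m + term b p p
      ≈⟨ +-cong (*-congˡ (partial a b m ℕₚ.≤-refl)) (trans (term-choose b p p) (trans (×-congˡ (choose-refl p)) (+-identityʳ _))) ⟩
    a * (a ^ m + p · horner a (quotientTerm b) m) + b ^ p
      ≈⟨ +-congʳ (trans (distribˡ a _ _) (+-congˡ (×-comm-* p a _))) ⟩
    a ^ p + p · quotient a b + b ^ p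
      ≈⟨ solve 3 (λ x y z → x :+ y :+ z := x :+ z :+ y) refl _ _ _ ⟩
    a ^ p + b ^ p + p · quotient a b ∎

module PrimeCoefficients {m : ℕ} (pp : Prime (suc m)) where
  open Binomials

  coefficient : ℕ → ℕ
  coefficient i with suc i ℕₚ.<? suc m
  ... | yes i<m = ℕD.quotient (prime∣choose pp i i<m)
  ... | no _    = 0

  coefficient-eq : ∀ i → i ℕ.< m → choose (suc m) (suc i) ≡ suc m ℕ.* coefficient i
  coefficient-eq i i<m with suc i ℕₚ.<? suc m
  ... | yes lt = ≡.trans (ℕD._∣_.equality (prime∣choose pp i lt)) (ℕₚ.*-comm _ (suc m))
  ... | no ≮   = ⊥-elim (≮ (s≤s i<m))

-- Monoid rings and Hurwitz series

-- ℤ[M] for a commutative monoid M; an element is known through its pairings with functions M → ℤ.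
module FormalSums (M : CommutativeMonoid 0ℓ 0ℓ) where
  open CommutativeMonoid M using (_∙_; ε; ∙-congˡ; assoc; identityˡ; comm) renaming (Carrier to G; _≈_ to _≈ᴹ_; sym to symᴹ)
  open ListSum ℤₚ.+-*-commutativeRing
  open ℤD using (_∣_)
  open import Data.Integer.Base using (_+_; _*_; _-_; -_; 0ℤ; 1ℤ)
  open import Data.Integer.Tactic.RingSolver using (solve-∀)
  open ≡ using (refl; sym; trans; cong; cong₂)

  FormalSum : Set
  FormalSum = List (ℤ × G)

  ⟪_⟫ : FormalSum → (G → ℤ) → ℤ
  ⟪ a ⟫ φ = ∑ a (λ t → proj₁ t * φ (proj₂ t))

  Respects : (G → ℤ) → Set
  Respects φ = ∀ {u v} → u ≈ᴹ v → φ u ≡ φ v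

  infixl 7 _⊗_
  _⊗_ : FormalSum → FormalSum → FormalSum
  a ⊗ b = concatMap (λ t → map (λ s → proj₁ t * proj₁ s , proj₂ t ∙ proj₂ s) b) a

  ⊖_ : FormalSum → FormalSum
  ⊖ a = map (λ t → - proj₁ t , proj₂ t) a

  const : ℤ → FormalSum
  const c = (c , ε) ∷ []

  ⟪⟫-cong : ∀ a {φ ψ} → (∀ u → φ u ≡ ψ u) → ⟪ a ⟫ φ ≡ ⟪ a ⟫ ψ
  ⟪⟫-cong a φ≡ψ = ∑-cong a (λ t → cong (proj₁ t *_) (φ≡ψ (proj₂ t)))

  ⟪⟫-+ : ∀ a φ ψ → ⟪ a ⟫ (λ u → φ u + ψ u) ≡ ⟪ a ⟫ φ + ⟪ a ⟫ ψ
  ⟪⟫-+ a φ ψ = trans (∑-cong a (λ t → ℤₚ.*-distribˡ-+ (proj₁ t) (φ (proj₂ t)) (ψ (proj₂ t))))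
    (∑-+ a (λ t → proj₁ t * φ (proj₂ t)) (λ t → proj₁ t * ψ (proj₂ t)))

  ⟪⟫-* : ∀ a c φ → ⟪ a ⟫ (λ u → c * φ u) ≡ c * ⟪ a ⟫ φ
  ⟪⟫-* a c φ = trans (∑-cong a (λ t → lemma (proj₁ t) c (φ (proj₂ t)))) (∑-*ˡ a c (λ t → proj₁ t * φ (proj₂ t)))
    where
    lemma : ∀ x c y → x * (c * y) ≡ c * (x * y)
    lemma = solve-∀

  ⟪⟫-*ʳ : ∀ a c φ → ⟪ a ⟫ (λ u → φ u * c) ≡ ⟪ a ⟫ φ * c
  ⟪⟫-*ʳ a c φ = trans (⟪⟫-cong a (λ u → ℤₚ.*-comm (φ u) c)) (trans (⟪⟫-* a c φ) (ℤₚ.*-comm c (⟪ a ⟫ φ)))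

  ⟪⟫-0 : ∀ a → ⟪ a ⟫ (λ _ → 0ℤ) ≡ 0ℤ
  ⟪⟫-0 a = ∑-zero a (λ t → ℤₚ.*-zeroʳ (proj₁ t))

  ⟪⟫-∑ : ∀ a {A : Set} (xs : List A) (φ : A → G → ℤ) → ⟪ a ⟫ (λ u → ∑ xs (λ x → φ x u)) ≡ ∑ xs (λ x → ⟪ a ⟫ (φ x))
  ⟪⟫-∑ a []       φ = ⟪⟫-0 a
  ⟪⟫-∑ a (x ∷ xs) φ = trans (⟪⟫-+ a (φ x) (λ u → ∑ xs (λ y → φ y u))) (cong (_+_ (⟪ a ⟫ (φ x))) (⟪⟫-∑ a xs φ))

  ⟪⟫-swap : ∀ a b (φ : G → G → ℤ) → ⟪ a ⟫ (λ u → ⟪ b ⟫ (φ u)) ≡ ⟪ b ⟫ (λ v → ⟪ a ⟫ (λ u → φ u v))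
  ⟪⟫-swap []      b φ = sym (⟪⟫-0 b)
  ⟪⟫-swap (t ∷ a) b φ = trans (cong₂ _+_ (sym (⟪⟫-* b (proj₁ t) (φ (proj₂ t)))) (⟪⟫-swap a b φ))
    (sym (⟪⟫-+ b (λ v → proj₁ t * φ (proj₂ t) v) (λ v → ⟪ a ⟫ (λ u → φ u v))))

  ⟪⟫-div : ∀ a {m φ} → (∀ u → m ∣ φ u) → m ∣ ⟪ a ⟫ φ
  ⟪⟫-div []      h = ℤD.divides 0ℤ refl
  ⟪⟫-div (t ∷ a) h = ℤD.∣m∣n⇒∣m+n (ℤD.∣n⇒∣m*n (proj₁ t) (h (proj₂ t))) (⟪⟫-div a h)

  ⟪++⟫ : ∀ a b φ → ⟪ a ++ b ⟫ φ ≡ ⟪ a ⟫ φ + ⟪ b ⟫ φ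
  ⟪++⟫ a b φ = ∑-++ a b (λ t → proj₁ t * φ (proj₂ t))

  ⟪⊖⟫ : ∀ a φ → ⟪ ⊖ a ⟫ φ ≡ - ⟪ a ⟫ φ
  ⟪⊖⟫ []      φ = refl
  ⟪⊖⟫ (t ∷ a) φ = trans (cong₂ _+_ (sym (ℤₚ.neg-distribˡ-* (proj₁ t) (φ (proj₂ t)))) (⟪⊖⟫ a φ)) (sym (ℤₚ.neg-distrib-+ (proj₁ t * φ (proj₂ t)) (⟪ a ⟫ φ)))

  ⟪⊗⟫ : ∀ a b φ → ⟪ a ⊗ b ⟫ φ ≡ ⟪ a ⟫ (λ u → ⟪ b ⟫ (λ v → φ (u ∙ v)))
  ⟪⊗⟫ a b φ = trans (∑-concatMap _ a (λ t → proj₁ t * φ (proj₂ t))) (∑-cong a λ t →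
    trans (∑-map _ b (λ t → proj₁ t * φ (proj₂ t)))
      (trans (∑-cong b (λ s → ℤₚ.*-assoc (proj₁ t) (proj₁ s) (φ (proj₂ t ∙ proj₂ s))))
        (∑-*ˡ b (proj₁ t) (λ s → proj₁ s * φ (proj₂ t ∙ proj₂ s)))))

  ⟪const⟫ : ∀ c φ → ⟪ const c ⟫ φ ≡ c * φ ε
  ⟪const⟫ c φ = ℤₚ.+-identityʳ (c * φ ε)

  ⟪const⊗⟫ : ∀ c a {φ} → Respects φ → ⟪ const c ⊗ a ⟫ φ ≡ c * ⟪ a ⟫ φ
  ⟪const⊗⟫ c a {φ} φ-resp = trans (⟪⊗⟫ (const c) a φ) (trans (⟪const⟫ c (λ u → ⟪ a ⟫ (λ v → φ (u ∙ v))))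
    (cong (c *_) (⟪⟫-cong a (λ u → φ-resp (identityˡ u)))))

  infix 4 _∼_
  -- Testing against all functions identifies lists up to order, merging and cancellation of terms,
  -- without normal forms. The record wrapper keeps a and b recoverable by inference.
  record _∼_ (a b : FormalSum) : Set where
    constructor exact
    field apply : ∀ φ → Respects φ → ⟪ a ⟫ φ ≡ ⟪ b ⟫ φ
  open _∼_ public

  ⊗-comm : ∀ a b → a ⊗ b ∼ b ⊗ a
  ⊗-comm a b = exact λ φ φ-resp → trans (⟪⊗⟫ a b φ) (trans (⟪⟫-swap a b (λ u v → φ (u ∙ v)))
    (trans (⟪⟫-cong b (λ v → ⟪⟫-cong a (λ u → φ-resp (comm u v)))) (sym (⟪⊗⟫ b a φ))))

  ⊗-congˡ : ∀ a {b b′} → b ∼ b′ → a ⊗ b ∼ a ⊗ b′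
  ⊗-congˡ a {b} {b′} h = exact λ φ φ-resp → trans (⟪⊗⟫ a b φ) (trans (⟪⟫-cong a (λ u → apply h (λ v → φ (u ∙ v)) (λ v≈w → φ-resp (∙-congˡ v≈w)))) (sym (⟪⊗⟫ a b′ φ)))

  ⊗-cong : ∀ {a a′ b b′} → a ∼ a′ → b ∼ b′ → a ⊗ b ∼ a′ ⊗ b′
  ⊗-cong {a} {a′} {b} {b′} h h′ = exact λ φ φ-resp → trans (apply (⊗-congˡ a h′) φ φ-resp) (trans (apply (⊗-comm a b′) φ φ-resp)
    (trans (apply (⊗-congˡ b′ h) φ φ-resp) (apply (⊗-comm b′ a′) φ φ-resp)))

  monoidRing : CommutativeRing 0ℓ 0ℓ
  monoidRing = record
    { Carrier = FormalSum ; _≈_ = _∼_ ; _+_ = _++_ ; _*_ = _⊗_ ; -_ = ⊖_ ; 0# = [] ; 1# = const 1ℤ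
    ; isCommutativeRing = record
      { isRing = record
        { +-isAbelianGroup = record
          { isGroup = record
            { isMonoid = record
              { isSemigroup = record
                { isMagma = record
                  { isEquivalence = record { refl = exact λ _ _ → refl ; sym = λ h → exact λ φ φ-resp → sym (apply h φ φ-resp)
                                           ; trans = λ h h′ → exact λ φ φ-resp → trans (apply h φ φ-resp) (apply h′ φ φ-resp) }
                  ; ∙-cong = λ {a} {a′} {b} {b′} h h′ → exact λ φ φ-resp → trans (⟪++⟫ a b φ) (trans (cong₂ _+_ (apply h φ φ-resp) (apply h′ φ φ-resp)) (sym (⟪++⟫ a′ b′ φ))) }
                ; assoc = λ a b c → exact (λ φ _ → trans (⟪++⟫ (a ++ b) c φ) (trans (cong (_+ ⟪ c ⟫ φ) (⟪++⟫ a b φ))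
                    (trans (ℤₚ.+-assoc (⟪ a ⟫ φ) (⟪ b ⟫ φ) (⟪ c ⟫ φ)) (sym (trans (⟪++⟫ a (b ++ c) φ) (cong (_+_ (⟪ a ⟫ φ)) (⟪++⟫ b c φ))))))) }
              ; identity = (λ a → exact (λ _ _ → refl)) , (λ a → exact (λ φ _ → trans (⟪++⟫ a [] φ) (ℤₚ.+-identityʳ (⟪ a ⟫ φ)))) }
            ; inverse = (λ a → exact (λ φ _ → trans (⟪++⟫ (⊖ a) a φ) (trans (cong (_+ ⟪ a ⟫ φ) (⟪⊖⟫ a φ)) (ℤₚ.+-inverseˡ (⟪ a ⟫ φ)))))
                      , (λ a → exact (λ φ _ → trans (⟪++⟫ a (⊖ a) φ) (trans (cong (_+_ (⟪ a ⟫ φ)) (⟪⊖⟫ a φ)) (ℤₚ.+-inverseʳ (⟪ a ⟫ φ)))))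
            ; ⁻¹-cong = λ {a} {b} h → exact λ φ φ-resp → trans (⟪⊖⟫ a φ) (trans (cong -_ (apply h φ φ-resp)) (sym (⟪⊖⟫ b φ))) }
          ; comm = λ a b → exact (λ φ _ → trans (⟪++⟫ a b φ) (trans (ℤₚ.+-comm (⟪ a ⟫ φ) (⟪ b ⟫ φ)) (sym (⟪++⟫ b a φ)))) }
        ; *-cong = ⊗-cong
        ; *-assoc = λ a b c → exact (λ φ φ-resp → trans (⟪⊗⟫ (a ⊗ b) c φ)
            (trans (⟪⊗⟫ a b (λ u → ⟪ c ⟫ (λ v → φ (u ∙ v)))) (sym (trans (⟪⊗⟫ a (b ⊗ c) φ)
              (⟪⟫-cong a (λ u → trans (⟪⊗⟫ b c (λ v → φ (u ∙ v))) (⟪⟫-cong b (λ v → ⟪⟫-cong c (λ w → φ-resp (symᴹ (assoc u v w)))))))))))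
        ; *-identity = (λ a → exact (λ φ φ-resp → trans (⟪const⊗⟫ 1ℤ a φ-resp) (ℤₚ.*-identityˡ (⟪ a ⟫ φ))))
                     , (λ a → exact λ φ φ-resp → trans (apply (⊗-comm a (const 1ℤ)) φ φ-resp) (trans (⟪const⊗⟫ 1ℤ a φ-resp) (ℤₚ.*-identityˡ (⟪ a ⟫ φ))))
        ; distrib = (λ a b c → exact (λ φ _ → trans (⟪⊗⟫ a (b ++ c) φ) (trans
                (trans (⟪⟫-cong a (λ u → ⟪++⟫ b c (λ v → φ (u ∙ v)))) (⟪⟫-+ a (λ u → ⟪ b ⟫ (λ v → φ (u ∙ v))) (λ u → ⟪ c ⟫ (λ v → φ (u ∙ v)))))
                (sym (trans (⟪++⟫ (a ⊗ b) (a ⊗ c) φ) (cong₂ _+_ (⟪⊗⟫ a b φ) (⟪⊗⟫ a c φ)))))))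
                  , (λ a b c → exact (λ φ _ → trans (⟪⊗⟫ (b ++ c) a φ) (trans
                (⟪++⟫ b c (λ u → ⟪ a ⟫ (λ v → φ (u ∙ v))))
                (sym (trans (⟪++⟫ (b ⊗ a) (c ⊗ a) φ) (cong₂ _+_ (⟪⊗⟫ b a φ) (⟪⊗⟫ c a φ)))))))
        }
      ; *-comm = ⊗-comm } }

  ⟪∑⟫ : {A : Set} (xs : List A) (f : A → FormalSum) (φ : G → ℤ) → ⟪ ListSum.∑ monoidRing xs f ⟫ φ ≡ ∑ xs (λ x → ⟪ f x ⟫ φ)
  ⟪∑⟫ []       f φ = refl
  ⟪∑⟫ (x ∷ xs) f φ = trans (⟪++⟫ (f x) (ListSum.∑ monoidRing xs f) φ) (cong (_+_ (⟪ f x ⟫ φ)) (⟪∑⟫ xs f φ))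

-- Hurwitz series: sequences multiplied like exponential generating functions, so that the shift ∂ is a derivation.
module HurwitzSeries (R : CommutativeRing 0ℓ 0ℓ) where
  open CommutativeRing R hiding (zero)
  open import Relation.Binary.Reasoning.Setoid setoid
  open IntegerSolver R using (solve; _:=_; _:+_)
  open import Algebra.Properties.Semiring.Mult semiring using (×-congʳ) renaming (_×_ to _·_)

  Series : Set
  Series = ℕ → Carrier

  infix 4 _≋_
  _≋_ : Series → Series → Set
  a ≋ b = ∀ n → a n ≈ b n

  ∂ : Series → Series
  ∂ a n = a (suc n)

  infixl 7 _∗_
  _∗_ : Series → Series → Series
  (a ∗ b) zero    = a 0 * b 0
  (a ∗ b) (suc n) = (∂ a ∗ b) n + (a ∗ ∂ b) n

  infixl 6 _⊞_
  _⊞_ : Series → Series → Series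
  (a ⊞ b) n = a n + b n

  infixr 8 _⊡_
  _⊡_ : Carrier → Series → Series
  (c ⊡ a) n = c * a n

  one : Series
  one zero    = 1#
  one (suc n) = 0#

  ∗-cong≤ : ∀ n {a a′ b b′} → (∀ i → i ℕ.≤ n → a i ≈ a′ i) → (∀ i → i ℕ.≤ n → b i ≈ b′ i) → (a ∗ b) n ≈ (a′ ∗ b′) n
  ∗-cong≤ zero    a≈ b≈ = *-cong (a≈ 0 z≤n) (b≈ 0 z≤n)
  ∗-cong≤ (suc n) a≈ b≈ = +-cong
    (∗-cong≤ n (λ i i≤n → a≈ (suc i) (s≤s i≤n)) (λ i i≤n → b≈ i (ℕₚ.m≤n⇒m≤1+n i≤n)))
    (∗-cong≤ n (λ i i≤n → a≈ i (ℕₚ.m≤n⇒m≤1+n i≤n)) (λ i i≤n → b≈ (suc i) (s≤s i≤n)))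

  ∗-cong : ∀ {a a′ b b′} → a ≋ a′ → b ≋ b′ → a ∗ b ≋ a′ ∗ b′
  ∗-cong a≈ b≈ n = ∗-cong≤ n (λ i _ → a≈ i) (λ i _ → b≈ i)

  ∗-comm : ∀ a b → a ∗ b ≋ b ∗ a
  ∗-comm a b zero    = *-comm (a 0) (b 0)
  ∗-comm a b (suc n) = trans (+-cong (∗-comm (∂ a) b n) (∗-comm a (∂ b) n)) (+-comm _ _)

  ∗-distribʳ : ∀ a b c → (a ⊞ b) ∗ c ≋ a ∗ c ⊞ b ∗ c
  ∗-distribʳ a b c zero    = distribʳ (c 0) (a 0) (b 0)
  ∗-distribʳ a b c (suc n) = trans (+-cong (∗-distribʳ (∂ a) (∂ b) c n) (∗-distribʳ a b (∂ c) n))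
    (solve 4 (λ a b c d → (a :+ b) :+ (c :+ d) := (a :+ c) :+ (b :+ d)) refl _ _ _ _)

  ∗-distribˡ : ∀ a b c → a ∗ (b ⊞ c) ≋ a ∗ b ⊞ a ∗ c
  ∗-distribˡ a b c n = trans (∗-comm a (b ⊞ c) n) (trans (∗-distribʳ b c a n) (+-cong (∗-comm b a n) (∗-comm c a n)))

  ∗-assoc : ∀ a b c → (a ∗ b) ∗ c ≋ a ∗ (b ∗ c)
  ∗-assoc a b c zero    = *-assoc (a 0) (b 0) (c 0)
  ∗-assoc a b c (suc n) = begin
    ((∂ a ∗ b ⊞ a ∗ ∂ b) ∗ c) n + ((a ∗ b) ∗ ∂ c) n
      ≈⟨ +-congʳ (∗-distribʳ (∂ a ∗ b) (a ∗ ∂ b) c n) ⟩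
    ((∂ a ∗ b) ∗ c) n + ((a ∗ ∂ b) ∗ c) n + ((a ∗ b) ∗ ∂ c) n
      ≈⟨ +-cong (+-cong (∗-assoc (∂ a) b c n) (∗-assoc a (∂ b) c n)) (∗-assoc a b (∂ c) n) ⟩
    (∂ a ∗ (b ∗ c)) n + (a ∗ (∂ b ∗ c)) n + (a ∗ (b ∗ ∂ c)) n
      ≈⟨ +-assoc _ _ _ ⟩
    (∂ a ∗ (b ∗ c)) n + ((a ∗ (∂ b ∗ c)) n + (a ∗ (b ∗ ∂ c)) n)
      ≈⟨ +-congˡ (∗-distribˡ a (∂ b ∗ c) (b ∗ ∂ c) n) ⟨
    (∂ a ∗ (b ∗ c)) n + (a ∗ ∂ (b ∗ c)) n ∎

  ⊡-∗ : ∀ c a b → (c ⊡ a) ∗ b ≋ c ⊡ (a ∗ b)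
  ⊡-∗ c a b zero    = *-assoc c (a 0) (b 0)
  ⊡-∗ c a b (suc n) = trans (+-cong (⊡-∗ c (∂ a) b n) (⊡-∗ c a (∂ b) n)) (sym (distribˡ c _ _))

  zero-∗ : ∀ b n → ((λ _ → 0#) ∗ b) n ≈ 0#
  zero-∗ b zero    = zeroˡ (b 0)
  zero-∗ b (suc n) = trans (+-cong (zero-∗ b n) (zero-∗ (∂ b) n)) (+-identityˡ 0#)

  one-∗ : ∀ b → one ∗ b ≋ b
  one-∗ b zero    = *-identityˡ (b 0)
  one-∗ b (suc n) = trans (+-cong (zero-∗ b n) (one-∗ (∂ b) n)) (+-identityˡ _)

  X∗ : Series → Series
  X∗ a zero    = 0#
  X∗ a (suc n) = suc n · a n

  ∂-X∗ : ∀ a → ∂ (X∗ a) ≋ a ⊞ X∗ (∂ a)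
  ∂-X∗ a zero    = refl
  ∂-X∗ a (suc n) = refl

  X∗-⊞ : ∀ a b → X∗ (a ⊞ b) ≋ X∗ a ⊞ X∗ b
  X∗-⊞ a b zero    = sym (+-identityˡ 0#)
  X∗-⊞ a b (suc n) = go (suc n)
    where
    go : ∀ k → k · (a n + b n) ≈ k · a n + k · b n
    go zero    = sym (+-identityˡ 0#)
    go (suc k) = trans (+-congˡ (go k)) (solve 4 (λ a b c d → (a :+ b) :+ (c :+ d) := (a :+ c) :+ (b :+ d)) refl _ _ _ _)

  X∗-∗ : ∀ a b → X∗ a ∗ b ≋ X∗ (a ∗ b)
  X∗-∗ a b zero    = zeroˡ (b 0)
  X∗-∗ a b (suc n) = begin
    (∂ (X∗ a) ∗ b) n + (X∗ a ∗ ∂ b) n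
      ≈⟨ +-cong (∗-cong (∂-X∗ a) (λ _ → refl) n) (X∗-∗ a (∂ b) n) ⟩
    ((a ⊞ X∗ (∂ a)) ∗ b) n + X∗ (a ∗ ∂ b) n
      ≈⟨ +-congʳ (trans (∗-distribʳ a (X∗ (∂ a)) b n) (+-congˡ (X∗-∗ (∂ a) b n))) ⟩
    (a ∗ b) n + X∗ (∂ a ∗ b) n + X∗ (a ∗ ∂ b) n
      ≈⟨ trans (+-assoc _ _ _) (+-congˡ (sym (X∗-⊞ (∂ a ∗ b) (a ∗ ∂ b) n))) ⟩
    (a ∗ b) n + X∗ (∂ (a ∗ b)) n
      ≈⟨ ∂-X∗ (a ∗ b) n ⟨
    X∗ (a ∗ b) (suc n) ∎

  -- The Hurwitz series with the same generating function as the ordinary series α.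
  hurwitz : Series → Series
  hurwitz α zero    = α 0
  hurwitz α (suc n) = suc n · hurwitz (∂ α) n

  -- Split off the constant term of the ordinary series, α = α 0 + X · ∂ α. In Hurwitz form
  -- multiplication by X is `X∗`, and it passes through products.
  hurwitz-∗ : ∀ α b n → (hurwitz α ∗ b) (suc n) ≈ α 0 * b (suc n) + suc n · (hurwitz (∂ α) ∗ b) n
  hurwitz-∗ α b n = begin
    (hurwitz α ∗ b) (suc n)
      ≈⟨ ∗-cong split (λ _ → refl) (suc n) ⟩
    ((α 0 ⊡ one ⊞ X∗ (hurwitz (∂ α))) ∗ b) (suc n)
      ≈⟨ ∗-distribʳ (α 0 ⊡ one) (X∗ (hurwitz (∂ α))) b (suc n) ⟩
    ((α 0 ⊡ one) ∗ b) (suc n) + (X∗ (hurwitz (∂ α)) ∗ b) (suc n)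
      ≈⟨ +-cong (trans (⊡-∗ (α 0) one b (suc n)) (*-congˡ (one-∗ b (suc n)))) (X∗-∗ (hurwitz (∂ α)) b (suc n)) ⟩
    α 0 * b (suc n) + suc n · (hurwitz (∂ α) ∗ b) n ∎
    where
    split : hurwitz α ≋ α 0 ⊡ one ⊞ X∗ (hurwitz (∂ α))
    split zero    = sym (trans (+-identityʳ _) (*-identityʳ _))
    split (suc n) = sym (trans (+-congʳ (zeroʳ _)) (+-identityˡ _))

  hurwitz-cong : ∀ {α β} → α ≋ β → hurwitz α ≋ hurwitz β
  hurwitz-cong α≈β zero    = α≈β 0
  hurwitz-cong α≈β (suc n) = ×-congʳ (suc n) (hurwitz-cong (α≈β ∘ suc) n)

  convolution : Series → Series → Series
  convolution α β zero    = α 0 * β 0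
  convolution α β (suc n) = α 0 * β (suc n) + convolution (∂ α) β n

  hurwitz-constant : ∀ α n → hurwitz α n ≈ hurwitz (λ _ → α n) n
  hurwitz-constant α zero    = refl
  hurwitz-constant α (suc n) = ×-congʳ (suc n) (hurwitz-constant (∂ α) n)

  hurwitz-constant-+ : ∀ x y n → hurwitz (λ _ → x + y) n ≈ hurwitz (λ _ → x) n + hurwitz (λ _ → y) n
  hurwitz-constant-+ x y zero    = refl
  hurwitz-constant-+ x y (suc n) = trans (×-congʳ (suc n) (hurwitz-constant-+ x y n)) (X∗-⊞ (hurwitz (λ _ → x)) (hurwitz (λ _ → y)) (suc n))

  hurwitz-constant-* : ∀ x y n → x * hurwitz (λ _ → y) n ≈ hurwitz (λ _ → x * y) n
  hurwitz-constant-* x y zero    = refl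
  hurwitz-constant-* x y (suc n) = trans (go (suc n)) (×-congʳ (suc n) (hurwitz-constant-* x y n))
    where
    go : ∀ k → x * (k · hurwitz (λ _ → y) n) ≈ k · (x * hurwitz (λ _ → y) n)
    go zero    = zeroʳ x
    go (suc k) = trans (distribˡ x _ _) (+-congˡ (go k))

  hurwitz-convolution : ∀ α β → hurwitz α ∗ hurwitz β ≋ hurwitz (convolution α β)
  hurwitz-convolution α β zero    = refl
  hurwitz-convolution α β (suc n) = begin
    (hurwitz α ∗ hurwitz β) (suc n)
      ≈⟨ hurwitz-∗ α (hurwitz β) n ⟩
    α 0 * hurwitz β (suc n) + suc n · (hurwitz (∂ α) ∗ hurwitz β) n
      ≈⟨ +-cong (trans (*-congˡ (hurwitz-constant β (suc n))) (hurwitz-constant-* (α 0) (β (suc n)) (suc n)))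
           (×-congʳ (suc n) (trans (hurwitz-convolution (∂ α) β n) (hurwitz-constant (convolution (∂ α) β) n))) ⟩
    hurwitz (λ _ → α 0 * β (suc n)) (suc n) + hurwitz (λ _ → convolution (∂ α) β n) (suc n)
      ≈⟨ hurwitz-constant-+ _ _ (suc n) ⟨
    hurwitz (λ _ → convolution α β (suc n)) (suc n)
      ≈⟨ hurwitz-constant (convolution α β) (suc n) ⟨
    hurwitz (convolution α β) (suc n) ∎

  module _ {c u v : Series} where
    linear-unique : (∀ n → u (suc n) ≈ (c ∗ u) n) → (∀ n → v (suc n) ≈ (c ∗ v) n) → u 0 ≈ v 0 → ∀ n i → i ℕ.≤ n → u i ≈ v i
    linear-unique u′ v′ u0 n       zero    i≤n       = u0
    linear-unique u′ v′ u0 (suc n) (suc i) (s≤s i≤n) = trans (u′ i) (trans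
      (∗-cong≤ i (λ _ _ → refl) (λ j j≤i → linear-unique u′ v′ u0 n j (ℕₚ.≤-trans j≤i i≤n))) (sym (v′ i)))

  private
    -- Iterates for z′ = c z with z(0) = 1, correct up to index n. The product at i reads only
    -- entries up to i but takes a whole series as argument, so the solution is read off from the
    -- diagonal.
    approximation : Series → ℕ → Series
    approximation c zero    i       = 1#
    approximation c (suc n) zero    = 1#
    approximation c (suc n) (suc i) = (c ∗ approximation c n) i

    approximation-stable : ∀ c n m i → i ℕ.≤ n → i ℕ.≤ m → approximation c n i ≈ approximation c m i
    approximation-stable c zero    zero    zero    _ _ = refl
    approximation-stable c zero    (suc m) zero    _ _ = refl
    approximation-stable c (suc n) zero    zero    _ _ = refl
    approximation-stable c (suc n) (suc m) zero    _ _ = refl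
    approximation-stable c (suc n) (suc m) (suc i) (s≤s i≤n) (s≤s i≤m) =
      ∗-cong≤ i (λ _ _ → refl) (λ j j≤i → approximation-stable c n m j (ℕₚ.≤-trans j≤i i≤n) (ℕₚ.≤-trans j≤i i≤m))

  exponential : Series → Series
  exponential c n = approximation c n n

  exponential-∂ : ∀ c n → exponential c (suc n) ≈ (c ∗ exponential c) n
  exponential-∂ c n = ∗-cong≤ n (λ _ _ → refl) (λ i i≤n → approximation-stable c n i i i≤n ℕₚ.≤-refl)

-- Fredholm determinants of integer matrices

module Minors {I : Set} (_≟_ : DecidableEquality I) (A : I → I → ℤ) where
  open import Data.Integer.Base using (_+_; _*_; _-_; -_; 0ℤ; 1ℤ)
  open import Data.Integer.Tactic.RingSolver using (solve-∀)
  open ≡ using (refl; sym; trans; cong; cong₂)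

  -- The pattern of a Laplace expansion: each entry is picked in turn and handed over with the
  -- remaining list. Minors are indexed by arbitrary lists, repetitions included, so that
  -- coefficients of det(1 - T A) become sums over all n-tuples at the price of a factor n!.
  alternatingPicks picks : (I → List I → ℤ) → List I → ℤ
  alternatingPicks g []       = 0ℤ
  alternatingPicks g (y ∷ ys) = g y ys - alternatingPicks (λ z zs → g z (y ∷ zs)) ys
  picks g []       = 0ℤ
  picks g (y ∷ ys) = g y ys + picks (λ z zs → g z (y ∷ zs)) ys

  alternatingPicks-cong : ∀ {g h} ys → (∀ z zs → g z zs ≡ h z zs) → alternatingPicks g ys ≡ alternatingPicks h ys
  alternatingPicks-cong []       g≡h = refl
  alternatingPicks-cong (y ∷ ys) g≡h = cong₂ _-_ (g≡h y ys) (alternatingPicks-cong ys (λ z zs → g≡h z (y ∷ zs)))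

  picks-cong : ∀ {g h} ys → (∀ z zs → g z zs ≡ h z zs) → picks g ys ≡ picks h ys
  picks-cong []       g≡h = refl
  picks-cong (y ∷ ys) g≡h = cong₂ _+_ (g≡h y ys) (picks-cong ys (λ z zs → g≡h z (y ∷ zs)))

  alternatingPicks-+ : ∀ g h ys → alternatingPicks (λ z zs → g z zs + h z zs) ys ≡ alternatingPicks g ys + alternatingPicks h ys
  alternatingPicks-+ g h []       = refl
  alternatingPicks-+ g h (y ∷ ys) = trans (cong (λ x → g y ys + h y ys - x) (alternatingPicks-+ _ _ ys)) (lemma (g y ys) (h y ys) _ _)
    where
    lemma : ∀ a b c d → a + b - (c + d) ≡ (a - c) + (b - d)
    lemma = solve-∀

  alternatingPicks-* : ∀ c g ys → alternatingPicks (λ z zs → c * g z zs) ys ≡ c * alternatingPicks g ys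
  alternatingPicks-* c g []       = sym (ℤₚ.*-zeroʳ c)
  alternatingPicks-* c g (y ∷ ys) = trans (cong (λ x → c * g y ys - x) (alternatingPicks-* c _ ys)) (lemma c (g y ys) _)
    where
    lemma : ∀ c a b → c * a - c * b ≡ c * (a - b)
    lemma = solve-∀

  picks-neg : ∀ g ys → picks (λ z zs → - g z zs) ys ≡ - picks g ys
  picks-neg g []       = refl
  picks-neg g (y ∷ ys) = trans (cong (_+_ (- g y ys)) (picks-neg _ ys)) (sym (ℤₚ.neg-distrib-+ (g y ys) _))

  -- The same ordered pair of entries is reached by two successive picks in either order, with
  -- opposite signs. This is the sign rule behind exchanging two rows.
  alternatingPicks-swap : ∀ (g : I → I → List I → ℤ) ys →
    alternatingPicks (λ y → alternatingPicks (g y)) ys + alternatingPicks (λ y → alternatingPicks (λ z → g z y)) ys ≡ 0ℤ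
  alternatingPicks-swap g []       = refl
  alternatingPicks-swap g (y ∷ ys) = trans
    (cong₂ _+_ (cong (λ u → alternatingPicks (g y) ys - u) (expand g)) (cong (λ u → alternatingPicks (λ z → g z y) ys - u) (expand (λ z w → g w z))))
    (trans (lemma (alternatingPicks (g y) ys) (alternatingPicks (λ z → g z y) ys) _ _)
      (alternatingPicks-swap (λ z w ws → g z w (y ∷ ws)) ys))
    where
    expand : ∀ g → alternatingPicks (λ z zs → alternatingPicks (g z) (y ∷ zs)) ys
      ≡ alternatingPicks (λ z zs → g z y zs) ys + - 1ℤ * alternatingPicks (λ z → alternatingPicks (λ w ws → g z w (y ∷ ws))) ys
    expand g = trans (alternatingPicks-cong ys (λ z zs → cong (_+_ (g z y zs)) (sym (ℤₚ.-1*i≡-i _))))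
      (trans (alternatingPicks-+ (λ z zs → g z y zs) (λ z zs → - 1ℤ * alternatingPicks (λ w ws → g z w (y ∷ ws)) zs) ys)
        (cong (_+_ (alternatingPicks (λ z zs → g z y zs) ys)) (alternatingPicks-* (- 1ℤ) (λ z → alternatingPicks (λ w ws → g z w (y ∷ ws))) ys)))
    lemma : ∀ a b c d → a - (b + - 1ℤ * c) + (b - (a + - 1ℤ * d)) ≡ c + d
    lemma = solve-∀

  minor : List I → List I → ℤ
  minor []       ys = 1ℤ
  minor (x ∷ xs) ys = alternatingPicks (λ y zs → A x y * minor xs zs) ys

  Alternating : (List I → ℤ) → Set
  Alternating N = ∀ ws x y zs → N (ws ++ x ∷ y ∷ zs) ≡ - N (ws ++ y ∷ x ∷ zs)

  minor-alternating : ∀ ys → Alternating (λ xs → minor xs ys)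
  minor-alternating ys [] x y zs = lemma _ _ (trans (cong₂ _+_
      (alternatingPicks-cong ys (λ a as → sym (alternatingPicks-* (A x a) _ as)))
      (trans (alternatingPicks-cong ys (λ a as → sym (alternatingPicks-* (A y a) _ as)))
        (alternatingPicks-cong ys (λ a as → alternatingPicks-cong as (λ b bs → swap (A y a) (A x b) _)))))
    (alternatingPicks-swap (λ a b bs → A x a * (A y b * minor zs bs)) ys))
    where
    swap : ∀ a b c → a * (b * c) ≡ b * (a * c)
    swap = solve-∀
    lemma : ∀ a b → a + b ≡ 0ℤ → a ≡ - b
    lemma a b eq = trans (lemma′ a b) (trans (cong (_- b) eq) (ℤₚ.+-identityˡ (- b)))
      where
      lemma′ : ∀ a b → a ≡ a + b - b
      lemma′ = solve-∀
  minor-alternating ys (w ∷ ws) x y zs = trans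
    (alternatingPicks-cong ys (λ a as → trans (cong (A w a *_) (minor-alternating as ws x y zs)) (lemma (A w a) _)))
    (trans (alternatingPicks-* (- 1ℤ) _ ys) (ℤₚ.-1*i≡-i _))
    where
    lemma : ∀ a b → a * - b ≡ - 1ℤ * (a * b)
    lemma = solve-∀

  -- Adjacent exchanges carry x next to its second occurrence, where the value equals its own
  -- negative, and ℤ has no 2-torsion.
  alternating-repeat : ∀ {N} → Alternating N → ∀ {x} xs → x ∈ xs → N (x ∷ xs) ≡ 0ℤ
  alternating-repeat {N} alt {x} (.x ∷ xs) (here refl) = self-neg _ (alt [] x x xs)
    where
    self-neg : ∀ a → a ≡ - a → a ≡ 0ℤ
    self-neg (+ zero)   _ = refl
    self-neg (+ suc n)  ()
    self-neg -[1+ n ]   ()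
  alternating-repeat {N} alt {x} (y ∷ xs) (there x∈xs) = trans (alt [] x y xs)
    (cong -_ (alternating-repeat {N ∘ (y ∷_)} (λ ws → alt (y ∷ ws)) xs x∈xs))

  open import Data.List.Relation.Unary.Unique.Propositional using (Unique)
  open import Data.List.Relation.Unary.AllPairs using ([]; _∷_)
  open import Data.List.Membership.DecPropositional _≟_ using (_∈?_)
  open import Data.List.Relation.Unary.All.Properties using (¬Any⇒All¬)

  alternating-unique : ∀ {N} → Alternating N → ∀ xs → Unique xs ⊎ N xs ≡ 0ℤ
  alternating-unique {N} alt [] = inj₁ []
  alternating-unique {N} alt (x ∷ xs) with x ∈? xs
  ... | yes x∈xs = inj₂ (alternating-repeat {N} alt xs x∈xs)
  ... | no x∉xs with alternating-unique {N ∘ (x ∷_)} (λ ws → alt (x ∷ ws)) xs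
  ...   | inj₁ u = inj₁ (¬Any⇒All¬ xs x∉xs ∷ u)
  ...   | inj₂ z = inj₂ z

  diagonal-unique : ∀ xs → Unique xs ⊎ minor xs xs ≡ 0ℤ
  diagonal-unique xs = alternating-unique {λ ys → minor ys xs} (minor-alternating xs) xs

  -- Moving the picked row to the front absorbs the signs.
  alternatingPicks≡picks : ∀ (N : I → List I → List I → ℤ) → (∀ z zs → Alternating (N z zs)) → ∀ xs →
    alternatingPicks (λ z zs → N z zs xs) xs ≡ picks (λ z zs → N z zs (z ∷ zs)) xs
  alternatingPicks≡picks N alt []       = refl
  alternatingPicks≡picks N alt (x ∷ xs) = cong (_+_ (N x xs (x ∷ xs))) (trans
    (cong -_ (trans (alternatingPicks≡picks (λ z zs rows → N z (x ∷ zs) (x ∷ rows)) (λ z zs ws → alt z (x ∷ zs) (x ∷ ws)) xs)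
      (trans (picks-cong xs (λ z zs → alt z (x ∷ zs) [] x z zs)) (picks-neg _ xs))))
    (ℤₚ.neg-involutive _))

module FredholmRecursion {I : Set} (_≟_ : DecidableEquality I) (elems : List I) (A : I → I → ℤ) where
  open import Data.Integer.Base using (_+_; _*_; _-_; -_; 1ℤ)
  open import Data.Integer.Tactic.RingSolver using (solve-∀)
  open ≡ using (refl; sym; trans; cong; cong₂)
  open Minors _≟_ A
  open ListSum ℤₚ.+-*-commutativeRing
  open Matrices ℤₚ.+-*-commutativeRing using (mul; tr)
  open HurwitzSeries ℤₚ.+-*-commutativeRing

  ∑ⁿ : ℕ → (List I → ℤ) → ℤ
  ∑ⁿ zero    F = F []
  ∑ⁿ (suc n) F = ∑ elems (λ x → ∑ⁿ n (λ xs → F (x ∷ xs)))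

  ∑ⁿ-cong : ∀ n {F G} → (∀ xs → F xs ≡ G xs) → ∑ⁿ n F ≡ ∑ⁿ n G
  ∑ⁿ-cong zero    F≡G = F≡G []
  ∑ⁿ-cong (suc n) F≡G = ∑-cong elems (λ x → ∑ⁿ-cong n (λ xs → F≡G (x ∷ xs)))

  ∑ⁿ-+ : ∀ n F G → ∑ⁿ n (λ xs → F xs + G xs) ≡ ∑ⁿ n F + ∑ⁿ n G
  ∑ⁿ-+ zero    F G = refl
  ∑ⁿ-+ (suc n) F G = trans (∑-cong elems (λ x → ∑ⁿ-+ n (F ∘ (x ∷_)) (G ∘ (x ∷_)))) (∑-+ elems _ _)

  ∑ⁿ-* : ∀ n c F → ∑ⁿ n (λ xs → c * F xs) ≡ c * ∑ⁿ n F
  ∑ⁿ-* zero    c F = refl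
  ∑ⁿ-* (suc n) c F = trans (∑-cong elems (λ x → ∑ⁿ-* n c (F ∘ (x ∷_)))) (∑-*ˡ elems c (λ x → ∑ⁿ n (F ∘ (x ∷_))))

  -- Each of the n + 1 positions of the picked entry contributes the same iterated sum once the
  -- order of summation is exchanged.
  ∑ⁿ-picks : ∀ n (Φ : I → List I → ℤ) → ∑ⁿ (suc n) (picks Φ) ≡ + suc n * ∑ elems (λ z → ∑ⁿ n (Φ z))
  ∑ⁿ-picks zero    Φ = trans (∑-cong elems (λ x → ℤₚ.+-identityʳ _)) (sym (ℤₚ.*-identityˡ _))
  ∑ⁿ-picks (suc n) Φ = begin
    ∑ elems (λ x → ∑ⁿ (suc n) (λ xs → Φ x xs + picks (Φ⁺ x) xs))
      ≡⟨ ∑-cong elems (λ x → ∑ⁿ-+ (suc n) (Φ x) (picks (Φ⁺ x))) ⟩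
    ∑ elems (λ x → ∑ⁿ (suc n) (Φ x) + ∑ⁿ (suc n) (picks (Φ⁺ x)))
      ≡⟨ ∑-+ elems (λ x → ∑ⁿ (suc n) (Φ x)) (λ x → ∑ⁿ (suc n) (picks (Φ⁺ x))) ⟩
    S + ∑ elems (λ x → ∑ⁿ (suc n) (picks (Φ⁺ x)))
      ≡⟨ cong (_+_ S) (∑-cong elems (λ x → ∑ⁿ-picks n (Φ⁺ x))) ⟩
    S + ∑ elems (λ x → + suc n * ∑ elems (λ z → ∑ⁿ n (Φ⁺ x z)))
      ≡⟨ cong (_+_ S) (∑-*ˡ elems (+ suc n) (λ x → ∑ elems (λ z → ∑ⁿ n (Φ⁺ x z)))) ⟩
    S + + suc n * ∑ elems (λ x → ∑ elems (λ z → ∑ⁿ n (Φ⁺ x z)))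
      ≡⟨ cong (λ u → S + + suc n * u) (∑-swap elems elems (λ x z → ∑ⁿ n (Φ⁺ x z))) ⟩
    S + + suc n * S
      ≡⟨ lemma (+ suc n) S ⟩
    (1ℤ + + suc n) * S ∎
    where
    open ≡.≡-Reasoning
    Φ⁺ : I → I → List I → ℤ
    Φ⁺ x z zs = Φ z (x ∷ zs)
    S : ℤ
    S = ∑ elems (λ z → ∑ⁿ (suc n) (Φ z))
    lemma : ∀ k a → a + k * a ≡ (1ℤ + k) * a
    lemma = solve-∀

  D : ℕ → ℤ
  D n = ∑ⁿ n (λ xs → minor xs xs)

  -- Fredholm's first minors, the coefficients of the numerator of the resolvent. By definition
  -- `D (suc n)` is the trace of `B n`.
  B : ℕ → I → I → ℤ
  B n x y = ∑ⁿ n (λ xs → minor (x ∷ xs) (y ∷ xs))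

  B-zero : ∀ x y → B 0 x y ≡ A x y * D 0
  B-zero x y = ℤₚ.+-identityʳ _

  -- Laplace expansion along row x. Column y yields A x y times a principal minor. A column z from
  -- the tuple yields A x z times a minor whose row z can be moved to the front, which absorbs the
  -- sign, and z has n + 1 possible positions.
  B-suc : ∀ n x y → B (suc n) x y ≡ A x y * D (suc n) - + suc n * mul elems A (B n) x y
  B-suc n x y = begin
    ∑ⁿ (suc n) (λ xs → A x y * minor xs xs - P xs)
      ≡⟨ ∑ⁿ-cong (suc n) (λ xs → cong (_+_ (A x y * minor xs xs)) (sym (ℤₚ.-1*i≡-i (P xs)))) ⟩
    ∑ⁿ (suc n) (λ xs → A x y * minor xs xs + - 1ℤ * P xs)
      ≡⟨ trans (∑ⁿ-+ (suc n) (λ xs → A x y * minor xs xs) (λ xs → - 1ℤ * P xs)) (cong₂ _+_ (∑ⁿ-* (suc n) (A x y) (λ xs → minor xs xs)) (∑ⁿ-* (suc n) (- 1ℤ) P)) ⟩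
    A x y * D (suc n) + - 1ℤ * ∑ⁿ (suc n) P
      ≡⟨ cong (_+_ (A x y * D (suc n))) (ℤₚ.-1*i≡-i _) ⟩
    A x y * D (suc n) - ∑ⁿ (suc n) P
      ≡⟨ cong (λ u → A x y * D (suc n) - u) (trans
           (∑ⁿ-cong (suc n) (λ xs → alternatingPicks≡picks (λ z zs rows → A x z * minor rows (y ∷ zs)) (alt y) xs))
           (trans (∑ⁿ-picks n (λ z zs → A x z * minor (z ∷ zs) (y ∷ zs)))
             (cong (_*_ (+ suc n)) (∑-cong elems (λ z → ∑ⁿ-* n (A x z) (λ zs → minor (z ∷ zs) (y ∷ zs))))))) ⟩
    A x y * D (suc n) - + suc n * mul elems A (B n) x y ∎
    where
    open ≡.≡-Reasoning
    P : List I → ℤ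
    P xs = alternatingPicks (λ z zs → A x z * minor xs (y ∷ zs)) xs
    alt : ∀ y z zs → Alternating (λ rows → A x z * minor rows (y ∷ zs))
    alt y z zs ws a b cs = trans (cong (_*_ (A x z)) (minor-alternating (y ∷ zs) ws a b cs)) (sym (ℤₚ.neg-distribʳ-* (A x z) _))

  powers : ℕ → I → I → ℤ
  powers zero    = A
  powers (suc k) = mul elems A (powers k)

  traces : ℕ → ℤ
  traces k = tr elems (powers k)

  V : ℕ → ℕ → I → I → ℤ
  V zero    n = B n
  V (suc k) n = mul elems A (V k n)

  V-zero : ∀ k x y → V k 0 x y ≡ powers k x y * D 0
  V-zero zero    x y = B-zero x y
  V-zero (suc k) x y = trans (∑-cong elems (λ z → trans (cong (_*_ (A x z)) (V-zero k z y)) (sym (ℤₚ.*-assoc (A x z) (powers k z y) (D 0)))))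
    (∑-*ʳ elems (D 0) (λ z → A x z * powers k z y))

  V-suc : ∀ k n x y → V k (suc n) x y ≡ powers k x y * D (suc n) - + suc n * V (suc k) n x y
  V-suc zero    n x y = B-suc n x y
  V-suc (suc k) n x y = trans (∑-cong elems (λ z → trans (cong (_*_ (A x z)) (V-suc k n z y)) (lemma (A x z) (powers k z y) (D (suc n)) (+ suc n) (V (suc k) n z y))))
    (trans (∑-- elems (λ z → A x z * powers k z y * D (suc n)) (λ z → + suc n * (A x z * V (suc k) n z y)))
      (cong₂ _-_ (∑-*ʳ elems (D (suc n)) (λ z → A x z * powers k z y)) (∑-*ˡ elems (+ suc n) (λ z → A x z * V (suc k) n z y))))
    where
    lemma : ∀ a p d n v → a * (p * d - n * v) ≡ a * p * d - n * (a * v)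
    lemma = solve-∀

  sign : ℕ → ℤ
  sign zero    = 1ℤ
  sign (suc n) = - sign n

  -- n! times the coefficients of det(1 − T A).
  characteristic : ℕ → ℤ
  characteristic n = sign n * D n

  characteristic-0 : characteristic 0 ≡ 1ℤ
  characteristic-0 = refl

  -- Lowering n by one through `V-suc` costs one more factor A, so the induction needs all k at
  -- once. The case k = 0 is Newton's identity for det(1 - T A), written as a differential equation.
  sign-tr-V : ∀ k n → sign n * tr elems (V k n) ≡ (hurwitz (λ r → traces (r ℕ.+ k)) ∗ characteristic) n
  sign-tr-V k zero = trans (cong (_*_ 1ℤ) (trans (∑-cong elems (λ x → V-zero k x x)) (∑-*ʳ elems (D 0) (λ x → powers k x x))))
    (lemma (traces k) (D 0))
    where
    lemma : ∀ t d → 1ℤ * (t * d) ≡ t * (1ℤ * d)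
    lemma = solve-∀
  sign-tr-V k (suc n) = begin
    - sign n * tr elems (V k (suc n))
      ≡⟨ cong (_*_ (- sign n)) (trans (∑-cong elems (λ x → V-suc k n x x))
           (trans (∑-- elems (λ x → powers k x x * D (suc n)) (λ x → + suc n * V (suc k) n x x))
             (cong₂ _-_ (∑-*ʳ elems (D (suc n)) (λ x → powers k x x)) (∑-*ˡ elems (+ suc n) (λ x → V (suc k) n x x))))) ⟩
    - sign n * (traces k * D (suc n) - + suc n * tr elems (V (suc k) n))
      ≡⟨ lemma (sign n) (traces k) (D (suc n)) (+ suc n) (tr elems (V (suc k) n)) ⟩
    traces k * characteristic (suc n) + + suc n * (sign n * tr elems (V (suc k) n))
      ≡⟨ cong (λ u → traces k * characteristic (suc n) + + suc n * u) (trans (sign-tr-V (suc k) n)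
           (∗-cong (hurwitz-cong (λ r → cong traces (ℕₚ.+-suc r k))) (λ _ → refl) n)) ⟩
    traces k * characteristic (suc n) + + suc n * (hurwitz (λ r → traces (suc r ℕ.+ k)) ∗ characteristic) n
      ≡⟨ cong (_+_ (traces k * characteristic (suc n))) (times (suc n) _) ⟩
    traces k * characteristic (suc n) + suc n · (hurwitz (λ r → traces (suc r ℕ.+ k)) ∗ characteristic) n
      ≡⟨ hurwitz-∗ (λ r → traces (r ℕ.+ k)) characteristic n ⟨
    (hurwitz (λ r → traces (r ℕ.+ k)) ∗ characteristic) (suc n) ∎
    where
    open ≡.≡-Reasoning
    open import Algebra.Properties.Semiring.Mult (CommutativeRing.semiring ℤₚ.+-*-commutativeRing) using () renaming (_×_ to _·_)
    lemma : ∀ s t d n v → - s * (t * d - n * v) ≡ t * (- s * d) + n * (s * v)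
    lemma = solve-∀
    times : ∀ n x → + n * x ≡ n · x
    times zero    x = ℤₚ.*-zeroˡ x
    times (suc n) x = trans (suc-* (+ n) x) (cong (_+_ x) (times n x))
      where
      suc-* : ∀ n x → (1ℤ + n) * x ≡ x + n * x
      suc-* = solve-∀

  characteristic-∂ : ∀ n → characteristic (suc n) ≡ - (hurwitz traces ∗ characteristic) n
  characteristic-∂ n = trans (sym (ℤₚ.neg-distribˡ-* (sign n) (D (suc n)))) (cong -_ (trans (sign-tr-V 0 n)
    (∗-cong (hurwitz-cong (λ r → cong traces (ℕₚ.+-identityʳ r))) (λ _ → refl) n)))

module UniqueSublists {I : Set} where
  open import Data.List.Relation.Unary.Unique.Propositional using (Unique)
  open import Data.List.Relation.Unary.AllPairs using ([]; _∷_)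
  open import Data.List.Membership.Propositional.Properties using (∈-∃++; ∈-++⁺ˡ; ∈-++⁺ʳ; ∈-++⁻)
  open import Data.List.Properties using (length-++)

  unique⊆⇒length≤ : ∀ {xs ys : List I} → Unique xs → (∀ {x} → x ∈ xs → x ∈ ys) → length xs ℕ.≤ length ys
  unique⊆⇒length≤ {[]} u xs⊆ys = z≤n
  unique⊆⇒length≤ {x ∷ xs} {ys} (x∉xs ∷ u) xs⊆ys with ∈-∃++ (xs⊆ys (here ≡.refl))
  ... | as , bs , ≡.refl = ≡.subst (suc (length xs) ℕ.≤_) (≡.sym (≡.trans (length-++ as) (≡.trans (ℕₚ.+-suc (length as) (length bs)) (≡.cong suc (≡.sym (length-++ as))))))
    (s≤s (unique⊆⇒length≤ u λ y∈xs → drop (xs⊆ys (there y∈xs)) (λ y≡x → All.lookup x∉xs y∈xs (≡.sym y≡x))))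
    where
    drop : ∀ {y} → y ∈ as ++ x ∷ bs → y ≢ x → y ∈ as ++ bs
    drop y∈ y≢x with ∈-++⁻ as y∈
    ... | inj₁ y∈as         = ∈-++⁺ˡ y∈as
    ... | inj₂ (here y≡x)   = ⊥-elim (y≢x y≡x)
    ... | inj₂ (there y∈bs) = ∈-++⁺ʳ as y∈bs

-- Matrices whose rows are increasingly divisible by p, with polynomially many rows of each weight.
record WeightedMatrix (p c k : ℕ) : Set₁ where
  field
    Idx          : Set
    _≟_          : DecidableEquality Idx
    elems        : List Idx
    mat          : Idx → Idx → ℤ
    wt co        : Idx → ℕ
    co≤          : ∀ i → 2 ℕ.* co i ℕ.≤ suc (wt i)
    -- The estimate for row i is relative to a loss p ^ `co j` in column j. In a principal minor the
    -- exponents `wt` - `co` remain, each at least (`wt` - 1) / 2.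
    mat-div      : ∀ i j → (+ p) ℤ.^ wt i ℤD.∣ mat i j ℤ.* (+ p) ℤ.^ co j
    small        : ℕ → List Idx
    small-length : ∀ w → length (small w) ℕ.≤ c ℕ.* suc w ℕ.^ k
    small-cover  : ∀ w i → i ∈ elems → wt i ℕ.≤ w → i ∈ small w
  open FredholmRecursion _≟_ elems mat public using (traces; characteristic; characteristic-0; characteristic-∂)

module CharacteristicDivisibility (p : ℕ) .{{_ : ℕ.NonZero p}} {c k : ℕ} (M : WeightedMatrix p c k) where
  open WeightedMatrix M
  open Minors _≟_ mat
  open FredholmRecursion _≟_ elems mat using (∑ⁿ; D; sign)
  open ListSum ℤₚ.+-*-commutativeRing
  open UniqueSublists
  open import Data.Integer.Base using (_+_; _*_; _-_; -_; 0ℤ; 1ℤ; _^_)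
  open ℤD using (_∣_)
  open import Data.Integer.Tactic.RingSolver using (solve-∀)
  open import Data.List.Relation.Unary.Unique.Propositional using (Unique)
  open import Data.List.Relation.Unary.Unique.Propositional.Properties using () renaming (filter⁺ to unique-filter)
  open import Data.List.Membership.Propositional.Properties using (∈-filter⁻)
  open import Data.List.Properties using (filter-accept; filter-reject)
  open ≡ using (refl; sym; trans; cong; subst)

  P : ℤ
  P = + p

  totalWt totalCo : List Idx → ℕ
  totalWt []       = 0
  totalWt (x ∷ xs) = wt x ℕ.+ totalWt xs
  totalCo []       = 0
  totalCo (x ∷ xs) = co x ℕ.+ totalCo xs

  ∣-*-mono : ∀ {a b c d} → a ∣ b → c ∣ d → a * c ∣ b * d
  ∣-*-mono {a} {b} {c} {d} a∣b c∣d = ℤD.∣-trans (ℤD.*-monoˡ-∣ c a∣b) (ℤD.*-monoʳ-∣ b c∣d)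

  -- The number e collects the co-weights of the columns already passed over in the expansion, so
  -- every summand is compared with the same total co-weight.
  alternatingPicks-div : ∀ d e ys g → (∀ z zs → d ∣ g z zs * P ^ (e ℕ.+ (co z ℕ.+ totalCo zs))) →
    d ∣ alternatingPicks g ys * P ^ (e ℕ.+ totalCo ys)
  alternatingPicks-div d e []       g h = ℤD.divides 0ℤ refl
  alternatingPicks-div d e (y ∷ ys) g h = subst (d ∣_) (lemma (g y ys) _ _)
    (ℤD.∣m∣n⇒∣m-n (h y ys) (subst (λ n → d ∣ alternatingPicks g′ ys * P ^ n) (ℕₚ.+-assoc e (co y) (totalCo ys))
      (alternatingPicks-div d (e ℕ.+ co y) ys g′
        (λ z zs → subst (λ n → d ∣ g z (y ∷ zs) * P ^ n) (exponents e (co z) (co y) (totalCo zs)) (h z (y ∷ zs))))))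
    where
    g′ : Idx → List Idx → ℤ
    g′ z zs = g z (y ∷ zs)
    lemma : ∀ a b c → a * c - b * c ≡ (a - b) * c
    lemma = solve-∀
    exponents : ∀ e a b c → e ℕ.+ (a ℕ.+ (b ℕ.+ c)) ≡ e ℕ.+ b ℕ.+ (a ℕ.+ c)
    exponents = ℕ-solve-∀
      where open import Data.Nat.Tactic.RingSolver using () renaming (solve-∀ to ℕ-solve-∀)

  minor-div : ∀ xs ys → P ^ totalWt xs ∣ minor xs ys * P ^ totalCo ys
  minor-div []       ys = ℤD.divides (1ℤ * P ^ totalCo ys) (sym (ℤₚ.*-identityʳ (1ℤ * P ^ totalCo ys)))
  minor-div (x ∷ xs) ys = alternatingPicks-div (P ^ (wt x ℕ.+ totalWt xs)) 0 ys _
    (λ z zs → ≡.subst₂ _∣_ (sym (ℤₚ.^-distribˡ-+-* P (wt x) (totalWt xs)))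
      (trans (lemma (mat x z) (P ^ co z) (minor xs zs) (P ^ totalCo zs))
        (cong (mat x z * minor xs zs *_) (sym (ℤₚ.^-distribˡ-+-* P (co z) (totalCo zs)))))
      (∣-*-mono (mat-div x z) (minor-div xs zs)))
    where
    lemma : ∀ a b c d → (a * b) * (c * d) ≡ (a * c) * (b * d)
    lemma = solve-∀

  totalCo≤ : ∀ xs → 2 ℕ.* totalCo xs ℕ.≤ totalWt xs ℕ.+ length xs
  totalCo≤ []       = z≤n
  totalCo≤ (x ∷ xs) = ≡.subst₂ ℕ._≤_ (sym (ℕₚ.*-distribˡ-+ 2 (co x) (totalCo xs))) (lemma (wt x) (totalWt xs) (length xs))
    (ℕₚ.+-mono-≤ (co≤ x) (totalCo≤ xs))
    where
    open import Data.Nat.Tactic.RingSolver using () renaming (solve-∀ to ℕ-solve-∀)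
    lemma : ∀ a b n → suc a ℕ.+ (b ℕ.+ n) ≡ a ℕ.+ b ℕ.+ suc n
    lemma = ℕ-solve-∀

  light : ℕ → List Idx → List Idx
  light w = List.filter (λ i → wt i ℕₚ.≤? w)

  heavy : ∀ w xs → w ℕ.* length xs ℕ.≤ totalWt xs ℕ.+ w ℕ.* length (light w xs)
  heavy w [] = ℕₚ.≤-reflexive (refl)
  heavy w (x ∷ xs) with wt x ℕₚ.≤? w
  ... | yes x≤w rewrite filter-accept (λ i → wt i ℕₚ.≤? w) {x} {xs} x≤w = ≡.subst₂ ℕ._≤_ (sym (ℕₚ.*-suc w (length xs)))
        (trans (lemma w (totalWt xs) (wt x) (length (light w xs))) (cong (wt x ℕ.+ totalWt xs ℕ.+_) (sym (ℕₚ.*-suc w _))))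
        (ℕₚ.+-monoʳ-≤ w (ℕₚ.≤-trans (heavy w xs) (ℕₚ.m≤n+m _ (wt x))))
    where
    open import Data.Nat.Tactic.RingSolver using () renaming (solve-∀ to ℕ-solve-∀)
    lemma : ∀ w a b n → w ℕ.+ (b ℕ.+ (a ℕ.+ w ℕ.* n)) ≡ b ℕ.+ a ℕ.+ (w ℕ.+ w ℕ.* n)
    lemma = ℕ-solve-∀
  ... | no x≰w rewrite filter-reject (λ i → wt i ℕₚ.≤? w) {x} {xs} x≰w = ≡.subst₂ ℕ._≤_ (sym (ℕₚ.*-suc w (length xs))) (sym (ℕₚ.+-assoc (wt x) (totalWt xs) _))
        (ℕₚ.+-mono-≤ (ℕₚ.<⇒≤ (ℕₚ.≰⇒> x≰w)) (heavy w xs))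

  light-length : ∀ w xs → Unique xs → All (_∈ elems) xs → length (light w xs) ℕ.≤ c ℕ.* suc w ℕ.^ k
  light-length w xs u xs∈ = ℕₚ.≤-trans (unique⊆⇒length≤ (unique-filter _ u) cover) (small-length w)
    where
    cover : ∀ {x} → x ∈ light w xs → x ∈ small w
    cover x∈ with ∈-filter⁻ (λ i → wt i ℕₚ.≤? w) {xs = xs} x∈
    ... | x∈xs , x≤w = small-cover w _ (All.lookup xs∈ x∈xs) x≤w

  -- At most β indices have weight at most w = 4 L + 2, and 2 β ≤ n, so the total weight is W ≥ w n
  -- / 2 = (2 L + 1) n. The total co-weight C satisfies 2 C ≤ W + n, hence W - C ≥ (W - n) / 2 ≥ n
  -- L.
  exponent≤ : ∀ L n xs → 2 ℕ.* (c ℕ.* suc (4 ℕ.* L ℕ.+ 2) ℕ.^ k) ℕ.≤ n → length xs ≡ n → Unique xs → All (_∈ elems) xs →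
    totalCo xs ℕ.+ n ℕ.* L ℕ.≤ totalWt xs
  exponent≤ L n xs 2β≤n refl u xs∈ = ℕₚ.*-cancelˡ-≤ 2 (ℕₚ.≤-trans (ℕₚ.≤-reflexive (ℕₚ.*-distribˡ-+ 2 C (n ℕ.* L)))
      (ℕₚ.≤-trans (ℕₚ.+-monoˡ-≤ (2 ℕ.* (n ℕ.* L)) (totalCo≤ xs)) (≡.subst₂ ℕ._≤_ (lemma₂ W n L) (lemma₃ W) (ℕₚ.+-monoʳ-≤ W half))))
    where
    open import Data.Nat.Tactic.RingSolver using () renaming (solve-∀ to ℕ-solve-∀)
    w W C β : ℕ
    w = 4 ℕ.* L ℕ.+ 2
    W = totalWt xs
    C = totalCo xs
    β = c ℕ.* suc w ℕ.^ k
    lemma₁ : ∀ n L → (4 ℕ.* L ℕ.+ 2) ℕ.* n ≡ 2 ℕ.* (n ℕ.+ 2 ℕ.* (n ℕ.* L))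
    lemma₁ = ℕ-solve-∀
    lemma₂ : ∀ W n L → W ℕ.+ (n ℕ.+ 2 ℕ.* (n ℕ.* L)) ≡ W ℕ.+ n ℕ.+ 2 ℕ.* (n ℕ.* L)
    lemma₂ = ℕ-solve-∀
    lemma₃ : ∀ W → W ℕ.+ W ≡ 2 ℕ.* W
    lemma₃ = ℕ-solve-∀
    lemma₄ : ∀ w n → 2 ℕ.* (w ℕ.* n) ≡ w ℕ.* n ℕ.+ w ℕ.* n
    lemma₄ = ℕ-solve-∀
    lemma₅ : ∀ w W β → 2 ℕ.* (W ℕ.+ w ℕ.* β) ≡ 2 ℕ.* W ℕ.+ w ℕ.* (2 ℕ.* β)
    lemma₅ = ℕ-solve-∀
    full : 2 ℕ.* (w ℕ.* n) ℕ.≤ 2 ℕ.* W ℕ.+ w ℕ.* n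
    full = ℕₚ.≤-trans (ℕₚ.*-monoʳ-≤ 2 (ℕₚ.≤-trans (heavy w xs) (ℕₚ.+-monoʳ-≤ W (ℕₚ.*-monoʳ-≤ w (light-length w xs u xs∈)))))
      (ℕₚ.≤-trans (ℕₚ.≤-reflexive (lemma₅ w W β)) (ℕₚ.+-monoʳ-≤ (2 ℕ.* W) (ℕₚ.*-monoʳ-≤ w 2β≤n)))
    half : n ℕ.+ 2 ℕ.* (n ℕ.* L) ℕ.≤ W
    half = ℕₚ.*-cancelˡ-≤ 2 (≡.subst (ℕ._≤ 2 ℕ.* W) (lemma₁ n L)
      (ℕₚ.+-cancelʳ-≤ (w ℕ.* n) (w ℕ.* n) (2 ℕ.* W) (≡.subst (ℕ._≤ 2 ℕ.* W ℕ.+ w ℕ.* n) (lemma₄ w n) full)))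

  P^≢0 : ∀ n → ℤ.NonZero (P ^ n)
  P^≢0 n = ℤ.≢-nonZero (λ eq → ℕ.≢-nonZero⁻¹ (p ℕ.^ n) {{ℕₚ.m^n≢0 p n}} (ℤₚ.+-injective (trans (pos-^ n) eq)))
    where
    pos-^ : ∀ n → + (p ℕ.^ n) ≡ P ^ n
    pos-^ zero    = refl
    pos-^ (suc n) = trans (ℤₚ.pos-* p (p ℕ.^ n)) (cong (P *_) (pos-^ n))

  -- A repeated index makes the minor vanish. For distinct indices the exponent estimate applies,
  -- and the column factor p ^ C is cancelled.
  diagonal-div : ∀ L n xs → 2 ℕ.* (c ℕ.* suc (4 ℕ.* L ℕ.+ 2) ℕ.^ k) ℕ.≤ n → length xs ≡ n → All (_∈ elems) xs →
    P ^ (n ℕ.* L) ∣ minor xs xs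
  diagonal-div L n xs 2β≤n len xs∈ with diagonal-unique xs
  ... | inj₂ eq = subst (_ ∣_) (sym eq) (ℤD.divides 0ℤ refl)
  ... | inj₁ u  = ℤD.*-cancelʳ-∣ (P ^ totalCo xs) {{P^≢0 (totalCo xs)}} (ℤD.∣-trans
      (subst (_∣ P ^ totalWt xs) (trans (cong (P ^_) (ℕₚ.+-comm (totalCo xs) (n ℕ.* L))) (ℤₚ.^-distribˡ-+-* P (n ℕ.* L) (totalCo xs)))
        (^-mono-∣ (exponent≤ L n xs 2β≤n len u xs∈)))
      (minor-div xs xs))
    where
    ^-mono-∣ : ∀ {a b} → a ℕ.≤ b → P ^ a ∣ P ^ b
    ^-mono-∣ {a} {b} a≤b = ℤD.divides (P ^ (b ℕ.∸ a)) (trans (cong (P ^_) (sym (ℕₚ.m∸n+n≡m a≤b))) (ℤₚ.^-distribˡ-+-* P (b ℕ.∸ a) a))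

  ∑-div : ∀ d {A : Set} (xs : List A) f → (∀ x → x ∈ xs → d ∣ f x) → d ∣ ∑ xs f
  ∑-div d []       f h = ℤD.divides 0ℤ refl
  ∑-div d (x ∷ xs) f h = ℤD.∣m∣n⇒∣m+n (h x (here refl)) (∑-div d xs f (λ y y∈ → h y (there y∈)))

  ∑ⁿ-div : ∀ d n F → (∀ xs → length xs ≡ n → All (_∈ elems) xs → d ∣ F xs) → d ∣ ∑ⁿ n F
  ∑ⁿ-div d zero    F h = h [] refl []
  ∑ⁿ-div d (suc n) F h = ∑-div d elems _ (λ x x∈ → ∑ⁿ-div d n _ (λ xs len xs∈ → h (x ∷ xs) (cong suc len) (x∈ ∷ xs∈)))

  characteristic-div : ∀ L n → 2 ℕ.* (c ℕ.* suc (4 ℕ.* L ℕ.+ 2) ℕ.^ k) ℕ.≤ n → P ^ (n ℕ.* L) ∣ characteristic n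
  characteristic-div L n 2β≤n = ℤD.∣n⇒∣m*n (sign n) (∑ⁿ-div _ n _ (λ xs len xs∈ → diagonal-div L n xs 2β≤n len xs∈))

-- Size estimates and Siegel's lemma

module Growth where
  open import Data.Nat.Base using (_+_; _*_; _^_; _≤_; _<_; ⌊_/2⌋; _!)
  open import Data.Nat.Tactic.RingSolver using (solve-∀)
  open ≡ using (refl; sym; trans; cong; subst)

  n<2^n : ∀ n → n < 2 ^ n
  n<2^n zero    = s≤s z≤n
  n<2^n (suc n) = ℕₚ.≤-trans (ℕₚ.+-mono-≤ (ℕₚ.m^n>0 2 n) (n<2^n n)) (ℕₚ.≤-reflexive (lemma (2 ^ n)))
    where
    lemma : ∀ x → x + x ≡ 2 * x
    lemma = solve-∀

  ^-distrib-* : ∀ a b k → (a * b) ^ k ≡ a ^ k * b ^ k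
  ^-distrib-* a b zero    = refl
  ^-distrib-* a b (suc k) = trans (cong (a * b *_) (^-distrib-* a b k)) (lemma a b (a ^ k) (b ^ k))
    where
    lemma : ∀ a b c d → a * b * (c * d) ≡ a * c * (b * d)
    lemma = solve-∀

  -- Induction on the degree. With H = ⌊ℓ / 2⌋, one factor H + 1 is at most 2 ^ H, and the induction
  -- hypothesis at H bounds the rest by another 2 ^ H; the constant 2 ^ (k + 1) pays for ℓ + 1 ≤ 2
  -- (H + 1).
  polynomial≤exponential : ∀ k a → ∃ λ ℓ₀ → ∀ ℓ → ℓ₀ ≤ ℓ → a * suc ℓ ^ k ≤ 2 ^ ℓ
  polynomial≤exponential zero a = a , λ ℓ a≤ℓ → ℕₚ.≤-trans (ℕₚ.≤-reflexive (ℕₚ.*-identityʳ a))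
    (ℕₚ.≤-trans (ℕₚ.<⇒≤ (n<2^n a)) (ℕₚ.^-monoʳ-≤ 2 a≤ℓ))
  polynomial≤exponential (suc k) a with polynomial≤exponential k (a * 2 ^ suc k)
  ... | ℓ₀ , bound = 2 * ℓ₀ , λ ℓ ℓ₀≤ℓ → go ℓ (half ℓ ℓ₀≤ℓ)
    where
    half : ∀ ℓ → 2 * ℓ₀ ≤ ℓ → ℓ₀ ≤ ⌊ ℓ /2⌋
    half ℓ h = subst (_≤ ⌊ ℓ /2⌋) (trans (cong ⌊_/2⌋ (cong (_+_ ℓ₀) (ℕₚ.+-identityʳ ℓ₀))) (sym (ℕₚ.n≡⌊n+n/2⌋ ℓ₀))) (ℕₚ.⌊n/2⌋-mono h)
    double : ∀ ℓ → ⌊ ℓ /2⌋ + ⌊ ℓ /2⌋ ≤ ℓ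
    double zero          = z≤n
    double (suc zero)    = z≤n
    double (suc (suc ℓ)) = s≤s (subst (_≤ suc ℓ) (sym (ℕₚ.+-suc ⌊ ℓ /2⌋ ⌊ ℓ /2⌋)) (s≤s (double ℓ)))
    undouble : ∀ ℓ → suc ℓ ≤ 2 * suc ⌊ ℓ /2⌋
    undouble zero          = s≤s z≤n
    undouble (suc zero)    = s≤s (s≤s z≤n)
    undouble (suc (suc ℓ)) = ℕₚ.≤-trans (s≤s (s≤s (undouble ℓ))) (ℕₚ.≤-reflexive (lemma ⌊ ℓ /2⌋))
      where
      lemma : ∀ h → suc (suc (2 * suc h)) ≡ 2 * suc (suc h)
      lemma = solve-∀
    go : ∀ ℓ → ℓ₀ ≤ ⌊ ℓ /2⌋ → a * suc ℓ ^ suc k ≤ 2 ^ ℓ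
    go ℓ h = begin
      a * suc ℓ ^ suc k             ≤⟨ ℕₚ.*-monoʳ-≤ a (ℕₚ.^-monoˡ-≤ (suc k) (undouble ℓ)) ⟩
      a * (2 * suc H) ^ suc k       ≡⟨ cong (a *_) (^-distrib-* 2 (suc H) (suc k)) ⟩
      a * (2 ^ suc k * suc H ^ suc k) ≡⟨ lemma a (2 ^ suc k) (suc H) (suc H ^ k) ⟩
      a * 2 ^ suc k * suc H ^ k * suc H ≤⟨ ℕₚ.*-mono-≤ (bound H h) (n<2^n H) ⟩
      2 ^ H * 2 ^ H                 ≡⟨ ℕₚ.^-distribˡ-+-* 2 H H ⟨
      2 ^ (H + H)                   ≤⟨ ℕₚ.^-monoʳ-≤ 2 (double ℓ) ⟩
      2 ^ ℓ                         ∎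
      where
      open ℕₚ.≤-Reasoning
      H : ℕ
      H = ⌊ ℓ /2⌋
      lemma : ∀ a b c d → a * (b * (c * d)) ≡ a * b * d * c
      lemma = solve-∀

  logarithm : ∀ n → ∃ λ ℓ → 2 ^ ℓ ≤ suc n × suc n < 2 ^ suc ℓ
  logarithm zero = 0 , s≤s z≤n , s≤s (s≤s z≤n)
  logarithm (suc n) with logarithm n
  ... | ℓ , lower , upper with suc (suc n) ℕₚ.<? 2 ^ suc ℓ
  ...   | yes n<  = ℓ , ℕₚ.m≤n⇒m≤1+n lower , n<
  ...   | no  n≮ = suc ℓ , ℕₚ.≮⇒≥ n≮ , ℕₚ.≤-trans (s≤s upper) (ℕₚ.≤-trans (ℕₚ.+-monoˡ-≤ (2 ^ suc ℓ) (ℕₚ.m^n>0 2 (suc ℓ)))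
        (ℕₚ.≤-reflexive (cong (_+_ (2 ^ suc ℓ)) (sym (ℕₚ.+-identityʳ _)))))

  !-mono : ∀ {m n} → m ≤ n → m ! ≤ n !
  !-mono {n = n} z≤n       = ℕₚ.1≤n! n
  !-mono         (s≤s m≤n) = ℕₚ.*-mono-≤ (s≤s m≤n) (!-mono m≤n)

  !≤^ : ∀ n x → n ≤ x → n ! ≤ x ^ n
  !≤^ zero    x n≤x = s≤s z≤n
  !≤^ (suc n) x n≤x = ℕₚ.*-mono-≤ n≤x (!≤^ n x (ℕₚ.<⇒≤ n≤x))

module Majorants where
  open HurwitzSeries ℤₚ.+-*-commutativeRing
  open import Data.Integer.Base using (_+_; _*_; ∣_∣)
  open import Data.Nat.Base using (_!)
  open ≡ using (refl; sym; trans; cong; cong₂; subst; subst₂)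

  ∗-majorant : ∀ n {a b α β : Series} → (∀ i → i ℕ.≤ n → + ∣ a i ∣ ℤ.≤ α i) → (∀ i → i ℕ.≤ n → + ∣ b i ∣ ℤ.≤ β i) →
    + ∣ (a ∗ b) n ∣ ℤ.≤ (α ∗ β) n
  ∗-majorant zero {a} {b} {α} {β} a≤ b≤ = begin
    + ∣ a 0 * b 0 ∣         ≡⟨ trans (cong +_ (ℤₚ.abs-* (a 0) (b 0))) (ℤₚ.pos-* ∣ a 0 ∣ ∣ b 0 ∣) ⟩
    + ∣ a 0 ∣ * + ∣ b 0 ∣   ≤⟨ ℤₚ.*-monoˡ-≤-nonNeg (+ ∣ a 0 ∣) (b≤ 0 z≤n) ⟩
    + ∣ a 0 ∣ * β 0         ≤⟨ ℤₚ.*-monoʳ-≤-nonNeg (β 0) {{ℤ.nonNegative (ℤₚ.≤-trans (ℤ.+≤+ z≤n) (b≤ 0 z≤n))}} (a≤ 0 z≤n) ⟩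
    α 0 * β 0               ∎
    where open ℤₚ.≤-Reasoning
  ∗-majorant (suc n) {a} {b} {α} {β} a≤ b≤ = begin
    + ∣ (∂ a ∗ b) n + (a ∗ ∂ b) n ∣             ≤⟨ ℤ.+≤+ (ℤₚ.∣i+j∣≤∣i∣+∣j∣ ((∂ a ∗ b) n) ((a ∗ ∂ b) n)) ⟩
    + ∣ (∂ a ∗ b) n ∣ + + ∣ (a ∗ ∂ b) n ∣       ≤⟨ ℤₚ.+-mono-≤
      (∗-majorant n (λ i i≤n → a≤ (suc i) (s≤s i≤n)) (λ i i≤n → b≤ i (ℕₚ.m≤n⇒m≤1+n i≤n)))
      (∗-majorant n (λ i i≤n → a≤ i (ℕₚ.m≤n⇒m≤1+n i≤n)) (λ i i≤n → b≤ (suc i) (s≤s i≤n))) ⟩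
    (∂ α ∗ β) n + (α ∗ ∂ β) n                   ∎
    where open ℤₚ.≤-Reasoning

  open import Algebra.Properties.Semiring.Mult (CommutativeRing.semiring ℤₚ.+-*-commutativeRing) using () renaming (_×_ to _·_)

  ·≡* : ∀ n x → n · x ≡ + n * x
  ·≡* zero    x = sym (ℤₚ.*-zeroˡ x)
  ·≡* (suc n) x = trans (cong (_+_ x) (·≡* n x)) (sym (ℤₚ.suc-* (+ n) x))

  hurwitz-value : ∀ α n → hurwitz α n ≡ + (n !) * α n
  hurwitz-value α zero    = sym (ℤₚ.*-identityˡ (α 0))
  hurwitz-value α (suc n) = trans (·≡* (suc n) (hurwitz (∂ α) n)) (trans (cong (_*_ (+ suc n)) (hurwitz-value (∂ α) n))
    (trans (sym (ℤₚ.*-assoc (+ suc n) (+ (n !)) (α (suc n)))) (cong (_* α (suc n)) (sym (ℤₚ.pos-* (suc n) (n !))))))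

  -- The coefficients of B ^ a / (1 - B T).
  geometric : ℕ → ℕ → Series
  geometric B a i = + (B ℕ.^ (i ℕ.+ a))

  geometric-convolution : ∀ B a n → convolution (geometric B a) (geometric B 0) n ≡ + (suc n ℕ.* B ℕ.^ (n ℕ.+ a))
  geometric-convolution B a zero = trans (ℤₚ.*-identityʳ _) (cong +_ (sym (ℕₚ.+-identityʳ _)))
  geometric-convolution B a (suc n) = trans (cong₂ _+_
      (trans (sym (ℤₚ.pos-* (B ℕ.^ a) (B ℕ.^ (suc n ℕ.+ 0)))) (cong +_ (trans (sym (ℕₚ.^-distribˡ-+-* B a (suc n ℕ.+ 0)))
        (cong (B ℕ.^_) (trans (cong (ℕ._+_ a) (ℕₚ.+-identityʳ (suc n))) (ℕₚ.+-comm a (suc n)))))))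
      (trans (convolution-cong n (λ i → cong (λ e → + (B ℕ.^ e)) (sym (ℕₚ.+-suc i a)))) (geometric-convolution B (suc a) n)))
    (cong (λ e → + (B ℕ.^ (suc n ℕ.+ a) ℕ.+ suc n ℕ.* B ℕ.^ e)) (ℕₚ.+-suc n a))
    where
    convolution-cong : ∀ n {α α′ β} → (∀ i → α i ≡ α′ i) → convolution α β n ≡ convolution α′ β n
    convolution-cong zero    {β = β} α≡ = cong (_* β 0) (α≡ 0)
    convolution-cong (suc n) {β = β} α≡ = cong₂ _+_ (cong (_* β (suc n)) (α≡ 0)) (convolution-cong n (α≡ ∘ suc))

  abs-! : ∀ n x m → ∣ x ∣ ℕ.≤ m → + ∣ + (n !) * x ∣ ℤ.≤ + (n !) * + m
  abs-! n x m x≤m = subst₂ ℤ._≤_ (cong +_ (sym (ℤₚ.abs-* (+ (n !)) x))) (ℤₚ.pos-* (n !) m) (ℤ.+≤+ (ℕₚ.*-monoʳ-≤ (n !) x≤m))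

  -- Method of majorants: exp(∑ B ^ i T ^ i / i) = 1 / (1 - B T) solves y′ = B / (1 - B T) · y, and
  -- this recursion preserves coefficientwise domination.
  exponential-bound : ∀ (s : Series) B → (∀ r → ∣ s r ∣ ℕ.≤ B ℕ.^ suc r) → ∀ n i → i ℕ.≤ n →
    + ∣ exponential (hurwitz s) i ∣ ℤ.≤ hurwitz (geometric B 0) i
  exponential-bound s B s≤ n zero i≤n = ℤₚ.≤-refl
  exponential-bound s B s≤ (suc n) (suc i) (s≤s i≤n) = begin
    + ∣ exponential (hurwitz s) (suc i) ∣
      ≡⟨ cong (λ x → + ∣ x ∣) (exponential-∂ (hurwitz s) i) ⟩
    + ∣ (hurwitz s ∗ exponential (hurwitz s)) i ∣
      ≤⟨ ∗-majorant i (λ j _ → bound j) (λ j j≤i → exponential-bound s B s≤ n j (ℕₚ.≤-trans j≤i i≤n)) ⟩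
    (hurwitz (geometric B 1) ∗ hurwitz (geometric B 0)) i
      ≡⟨ trans (hurwitz-convolution (geometric B 1) (geometric B 0) i) (hurwitz-value _ i) ⟩
    + (i !) * convolution (geometric B 1) (geometric B 0) i
      ≡⟨ cong (_*_ (+ (i !))) (geometric-convolution B 1 i) ⟩
    + (i !) * + (suc i ℕ.* B ℕ.^ (i ℕ.+ 1))
      ≡⟨ cong₂ (λ e x → + (i !) * + (suc i ℕ.* B ℕ.^ e)) (trans (ℕₚ.+-comm i 1) (cong suc (sym (ℕₚ.+-identityʳ i)))) (refl {x = 0}) ⟩
    + (i !) * + (suc i ℕ.* B ℕ.^ (suc i ℕ.+ 0))
      ≡⟨ trans (cong (_*_ (+ (i !))) (ℤₚ.pos-* (suc i) _)) (trans (sym (ℤₚ.*-assoc (+ (i !)) (+ suc i) _))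
           (cong (_* + (B ℕ.^ (suc i ℕ.+ 0))) (trans (ℤₚ.*-comm (+ (i !)) (+ suc i)) (sym (ℤₚ.pos-* (suc i) (i !)))))) ⟩
    + (suc i !) * geometric B 0 (suc i)
      ≡⟨ hurwitz-value (geometric B 0) (suc i) ⟨
    hurwitz (geometric B 0) (suc i) ∎
    where
    open ℤₚ.≤-Reasoning
    bound : ∀ j → + ∣ hurwitz s j ∣ ℤ.≤ hurwitz (geometric B 1) j
    bound j = subst₂ ℤ._≤_ (cong (λ x → + ∣ x ∣) (sym (hurwitz-value s j))) (sym (hurwitz-value (geometric B 1) j))
      (abs-! j (s j) (B ℕ.^ (j ℕ.+ 1)) (subst (λ e → ∣ s j ∣ ℕ.≤ B ℕ.^ e) (ℕₚ.+-comm 1 j) (s≤ j)))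

  -- The series a is dominated by X / (1 - B T) and z by 1 / (1 - B T), so the product is dominated
  -- by X / (1 - B T) ^ 2, whose n-th coefficient is X (n + 1) B ^ n.
  multiple-bound : ∀ (s : Series) B X (a : Series) .{{_ : ℕ.NonZero B}} → (∀ r → ∣ s r ∣ ℕ.≤ B ℕ.^ suc r) → (∀ i → ∣ a i ∣ ℕ.≤ X) → ∀ n →
    ∣ (hurwitz a ∗ exponential (hurwitz s)) n ∣ ℕ.≤ n ! ℕ.* (X ℕ.* (suc n ℕ.* B ℕ.^ n))
  multiple-bound s B X a s≤ a≤ n = ℤₚ.drop‿+≤+ (begin
    + ∣ (hurwitz a ∗ exponential (hurwitz s)) n ∣
      ≤⟨ ∗-majorant n {hurwitz a} {exponential (hurwitz s)} (λ i _ → bound i) (λ i i≤n → exponential-bound s B s≤ n i i≤n) ⟩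
    (((+ X) ⊡ hurwitz (geometric B 0)) ∗ hurwitz (geometric B 0)) n
      ≡⟨ ⊡-∗ (+ X) (hurwitz (geometric B 0)) (hurwitz (geometric B 0)) n ⟩
    + X * (hurwitz (geometric B 0) ∗ hurwitz (geometric B 0)) n
      ≡⟨ cong (_*_ (+ X)) (trans (hurwitz-convolution (geometric B 0) (geometric B 0) n) (hurwitz-value _ n)) ⟩
    + X * (+ (n !) * convolution (geometric B 0) (geometric B 0) n)
      ≡⟨ cong (λ y → + X * (+ (n !) * y)) (geometric-convolution B 0 n) ⟩
    + X * (+ (n !) * + (suc n ℕ.* B ℕ.^ (n ℕ.+ 0)))
      ≡⟨ cong (λ e → + X * (+ (n !) * + (suc n ℕ.* B ℕ.^ e))) (ℕₚ.+-identityʳ n) ⟩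
    + X * (+ (n !) * + (suc n ℕ.* B ℕ.^ n))
      ≡⟨ trans (cong (_*_ (+ X)) (sym (ℤₚ.pos-* (n !) _))) (trans (sym (ℤₚ.pos-* X _)) (cong +_ (rearrange X (n !) _))) ⟩
    + (n ! ℕ.* (X ℕ.* (suc n ℕ.* B ℕ.^ n))) ∎)
    where
    open ℤₚ.≤-Reasoning
    rearrange : ∀ x y z → x ℕ.* (y ℕ.* z) ≡ y ℕ.* (x ℕ.* z)
    rearrange = solve-∀
      where open import Data.Nat.Tactic.RingSolver using (solve-∀)
    bound : ∀ i → + ∣ hurwitz a i ∣ ℤ.≤ + X * hurwitz (geometric B 0) i
    bound i = subst₂ ℤ._≤_ (cong (λ x → + ∣ x ∣) (sym (hurwitz-value a i)))
      (trans (cong (_*_ (+ (i !))) (ℤₚ.pos-* X _)) (trans (sym (ℤₚ.*-assoc (+ (i !)) (+ X) _)) (trans (cong (_* geometric B 0 i) (ℤₚ.*-comm (+ (i !)) (+ X)))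
        (trans (ℤₚ.*-assoc (+ X) (+ (i !)) _) (cong (_*_ (+ X)) (sym (hurwitz-value (geometric B 0) i)))))))
      (abs-! i (a i) (X ℕ.* B ℕ.^ (i ℕ.+ 0)) (ℕₚ.≤-trans (a≤ i) (ℕₚ.m≤m*n X _ {{ℕₚ.m^n≢0 B (i ℕ.+ 0)}})))

module Siegel (s : ℕ → ℤ) (B : ℕ) .{{_ : ℕ.NonZero B}} (s≤ : ∀ r → ℤ.∣ s r ∣ ℕ.≤ B ℕ.^ suc r) where
  open HurwitzSeries ℤₚ.+-*-commutativeRing
  open Majorants using (hurwitz-value; multiple-bound)
  open Growth using (!-mono)
  open import Data.Integer.Base using (_+_; _*_; _-_; -_; 0ℤ; 1ℤ; ∣_∣)
  open import Data.Nat.Base using (_!)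
  open import Data.Fin.Properties using (pigeonhole; funToFin-finToFin; finToFun-funToFin; toℕ<n; toℕ-fromℕ<; toℕ-injective; ¬∀⟶∃¬; <⇒≢) renaming (_≟_ to _≟ᶠ_)
  open import Data.Fin.Base using (toℕ; fromℕ<; finToFun; funToFin)
  open import Data.Integer.Tactic.RingSolver using (solve-∀)
  open import Data.Nat.Tactic.RingSolver using () renaming (solve-∀ to ℕ-solve-∀)
  open ≡ using (refl; sym; trans; cong; cong₂; subst)

  z : Series
  z = exponential (hurwitz s)

  digits : ∀ m {X} → (Fin m → Fin X) → ℕ → ℕ
  digits zero    v i       = 0
  digits (suc m) v zero    = toℕ (v Fin.zero)
  digits (suc m) v (suc i) = digits m (v ∘ Fin.suc) i

  digits-≤ : ∀ m {X} (v : Fin m → Fin X) i → digits m v i ℕ.≤ X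
  digits-≤ zero    v i       = z≤n
  digits-≤ (suc m) v zero    = ℕₚ.<⇒≤ (toℕ<n (v Fin.zero))
  digits-≤ (suc m) v (suc i) = digits-≤ m (v ∘ Fin.suc) i

  digits-large : ∀ m {X} (v : Fin m → Fin X) i → m ℕ.≤ i → digits m v i ≡ 0
  digits-large zero    v i       m≤i       = refl
  digits-large (suc m) v (suc i) (s≤s m≤i) = digits-large m (v ∘ Fin.suc) i m≤i

  digits-toℕ : ∀ m {X} (v : Fin m → Fin X) j → digits m v (toℕ j) ≡ toℕ (v j)
  digits-toℕ (suc m) v Fin.zero    = refl
  digits-toℕ (suc m) v (Fin.suc j) = digits-toℕ m (v ∘ Fin.suc) j

  value : ∀ m {X} → (Fin m → Fin X) → ℕ → ℤ
  value m v = hurwitz (λ i → + digits m v i) ∗ z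

  module Collision (h X Y : ℕ) (fewer : suc (Y ℕ.+ Y) ℕ.^ h ℕ.< X ℕ.^ suc (h ℕ.+ h))
    (value-bound : ∀ (v : Fin (suc (h ℕ.+ h)) → Fin X) n → n ℕ.≤ 3 ℕ.* h → ∣ value (suc (h ℕ.+ h)) v n ∣ ℕ.≤ Y) where

    private
      in-range : ∀ (j : Fin h) → suc (h ℕ.+ h) ℕ.+ toℕ j ℕ.≤ 3 ℕ.* h
      in-range j = subst (suc (h ℕ.+ h) ℕ.+ toℕ j ℕ.≤_) (lemma h) (subst (ℕ._≤ h ℕ.+ h ℕ.+ h) (ℕₚ.+-suc (h ℕ.+ h) (toℕ j)) (ℕₚ.+-monoʳ-≤ (h ℕ.+ h) (toℕ<n j)))
        where
        lemma : ∀ h → h ℕ.+ h ℕ.+ h ≡ 3 ℕ.* h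
        lemma = ℕ-solve-∀

      offset : ∀ x → ∣ x ∣ ℕ.≤ Y → ∣ + Y + x ∣ ℕ.< suc (Y ℕ.+ Y)
      offset x x≤Y = s≤s (ℕₚ.≤-trans (ℤₚ.∣i+j∣≤∣i∣+∣j∣ (+ Y) x) (ℕₚ.+-monoʳ-≤ Y x≤Y))

      offset-injective : ∀ x y → ∣ x ∣ ℕ.≤ Y → ∣ y ∣ ℕ.≤ Y → ∣ + Y + x ∣ ≡ ∣ + Y + y ∣ → x ≡ y
      offset-injective x y x≤ y≤ eq = trans (cancel (+ Y) x) (trans (cong (_+_ (- + Y)) (trans (sym (nonneg x x≤)) (trans (cong +_ eq) (nonneg y y≤)))) (sym (cancel (+ Y) y)))
        where
        cancel : ∀ c x → x ≡ - c + (c + x)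
        cancel = solve-∀
        nonneg : ∀ x → ∣ x ∣ ℕ.≤ Y → + ∣ + Y + x ∣ ≡ + Y + x
        nonneg (+ n)    x≤ = refl
        nonneg -[1+ n ] x≤ = trans (cong (λ w → + ∣ w ∣) (ℤₚ.⊖-≥ x≤)) (sym (ℤₚ.⊖-≥ x≤))

      encode : (Fin (suc (h ℕ.+ h)) → Fin X) → Fin h → Fin (suc (Y ℕ.+ Y))
      encode v j = fromℕ< (offset (value (suc (h ℕ.+ h)) v (suc (h ℕ.+ h) ℕ.+ toℕ j)) (value-bound v _ (in-range j)))

      encode-value : ∀ v w → (∀ j → encode v j ≡ encode w j) → ∀ n → suc (h ℕ.+ h) ℕ.≤ n → n ℕ.≤ 3 ℕ.* h → value (suc (h ℕ.+ h)) v n ≡ value (suc (h ℕ.+ h)) w n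
      encode-value v w eq n m≤n n≤ = subst (λ n → value (suc (h ℕ.+ h)) v n ≡ value (suc (h ℕ.+ h)) w n) n≡
        (offset-injective _ _ (value-bound v _ (in-range j)) (value-bound w _ (in-range j))
          (trans (sym (toℕ-fromℕ< _)) (trans (cong toℕ (eq j)) (toℕ-fromℕ< _))))
        where
        d<h : n ℕ.∸ suc (h ℕ.+ h) ℕ.< h
        d<h = ℕₚ.+-cancelˡ-< (suc (h ℕ.+ h)) _ _ (subst (ℕ._< suc (h ℕ.+ h) ℕ.+ h) (sym (ℕₚ.m+[n∸m]≡n m≤n)) (s≤s (ℕₚ.≤-trans n≤ (ℕₚ.≤-reflexive (lemma h)))))
          where
          lemma : ∀ h → 3 ℕ.* h ≡ h ℕ.+ h ℕ.+ h
          lemma = ℕ-solve-∀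
        j : Fin h
        j = fromℕ< d<h
        n≡ : suc (h ℕ.+ h) ℕ.+ toℕ j ≡ n
        n≡ = trans (cong (ℕ._+_ (suc (h ℕ.+ h))) (toℕ-fromℕ< d<h)) (ℕₚ.m+[n∸m]≡n m≤n)

    -- Pigeonhole: vectors of 2 h + 1 digits below X are sent to their h values in degrees 2 h + 1,
    -- ..., 3 h. Two vectors with equal values differ by a nonzero solution whose entries are still
    -- bounded by X.
    collision : ∃ λ (a : ℕ → ℤ) → (∀ i → h ℕ.+ h ℕ.< i → a i ≡ 0ℤ) × (∃ λ i → a i ≢ 0ℤ) × (∀ i → ∣ a i ∣ ℕ.≤ X) ×
      (∀ n → h ℕ.+ h ℕ.< n → n ℕ.≤ 3 ℕ.* h → (hurwitz a ∗ z) n ≡ 0ℤ)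
    collision with pigeonhole fewer (λ i → funToFin (encode (finToFun i)))
    ... | i , i′ , i<i′ , same = a , large , nonzero , small , vanish
      where
      m : ℕ
      m = suc (h ℕ.+ h)
      v w : Fin m → Fin X
      v = finToFun i
      w = finToFun i′
      a : ℕ → ℤ
      a j = + digits m v j - + digits m w j
      large : ∀ j → m ℕ.≤ j → a j ≡ 0ℤ
      large j m≤j = cong₂ (λ x y → + x - + y) (digits-large m v j m≤j) (digits-large m w j m≤j)
      same-encoding : ∀ j → encode v j ≡ encode w j
      same-encoding j = trans (sym (finToFun-funToFin (encode v) j)) (trans (cong (λ k → finToFun k j) same) (finToFun-funToFin (encode w) j))
      funToFin-cong : ∀ {m n} {f g : Fin m → Fin n} → (∀ j → f j ≡ g j) → funToFin f ≡ funToFin g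
      funToFin-cong {zero}  f≡g = refl
      funToFin-cong {suc m} f≡g = cong₂ Fin.combine (f≡g Fin.zero) (funToFin-cong (f≡g ∘ Fin.suc))
      v≢w : ¬ (∀ j → v j ≡ w j)
      v≢w v≡w = <⇒≢ i<i′ (trans (sym (funToFin-finToFin {m} {X} i)) (trans (funToFin-cong v≡w) (funToFin-finToFin {m} {X} i′)))
      nonzero : ∃ λ j → a j ≢ 0ℤ
      nonzero with ¬∀⟶∃¬ m (λ j → v j ≡ w j) (λ j → v j ≟ᶠ w j) v≢w
      ... | j , vj≢wj = toℕ j , λ aj≡0 → vj≢wj (toℕ-injective (trans (sym (digits-toℕ m v j))
            (trans (ℤₚ.+-injective (ℤₚ.i-j≡0⇒i≡j _ _ aj≡0)) (digits-toℕ m w j))))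
      small : ∀ j → ∣ a j ∣ ℕ.≤ X
      small j = subst (ℕ._≤ X) (cong ∣_∣ (sym (ℤₚ.m-n≡m⊖n (digits m v j) (digits m w j))))
        (ℕₚ.≤-trans (ℤₚ.∣m⊝n∣≤m⊔n (digits m v j) (digits m w j)) (ℕₚ.⊔-lub (digits-≤ m v j) (digits-≤ m w j)))
      difference : hurwitz a ≋ hurwitz (λ j → + digits m v j) ⊞ (- 1ℤ) ⊡ hurwitz (λ j → + digits m w j)
      difference n = trans (hurwitz-value a n) (trans (lemma (+ (n !)) (+ digits m v n) (+ digits m w n))
          (sym (cong₂ (λ x y → x + - 1ℤ * y) (hurwitz-value (λ j → + digits m v j) n) (hurwitz-value (λ j → + digits m w j) n))))
        where
        lemma : ∀ f x y → f * (x - y) ≡ f * x + - 1ℤ * (f * y)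
        lemma = solve-∀
      vanish : ∀ n → h ℕ.+ h ℕ.< n → n ℕ.≤ 3 ℕ.* h → (hurwitz a ∗ z) n ≡ 0ℤ
      vanish n m≤n n≤ = trans (∗-cong difference (λ _ → refl) n) (trans
        (∗-distribʳ (hurwitz (λ j → + digits m v j)) ((- 1ℤ) ⊡ hurwitz (λ j → + digits m w j)) z n)
        (trans (cong (_+_ (value (suc (h ℕ.+ h)) v n)) (trans (⊡-∗ (- 1ℤ) (hurwitz (λ j → + digits m w j)) z n) (cong (_*_ (- 1ℤ)) (sym (encode-value v w same-encoding n m≤n n≤)))))
          (lemma (value (suc (h ℕ.+ h)) v n))))
        where
        lemma : ∀ x → x + - 1ℤ * x ≡ 0ℤ
        lemma = solve-∀

  siegel : ∀ h → ∃ λ (a : ℕ → ℤ) → (∀ i → h ℕ.+ h ℕ.< i → a i ≡ 0ℤ) × (∃ λ i → a i ≢ 0ℤ) ×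
    (∀ i → ∣ a i ∣ ℕ.≤ 3 ℕ.* ((3 ℕ.* h) ! ℕ.* (suc (3 ℕ.* h) ℕ.* B ℕ.^ (3 ℕ.* h)))) ×
    (∀ n → h ℕ.+ h ℕ.< n → n ℕ.≤ 3 ℕ.* h → (hurwitz a ∗ z) n ≡ 0ℤ)
  siegel h = Collision.collision h X Y fewer value-bound
    where
    Q X Y : ℕ
    Q = (3 ℕ.* h) ! ℕ.* (suc (3 ℕ.* h) ℕ.* B ℕ.^ (3 ℕ.* h))
    -- Q bounds the values per unit of digit size. With Y = X Q = 3 Q ^ 2 there are at most (6 Q ^ 2
    -- + 1) ^ h ≤ (9 Q ^ 2) ^ h = X ^ (2 h) value vectors, fewer than the X ^ (2 h + 1) digit
    -- vectors.
    X = 3 ℕ.* Q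
    Y = X ℕ.* Q
    1≤Q : 1 ℕ.≤ Q
    1≤Q = ℕₚ.*-mono-≤ (ℕₚ.1≤n! (3 ℕ.* h)) (ℕₚ.*-mono-≤ (s≤s (z≤n {3 ℕ.* h})) (ℕₚ.m^n>0 B (3 ℕ.* h)))
    fewer : suc (Y ℕ.+ Y) ℕ.^ h ℕ.< X ℕ.^ suc (h ℕ.+ h)
    fewer = counting Q 1≤Q
      where
      lemma : ∀ Q → 3 ℕ.* Q ℕ.* Q ℕ.+ (3 ℕ.* Q ℕ.* Q ℕ.+ 3 ℕ.* Q ℕ.* Q) ≡ 3 ℕ.* Q ℕ.* (3 ℕ.* Q)
      lemma = ℕ-solve-∀
      counting : ∀ Q → 1 ℕ.≤ Q → suc (3 ℕ.* Q ℕ.* Q ℕ.+ 3 ℕ.* Q ℕ.* Q) ℕ.^ h ℕ.< (3 ℕ.* Q) ℕ.^ suc (h ℕ.+ h)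
      counting Q 1≤Q = ℕₚ.≤-<-trans
        (ℕₚ.^-monoˡ-≤ h (ℕₚ.≤-trans (ℕₚ.+-monoˡ-≤ (3 ℕ.* Q ℕ.* Q ℕ.+ 3 ℕ.* Q ℕ.* Q) (ℕₚ.*-mono-≤ (ℕₚ.*-mono-≤ (s≤s (z≤n {2})) 1≤Q) 1≤Q)) (ℕₚ.≤-reflexive (lemma Q))))
        (subst (ℕ._< (3 ℕ.* Q) ℕ.^ suc (h ℕ.+ h)) (trans (ℕₚ.^-distribˡ-+-* (3 ℕ.* Q) h h) (sym (Growth.^-distrib-* (3 ℕ.* Q) (3 ℕ.* Q) h)))
          (ℕₚ.^-monoʳ-< (3 ℕ.* Q) (ℕₚ.≤-trans (s≤s (s≤s (z≤n {1}))) (ℕₚ.*-monoʳ-≤ 3 1≤Q)) (ℕₚ.n<1+n (h ℕ.+ h))))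
    value-bound : ∀ (v : Fin (suc (h ℕ.+ h)) → Fin X) n → n ℕ.≤ 3 ℕ.* h → ∣ value (suc (h ℕ.+ h)) v n ∣ ℕ.≤ Y
    value-bound v n n≤ = ℕₚ.≤-trans (multiple-bound s B X _ s≤ (λ i → digits-≤ (suc (h ℕ.+ h)) v i) n)
      (ℕₚ.≤-trans (ℕₚ.*-mono-≤ (!-mono n≤) (ℕₚ.*-monoʳ-≤ X (ℕₚ.*-mono-≤ (s≤s n≤) (ℕₚ.^-monoʳ-≤ B n≤))))
        (ℕₚ.≤-reflexive (swap ((3 ℕ.* h) !) X (suc (3 ℕ.* h) ℕ.* B ℕ.^ (3 ℕ.* h)))))
      where
      swap : ∀ a b c → a ℕ.* (b ℕ.* c) ≡ b ℕ.* (a ℕ.* c)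
      swap = ℕ-solve-∀

module HurwitzDivisibility where
  open HurwitzSeries ℤₚ.+-*-commutativeRing
  open ℤD using (_∣_)
  open import Data.Integer.Base using (_+_; _*_; _-_; -_; 0ℤ; 1ℤ; ∣_∣)
  open import Data.Integer.Tactic.RingSolver using (solve-∀)
  open Majorants using (hurwitz-value)
  open ≡ using (refl; sym; trans; cong; cong₂; subst)

  ∗-div : ∀ n {M a b} → (∀ i j → i ℕ.+ j ≡ n → M ∣ a i * b j) → M ∣ (a ∗ b) n
  ∗-div zero    h = h 0 0 refl
  ∗-div (suc n) {M} {a} {b} h = ℤD.∣m∣n⇒∣m+n (∗-div n {M} {∂ a} {b} (λ i j eq → h (suc i) j (cong suc eq)))
    (∗-div n {M} {a} {∂ b} (λ i j eq → h i (suc j) (trans (ℕₚ.+-suc i j) (cong suc eq))))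

  ∗-congruent : ∀ n {M a a′ b b′} → (∀ i → i ℕ.≤ n → M ∣ a i - a′ i) → (∀ i → i ℕ.≤ n → M ∣ b i - b′ i) →
    M ∣ (a ∗ b) n - (a′ ∗ b′) n
  ∗-congruent n {M} {a} {a′} {b} {b′} a≡ b≡ = subst (M ∣_) (sym split)
    (ℤD.∣m∣n⇒∣m+n
      (∗-div n {M} {a ⊞ (- 1ℤ) ⊡ a′} {b} (λ i j eq → ℤD.∣m⇒∣m*n (b j) (subst (M ∣_) (lemma₁ (a i) (a′ i)) (a≡ i (subst (i ℕ.≤_) eq (ℕₚ.m≤m+n i j))))))
      (∗-div n {M} {a′} {b ⊞ (- 1ℤ) ⊡ b′} (λ i j eq → ℤD.∣n⇒∣m*n (a′ i) (subst (M ∣_) (lemma₁ (b j) (b′ j)) (b≡ j (subst (j ℕ.≤_) eq (ℕₚ.m≤n+m j i)))))))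
    where
    lemma₁ : ∀ x y → x - y ≡ x + - 1ℤ * y
    lemma₁ = solve-∀
    lemma₂ : ∀ x y z → x - z ≡ (x + - 1ℤ * y) + (y + - 1ℤ * z)
    lemma₂ = solve-∀
    split : (a ∗ b) n - (a′ ∗ b′) n ≡ ((a ⊞ (- 1ℤ) ⊡ a′) ∗ b) n + (a′ ∗ (b ⊞ (- 1ℤ) ⊡ b′)) n
    split = trans (lemma₂ ((a ∗ b) n) ((a′ ∗ b) n) ((a′ ∗ b′) n)) (sym (cong₂ _+_
      (trans (∗-distribʳ a ((- 1ℤ) ⊡ a′) b n) (cong (_+_ ((a ∗ b) n)) (⊡-∗ (- 1ℤ) a′ b n)))
      (trans (∗-distribˡ a′ b ((- 1ℤ) ⊡ b′) n) (cong (_+_ ((a′ ∗ b) n))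
        (trans (∗-comm a′ ((- 1ℤ) ⊡ b′) n) (trans (⊡-∗ (- 1ℤ) b′ a′ n) (cong (_*_ (- 1ℤ)) (∗-comm b′ a′ n))))))))

  hurwitz-congruent : ∀ {M α β} → (∀ i → M ∣ α i - β i) → ∀ i → M ∣ hurwitz α i - hurwitz β i
  hurwitz-congruent {M} {α} {β} h i = subst (M ∣_) (trans (lemma (+ (i ℕ.!)) (α i) (β i)) (sym (cong₂ _-_ (hurwitz-value α i) (hurwitz-value β i))))
    (ℤD.∣n⇒∣m*n (+ (i ℕ.!)) (h i))
    where
    lemma : ∀ f x y → f * (x - y) ≡ f * x - f * y
    lemma = solve-∀

  multiple-small⇒0 : ∀ {M x} → M ∣ x → ∣ x ∣ ℕ.< ∣ M ∣ → x ≡ 0ℤ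
  multiple-small⇒0 {M} {x} M∣x x<M with ∣ x ∣ in eq
  ... | zero  = ℤₚ.∣i∣≡0⇒i≡0 eq
  ... | suc n = ⊥-elim (ℕₚ.<⇒≱ x<M (ℕD.∣⇒≤ (subst (∣ M ∣ ℕD.∣_) eq (ℤD.∣⇒∣ᵤ M∣x))))

-- A rationality criterion

-- The matrices may change with the precision N, but c and k may not: the count of rows of bounded
-- weight is uniform. The index r stands for degree r + 1, in accordance with `traces`.
Approximable : ℕ → ℕ → ℕ → (ℕ → ℤ) → Set₁
Approximable p c k s = ∀ N → Σ (WeightedMatrix p c k) λ A → Σ (WeightedMatrix p c k) λ A′ →
  ∀ r → ((+ p) ℤ.^ N) ℤD.∣ s r ℤ.- (WeightedMatrix.traces A r ℤ.- WeightedMatrix.traces A′ r)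

module PadicVanishing (p c k : ℕ) (2≤p : 2 ℕ.≤ p) (s : ℕ → ℤ) (approx : Approximable p c k s) where
  open HurwitzSeries ℤₚ.+-*-commutativeRing
  open HurwitzDivisibility
  open ℤD using (_∣_)
  open import Data.Integer.Base using (_+_; _*_; _-_; -_; 0ℤ; 1ℤ; ∣_∣; _^_)
  open import Data.Integer.Tactic.RingSolver using (solve-∀)
  open ≡ using (refl; sym; trans; cong; cong₂; subst)

  instance
    p≢0 : ℕ.NonZero p
    p≢0 = ℕ.>-nonZero (ℕₚ.≤-trans (s≤s z≤n) 2≤p)

  P : ℤ
  P = + p

  z : Series
  z = exponential (hurwitz s)

  pos-^ : ∀ n → + (p ℕ.^ n) ≡ P ^ n
  pos-^ zero    = refl
  pos-^ (suc n) = trans (ℤₚ.pos-* p (p ℕ.^ n)) (cong (P *_) (pos-^ n))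

  ^-mono-∣ : ∀ {a b} → a ℕ.≤ b → P ^ a ∣ P ^ b
  ^-mono-∣ {a} {b} a≤b = ℤD.divides (P ^ (b ℕ.∸ a)) (trans (cong (P ^_) (sym (ℕₚ.m∸n+n≡m a≤b))) (ℤₚ.^-distribˡ-+-* P (b ℕ.∸ a) a))

  module _ {M : ℤ} (A A′ : WeightedMatrix p c k)
    (s≡ : ∀ r → M ∣ s r - (WeightedMatrix.traces A r - WeightedMatrix.traces A′ r)) where
    private
      module A = WeightedMatrix A
      module A′ = WeightedMatrix A′
      u : Series
      u = A.characteristic ∗ z
      w w′ : Series
      w  = hurwitz s ⊞ (- 1ℤ) ⊡ hurwitz A.traces
      w′ = (- 1ℤ) ⊡ hurwitz A′.traces

      u-∂ : ∀ n → u (suc n) ≡ (w ∗ u) n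
      u-∂ n = begin
        (∂ A.characteristic ∗ z) n + (A.characteristic ∗ ∂ z) n
          ≡⟨ cong₂ _+_ (∗-cong (λ i → trans (A.characteristic-∂ i) (sym (ℤₚ.-1*i≡-i _))) (λ _ → refl) n)
                       (∗-cong (λ _ → refl) (exponential-∂ (hurwitz s)) n) ⟩
        (((- 1ℤ) ⊡ (hurwitz A.traces ∗ A.characteristic)) ∗ z) n + (A.characteristic ∗ (hurwitz s ∗ z)) n
          ≡⟨ cong₂ _+_ (trans (⊡-∗ (- 1ℤ) (hurwitz A.traces ∗ A.characteristic) z n) (cong (_*_ (- 1ℤ)) (∗-assoc (hurwitz A.traces) A.characteristic z n)))
               (trans (sym (∗-assoc A.characteristic (hurwitz s) z n)) (trans (∗-cong (∗-comm A.characteristic (hurwitz s)) (λ _ → refl) n)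
                 (∗-assoc (hurwitz s) A.characteristic z n))) ⟩
        - 1ℤ * (hurwitz A.traces ∗ u) n + (hurwitz s ∗ u) n
          ≡⟨ ℤₚ.+-comm (- 1ℤ * (hurwitz A.traces ∗ u) n) _ ⟩
        (hurwitz s ∗ u) n + - 1ℤ * (hurwitz A.traces ∗ u) n
          ≡⟨ trans (∗-distribʳ (hurwitz s) ((- 1ℤ) ⊡ hurwitz A.traces) u n) (cong (_+_ ((hurwitz s ∗ u) n)) (⊡-∗ (- 1ℤ) (hurwitz A.traces) u n)) ⟨
        (w ∗ u) n ∎
        where open ≡.≡-Reasoning

      w≡w′ : ∀ i → M ∣ w i - w′ i
      w≡w′ i = subst (M ∣_) (trans (sub i) (lemma (hurwitz s i) (hurwitz A.traces i) (hurwitz A′.traces i)))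
          (hurwitz-congruent s≡ i)
        where
        open Majorants using (hurwitz-value)
        lemma : ∀ x y y′ → x - (y - y′) ≡ x + - 1ℤ * y - - 1ℤ * y′
        lemma = solve-∀
        lemma′ : ∀ f y y′ → f * (y - y′) ≡ f * y - f * y′
        lemma′ = solve-∀
        sub : ∀ i → hurwitz s i - hurwitz (λ r → A.traces r - A′.traces r) i ≡ hurwitz s i - (hurwitz A.traces i - hurwitz A′.traces i)
        sub i = cong (_-_ (hurwitz s i)) (trans (hurwitz-value (λ r → A.traces r - A′.traces r) i)
          (trans (lemma′ (+ (i ℕ.!)) (A.traces i) (A′.traces i)) (sym (cong₂ _-_ (hurwitz-value A.traces i) (hurwitz-value A′.traces i)))))

    -- The product of det(1 - T A) and Z solves u′ = (s - traces of A) u, while det(1 - T A′) solves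
    -- the equation with coefficient -(traces of A′). These coefficients agree modulo M, and the
    -- Hurwitz recursion has no denominators, so the congruence carries over to the solutions.
    denominator-congruence : ∀ n i → i ℕ.≤ n → M ∣ u i - A′.characteristic i
    denominator-congruence n       zero    _         = ℤD.divides 0ℤ refl
    denominator-congruence (suc n) (suc i) (s≤s i≤n) = subst (M ∣_)
      (sym (cong₂ _-_ (u-∂ i) (trans (A′.characteristic-∂ i) (trans (sym (ℤₚ.-1*i≡-i _)) (sym (⊡-∗ (- 1ℤ) (hurwitz A′.traces) A′.characteristic i))))))
      (∗-congruent i (λ j _ → w≡w′ j) (λ j j≤i → denominator-congruence n j (ℕₚ.≤-trans j≤i i≤n)))

    -- Compare coefficient n of d b = α u, where b = α z, d belongs to A and u agrees with the
    -- series d′ of A′ modulo M. On the right, α has degree at most m, so only d′_j with j ≥ n - m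
    -- enter. On the left, b_j = 0 for m < j < n, so besides b_n itself, which has coefficient d_0 =
    -- 1, only d_i with i ≥ n - m enter.
    coefficient-div : ∀ (α : Series) m n → m ℕ.< n → (∀ i → m ℕ.< i → α i ≡ 0ℤ) → (∀ i → m ℕ.< i → i ℕ.< n → (α ∗ z) i ≡ 0ℤ) →
      (∀ j → n ℕ.≤ m ℕ.+ j → M ∣ A.characteristic j) → (∀ j → n ℕ.≤ m ℕ.+ j → M ∣ A′.characteristic j) →
      M ∣ (α ∗ z) n
    coefficient-div α m n m<n α≡0 b≡0 A-div A′-div =
      subst (M ∣_) (sym (trans (lemma (b n) ((A.characteristic ∗ b) n)) (cong (λ x → (A.characteristic ∗ b) n - x) (sym rest))))
        (ℤD.∣m∣n⇒∣m-n product-div rest-div)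
      where
      b d⁻ : Series
      b = α ∗ z
      d⁻ = A.characteristic ⊞ (- 1ℤ) ⊡ one
      lemma : ∀ x y → x ≡ y - (y - x)
      lemma = solve-∀
      rest : (d⁻ ∗ b) n ≡ (A.characteristic ∗ b) n - b n
      rest = trans (∗-distribʳ A.characteristic ((- 1ℤ) ⊡ one) b n)
        (cong (_+_ ((A.characteristic ∗ b) n)) (trans (⊡-∗ (- 1ℤ) one b n) (trans (cong (_*_ (- 1ℤ)) (one-∗ b n)) (ℤₚ.-1*i≡-i (b n)))))
      vanishing : ∀ i j → i ℕ.+ j ≡ n → M ∣ d⁻ i * b j
      vanishing zero j eq = ℤD.divides 0ℤ refl
      vanishing (suc i) j eq with j ℕₚ.≤? m
      ... | yes j≤m = ℤD.∣m⇒∣m*n (b j) (subst (M ∣_) (sym (ℤₚ.+-identityʳ (A.characteristic (suc i))))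
            (A-div (suc i) (subst (ℕ._≤ m ℕ.+ suc i) eq (ℕₚ.≤-trans (ℕₚ.≤-reflexive (ℕₚ.+-comm (suc i) j)) (ℕₚ.+-monoˡ-≤ (suc i) j≤m)))))
      ... | no j≰m = subst (M ∣_) (sym (trans (cong (_*_ (d⁻ (suc i))) (b≡0 j (ℕₚ.≰⇒> j≰m) (subst (suc j ℕ.≤_) eq (s≤s (ℕₚ.m≤n+m j i))))) (ℤₚ.*-zeroʳ (d⁻ (suc i)))))
            (ℤD.divides 0ℤ refl)
      rest-div : M ∣ (d⁻ ∗ b) n
      rest-div = ∗-div n {M} {d⁻} {b} vanishing
      product-div : M ∣ (A.characteristic ∗ b) n
      product-div = subst (M ∣_) (trans (lemma₁ _ _) (sym (reorder n)))
        (ℤD.∣m∣n⇒∣m+n (∗-congruent n {M} {α} {α} {u} {A′.characteristic} (λ i _ → subst (M ∣_) (sym (ℤₚ.+-inverseʳ (α i))) (ℤD.divides 0ℤ refl)) (λ i i≤n → denominator-congruence n i i≤n))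
          (∗-div n {M} {α} {A′.characteristic} main))
        where
        lemma₁ : ∀ x y → (x - y) + y ≡ x
        lemma₁ = solve-∀
        reorder : ∀ n → (A.characteristic ∗ (α ∗ z)) n ≡ (α ∗ u) n
        reorder n = trans (sym (∗-assoc A.characteristic α z n)) (trans (∗-cong (∗-comm A.characteristic α) (λ _ → refl) n) (∗-assoc α A.characteristic z n))
        main : ∀ i j → i ℕ.+ j ≡ n → M ∣ α i * A′.characteristic j
        main i j eq with i ℕₚ.≤? m
        ... | yes i≤m = ℤD.∣n⇒∣m*n (α i) (A′-div j (subst (ℕ._≤ m ℕ.+ j) eq (ℕₚ.+-monoˡ-≤ j i≤m)))
        ... | no i≰m  = subst (M ∣_) (sym (trans (cong (_* A′.characteristic j) (α≡0 i (ℕₚ.≰⇒> i≰m))) (ℤₚ.*-zeroˡ (A′.characteristic j)))) (ℤD.divides 0ℤ refl)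

module RationalityCriterion (p c k b : ℕ) (2≤p : 2 ℕ.≤ p) (s : ℕ → ℤ) (approx : Approximable p c k s)
  (s≤ : ∀ r → ℤ.∣ s r ∣ ℕ.≤ (2 ℕ.^ b) ℕ.^ suc r) where
  open HurwitzSeries ℤₚ.+-*-commutativeRing
  open HurwitzDivisibility
  open PadicVanishing p c k 2≤p s approx
  open Majorants using (multiple-bound)
  open ℤD using (_∣_)
  open import Data.Integer.Base using (0ℤ; ∣_∣; _^_)
  open import Data.Nat.Base using (_!)
  open import Data.Nat.Tactic.RingSolver using (solve-∀)
  open ≡ using (sym; trans; cong; cong₂; subst)

  B : ℕ
  B = 2 ℕ.^ b

  instance
    B≢0 : ℕ.NonZero B
    B≢0 = ℕₚ.m^n≢0 2 b

  open Growth using (polynomial≤exponential; logarithm; !-mono; !≤^; ^-distrib-*)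

  -- Two opposing demands on L. A fixed polynomial in L must stay below n, for the determinants to
  -- be divisible, while 2 ^ (n L) must exceed the size of coefficient n, which grows like n! up to
  -- exponential factors. An L of the order of log n meets both.
  Precision : ℕ → Set
  Precision h = ∀ n → 3 ℕ.* h ℕ.< n → ∃ λ L →
      (6 ℕ.* (c ℕ.* suc (4 ℕ.* (3 ℕ.* L) ℕ.+ 2) ℕ.^ k) ℕ.≤ n) ×
      (n ! ℕ.* ((3 ℕ.* ((3 ℕ.* h) ! ℕ.* (suc (3 ℕ.* h) ℕ.* B ℕ.^ (3 ℕ.* h)))) ℕ.* (suc n ℕ.* B ℕ.^ n)) ℕ.< 2 ℕ.^ (n ℕ.* L))

  module _ (h : ℕ) (precision : Precision h) where
    private
      bound : ℕ
      bound = 3 ℕ.* ((3 ℕ.* h) ! ℕ.* (suc (3 ℕ.* h) ℕ.* B ℕ.^ (3 ℕ.* h)))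

      module _ (a : ℕ → ℤ) (a-large : ∀ i → h ℕ.+ h ℕ.< i → a i ≡ 0ℤ) (a≤ : ∀ i → ∣ a i ∣ ℕ.≤ bound)
        (gap : ∀ n → h ℕ.+ h ℕ.< n → n ℕ.≤ 3 ℕ.* h → (hurwitz a ∗ z) n ≡ 0ℤ) where
        hurwitz-large : ∀ i → h ℕ.+ h ℕ.< i → hurwitz a i ≡ 0ℤ
        hurwitz-large i m<i = trans (Majorants.hurwitz-value a i) (trans (cong (ℤ._*_ (+ (i !))) (a-large i m<i)) (ℤₚ.*-zeroʳ (+ (i !))))

        -- Determinant coefficients that enter degree n have index j ≥ n - 2 h, hence j ≥ n / 3. To
        -- make up for this factor 3, the divisibility is used with 3 L and the threshold 2 becomes
        -- 6.
        third : ∀ n j → 3 ℕ.* h ℕ.≤ n → n ℕ.≤ h ℕ.+ h ℕ.+ j → n ℕ.≤ 3 ℕ.* j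
        third n j 3h≤n n≤ = ℕₚ.+-cancelʳ-≤ (2 ℕ.* n) n (3 ℕ.* j) (ℕₚ.≤-trans (ℕₚ.≤-reflexive (lemma₁ n)) (ℕₚ.≤-trans (ℕₚ.*-monoʳ-≤ 3 n≤)
          (ℕₚ.≤-trans (ℕₚ.≤-reflexive (lemma₂ h j)) (ℕₚ.+-monoʳ-≤ (3 ℕ.* j) (ℕₚ.*-monoʳ-≤ 2 3h≤n)))))
          where
          lemma₁ : ∀ n → n ℕ.+ 2 ℕ.* n ≡ 3 ℕ.* n
          lemma₁ = solve-∀
          lemma₂ : ∀ h j → 3 ℕ.* (h ℕ.+ h ℕ.+ j) ≡ 3 ℕ.* j ℕ.+ 2 ℕ.* (3 ℕ.* h)
          lemma₂ = solve-∀

        module _ (n L : ℕ) (3h≤n : 3 ℕ.* h ℕ.≤ n) (small : 6 ℕ.* (c ℕ.* suc (4 ℕ.* (3 ℕ.* L) ℕ.+ 2) ℕ.^ k) ℕ.≤ n) where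
          w : ℕ
          w = c ℕ.* suc (4 ℕ.* (3 ℕ.* L) ℕ.+ 2) ℕ.^ k

          characteristic-divisible : ∀ (A : WeightedMatrix p c k) j → n ℕ.≤ h ℕ.+ h ℕ.+ j → P ^ (n ℕ.* L) ∣ WeightedMatrix.characteristic A j
          characteristic-divisible A j n≤ = ℤD.∣-trans (^-mono-∣ (subst (n ℕ.* L ℕ.≤_) (lemma₁ j L) (ℕₚ.*-monoˡ-≤ L (third n j 3h≤n n≤))))
            (CharacteristicDivisibility.characteristic-div p A (3 ℕ.* L) j
              (ℕₚ.*-cancelˡ-≤ {2 ℕ.* w} {j} 3 (ℕₚ.≤-trans (ℕₚ.≤-reflexive (lemma₂ w)) (ℕₚ.≤-trans small (third n j 3h≤n n≤)))))
            where
            lemma₁ : ∀ j L → 3 ℕ.* j ℕ.* L ≡ j ℕ.* (3 ℕ.* L)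
            lemma₁ = solve-∀
            lemma₂ : ∀ x → 3 ℕ.* (2 ℕ.* x) ≡ 6 ℕ.* x
            lemma₂ = solve-∀

        -- Strong induction on n, run through the bound N. The degrees up to 3 h come from Siegel's
        -- lemma; beyond, the vanishing of the earlier coefficients makes the next one divisible by
        -- more than its size allows.
        vanish : ∀ N n → n ℕ.≤ N → h ℕ.+ h ℕ.< n → (hurwitz a ∗ z) n ≡ 0ℤ
        beyond : ∀ N n → n ℕ.≤ suc N → h ℕ.+ h ℕ.< n → 3 ℕ.* h ℕ.< n →
          (∃ λ L → (6 ℕ.* (c ℕ.* suc (4 ℕ.* (3 ℕ.* L) ℕ.+ 2) ℕ.^ k) ℕ.≤ n) × (n ! ℕ.* (bound ℕ.* (suc n ℕ.* B ℕ.^ n)) ℕ.< 2 ℕ.^ (n ℕ.* L))) →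
          (hurwitz a ∗ z) n ≡ 0ℤ
        vanish N n n≤N m<n = split N n≤N (n ℕₚ.≤? 3 ℕ.* h)
          where
          split : ∀ N → n ℕ.≤ N → Dec (n ℕ.≤ 3 ℕ.* h) → (hurwitz a ∗ z) n ≡ 0ℤ
          split N       n≤N (yes n≤3h) = gap n m<n n≤3h
          split zero    n≤0 (no n≰3h)  = ⊥-elim (n≰3h (ℕₚ.≤-trans n≤0 z≤n))
          split (suc N) n≤N (no n≰3h)  = beyond N n n≤N m<n (ℕₚ.≰⇒> n≰3h) (precision n (ℕₚ.≰⇒> n≰3h))
        beyond N n n≤N m<n 3h<n (L , small , big) = multiple-small⇒0 {P ^ (n ℕ.* L)} {(hurwitz a ∗ z) n}
          (coefficient-div (proj₁ (approx (n ℕ.* L))) (proj₁ (proj₂ (approx (n ℕ.* L)))) (proj₂ (proj₂ (approx (n ℕ.* L)))) (hurwitz a) (h ℕ.+ h) n m<n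
            hurwitz-large
            (λ i m<i i<n → vanish N i (ℕₚ.≤-pred (ℕₚ.≤-trans i<n n≤N)) m<i)
            (characteristic-divisible n L (ℕₚ.<⇒≤ 3h<n) small (proj₁ (approx (n ℕ.* L))))
            (characteristic-divisible n L (ℕₚ.<⇒≤ 3h<n) small (proj₁ (proj₂ (approx (n ℕ.* L))))))
          (ℕₚ.≤-<-trans (multiple-bound s B bound a s≤ a≤ n) (ℕₚ.<-≤-trans big
            (subst (2 ℕ.^ (n ℕ.* L) ℕ.≤_) (cong ∣_∣ (pos-^ (n ℕ.* L))) (ℕₚ.^-monoˡ-≤ (n ℕ.* L) 2≤p))))

    annihilator-from : ∃ λ (a : ℕ → ℤ) → ∃ λ m → (∀ i → m ℕ.< i → a i ≡ 0ℤ) × (∃ λ i → a i ≢ 0ℤ) ×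
      (∀ n → m ℕ.< n → (hurwitz a ∗ z) n ≡ 0ℤ)
    annihilator-from = collect (Siegel.siegel s B s≤ h)
      where
      collect : (∃ λ (a : ℕ → ℤ) → (∀ i → h ℕ.+ h ℕ.< i → a i ≡ 0ℤ) × (∃ λ i → a i ≢ 0ℤ) × (∀ i → ∣ a i ∣ ℕ.≤ bound) ×
          (∀ n → h ℕ.+ h ℕ.< n → n ℕ.≤ 3 ℕ.* h → (hurwitz a ∗ z) n ≡ 0ℤ)) →
        ∃ λ (a : ℕ → ℤ) → ∃ λ m → (∀ i → m ℕ.< i → a i ≡ 0ℤ) × (∃ λ i → a i ≢ 0ℤ) × (∀ n → m ℕ.< n → (hurwitz a ∗ z) n ≡ 0ℤ)
      collect (a , a-large , a≢0 , a≤ , gap) = a , h ℕ.+ h , a-large , a≢0 , λ n → vanish a a-large a≤ gap n n ℕₚ.≤-refl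

  ℓ₀ h : ℕ
  ℓ₀ = proj₁ (polynomial≤exponential k (6 ℕ.* (c ℕ.* (87 ℕ.+ 24 ℕ.* b) ℕ.^ k)))
  -- Every n > 3 h then has binary logarithm at least ℓ₀, where 2 ^ ℓ dominates the required
  -- polynomial in ℓ. The constant 87 + 24 b comes from 12 L + 3 ≤ (87 + 24 b) (ℓ + 1) for the L
  -- chosen below.
  h = 2 ℕ.^ ℓ₀

  precision : Precision h
  precision (suc n′) 3h<n with logarithm n′
  ... | ℓ , 2^ℓ≤n , n<T = L , small , big
    where
    n L T : ℕ
    n = suc n′
    -- As n < T, the size is at most T ^ (2 n + 4) B ^ (2 n) ≤ T ^ (6 n) B ^ (2 n) = 2 ^ (n (6 (ℓ +
    -- 1) + 2 b)). The one unit left over in 7 = 6 + 1 makes the inequality strict.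
    L = 6 ℕ.* ℓ ℕ.+ 7 ℕ.+ 2 ℕ.* b
    T = 2 ℕ.^ suc ℓ
    ℓ₀≤ℓ : ℓ₀ ℕ.≤ ℓ
    ℓ₀≤ℓ = ℕₚ.≮⇒≥ λ ℓ<ℓ₀ → ℕₚ.<⇒≱ n<T (ℕₚ.≤-trans (ℕₚ.^-monoʳ-≤ 2 ℓ<ℓ₀) (ℕₚ.≤-trans (ℕₚ.m≤m+n h _) (ℕₚ.<⇒≤ 3h<n)))
    linear : suc (4 ℕ.* (3 ℕ.* L) ℕ.+ 2) ℕ.≤ (87 ℕ.+ 24 ℕ.* b) ℕ.* suc ℓ
    linear = subst (suc (4 ℕ.* (3 ℕ.* L) ℕ.+ 2) ℕ.≤_) (sym (lemma ℓ b)) (ℕₚ.m≤m+n _ (15 ℕ.* ℓ ℕ.+ 24 ℕ.* b ℕ.* ℓ))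
      where
      lemma : ∀ ℓ b → (87 ℕ.+ 24 ℕ.* b) ℕ.* suc ℓ ≡ suc (4 ℕ.* (3 ℕ.* (6 ℕ.* ℓ ℕ.+ 7 ℕ.+ 2 ℕ.* b)) ℕ.+ 2) ℕ.+ (15 ℕ.* ℓ ℕ.+ 24 ℕ.* b ℕ.* ℓ)
      lemma = solve-∀
    small : 6 ℕ.* (c ℕ.* suc (4 ℕ.* (3 ℕ.* L) ℕ.+ 2) ℕ.^ k) ℕ.≤ n
    small = begin
      6 ℕ.* (c ℕ.* suc (4 ℕ.* (3 ℕ.* L) ℕ.+ 2) ℕ.^ k)
        ≤⟨ ℕₚ.*-monoʳ-≤ 6 (ℕₚ.*-monoʳ-≤ c (ℕₚ.^-monoˡ-≤ k linear)) ⟩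
      6 ℕ.* (c ℕ.* ((87 ℕ.+ 24 ℕ.* b) ℕ.* suc ℓ) ℕ.^ k)
        ≡⟨ cong (λ x → 6 ℕ.* (c ℕ.* x)) (^-distrib-* (87 ℕ.+ 24 ℕ.* b) (suc ℓ) k) ⟩
      6 ℕ.* (c ℕ.* ((87 ℕ.+ 24 ℕ.* b) ℕ.^ k ℕ.* suc ℓ ℕ.^ k))
        ≡⟨ lemma c ((87 ℕ.+ 24 ℕ.* b) ℕ.^ k) (suc ℓ ℕ.^ k) ⟩
      6 ℕ.* (c ℕ.* (87 ℕ.+ 24 ℕ.* b) ℕ.^ k) ℕ.* suc ℓ ℕ.^ k
        ≤⟨ proj₂ (polynomial≤exponential k (6 ℕ.* (c ℕ.* (87 ℕ.+ 24 ℕ.* b) ℕ.^ k))) ℓ ℓ₀≤ℓ ⟩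
      2 ℕ.^ ℓ
        ≤⟨ 2^ℓ≤n ⟩
      n ∎
      where
      open ℕₚ.≤-Reasoning
      lemma : ∀ c x y → 6 ℕ.* (c ℕ.* (x ℕ.* y)) ≡ 6 ℕ.* (c ℕ.* x) ℕ.* y
      lemma = solve-∀
    n≤T : n ℕ.≤ T
    n≤T = ℕₚ.<⇒≤ n<T
    3h≤n : 3 ℕ.* h ℕ.≤ n
    3h≤n = ℕₚ.<⇒≤ 3h<n
    2≤T : 2 ℕ.≤ T
    2≤T = ℕₚ.*-monoʳ-≤ 2 (ℕₚ.m^n>0 2 ℓ)
    factorial : n ! ℕ.≤ T ℕ.^ n
    factorial = !≤^ n T n≤T
    T^≤ : T ℕ.^ 4 ℕ.≤ T ℕ.^ (4 ℕ.* n)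
    T^≤ = ℕₚ.^-monoʳ-≤ T {{ℕₚ.m^n≢0 2 (suc ℓ)}} {4} {4 ℕ.* n} (ℕₚ.*-monoʳ-≤ 4 {1} {n} (s≤s z≤n))
    exponents : ∀ ℓ b n → suc ℓ ℕ.* (6 ℕ.* n) ℕ.+ b ℕ.* (2 ℕ.* n) ℕ.+ n ≡ n ℕ.* (6 ℕ.* ℓ ℕ.+ 7 ℕ.+ 2 ℕ.* b)
    exponents = solve-∀
    collect : ∀ t u x → t ℕ.* ((u ℕ.* u ℕ.* (t ℕ.* (u ℕ.* x))) ℕ.* (u ℕ.* x)) ≡ t ℕ.* t ℕ.* (u ℕ.* (u ℕ.* (u ℕ.* (u ℕ.* 1)))) ℕ.* (x ℕ.* x)
    collect = solve-∀
    big : n ! ℕ.* ((3 ℕ.* ((3 ℕ.* h) ! ℕ.* (suc (3 ℕ.* h) ℕ.* B ℕ.^ (3 ℕ.* h)))) ℕ.* (suc n ℕ.* B ℕ.^ n)) ℕ.< 2 ℕ.^ (n ℕ.* L)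
    big = begin-strict
      n ! ℕ.* ((3 ℕ.* ((3 ℕ.* h) ! ℕ.* (suc (3 ℕ.* h) ℕ.* B ℕ.^ (3 ℕ.* h)))) ℕ.* (suc n ℕ.* B ℕ.^ n))
        ≤⟨ ℕₚ.*-mono-≤ factorial (ℕₚ.*-mono-≤
             (ℕₚ.*-mono-≤ (ℕₚ.≤-trans (ℕₚ.n≤1+n 3) (ℕₚ.*-mono-≤ 2≤T 2≤T)) (ℕₚ.*-mono-≤ (ℕₚ.≤-trans (!-mono 3h≤n) factorial)
               (ℕₚ.*-mono-≤ (ℕₚ.≤-trans 3h<n n≤T) (ℕₚ.^-monoʳ-≤ B 3h≤n))))
             (ℕₚ.*-monoˡ-≤ (B ℕ.^ n) n<T)) ⟩
      T ℕ.^ n ℕ.* ((T ℕ.* T ℕ.* (T ℕ.^ n ℕ.* (T ℕ.* B ℕ.^ n))) ℕ.* (T ℕ.* B ℕ.^ n))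
        ≡⟨ collect (T ℕ.^ n) T (B ℕ.^ n) ⟩
      T ℕ.^ n ℕ.* T ℕ.^ n ℕ.* T ℕ.^ 4 ℕ.* (B ℕ.^ n ℕ.* B ℕ.^ n)
        ≤⟨ ℕₚ.*-monoˡ-≤ (B ℕ.^ n ℕ.* B ℕ.^ n) (ℕₚ.*-monoʳ-≤ (T ℕ.^ n ℕ.* T ℕ.^ n) T^≤) ⟩
      T ℕ.^ n ℕ.* T ℕ.^ n ℕ.* T ℕ.^ (4 ℕ.* n) ℕ.* (B ℕ.^ n ℕ.* B ℕ.^ n)
        ≡⟨ cong₂ ℕ._*_ (trans (cong (ℕ._* T ℕ.^ (4 ℕ.* n)) (sym (ℕₚ.^-distribˡ-+-* T n n))) (sym (ℕₚ.^-distribˡ-+-* T (n ℕ.+ n) (4 ℕ.* n))))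
             (sym (ℕₚ.^-distribˡ-+-* B n n)) ⟩
      T ℕ.^ (n ℕ.+ n ℕ.+ 4 ℕ.* n) ℕ.* B ℕ.^ (n ℕ.+ n)
        ≡⟨ cong₂ (λ x y → T ℕ.^ x ℕ.* B ℕ.^ y) (lemma₁ n) (lemma₂ n) ⟩
      T ℕ.^ (6 ℕ.* n) ℕ.* B ℕ.^ (2 ℕ.* n)
        ≡⟨ cong₂ ℕ._*_ (ℕₚ.^-*-assoc 2 (suc ℓ) (6 ℕ.* n)) (ℕₚ.^-*-assoc 2 b (2 ℕ.* n)) ⟩
      2 ℕ.^ (suc ℓ ℕ.* (6 ℕ.* n)) ℕ.* 2 ℕ.^ (b ℕ.* (2 ℕ.* n))
        ≡⟨ ℕₚ.^-distribˡ-+-* 2 (suc ℓ ℕ.* (6 ℕ.* n)) (b ℕ.* (2 ℕ.* n)) ⟨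
      2 ℕ.^ (suc ℓ ℕ.* (6 ℕ.* n) ℕ.+ b ℕ.* (2 ℕ.* n))
        <⟨ ℕₚ.^-monoʳ-< 2 (s≤s (s≤s z≤n)) (subst (suc ℓ ℕ.* (6 ℕ.* n) ℕ.+ b ℕ.* (2 ℕ.* n) ℕ.<_) (exponents ℓ b n)
             (ℕₚ.m<m+n (suc ℓ ℕ.* (6 ℕ.* n) ℕ.+ b ℕ.* (2 ℕ.* n)) (s≤s z≤n))) ⟩
      2 ℕ.^ (n ℕ.* L) ∎
      where
      open ℕₚ.≤-Reasoning
      lemma₁ : ∀ n → n ℕ.+ n ℕ.+ 4 ℕ.* n ≡ 6 ℕ.* n
      lemma₁ = solve-∀
      lemma₂ : ∀ n → n ℕ.+ n ≡ 2 ℕ.* n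
      lemma₂ = solve-∀

  annihilator : ∃ λ (a : ℕ → ℤ) → ∃ λ m → (∀ i → m ℕ.< i → a i ≡ 0ℤ) × (∃ λ i → a i ≢ 0ℤ) ×
    (∀ n → m ℕ.< n → (hurwitz a ∗ z) n ≡ 0ℤ)
  annihilator = annihilator-from h precision

-- The exponential of a rational power series

module RationalArithmetic where
  open import Data.Rational.Base as ℚ using (ℚ; 0ℚ; 1ℚ; toℚᵘ)
  open import Data.Rational.Unnormalised.Base using (mkℚᵘ; *≡*; _≃_)
  import Data.Rational.Properties as ℚₚ
  import Data.Rational.Unnormalised.Properties as ℚᵘₚ
  open IntegerSolver ℚₚ.+-*-commutativeRing using (fromℤ)
  open import Data.Integer.Tactic.RingSolver using (solve-∀)
  open ≡ using (refl; sym; trans; cong)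

  toℚᵘ-/ : ∀ i n → toℚᵘ (i ℚ./ suc n) ≃ mkℚᵘ i n
  toℚᵘ-/ i n = ℚₚ.toℚᵘ-fromℚᵘ (mkℚᵘ i n)

  fromℤ-ᵘ : ∀ i → toℚᵘ (fromℤ i) ≃ mkℚᵘ i 0
  fromℤ-ᵘ (+ n) = natural n
    where
    open import Algebra.Properties.Semiring.Mult.TCOptimised (CommutativeRing.semiring ℚₚ.+-*-commutativeRing) using (1+×)
    natural : ∀ n → toℚᵘ (fromℤ (+ n)) ≃ mkℚᵘ (+ n) 0
    natural zero    = *≡* refl
    natural (suc n) = ℚᵘₚ.≃-trans (ℚᵘₚ.≃-reflexive (cong toℚᵘ (1+× n 1ℚ))) (ℚᵘₚ.≃-trans (ℚₚ.toℚᵘ-homo-+ 1ℚ (fromℤ (+ n)))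
      (ℚᵘₚ.≃-trans (ℚᵘₚ.+-congʳ (toℚᵘ 1ℚ) (natural n)) (*≡* (lemma (+ n)))))
      where
      lemma : ∀ n → (+ 1 ℤ.* + 1 ℤ.+ n ℤ.* + 1) ℤ.* + 1 ≡ (+ 1 ℤ.+ n) ℤ.* (+ 1 ℤ.* + 1)
      lemma = solve-∀
  fromℤ-ᵘ -[1+ n ] = ℚᵘₚ.≃-trans (ℚₚ.toℚᵘ-homo‿- (fromℤ (+ suc n))) (ℚᵘₚ.-‿cong (fromℤ-ᵘ (+ suc n)))

  fromℤ-/ : ∀ i n → fromℤ (+ suc n) ℚ.* (i ℚ./ suc n) ≡ fromℤ i
  fromℤ-/ i n = ℚₚ.toℚᵘ-injective (ℚᵘₚ.≃-trans (ℚₚ.toℚᵘ-homo-* (fromℤ (+ suc n)) (i ℚ./ suc n))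
    (ℚᵘₚ.≃-trans (ℚᵘₚ.*-cong (fromℤ-ᵘ (+ suc n)) (toℚᵘ-/ i n)) (ℚᵘₚ.≃-trans (*≡* (lemma (+ suc n) i)) (ℚᵘₚ.≃-sym (fromℤ-ᵘ i)))))
    where
    lemma : ∀ d i → (d ℤ.* i) ℤ.* + 1 ≡ i ℤ.* (+ 1 ℤ.* d)
    lemma = solve-∀

  fromℤ-injective : ∀ i → fromℤ i ≡ 0ℚ → i ≡ + 0
  fromℤ-injective i eq = ≃0 (ℚᵘₚ.≃-trans (ℚᵘₚ.≃-sym (fromℤ-ᵘ i)) (ℚᵘₚ.≃-reflexive (cong toℚᵘ eq)))
    where
    ≃0 : mkℚᵘ i 0 ≃ mkℚᵘ (+ 0) 0 → i ≡ + 0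
    ≃0 (*≡* eq) = trans (sym (ℤₚ.*-identityʳ i)) eq

  inverseFactorial : ℕ → ℚ
  inverseFactorial n = ((+ 1) ℚ./ (n ℕ.!)) {{ℕₚ._!≢0 n}}

  inverseFactorial-suc : ∀ n → fromℤ (+ suc n) ℚ.* inverseFactorial (suc n) ≡ inverseFactorial n
  inverseFactorial-suc n = general (n ℕ.!) (suc n ℕ.!) {{ℕₚ._!≢0 n}} {{ℕₚ._!≢0 (suc n)}} refl
    where
    general : ∀ a b .{{_ : ℕ.NonZero a}} .{{_ : ℕ.NonZero b}} → b ≡ suc n ℕ.* a → fromℤ (+ suc n) ℚ.* ((+ 1) ℚ./ b) ≡ (+ 1) ℚ./ a
    general (suc a) (suc b) eq = ℚₚ.toℚᵘ-injective (ℚᵘₚ.≃-trans (ℚₚ.toℚᵘ-homo-* (fromℤ (+ suc n)) ((+ 1) ℚ./ suc b))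
      (ℚᵘₚ.≃-trans (ℚᵘₚ.*-cong (fromℤ-ᵘ (+ suc n)) (toℚᵘ-/ (+ 1) b)) (ℚᵘₚ.≃-trans (*≡* (cross (cong +_ eq))) (ℚᵘₚ.≃-sym (toℚᵘ-/ (+ 1) a)))))
      where
      lemma : ∀ s a → (s ℤ.* + 1) ℤ.* a ≡ + 1 ℤ.* (+ 1 ℤ.* (s ℤ.* a))
      lemma = solve-∀
      cross : + suc b ≡ + (suc n ℕ.* suc a) → (+ suc n ℤ.* + 1) ℤ.* + suc a ≡ + 1 ℤ.* (+ 1 ℤ.* + suc b)
      cross eq = trans (lemma (+ suc n) (+ suc a)) (cong (λ x → + 1 ℤ.* (+ 1 ℤ.* x)) (sym (trans eq (ℤₚ.pos-* (suc n) (suc a)))))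

module ExponentialSeries where
  open import Data.Rational.Base as ℚ using (ℚ; 0ℚ; 1ℚ; _+_; _*_)
  import Data.Rational.Properties as ℚₚ
  open RationalArithmetic
  private
    Qring : CommutativeRing 0ℓ 0ℓ
    Qring = ℚₚ.+-*-commutativeRing
    module Q = CommutativeRing Qring
    module HZ = HurwitzSeries ℤₚ.+-*-commutativeRing
  open HurwitzSeries Qring
  open IntegerSolver Qring using (solve; _:=_; _:*_; fromℤ; fromℤ-+; fromℤ-*)
  open import Algebra.Properties.Semiring.Mult Q.semiring using () renaming (_×_ to _·_)
  open ≡ using (refl; sym; trans; cong; cong₂)

  sumUpTo-cong : ∀ n {f g : ℕ → ℚ} → (∀ i → i ℕ.≤ n → f i ≡ g i) → sumUpTo n f ≡ sumUpTo n g
  sumUpTo-cong zero    h = h 0 z≤n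
  sumUpTo-cong (suc n) h = cong₂ _+_ (sumUpTo-cong n (λ i i≤n → h i (ℕₚ.m≤n⇒m≤1+n i≤n))) (h (suc n) ℕₚ.≤-refl)

  sumUpTo-head : ∀ n (f : ℕ → ℚ) → sumUpTo (suc n) f ≡ f 0 + sumUpTo n (f ∘ suc)
  sumUpTo-head zero    f = refl
  sumUpTo-head (suc n) f = trans (cong (_+ f (suc (suc n))) (sumUpTo-head n f)) (ℚₚ.+-assoc (f 0) (sumUpTo n (f ∘ suc)) (f (suc (suc n))))

  ⊛-convolution : ∀ f g n → (f ⊛ g) n ≡ convolution f g n
  ⊛-convolution f g zero    = refl
  ⊛-convolution f g (suc n) = trans (sumUpTo-head n (λ i → f i * g (suc n ℕ.∸ i))) (cong (_+_ (f 0 * g (suc n))) (⊛-convolution (f ∘ suc) g n))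

  hurwitz-⊛ : ∀ f g n → hurwitz (f ⊛ g) n ≡ (hurwitz f ∗ hurwitz g) n
  hurwitz-⊛ f g n = trans (hurwitz-cong (⊛-convolution f g) n) (sym (hurwitz-convolution f g n))

  ·-fromℤ : ∀ n x → n · x ≡ fromℤ (+ n) * x
  ·-fromℤ zero    x = sym (ℚₚ.*-zeroˡ x)
  ·-fromℤ (suc n) x = trans (cong₂ _+_ (sym (ℚₚ.*-identityˡ x)) (·-fromℤ n x)) (trans (sym (ℚₚ.*-distribʳ-+ x 1ℚ (fromℤ (+ n)))) (cong (_* x) (sym (fromℤ-+ (+ 1) (+ n)))))

  module _ (s : ℕ → ℤ) (S : PowerSeries) (S-0 : S 0 ≡ 0ℚ) (S-suc : ∀ r → S (suc r) ≡ s r ℚ./ suc r) where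
    private
      h c : Series
      h = hurwitz S
      c = hurwitz (fromℤ ∘ s)

      h-0 : h 0 ≡ 0ℚ
      h-0 = S-0

      ∂h : ∂ h ≋ c
      ∂h r = trans (cong (suc r ·_) (hurwitz-constant (∂ S) r)) (trans (scale r (suc r))
          (trans (constant-cong r (trans (·-fromℤ (suc r) (S (suc r))) (trans (cong (fromℤ (+ suc r) *_) (S-suc r)) (fromℤ-/ (s r) r)))) (sym (hurwitz-constant (fromℤ ∘ s) r))))
        where
        constant-cong : ∀ r {x y} → x ≡ y → hurwitz (λ _ → x) r ≡ hurwitz (λ _ → y) r
        constant-cong r refl = refl
        scale : ∀ r k → k · hurwitz (λ _ → S (suc r)) r ≡ hurwitz (λ _ → k · S (suc r)) r
        scale r k = trans (·-fromℤ k _) (trans (hurwitz-constant-* (fromℤ (+ k)) (S (suc r)) r) (constant-cong r (sym (·-fromℤ k (S (suc r))))))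

      Y : ℕ → Series
      Y n = hurwitz (psPow S n)

      Y-suc : ∀ n → Y (suc n) ≋ h ∗ Y n
      Y-suc n = hurwitz-⊛ S (psPow S n)

      Y-0 : ∀ m → Y 0 (suc m) ≡ 0ℚ
      Y-0 m = trans (hurwitz-constant psOne (suc m)) (vanish (suc m))
        where
        vanish : ∀ m → hurwitz (λ _ → 0ℚ) m ≡ 0ℚ
        vanish zero    = refl
        vanish (suc m) = trans (cong (suc m ·_) (vanish m)) (trans (·-fromℤ (suc m) 0ℚ) (ℚₚ.*-zeroʳ (fromℤ (+ suc m))))

      -- The power rule (S ^ (n + 1))′ = (n + 1) S′ S ^ n; here `Y n` is the Hurwitz form of S ^ n
      -- and `c` that of S′.
      ∂Y : ∀ n m → Y (suc n) (suc m) ≡ suc n · (c ∗ Y n) m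
      ∂Y zero m = trans (Y-suc 0 (suc m)) (cong₂ _+_ (∗-cong ∂h (λ _ → refl) m)
        (trans (∗-cong {b = ∂ (Y 0)} (λ _ → refl) Y-0 m) (trans (∗-comm h (λ _ → 0ℚ) m) (zero-∗ h m))))
      ∂Y (suc n) m = trans (Y-suc (suc n) (suc m)) (cong₂ _+_ (∗-cong ∂h (λ _ → refl) m)
        (trans (∗-cong (λ _ → refl) (λ j → trans (∂Y n j) (·-fromℤ (suc n) ((c ∗ Y n) j))) m)
          (trans (∗-comm h (fromℤ (+ suc n) ⊡ (c ∗ Y n)) m) (trans (⊡-∗ (fromℤ (+ suc n)) (c ∗ Y n) h m)
            (trans (cong (fromℤ (+ suc n) *_) (trans (∗-assoc c (Y n) h m) (∗-cong (λ _ → refl) (λ j → trans (∗-comm (Y n) h j) (sym (Y-suc n j))) m)))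
              (sym (·-fromℤ (suc n) ((c ∗ Y (suc n)) m))))))))

      Y-small : ∀ n m → m ℕ.< n → Y n m ≡ 0ℚ
      Y-small (suc n) zero    m<n       = trans (Y-suc n 0) (trans (cong (_* Y n 0) h-0) (ℚₚ.*-zeroˡ (Y n 0)))
      Y-small (suc n) (suc m) (s≤s m<n) = trans (∂Y n m) (trans (cong (suc n ·_) (trans (∗-cong≤ m {c} {c} {Y n} {λ _ → 0ℚ} (λ _ _ → refl) (λ i i≤m → Y-small n i (ℕₚ.≤-<-trans i≤m m<n)))
        (trans (∗-comm c (λ _ → 0ℚ) m) (zero-∗ c m)))) (trans (·-fromℤ (suc n) 0ℚ) (ℚₚ.*-zeroʳ (fromℤ (+ suc n)))))

      partialSum : ℕ → Series
      partialSum M m = sumUpTo M (λ n → inverseFactorial n * Y n m)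

      partialSum-stable : ∀ d m → partialSum (d ℕ.+ m) m ≡ partialSum m m
      partialSum-stable zero    m = refl
      partialSum-stable (suc d) m = trans (cong₂ _+_ (partialSum-stable d m) (trans (cong (inverseFactorial (suc (d ℕ.+ m)) *_) (Y-small (suc (d ℕ.+ m)) m (s≤s (ℕₚ.m≤n+m m d)))) (ℚₚ.*-zeroʳ (inverseFactorial (suc (d ℕ.+ m))))))
        (ℚₚ.+-identityʳ _)

      partialSum-≥ : ∀ {M m} → m ℕ.≤ M → partialSum M m ≡ partialSum m m
      partialSum-≥ {M} {m} m≤M = trans (cong (λ k → partialSum k m) (sym (ℕₚ.m∸n+n≡m m≤M))) (partialSum-stable (M ℕ.∸ m) m)

      hurwitz-sum : ∀ M m (f : ℕ → ℚ) → hurwitz (λ _ → sumUpTo M f) m ≡ sumUpTo M (λ n → hurwitz (λ _ → f n) m)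
      hurwitz-sum zero    m f = refl
      hurwitz-sum (suc M) m f = trans (hurwitz-constant-+ (sumUpTo M f) (f (suc M)) m) (cong (_+ hurwitz (λ _ → f (suc M)) m) (hurwitz-sum M m f))

      hurwitz-psExp : ∀ m → hurwitz (psExp S) m ≡ partialSum m m
      hurwitz-psExp m = trans (hurwitz-constant (psExp S) m) (trans (hurwitz-sum m m _) (sumUpTo-cong m (λ n _ →
        trans (cong (λ x → hurwitz (λ _ → x) m) (ℚₚ.*-comm (psPow S n m) (inverseFactorial n)))
          (trans (sym (hurwitz-constant-* (inverseFactorial n) (psPow S n m) m)) (cong (inverseFactorial n *_) (sym (hurwitz-constant (psPow S n) m)))))))

      ∗-partialSum : ∀ M m → (c ∗ partialSum M) m ≡ sumUpTo M (λ n → inverseFactorial n * (c ∗ Y n) m)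
      ∗-partialSum zero    m = scalar 0 m
        where
        scalar : ∀ n m → (c ∗ (inverseFactorial n ⊡ Y n)) m ≡ inverseFactorial n * (c ∗ Y n) m
        scalar n m = trans (∗-comm c (inverseFactorial n ⊡ Y n) m) (trans (⊡-∗ (inverseFactorial n) (Y n) c m) (cong (inverseFactorial n *_) (∗-comm (Y n) c m)))
      ∗-partialSum (suc M) m = trans (∗-distribˡ c (partialSum M) (inverseFactorial (suc M) ⊡ Y (suc M)) m) (cong₂ _+_ (∗-partialSum M m) (scalar (suc M) m))
        where
        scalar : ∀ n m → (c ∗ (inverseFactorial n ⊡ Y n)) m ≡ inverseFactorial n * (c ∗ Y n) m
        scalar n m = trans (∗-comm c (inverseFactorial n ⊡ Y n) m) (trans (⊡-∗ (inverseFactorial n) (Y n) c m) (cong (inverseFactorial n *_) (∗-comm (Y n) c m)))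

      -- Differentiation lowers the index in ∑ S ^ n / n! by one. The cut-off at n ≤ m, which moves
      -- with the coefficient, is harmless because S ^ n starts in degree n. Uniqueness for this
      -- equation then identifies `psExp S` with the integral series z.
      ∂-psExp : ∀ m → hurwitz (psExp S) (suc m) ≡ (c ∗ hurwitz (psExp S)) m
      ∂-psExp m = trans (hurwitz-psExp (suc m)) (trans (sumUpTo-head m (λ n → inverseFactorial n * Y n (suc m)))
        (trans (cong₂ _+_ (trans (cong (inverseFactorial 0 *_) (Y-0 m)) (ℚₚ.*-zeroʳ (inverseFactorial 0))) (sumUpTo-cong m (λ n _ → step n)))
          (trans (ℚₚ.+-identityˡ _) (trans (sym (∗-partialSum m m))
            (∗-cong≤ m (λ _ _ → refl) (λ j j≤m → trans (partialSum-≥ j≤m) (sym (hurwitz-psExp j))))))))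
        where
        step : ∀ n → inverseFactorial (suc n) * Y (suc n) (suc m) ≡ inverseFactorial n * (c ∗ Y n) m
        step n = trans (cong (inverseFactorial (suc n) *_) (trans (∂Y n m) (·-fromℤ (suc n) ((c ∗ Y n) m))))
          (trans (solve 3 (λ a b x → a :* (b :* x) := (b :* a) :* x) refl (inverseFactorial (suc n)) (fromℤ (+ suc n)) ((c ∗ Y n) m))
            (cong (_* (c ∗ Y n) m) (inverseFactorial-suc n)))

      fromℤ-∗ : ∀ n a b → fromℤ ((a HZ.∗ b) n) ≡ ((fromℤ ∘ a) ∗ (fromℤ ∘ b)) n
      fromℤ-∗ zero    a b = fromℤ-* (a 0) (b 0)
      fromℤ-∗ (suc n) a b = trans (fromℤ-+ ((HZ.∂ a HZ.∗ b) n) ((a HZ.∗ HZ.∂ b) n)) (cong₂ _+_ (fromℤ-∗ n (HZ.∂ a) b) (fromℤ-∗ n a (HZ.∂ b)))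

      fromℤ-hurwitz : ∀ n α → fromℤ (HZ.hurwitz α n) ≡ hurwitz (fromℤ ∘ α) n
      fromℤ-hurwitz zero    α = refl
      fromℤ-hurwitz (suc n) α = trans (cong fromℤ (Majorants.·≡* (suc n) (HZ.hurwitz (HZ.∂ α) n)))
        (trans (fromℤ-* (+ suc n) (HZ.hurwitz (HZ.∂ α) n)) (trans (cong (fromℤ (+ suc n) *_) (fromℤ-hurwitz n (HZ.∂ α))) (sym (·-fromℤ (suc n) _))))

      z : ℕ → ℤ
      z = HZ.exponential (HZ.hurwitz s)

      hurwitz-psExp≡z : ∀ n → hurwitz (psExp S) n ≡ fromℤ (z n)
      hurwitz-psExp≡z n = linear-unique {c} {hurwitz (psExp S)} {fromℤ ∘ z} ∂-psExp
        (λ m → trans (cong fromℤ (HZ.exponential-∂ (HZ.hurwitz s) m)) (trans (fromℤ-∗ m (HZ.hurwitz s) z) (∗-cong (λ j → fromℤ-hurwitz j s) (λ _ → refl) m)))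
        refl n n ℕₚ.≤-refl

      hurwitz-cancel : ∀ n (x : ℚ) → hurwitz (λ _ → x) n ≡ 0ℚ → x ≡ 0ℚ
      hurwitz-cancel zero    x eq = eq
      hurwitz-cancel (suc n) x eq = hurwitz-cancel n x (nonzero n (trans (sym (·-fromℤ (suc n) (hurwitz (λ _ → x) n))) eq))
        where
        nonzero : ∀ n {y} → fromℤ (+ suc n) * y ≡ 0ℚ → y ≡ 0ℚ
        nonzero n {y} eq = trans (sym (ℚₚ.*-identityˡ y)) (trans (cong (_* y) (sym (trans (ℚₚ.*-comm ((+ 1) ℚ./ suc n) (fromℤ (+ suc n))) (fromℤ-/ (+ 1) n))))
          (trans (ℚₚ.*-assoc ((+ 1) ℚ./ suc n) (fromℤ (+ suc n)) y) (trans (cong (((+ 1) ℚ./ suc n) *_) eq) (ℚₚ.*-zeroʳ ((+ 1) ℚ./ suc n)))))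

      prefix : ℕ → (ℕ → ℚ) → List ℚ
      prefix zero    f = []
      prefix (suc m) f = f 0 ∷ prefix m (f ∘ suc)

      coeff-prefix-< : ∀ m f i → i ℕ.< m → coeff (prefix m f) i ≡ f i
      coeff-prefix-< (suc m) f zero    i<m       = refl
      coeff-prefix-< (suc m) f (suc i) (s≤s i<m) = coeff-prefix-< m (f ∘ suc) i i<m

      coeff-prefix-≥ : ∀ m f i → m ℕ.≤ i → coeff (prefix m f) i ≡ 0ℚ
      coeff-prefix-≥ zero    f i       m≤i       = refl
      coeff-prefix-≥ (suc m) f (suc i) (s≤s m≤i) = coeff-prefix-≥ m (f ∘ suc) i m≤i

    rational-of-annihilator : (∃ λ (a : ℕ → ℤ) → ∃ λ m → (∀ i → m ℕ.< i → a i ≡ + 0) × (∃ λ i → a i ≢ + 0) × (∀ n → m ℕ.< n → (HZ.hurwitz a HZ.∗ z) n ≡ + 0)) →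
      IsRationalSeries (psExp S)
    rational-of-annihilator (a , m , a-large , (i , aᵢ≢0) , vanish) =
      prefix (suc m) (coeff D ⊛ psExp S) , D , (i , λ eq → aᵢ≢0 (fromℤ-injective (a i) (trans (sym (coeff-D i)) eq))) , product
      where
      D : List ℚ
      D = prefix (suc m) (fromℤ ∘ a)
      coeff-D : ∀ i → coeff D i ≡ fromℤ (a i)
      coeff-D i with i ℕₚ.<? suc m
      ... | yes i<m = coeff-prefix-< (suc m) (fromℤ ∘ a) i i<m
      ... | no i≮m  = trans (coeff-prefix-≥ (suc m) (fromℤ ∘ a) i (ℕₚ.≮⇒≥ i≮m)) (cong fromℤ (sym (a-large i (ℕₚ.≮⇒≥ i≮m))))
      product : ∀ n → (coeff D ⊛ psExp S) n ≡ coeff (prefix (suc m) (coeff D ⊛ psExp S)) n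
      product n with n ℕₚ.<? suc m
      ... | yes n<m = sym (coeff-prefix-< (suc m) (coeff D ⊛ psExp S) n n<m)
      ... | no n≮m  = trans (hurwitz-cancel n ((coeff D ⊛ psExp S) n) (trans (sym (hurwitz-constant (coeff D ⊛ psExp S) n))
            (trans (hurwitz-⊛ (coeff D) (psExp S) n) (trans (∗-cong (λ j → trans (hurwitz-cong coeff-D j) (sym (fromℤ-hurwitz j a))) hurwitz-psExp≡z n)
              (trans (sym (fromℤ-∗ n (HZ.hurwitz a) z)) (cong fromℤ (vanish n (ℕₚ.≮⇒≥ n≮m))))))))
          (sym (coeff-prefix-≥ (suc m) (coeff D ⊛ psExp S) n (ℕₚ.≮⇒≥ n≮m)))

-- Finite fields

module FieldFacts {q : ℕ} (K : FiniteField q) where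
  open FiniteField K hiding (zero)
  open import Algebra.Properties.Semiring.Exp semiring using (_^_; ^-congˡ; ^-homo-*; ^-assocʳ)
  open import Relation.Binary.Reasoning.Setoid setoid
  open IntegerSolver commRing using (solve; _:=_; _:+_; _:*_; _:-_; :-_; con)
  open import Data.Fin.Properties using (¬∀⟶∃¬)
  import Data.Nat.DivMod as DM
  open import Data.Fin.Permutation using (Permutation; permutation)

  elems : List Carrier
  elems = List.tabulate enum

  squareRoots : Carrier → List Carrier
  squareRoots z = List.filter (λ y → (y * y) ≈? z) elems

  index : Carrier → Fin q
  index x = proj₁ (enum-surj x)

  enum-index : ∀ x → enum (index x) ≈ x
  enum-index x = proj₂ (enum-surj x)

  permutationOf : (π π′ : Carrier → Carrier) → (∀ {x y} → x ≈ y → π x ≈ π y) → (∀ {x y} → x ≈ y → π′ x ≈ π′ y) →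
    (∀ x → π (π′ x) ≈ x) → (∀ x → π′ (π x) ≈ x) → Permutation q q
  permutationOf π π′ π-cong π′-cong ππ′ π′π = permutation (index ∘ π ∘ enum) (index ∘ π′ ∘ enum)
    (λ i → enum-inj _ _ (trans (enum-index _) (trans (π-cong (enum-index _)) (ππ′ (enum i)))))
    (λ i → enum-inj _ _ (trans (enum-index _) (trans (π′-cong (enum-index _)) (π′π (enum i)))))

  module OverMonoid (M : CommutativeMonoid 0ℓ 0ℓ) where
    private module M = CommutativeMonoid M
    open import Algebra.Properties.CommutativeMonoid.Sum M public using (sum; ∑-permute; ∑-distrib-+; sum-cong-≋)

    sum-substitution : (π π′ : Carrier → Carrier) → (∀ {x y} → x ≈ y → π x ≈ π y) → (∀ {x y} → x ≈ y → π′ x ≈ π′ y) →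
      (∀ x → π (π′ x) ≈ x) → (∀ x → π′ (π x) ≈ x) → (g : Carrier → M.Carrier) → (∀ {x y} → x ≈ y → g x M.≈ g y) →
      sum (λ i → g (π (enum i))) M.≈ sum (λ i → g (enum i))
    sum-substitution π π′ π-cong π′-cong ππ′ π′π g g-cong = M.sym (M.trans
      (∑-permute (λ i → g (enum i)) (permutationOf π π′ π-cong π′-cong ππ′ π′π))
      (sum-cong-≋ {q} (λ i → g-cong (enum-index (π (enum i))))))

    sum-single : ∀ {n} (j : Fin n) (f : Fin n → M.Carrier) → (∀ i → i ≢ j → f i M.≈ M.ε) → sum f M.≈ f j
    sum-single Fin.zero    f h = M.trans (M.∙-congˡ (zeros _ (λ i → h (Fin.suc i) λ ()))) (M.identityʳ _)
      where
      zeros : ∀ {n} (f : Fin n → M.Carrier) → (∀ i → f i M.≈ M.ε) → sum f M.≈ M.ε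
      zeros {zero}  f h = M.refl
      zeros {suc n} f h = M.trans (M.∙-cong (h Fin.zero) (zeros (f ∘ Fin.suc) (h ∘ Fin.suc))) (M.identityˡ _)
    sum-single (Fin.suc j) f h = M.trans (M.∙-congʳ (h Fin.zero λ ())) (M.trans (M.identityˡ _)
      (sum-single j (f ∘ Fin.suc) (λ i i≢j → h (Fin.suc i) (i≢j ∘ suc-injective))))
      where open import Data.Fin.Properties using (suc-injective)

  module OverRing (R : CommutativeRing 0ℓ 0ℓ) where
    private module R = CommutativeRing R
    open ListSum R
    open OverMonoid R.+-commutativeMonoid

    ∑-tabulate : ∀ {n} (f : Fin n → Carrier) (g : Carrier → R.Carrier) → ∑ (List.tabulate f) g R.≈ sum (g ∘ f)
    ∑-tabulate {zero}  f g = R.refl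
    ∑-tabulate {suc n} f g = R.+-congˡ (∑-tabulate (f ∘ Fin.suc) g)

    substitution : (π π′ : Carrier → Carrier) → (∀ {x y} → x ≈ y → π x ≈ π y) → (∀ {x y} → x ≈ y → π′ x ≈ π′ y) →
      (∀ x → π (π′ x) ≈ x) → (∀ x → π′ (π x) ≈ x) → (g : Carrier → R.Carrier) → (∀ {x y} → x ≈ y → g x R.≈ g y) →
      ∑ elems (g ∘ π) R.≈ ∑ elems g
    substitution π π′ π-cong π′-cong ππ′ π′π g g-cong = R.trans (∑-tabulate enum (g ∘ π))
      (R.trans (sum-substitution π π′ π-cong π′-cong ππ′ π′π g g-cong) (R.sym (∑-tabulate enum g)))

    single : ∀ z (g : Carrier → R.Carrier) → (∀ {x y} → x ≈ y → g x R.≈ g y) → (∀ x → ¬ x ≈ z → g x R.≈ R.0#) → ∑ elems g R.≈ g z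
    single z g g-cong h = R.trans (∑-tabulate enum g) (R.trans (sum-single (index z) (g ∘ enum)
        (λ i i≢z → h (enum i) (λ eq → i≢z (enum-inj i (index z) (trans eq (sym (enum-index z)))))))
      (g-cong (enum-index z)))

  open ListSum commRing
  open OverRing commRing

  inv : Carrier → Carrier
  inv x with x ≈? 0#
  ... | yes _  = 0#
  ... | no x≉0 = proj₁ (inverse x x≉0)

  inv-0 : ∀ {x} → x ≈ 0# → inv x ≈ 0#
  inv-0 {x} x≈0 with x ≈? 0#
  ... | yes _  = refl
  ... | no x≉0 = ⊥-elim (x≉0 x≈0)

  inv-inverse : ∀ {x} → ¬ x ≈ 0# → x * inv x ≈ 1#
  inv-inverse {x} x≉0 with x ≈? 0#
  ... | yes x≈0 = ⊥-elim (x≉0 x≈0)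
  ... | no x≉0′ = proj₂ (inverse x x≉0′)

  cancelˡ : ∀ {x y z} → ¬ x ≈ 0# → x * y ≈ x * z → y ≈ z
  cancelˡ {x} {y} {z} x≉0 eq = begin
    y                ≈⟨ *-identityˡ y ⟨
    1# * y           ≈⟨ *-congʳ (inv-inverse x≉0) ⟨
    x * inv x * y    ≈⟨ solve 3 (λ x i y → x :* i :* y := i :* (x :* y)) refl x (inv x) y ⟩
    inv x * (x * y)  ≈⟨ *-congˡ eq ⟩
    inv x * (x * z)  ≈⟨ solve 3 (λ x i y → i :* (x :* y) := x :* i :* y) refl x (inv x) z ⟩
    x * inv x * z    ≈⟨ *-congʳ (inv-inverse x≉0) ⟩
    1# * z           ≈⟨ *-identityˡ z ⟩
    z                ∎

  inv-cong : ∀ {x y} → x ≈ y → inv x ≈ inv y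
  inv-cong {x} {y} x≈y with x ≈? 0#
  ... | yes x≈0 = sym (inv-0 (trans (sym x≈y) x≈0))
  ... | no x≉0  = cancelˡ x≉0 (trans (proj₂ (inverse x x≉0)) (sym (trans (*-congʳ x≈y) (inv-inverse (x≉0 ∘ trans x≈y)))))

  integral : ∀ {x y} → x * y ≈ 0# → x ≈ 0# ⊎ y ≈ 0#
  integral {x} {y} xy≈0 with x ≈? 0#
  ... | yes x≈0 = inj₁ x≈0
  ... | no x≉0  = inj₂ (cancelˡ x≉0 (trans xy≈0 (sym (zeroʳ x))))

  *-nonzero : ∀ {x y} → ¬ x ≈ 0# → ¬ y ≈ 0# → ¬ x * y ≈ 0#
  *-nonzero x≉0 y≉0 xy≈0 with integral xy≈0
  ... | inj₁ x≈0 = x≉0 x≈0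
  ... | inj₂ y≈0 = y≉0 y≈0

  ^-zero : ∀ {x} n → x ^ n ≈ 0# → x ≈ 0#
  ^-zero zero    1≈0 = ⊥-elim (1≉0 1≈0)
  ^-zero (suc n) eq with integral eq
  ... | inj₁ x≈0 = x≈0
  ... | inj₂ x^≈0 = ^-zero n x^≈0

  0^suc : ∀ {x} n → x ≈ 0# → x ^ suc n ≈ 0#
  0^suc n x≈0 = trans (*-congʳ x≈0) (zeroˡ _)

  1^ : ∀ n → 1# ^ n ≈ 1#
  1^ zero    = refl
  1^ (suc n) = trans (*-identityˡ _) (1^ n)

  sub≈0 : ∀ {x y} → x - y ≈ 0# → x ≈ y
  sub≈0 {x} {y} eq = trans (solve 2 (λ x y → x := (x :- y) :+ y) refl x y) (trans (+-congʳ eq) (+-identityˡ y))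

  module Multiplicative = OverMonoid *-commutativeMonoid

  private
    unlessZero : Carrier → Carrier → Carrier → Carrier
    unlessZero z a y with y ≈? 0#
    ... | yes _ = z
    ... | no _  = a

    unlessZero-0 : ∀ z a {y} → y ≈ 0# → unlessZero z a y ≈ z
    unlessZero-0 z a {y} y≈0 with y ≈? 0#
    ... | yes _  = refl
    ... | no y≉0 = ⊥-elim (y≉0 y≈0)

    unlessZero-≉ : ∀ z a {y} → ¬ y ≈ 0# → unlessZero z a y ≈ a
    unlessZero-≉ z a {y} y≉0 with y ≈? 0#
    ... | yes y≈0 = ⊥-elim (y≉0 y≈0)
    ... | no _    = refl

  -- Compare the products of all nonzero y and of all nonzero x y.
  fermat : ∀ x → x ^ q ≈ x
  fermat x with x ≈? 0#
  ... | yes x≈0 = trans (zero-case q (index x)) (sym x≈0)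
    where
    zero-case : ∀ n → Fin n → x ^ n ≈ 0#
    zero-case (suc n) _ = 0^suc n x≈0
  ... | no x≉0 = begin
    x ^ q                            ≈⟨ constant q ⟨
    prod (λ (i : Fin q) → x)         ≈⟨ sum-cong-≋ (λ i → split (enum i)) ⟩
    prod (λ i → h (enum i) * h′ (enum i)) ≈⟨ ∑-distrib-+ (λ i → h (enum i)) (λ i → h′ (enum i)) ⟩
    prod (λ i → h (enum i)) * prod (λ i → h′ (enum i))
      ≈⟨ *-cong h-product h′-product ⟩
    1# * x                           ≈⟨ *-identityˡ x ⟩
    x                                ∎
    where
    open Multiplicative using (sum-cong-≋; ∑-distrib-+; sum-substitution) renaming (sum to prod; sum-single to prod-single)
    h h′ g : Carrier → Carrier
    h  = unlessZero 1# x
    h′ = unlessZero x 1#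
    g y = unlessZero 1# y y
    constant : ∀ n → prod (λ (i : Fin n) → x) ≈ x ^ n
    constant zero    = refl
    constant (suc n) = *-congˡ (constant n)
    split : ∀ y → x ≈ h y * h′ y
    split y with y ≈? 0#
    ... | yes _ = sym (*-identityˡ x)
    ... | no _  = sym (*-identityʳ x)
    g-nonzero : ∀ y → ¬ g y ≈ 0#
    g-nonzero y with y ≈? 0#
    ... | yes _  = 1≉0
    ... | no y≉0 = y≉0
    g-cong : ∀ {y z} → y ≈ z → g y ≈ g z
    g-cong {y} {z} y≈z with y ≈? 0#
    ... | yes y≈0 = sym (unlessZero-0 1# z (trans (sym y≈z) y≈0))
    ... | no y≉0  = trans y≈z (sym (unlessZero-≉ 1# z (y≉0 ∘ trans y≈z)))
    prod-nonzero : ∀ {n} (f : Fin n → Carrier) → (∀ i → ¬ f i ≈ 0#) → ¬ prod f ≈ 0#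
    prod-nonzero {zero}  f f≉0 = 1≉0
    prod-nonzero {suc n} f f≉0 = *-nonzero (f≉0 Fin.zero) (prod-nonzero (f ∘ Fin.suc) (f≉0 ∘ Fin.suc))
    scaled : ∀ y → g (x * y) ≈ g y * h y
    scaled y with y ≈? 0#
    ... | yes y≈0 = trans (unlessZero-0 1# (x * y) (trans (*-congˡ y≈0) (zeroʳ x))) (sym (*-identityˡ 1#))
    ... | no y≉0  = trans (unlessZero-≉ 1# (x * y) (*-nonzero x≉0 y≉0)) (*-comm x y)
    inv-left : ∀ y → inv x * (x * y) ≈ y
    inv-left y = trans (solve 3 (λ i x y → i :* (x :* y) := x :* i :* y) refl (inv x) x y) (trans (*-congʳ (inv-inverse x≉0)) (*-identityˡ y))
    inv-right : ∀ y → x * (inv x * y) ≈ y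
    inv-right y = trans (sym (*-assoc x (inv x) y)) (trans (*-congʳ (inv-inverse x≉0)) (*-identityˡ y))
    G : Carrier
    G = prod (λ i → g (enum i))
    h-product : prod (λ i → h (enum i)) ≈ 1#
    h-product = cancelˡ (prod-nonzero (λ i → g (enum i)) (λ i → g-nonzero (enum i))) (begin
      G * prod (λ i → h (enum i))          ≈⟨ ∑-distrib-+ (λ i → g (enum i)) (λ i → h (enum i)) ⟨
      prod (λ i → g (enum i) * h (enum i)) ≈⟨ sum-cong-≋ (λ i → scaled (enum i)) ⟨
      prod (λ i → g (x * enum i))          ≈⟨ sum-substitution (x *_) (inv x *_) *-congˡ *-congˡ inv-right inv-left g g-cong ⟩
      G                                    ≈⟨ *-identityʳ G ⟨
      G * 1#                               ∎)
    h′-product : prod (λ i → h′ (enum i)) ≈ x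
    h′-product = trans (prod-single (index 0#) (λ i → h′ (enum i))
        (λ i i≢0 → unlessZero-≉ x 1# (λ eq → i≢0 (enum-inj i (index 0#) (trans eq (sym (enum-index 0#)))))))
      (unlessZero-0 x 1# (enum-index 0#))

  ι : ℕ → Carrier
  ι = ℕ→K K

  ι-+ : ∀ m n → ι (m ℕ.+ n) ≈ ι m + ι n
  ι-+ zero    n = sym (+-identityˡ (ι n))
  ι-+ (suc m) n = trans (+-congˡ (ι-+ m n)) (sym (+-assoc 1# (ι m) (ι n)))

  ι-* : ∀ m n → ι (m ℕ.* n) ≈ ι m * ι n
  ι-* zero    n = sym (zeroˡ (ι n))
  ι-* (suc m) n = trans (ι-+ n (m ℕ.* n)) (trans (+-cong (sym (*-identityˡ (ι n))) (ι-* m n)) (sym (distribʳ (ι n) 1# (ι m))))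

  ι-^ : ∀ m n → ι (m ℕ.^ n) ≈ ι m ^ n
  ι-^ m zero    = +-identityʳ 1#
  ι-^ m (suc n) = trans (ι-* m (m ℕ.^ n)) (*-congˡ (ι-^ m n))

  open import Algebra.Properties.Semiring.Mult semiring using () renaming (_×_ to _·_)

  ·-ι : ∀ n x → n · x ≈ ι n * x
  ·-ι zero    x = sym (zeroˡ x)
  ·-ι (suc n) x = trans (+-cong (sym (*-identityˡ x)) (·-ι n x)) (sym (distribʳ x 1# (ι n)))

  private
    ∑-1 : ∀ {n} (f : Fin n → Carrier) → ∑ (List.tabulate f) (λ _ → 1#) ≈ ι n
    ∑-1 {zero}  f = refl
    ∑-1 {suc n} f = +-congˡ (∑-1 (f ∘ Fin.suc))

  -- Translation by 1 permutes the field, so the sums of y and of y + 1 agree, and their difference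
  -- is q · 1.
  ι-q : ι q ≈ 0#
  ι-q = begin
    ι q                                  ≈⟨ ∑-1 enum ⟨
    ∑ elems (λ _ → 1#)                   ≈⟨ solve 2 (λ s t → t := (s :+ t) :- s) refl (∑ elems id) _ ⟩
    ∑ elems id + ∑ elems (λ _ → 1#) - ∑ elems id ≈⟨ +-congʳ (∑-+ elems id (λ _ → 1#)) ⟨
    ∑ elems (λ y → y + 1#) - ∑ elems id
      ≈⟨ +-congʳ (substitution (_+ 1#) (_- 1#) +-congʳ +-congʳ
           (λ x → solve 1 (λ x → x :- con (+ 1) :+ con (+ 1) := x) refl x) (λ x → solve 1 (λ x → x :+ con (+ 1) :- con (+ 1) := x) refl x) id id) ⟩
    ∑ elems id - ∑ elems id              ≈⟨ -‿inverseʳ _ ⟩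
    0#                                   ∎

  -- The value at x of the monic polynomial with the given lower coefficients, constant term first.
  monic : List Carrier → Carrier → Carrier
  monic []       x = 1#
  monic (c ∷ cs) x = c + x * monic cs x

  private
    deflate : Carrier → List Carrier → List Carrier
    deflate a []            = []
    deflate a (c ∷ [])      = []
    deflate a (c ∷ c′ ∷ cs) = monic (c′ ∷ cs) a ∷ deflate a (c′ ∷ cs)

    deflate-length : ∀ a c cs → length (deflate a (c ∷ cs)) ≡ length cs
    deflate-length a c []        = ≡.refl
    deflate-length a c (c′ ∷ cs) = ≡.cong suc (deflate-length a c′ cs)

    deflate-factor : ∀ a c cs x → monic (c ∷ cs) x ≈ monic (c ∷ cs) a + (x - a) * monic (deflate a (c ∷ cs)) x
    deflate-factor a c [] x = solve 3 (λ a c x → c :+ x :* con (+ 1) := c :+ a :* con (+ 1) :+ (x :- a) :* con (+ 1)) refl a c x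
    deflate-factor a c (c′ ∷ cs) x = begin
      c + x * monic (c′ ∷ cs) x
        ≈⟨ +-congˡ (*-congˡ (deflate-factor a c′ cs x)) ⟩
      c + x * (m + (x - a) * n)
        ≈⟨ solve 5 (λ a c x m n → c :+ x :* (m :+ (x :- a) :* n) := c :+ a :* m :+ (x :- a) :* (m :+ x :* n)) refl a c x m n ⟩
      c + a * m + (x - a) * (m + x * n) ∎
      where
      m n : Carrier
      m = monic (c′ ∷ cs) a
      n = monic (deflate a (c′ ∷ cs)) x

  open import Data.List.Relation.Unary.AllPairs using (AllPairs; []; _∷_)

  Distinct : List Carrier → Set
  Distinct = AllPairs (λ x y → ¬ x ≈ y)

  roots≤degree : ∀ cs xs → Distinct xs → All (λ x → monic cs x ≈ 0#) xs → length xs ℕ.≤ length cs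
  roots≤degree cs       []       _          _         = z≤n
  roots≤degree []       (x ∷ xs) _          (eq ∷ _)  = ⊥-elim (1≉0 eq)
  roots≤degree (c ∷ cs) (x ∷ xs) (x∉ ∷ dis) (eq ∷ eqs) = s≤s (≡.subst (length xs ℕ.≤_) (deflate-length x c cs)
    (roots≤degree (deflate x (c ∷ cs)) xs dis (All.map root (All.zip (x∉ , eqs)))))
    where
    root : ∀ {y} → (¬ x ≈ y) × (monic (c ∷ cs) y ≈ 0#) → monic (deflate x (c ∷ cs)) y ≈ 0#
    root {y} (x≉y , eqy) with integral (trans (sym (trans (deflate-factor x c cs y) (trans (+-congʳ eq) (+-identityˡ _)))) eqy)
    ... | inj₁ y-x≈0 = ⊥-elim (x≉y (sym (sub≈0 y-x≈0)))
    ... | inj₂ z     = z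

  -- The polynomial X ^ (j + 2) − X.
  artinSchreier : ℕ → List Carrier
  artinSchreier j = 0# ∷ - 1# ∷ List.replicate j 0#

  artinSchreier-value : ∀ j x → monic (artinSchreier j) x ≈ x ^ suc (suc j) - x
  artinSchreier-value j x = trans (+-congˡ (*-congˡ (+-congˡ (*-congˡ (go j)))))
    (solve 2 (λ x y → con (+ 0) :+ x :* (:- con (+ 1) :+ x :* y) := x :* (x :* y) :- x) refl x (x ^ j))
    where
    go : ∀ j → monic (List.replicate j 0#) x ≈ x ^ j
    go zero    = refl
    go (suc j) = trans (+-identityˡ _) (*-congˡ (go j))

  fixed-points≤ : ∀ j xs → Distinct xs → All (λ x → x ^ suc (suc j) ≈ x) xs → length xs ℕ.≤ suc (suc j)
  fixed-points≤ j xs dis fixed = ≡.subst (length xs ℕ.≤_) (≡.cong (λ n → suc (suc n)) (length-replicate j))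
    (roots≤degree (artinSchreier j) xs dis (All.map (λ {x} eq → trans (artinSchreier-value j x) (trans (+-congʳ eq) (-‿inverseʳ x))) fixed))
    where open import Data.List.Properties using (length-replicate)

  elems-distinct : Distinct elems
  elems-distinct = go enum (λ i j i≢j eq → i≢j (enum-inj i j eq))
    where
    open import Data.Fin.Properties using (suc-injective)
    import Data.List.Relation.Unary.All.Properties as AllP
    go : ∀ {n} (f : Fin n → Carrier) → (∀ i j → i ≢ j → ¬ f i ≈ f j) → Distinct (List.tabulate f)
    go {zero}  f h = []
    go {suc n} f h = AllP.tabulate⁺ (λ i → h Fin.zero (Fin.suc i) (λ ())) ∷ go (f ∘ Fin.suc) (λ i j i≢j → h (Fin.suc i) (Fin.suc j) (i≢j ∘ suc-injective))

  non-fixed : ∀ j → suc (suc j) ℕ.< q → ∃ λ x → ¬ x ^ suc (suc j) ≈ x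
  non-fixed j j<q with ¬∀⟶∃¬ q (λ i → enum i ^ suc (suc j) ≈ enum i) (λ i → (enum i ^ suc (suc j)) ≈? enum i)
      (λ fixed → ℕₚ.<⇒≱ j<q (≡.subst (ℕ._≤ suc (suc j)) (length-tabulate enum)
        (fixed-points≤ j elems elems-distinct (tabulate⁺ fixed))))
    where
    open import Data.List.Properties using (length-tabulate)
    open import Data.List.Relation.Unary.All.Properties using (tabulate⁺)
  ... | i , ne = enum i , ne

  ^-div : ∀ {x} m k → ¬ x ≈ 0# → suc m ≡ q → x ^ (k ℕ.* m) ≈ 1#
  ^-div {x} m k x≉0 ≡.refl = trans (reflexive (≡.cong (x ^_) (ℕₚ.*-comm k m))) (trans (sym (^-assocʳ x m k)) (trans (^-congˡ k x^m) (1^ k)))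
    where
    x^m : x ^ m ≈ 1#
    x^m = cancelˡ x≉0 (trans (fermat x) (sym (*-identityʳ x)))

  -- Replaces a generator of the multiplicative group. If j is the remainder of u modulo m = q - 1,
  -- then X ^ (j + 1) - X has fewer than q roots, and any non-root g satisfies g ^ u = g ^ j ≠ 1.
  nontrivial-power : ∀ m u → suc m ≡ q → ¬ m ℕD.∣ u → ∃ λ g → ¬ g ≈ 0# × ¬ g ^ u ≈ 1#
  nontrivial-power zero u eq m∤u with 0# ≈? 1#
  ... | yes 0≈1 = ⊥-elim (1≉0 (sym 0≈1))
  ... | no 0≉1 = ⊥-elim (0≉1 (trans (sym (enum-index 0#)) (trans (reflexive (≡.cong enum (only eq (index 0#) (index 1#)))) (enum-index 1#))))
    where
    only : 1 ≡ q → (i j : Fin q) → i ≡ j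
    only ≡.refl Fin.zero Fin.zero = ≡.refl
  nontrivial-power m@(suc m′) u eq m∤u with u ℕ.% m in rem | DM.m%n<n u m | DM.m≡m%n+[m/n]*n u m
  ... | zero  | _   | _ = ⊥-elim (m∤u (ℕD.m%n≡0⇒n∣m u m rem))
  ... | suc j | j<m | u≡ with non-fixed j (≡.subst (suc (suc j) ℕ.<_) eq (s≤s j<m))
  ...   | g , ne = g , (λ g≈0 → ne (trans (0^suc (suc j) g≈0) (sym g≈0))) , λ g^u≈1 → ne (trans (*-congˡ (begin
      g ^ suc j                        ≈⟨ *-identityʳ _ ⟨
      g ^ suc j * 1#                   ≈⟨ *-congˡ (^-div m (u ℕ./ m) (λ g≈0 → ne (trans (0^suc (suc j) g≈0) (sym g≈0))) eq) ⟨
      g ^ suc j * g ^ (u ℕ./ m ℕ.* m)  ≈⟨ ^-homo-* g (suc j) (u ℕ./ m ℕ.* m) ⟨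
      g ^ (suc j ℕ.+ u ℕ./ m ℕ.* m)    ≈⟨ reflexive (≡.cong (g ^_) u≡) ⟨
      g ^ u                            ≈⟨ g^u≈1 ⟩
      1#                               ∎)) (*-identityʳ g))

module PowerSums {q : ℕ} (K : FiniteField q) (m : ℕ) (q≡ : suc m ≡ q) where
  open FiniteField K hiding (zero)
  open FieldFacts K
  open OverRing commRing
  open ListSum commRing
  open import Algebra.Properties.CommutativeSemiring.Exp commutativeSemiring using (^-distrib-*)
  open import Algebra.Properties.Semiring.Exp semiring using (_^_; ^-congˡ)
  open import Relation.Binary.Reasoning.Setoid setoid
  open IntegerSolver commRing using (solve; _:=_; _:+_; _:*_; _:-_; :-_; con)

  multiplicative-substitution : ∀ (R : CommutativeRing 0ℓ 0ℓ) {g} → ¬ g ≈ 0# → (h : Carrier → CommutativeRing.Carrier R) →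
    (∀ {x y} → x ≈ y → CommutativeRing._≈_ R (h x) (h y)) →
    CommutativeRing._≈_ R (ListSum.∑ R elems (h ∘ (g *_))) (ListSum.∑ R elems h)
  multiplicative-substitution R {g} g≉0 h h-cong = OverRing.substitution R (g *_) (inv g *_) *-congˡ *-congˡ
    (λ y → trans (sym (*-assoc g (inv g) y)) (trans (*-congʳ (inv-inverse g≉0)) (*-identityˡ y)))
    (λ y → trans (solve 3 (λ i x y → i :* (x :* y) := x :* i :* y) refl (inv g) g y) (trans (*-congʳ (inv-inverse g≉0)) (*-identityˡ y)))
    h h-cong

  powerSum : ℕ → Carrier
  powerSum u = ∑ elems (λ x → x ^ u)

  -- Multiplication by g permutes the field, so the sum is fixed by the factor g ^ u; choose g with
  -- g ^ u ≠ 1.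
  powerSum-nontrivial : ∀ u → ¬ m ℕD.∣ u → powerSum u ≈ 0#
  powerSum-nontrivial u m∤u with nontrivial-power m u q≡ m∤u
  ... | g , g≉0 , g^u≉1 with integral {g ^ u - 1#} {powerSum u} (begin
      (g ^ u - 1#) * powerSum u          ≈⟨ solve 2 (λ a s → (a :- con (+ 1)) :* s := a :* s :- s) refl (g ^ u) (powerSum u) ⟩
      g ^ u * powerSum u - powerSum u    ≈⟨ +-congʳ (trans (sym (∑-*ˡ elems (g ^ u) (_^ u))) (trans (∑-cong elems (λ x → sym (^-distrib-* g x u)))
                                              (multiplicative-substitution commRing g≉0 (_^ u) (^-congˡ u)))) ⟩
      powerSum u - powerSum u            ≈⟨ -‿inverseʳ _ ⟩
      0#                                 ∎)
  ...   | inj₁ eq = ⊥-elim (g^u≉1 (sub≈0 eq))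
  ...   | inj₂ eq = eq

  private
    ∑-one : ∑ elems (λ _ → 1#) ≈ 0#
    ∑-one = trans (go enum) ι-q
      where
      go : ∀ {n} (f : Fin n → Carrier) → ∑ (List.tabulate f) (λ _ → 1#) ≈ ι n
      go {zero}  f = refl
      go {suc n} f = +-congˡ (go (f ∘ Fin.suc))

  powerSum-0 : powerSum 0 ≈ 0#
  powerSum-0 = ∑-one

  powerSum-full : ∀ k → 0 ℕ.< k ℕ.* m → powerSum (k ℕ.* m) ≈ - 1#
  powerSum-full k 0<km = begin
    ∑ elems (λ x → x ^ u)                       ≈⟨ ∑-cong elems (λ x → solve 1 (λ a → a := (a :- con (+ 1)) :+ con (+ 1)) refl (x ^ u)) ⟩
    ∑ elems (λ x → (x ^ u - 1#) + 1#)           ≈⟨ ∑-+ elems (λ x → x ^ u - 1#) (λ _ → 1#) ⟩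
    ∑ elems (λ x → x ^ u - 1#) + ∑ elems (λ _ → 1#)
      ≈⟨ +-cong (single 0# (λ x → x ^ u - 1#) (λ eq → +-congʳ (^-congˡ u eq))
           (λ x x≉0 → trans (+-congʳ (^-div m k x≉0 q≡)) (-‿inverseʳ 1#))) ∑-one ⟩
    (0# ^ u - 1#) + 0#                          ≈⟨ +-congʳ (+-congʳ (0^ u 0<km)) ⟩
    (0# - 1#) + 0#                              ≈⟨ solve 0 ((con (+ 0) :- con (+ 1)) :+ con (+ 0) := :- con (+ 1)) refl ⟩
    - 1#                                        ∎
    where
    u : ℕ
    u = k ℕ.* m
    0^ : ∀ u → 0 ℕ.< u → 0# ^ u ≈ 0#
    0^ (suc u) _ = zeroˡ _

module GeometricSum (R : CommutativeRing 0ℓ 0ℓ) where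
  open CommutativeRing R hiding (zero)
  open import Algebra.Properties.Semiring.Exp semiring using (_^_; ^-congˡ)
  open import Algebra.Properties.Semiring.Mult semiring using (×-comm-*) renaming (_×_ to _·_)
  open import Relation.Binary.Reasoning.Setoid setoid
  open IntegerSolver R using (solve; _:=_; _:+_; _:*_; _:-_; :-_)

  -- (u ^ n − z ^ n) / (u − z).
  geometric : ℕ → Carrier → Carrier → Carrier
  geometric zero    u z = 0#
  geometric (suc n) u z = z * geometric n u z + u ^ n

  geometric-difference : ∀ n u z → (u - z) * geometric n u z ≈ u ^ n - z ^ n
  geometric-difference zero    u z = trans (zeroʳ _) (sym (-‿inverseʳ 1#))
  geometric-difference (suc n) u z = begin
    (u - z) * (z * geometric n u z + u ^ n)
      ≈⟨ solve 4 (λ u z g x → (u :- z) :* (z :* g :+ x) := z :* ((u :- z) :* g) :+ (u :- z) :* x) refl u z (geometric n u z) (u ^ n) ⟩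
    z * ((u - z) * geometric n u z) + (u - z) * u ^ n
      ≈⟨ +-congʳ (*-congˡ (geometric-difference n u z)) ⟩
    z * (u ^ n - z ^ n) + (u - z) * u ^ n
      ≈⟨ solve 4 (λ u z x y → z :* (x :- y) :+ (u :- z) :* x := u :* x :- z :* y) refl u z (u ^ n) (z ^ n) ⟩
    u * u ^ n - z * z ^ n ∎

  geometric-diagonal : ∀ n {u z} → u ≈ z → geometric (suc n) u z ≈ suc n · (z ^ n)
  geometric-diagonal zero    {u} {z} u≈z = trans (+-congʳ (zeroʳ z)) (+-comm 0# 1#)
  geometric-diagonal (suc n) {u} {z} u≈z = begin
    z * geometric (suc n) u z + u ^ suc n   ≈⟨ +-cong (*-congˡ (geometric-diagonal n u≈z)) (^-congˡ (suc n) u≈z) ⟩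
    z * (suc n · (z ^ n)) + z ^ suc n       ≈⟨ +-congʳ (×-comm-* (suc n) z (z ^ n)) ⟩
    suc n · (z ^ suc n) + z ^ suc n         ≈⟨ +-comm _ _ ⟩
    suc (suc n) · (z ^ suc n)               ∎

module QuadraticCharacter {q : ℕ} (K : FiniteField q) (E′ : ℕ) (q≡ : suc (suc E′ ℕ.+ suc E′) ≡ q) where
  open FiniteField K hiding (zero)
  open FieldFacts K
  open ListSum commRing
  private
    E m : ℕ
    E = suc E′
    m = E ℕ.+ E
  open PowerSums K m q≡
  open import Algebra.Properties.Semiring.Exp semiring using (_^_)
  open import Relation.Binary.Reasoning.Setoid setoid
  open IntegerSolver commRing using (solve; _:=_; _:+_; _:*_; _:-_; :-_; con)

  open GeometricSum commRing

  private
    -- The quotient (u ^ q - z ^ q) / (u - z) is 1 for u ≠ z because x ^ q = x, and it is q z ^ (q -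
    -- 1) = 0 for u = z.
    indicator : ∀ u z → ι (if does (u ≈? z) then 1 else 0) ≈ 1# - geometric q u z
    indicator u z with u ≈? z
    ... | no u≉z = sym (trans (+-congˡ (-‿cong (cancelˡ (λ eq → u≉z (sub≈0 eq)) (begin
            (u - z) * geometric q u z   ≈⟨ geometric-difference q u z ⟩
            u ^ q - z ^ q               ≈⟨ +-cong (fermat u) (-‿cong (fermat z)) ⟩
            u - z                       ≈⟨ *-identityʳ _ ⟨
            (u - z) * 1#                ∎)))) (-‿inverseʳ 1#))
    ... | yes u≈z = +-congˡ (trans (solve 0 (con (+ 0) := :- con (+ 0)) refl) (-‿cong (sym
            (≡.subst (λ n → geometric n u z ≈ 0#) q≡ (trans (geometric-diagonal m u≈z) (trans (·-ι (suc m) (z ^ m))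
              (trans (*-congʳ (trans (reflexive (≡.cong ι q≡)) ι-q)) (zeroˡ _))))))))

    S : ℕ → Carrier → Carrier
    S n z = ∑ elems (λ y → geometric n (y * y) z)

    square-^ : ∀ y n → (y * y) ^ n ≈ y ^ (n ℕ.+ n)
    square-^ y zero    = refl
    square-^ y (suc n) = trans (*-congˡ (square-^ y n)) (trans (*-assoc y y _) (reflexive (≡.cong (λ k → y * y ^ k) (≡.sym (ℕₚ.+-suc n n)))))

    S-suc : ∀ n z → S (suc n) z ≈ z * S n z + powerSum (n ℕ.+ n)
    S-suc n z = trans (∑-+ elems (λ y → z * geometric n (y * y) z) (λ y → (y * y) ^ n))
      (+-cong (∑-*ˡ elems z (λ y → geometric n (y * y) z)) (∑-cong elems (λ y → square-^ y n)))

    half-div : ∀ n → m ℕD.∣ n ℕ.+ n → E ℕD.∣ n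
    half-div n (ℕD.divides k eq) = ℕD.divides k (ℕₚ.*-cancelˡ-≡ n (k ℕ.* E) 2 (≡.trans (≡.cong (n ℕ.+_) (ℕₚ.+-identityʳ n))
        (≡.trans eq (lemma k E))))
      where
      open import Data.Nat.Tactic.RingSolver using (solve-∀)
      lemma : ∀ k E → k ℕ.* (E ℕ.+ E) ≡ 2 ℕ.* (k ℕ.* E)
      lemma = solve-∀

    S-small : ∀ n z → n ℕ.≤ E → S n z ≈ 0#
    S-small zero    z n≤E = ∑-zero elems (λ _ → refl)
    S-small (suc n) z n<E = trans (S-suc n z) (trans (+-cong (trans (*-congˡ (S-small n z (ℕₚ.<⇒≤ n<E))) (zeroʳ z)) (vanish n n<E)) (+-identityˡ 0#))
      where
      vanish : ∀ n → n ℕ.< E → powerSum (n ℕ.+ n) ≈ 0#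
      vanish zero    _   = powerSum-0
      vanish (suc n) n<E = powerSum-nontrivial _ (λ m∣ → ℕₚ.<⇒≱ n<E (ℕD.∣⇒≤ (half-div (suc n) m∣)))

    S-middle : ∀ j z → j ℕ.< E → S (suc (j ℕ.+ E)) z ≈ - (z ^ j)
    S-middle zero z j<E = trans (S-suc E z) (trans (+-cong (trans (*-congˡ (S-small E z ℕₚ.≤-refl)) (zeroʳ z))
      (trans (reflexive (≡.cong powerSum (≡.sym (ℕₚ.*-identityˡ m)))) (powerSum-full 1 (s≤s z≤n)))) (+-identityˡ _))
    S-middle (suc j) z j<E = trans (S-suc (suc j ℕ.+ E) z) (trans (+-cong (*-congˡ (S-middle j z (ℕₚ.<⇒≤ j<E)))
      (powerSum-nontrivial _ (λ m∣ → ℕₚ.<⇒≱ j<E (ℕD.∣⇒≤ (ℕD.∣m+n∣m⇒∣n (≡.subst (E ℕD.∣_) (ℕₚ.+-comm (suc j) E) (half-div (suc j ℕ.+ E) m∣)) ℕD.∣-refl)))))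
      (solve 2 (λ z x → z :* (:- x) :+ con (+ 0) := :- (z :* x)) refl z (z ^ j)))

    -- In the recursion S (n + 1) = z S n + ∑ y ^ (2 n) the power sum is -1 for n = E and n = 2 E
    -- and zero for the other n up to 2 E. The first -1 is then multiplied by z another E times, the
    -- second arrives at the last step.
    S-full : ∀ z → S q z ≈ - (1# + z ^ E)
    S-full z = ≡.subst (λ n → S n z ≈ - (1# + z ^ E)) q≡ (trans (S-suc m z) (trans
      (+-cong (*-congˡ (S-middle E′ z ℕₚ.≤-refl)) (trans (reflexive (≡.cong powerSum (≡.cong (m ℕ.+_) (≡.sym (ℕₚ.+-identityʳ m))))) (powerSum-full 2 (s≤s z≤n))))
      (solve 2 (λ z x → z :* (:- x) :+ (:- con (+ 1)) := :- (con (+ 1) :+ z :* x)) refl z (z ^ E′))))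

  -- Euler's criterion, read as a count modulo p. With at most two roots, the number of roots minus
  -- 1 lies in -1, 0, 1 and lifts z ^ E to an integer.
  ι-squareRoots : ∀ z → ι (length (squareRoots z)) ≈ 1# + z ^ E
  ι-squareRoots z = begin
    ι (length (squareRoots z))                                              ≈⟨ counted elems ⟩
    ∑ elems (λ y → ι (if does ((y * y) ≈? z) then 1 else 0))          ≈⟨ ∑-cong elems (λ y → indicator (y * y) z) ⟩
    ∑ elems (λ y → 1# - geometric q (y * y) z)                        ≈⟨ ∑-- elems (λ _ → 1#) (λ y → geometric q (y * y) z) ⟩
    powerSum 0 - S q z                                                ≈⟨ +-cong powerSum-0 (-‿cong (S-full z)) ⟩
    0# - - (1# + z ^ E)                                               ≈⟨ solve 1 (λ x → con (+ 0) :- (:- x) := x) refl _ ⟩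
    1# + z ^ E                                                        ∎
    where
    counted : ∀ ys → ι (length (List.filter (λ y → (y * y) ≈? z) ys)) ≈ ∑ ys (λ y → ι (if does ((y * y) ≈? z) then 1 else 0))
    counted []       = refl
    counted (y ∷ ys) with does ((y * y) ≈? z)
    ... | true  = +-cong (sym (+-identityʳ 1#)) (counted ys)
    ... | false = trans (counted ys) (sym (+-identityˡ _))

  squareRoots≤2 : ∀ z → length (squareRoots z) ℕ.≤ 2
  squareRoots≤2 z = roots≤degree (- z ∷ 0# ∷ []) (squareRoots z) (AP.filter⁺ (λ y → (y * y) ≈? z) elems-distinct)
    (All.map (λ {y} eq → trans (solve 2 (λ y z → :- z :+ y :* (con (+ 0) :+ y :* con (+ 1)) := y :* y :- z) refl y z) (trans (+-congʳ eq) (-‿inverseʳ z)))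
      (AllP.all-filter (λ y → (y * y) ≈? z) elems))
    where
    import Data.List.Relation.Unary.AllPairs.Properties as AP
    import Data.List.Relation.Unary.All.Properties as AllP

module CharacteristicP {q : ℕ} (K : FiniteField q) (m : ℕ) (pp : Prime (suc m)) (r : ℕ) (q≡ : q ≡ suc m ℕ.^ suc r) where
  open FiniteField K hiding (zero)
  open FieldFacts K
  open ListSum commRing
  open FreshmanDream commRing m (PrimeCoefficients.coefficient pp) (PrimeCoefficients.coefficient-eq pp) using (freshman)
  open import Algebra.Properties.Semiring.Exp semiring using (_^_; ^-congˡ; ^-congʳ; ^-assocʳ)
  open import Relation.Binary.Reasoning.Setoid setoid
  open IntegerSolver commRing using (solve; _:=_; _:+_; _:*_; _:-_; :-_; con; fromℤ)
  open import Algebra.Properties.Semiring.Mult.TCOptimised semiring using (1+×)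
  open import Algebra.Properties.Ring (CommutativeRing.ring commRing) using (-0#≈0#; -‿involutive; -‿distribˡ-*)

  p : ℕ
  p = suc m

  ι-p : ι p ≈ 0#
  ι-p = ^-zero (suc r) (trans (sym (ι-^ p (suc r))) (trans (reflexive (≡.cong ι (≡.sym q≡))) ι-q))

  fromℤ-pos : ∀ n → fromℤ (+ n) ≈ ι n
  fromℤ-pos zero    = refl
  fromℤ-pos (suc n) = trans (1+× n 1#) (+-congˡ (fromℤ-pos n))

  fromℤ-p : fromℤ (+ p) ≈ 0#
  fromℤ-p = trans (fromℤ-pos p) ι-p

  frobenius-+ : ∀ x y → (x + y) ^ p ≈ x ^ p + y ^ p
  frobenius-+ x y = trans (freshman x y) (trans (+-congˡ (trans (·-ι p _) (trans (*-congʳ ι-p) (zeroˡ _)))) (+-identityʳ _))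

  iterate-+ : ∀ j x y → (x + y) ^ (p ℕ.^ j) ≈ x ^ (p ℕ.^ j) + y ^ (p ℕ.^ j)
  iterate-+ zero    x y = solve 2 (λ x y → (x :+ y) :* con (+ 1) := x :* con (+ 1) :+ y :* con (+ 1)) refl x y
  iterate-+ (suc j) x y = begin
    (x + y) ^ (p ℕ.* p ℕ.^ j)                          ≈⟨ ^-assocʳ (x + y) p (p ℕ.^ j) ⟨
    ((x + y) ^ p) ^ (p ℕ.^ j)                          ≈⟨ ^-congˡ (p ℕ.^ j) (frobenius-+ x y) ⟩
    (x ^ p + y ^ p) ^ (p ℕ.^ j)                        ≈⟨ iterate-+ j (x ^ p) (y ^ p) ⟩
    (x ^ p) ^ (p ℕ.^ j) + (y ^ p) ^ (p ℕ.^ j)          ≈⟨ +-cong (^-assocʳ x p (p ℕ.^ j)) (^-assocʳ y p (p ℕ.^ j)) ⟩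
    x ^ (p ℕ.* p ℕ.^ j) + y ^ (p ℕ.* p ℕ.^ j)          ∎

  Tr : Carrier → Carrier
  Tr x = ∑< (suc r) (λ j → x ^ (p ℕ.^ j))

  Tr-cong : ∀ {x y} → x ≈ y → Tr x ≈ Tr y
  Tr-cong x≈y = ∑-cong (downFrom (suc r)) (λ j → ^-congˡ (p ℕ.^ j) x≈y)

  Tr-+ : ∀ x y → Tr (x + y) ≈ Tr x + Tr y
  Tr-+ x y = trans (∑-cong (downFrom (suc r)) (λ j → iterate-+ j x y)) (∑-+ (downFrom (suc r)) _ _)

  Tr-0 : ∀ {x} → x ≈ 0# → Tr x ≈ 0#
  Tr-0 {x} x≈0 = ∑-zero (downFrom (suc r)) (λ j → power (p ℕ.^ j) (ℕₚ.m^n>0 p j))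
    where
    power : ∀ n → 0 ℕ.< n → x ^ n ≈ 0#
    power (suc n) _ = 0^suc n x≈0

  private
    Tr-neg : ∀ x → Tr (- x) ≈ - Tr x
    Tr-neg x = begin
      Tr (- x)                        ≈⟨ solve 2 (λ a b → a := (a :+ b) :- b) refl (Tr (- x)) (Tr x) ⟩
      (Tr (- x) + Tr x) - Tr x        ≈⟨ +-congʳ (trans (sym (Tr-+ (- x) x)) (Tr-0 (-‿inverseˡ x))) ⟩
      0# - Tr x                       ≈⟨ +-identityˡ _ ⟩
      - Tr x                          ∎

    Tr-ι : ∀ n x → Tr (ι n * x) ≈ ι n * Tr x
    Tr-ι zero    x = trans (Tr-0 (zeroˡ x)) (sym (zeroˡ _))
    Tr-ι (suc n) x = begin
      Tr ((1# + ι n) * x)       ≈⟨ Tr-cong (solve 2 (λ i x → (con (+ 1) :+ i) :* x := x :+ i :* x) refl (ι n) x) ⟩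
      Tr (x + ι n * x)          ≈⟨ trans (Tr-+ x (ι n * x)) (+-congˡ (Tr-ι n x)) ⟩
      Tr x + ι n * Tr x         ≈⟨ solve 2 (λ i x → x :+ i :* x := (con (+ 1) :+ i) :* x) refl (ι n) (Tr x) ⟩
      (1# + ι n) * Tr x         ∎

  Tr-fromℤ : ∀ c x → Tr (fromℤ c * x) ≈ fromℤ c * Tr x
  Tr-fromℤ (+ n) x = trans (Tr-cong (*-congʳ (fromℤ-pos n))) (trans (Tr-ι n x) (*-congʳ (sym (fromℤ-pos n))))
  Tr-fromℤ -[1+ n ] x = begin
    Tr (- fromℤ (+ suc n) * x)      ≈⟨ Tr-cong (-‿distribˡ-* _ x) ⟨
    Tr (- (fromℤ (+ suc n) * x))    ≈⟨ Tr-neg _ ⟩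
    - Tr (fromℤ (+ suc n) * x)      ≈⟨ -‿cong (Tr-fromℤ (+ suc n) x) ⟩
    - (fromℤ (+ suc n) * Tr x)      ≈⟨ -‿distribˡ-* _ _ ⟩
    - fromℤ (+ suc n) * Tr x        ∎

  Tr-fixed : ∀ x → Tr x ^ p ≈ Tr x
  Tr-fixed x = begin
    Tr x ^ p                                               ≈⟨ power-∑ (suc r) _ ⟩
    ∑< (suc r) (λ j → (x ^ (p ℕ.^ j)) ^ p)                 ≈⟨ ∑-cong (downFrom (suc r)) (λ j → trans (^-assocʳ x (p ℕ.^ j) p) (^-congʳ x (ℕₚ.*-comm (p ℕ.^ j) p))) ⟩
    ∑< (suc r) (λ j → x ^ (p ℕ.^ suc j))                   ≈⟨ solve 2 (λ a b → a := (a :+ b) :- b) refl _ (x ^ (p ℕ.^ 0)) ⟩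
    (∑< (suc r) (λ j → x ^ (p ℕ.^ suc j)) + x ^ (p ℕ.^ 0)) - x ^ (p ℕ.^ 0) ≈⟨ +-congʳ (∑<-head (suc r) (λ j → x ^ (p ℕ.^ j))) ⟨
    (x ^ (p ℕ.^ suc r) + Tr x) - x ^ (p ℕ.^ 0)             ≈⟨ +-cong (+-congʳ (trans (^-congʳ x (≡.sym q≡)) (fermat x))) (-‿cong (*-identityʳ x)) ⟩
    (x + Tr x) - x                                         ≈⟨ solve 2 (λ x t → (x :+ t) :- x := t) refl x (Tr x) ⟩
    Tr x                                                   ∎
    where
    power-∑ : ∀ n (f : ℕ → Carrier) → ∑< n f ^ p ≈ ∑< n (λ j → f j ^ p)
    power-∑ zero    f = zeroˡ _
    power-∑ (suc n) f = trans (frobenius-+ (f n) (∑< n f)) (+-congˡ (power-∑ n f))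

  ι-kernel : ∀ n → ι n ≈ 0# → p ℕD.∣ n
  ι-kernel n ιn≈0 with n ℕ.% p in eq | DM.m%n<n n p | DM.m≡m%n+[m/n]*n n p
    where import Data.Nat.DivMod as DM
  ... | zero    | _   | _  = ℕD.m%n≡0⇒n∣m n p eq
  ... | d@(suc _) | d<p | n≡ = ⊥-elim (1≉0 (bezout (coprime-Bézout {p} {d} (prime⇒coprime pp d<p))))
    where
    open import Data.Nat.Coprimality using (coprime-Bézout; prime⇒coprime)
    open import Data.Nat.GCD using (module Bézout)
    ι-d : ι d ≈ 0#
    ι-d = begin
      ι d                              ≈⟨ +-identityʳ _ ⟨
      ι d + 0#                         ≈⟨ +-congˡ (trans (ι-* (n ℕ./ p) p) (trans (*-congˡ ι-p) (zeroʳ _))) ⟨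
      ι d + ι (n ℕ./ p ℕ.* p)          ≈⟨ ι-+ d (n ℕ./ p ℕ.* p) ⟨
      ι (d ℕ.+ n ℕ./ p ℕ.* p)          ≈⟨ reflexive (≡.cong ι n≡) ⟨
      ι n                              ≈⟨ ιn≈0 ⟩
      0#                               ∎
    multiple : ∀ a b → ι b ≈ 0# → ι (a ℕ.* b) ≈ 0#
    multiple a b ιb≈0 = trans (ι-* a b) (trans (*-congˡ ιb≈0) (zeroʳ _))
    conclude : ∀ a b → 1 ℕ.+ a ≡ b → ι a ≈ 0# → ι b ≈ 0# → 1# ≈ 0#
    conclude a b ≡.refl ιa≈0 ιb≈0 = trans (sym (+-identityʳ 1#)) (trans (+-congˡ (sym ιa≈0)) ιb≈0)
    bezout : Bézout.Identity 1 p d → 1# ≈ 0#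
    bezout (Bézout.+- x y eq) = conclude (y ℕ.* d) (x ℕ.* p) eq (multiple y d ι-d) (multiple x p ι-p)
    bezout (Bézout.-+ x y eq) = conclude (x ℕ.* p) (y ℕ.* d) eq (multiple x p ι-p) (multiple y d ι-d)

  fromℤ-kernel : ∀ i → fromℤ i ≈ 0# → (+ p) ℤD.∣ i
  fromℤ-kernel (+ n) eq = ℤD.∣ᵤ⇒∣ (ι-kernel n (trans (sym (fromℤ-pos n)) eq))
  fromℤ-kernel -[1+ n ] eq = ℤD.∣ᵤ⇒∣ (ι-kernel (suc n) (trans (sym (fromℤ-pos (suc n))) (trans (sym (-‿involutive _)) (trans (-‿cong eq) -0#≈0#))))

  private
    too-small : ∀ a b → a ℕ.< b → b ℕ.< p → ι a ≈ ι b → ⊥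
    too-small a b a<b b<p eq = ℕₚ.<⇒≱ (ℕₚ.≤-<-trans (ℕₚ.m∸n≤m b a) b<p) (ℕD.∣⇒≤ {{ℕ.≢-nonZero (ℕₚ.m>n⇒m∸n≢0 a<b)}}
      (ι-kernel (b ℕ.∸ a) (begin
        ι (b ℕ.∸ a)                   ≈⟨ solve 2 (λ x y → x := (y :+ x) :- y) refl (ι (b ℕ.∸ a)) (ι a) ⟩
        (ι a + ι (b ℕ.∸ a)) - ι a     ≈⟨ +-congʳ (ι-+ a (b ℕ.∸ a)) ⟨
        ι (a ℕ.+ (b ℕ.∸ a)) - ι a     ≈⟨ +-cong (reflexive (≡.cong ι (ℕₚ.m+[n∸m]≡n (ℕₚ.<⇒≤ a<b)))) (-‿cong eq) ⟩
        ι b - ι b                     ≈⟨ -‿inverseʳ _ ⟩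
        0#                            ∎)))

  ι-injective : ∀ {a b} → a ℕ.< p → b ℕ.< p → ι a ≈ ι b → a ≡ b
  ι-injective {a} {b} a<p b<p eq with ℕₚ.<-cmp a b
  ... | Relation.Binary.Definitions.tri≈ _ a≡b _ = a≡b
  ... | Relation.Binary.Definitions.tri< a<b _ _ = ⊥-elim (too-small a b a<b b<p eq)
  ... | Relation.Binary.Definitions.tri> _ _ b<a = ⊥-elim (too-small b a b<a a<p (sym eq))

  2≤p : 2 ℕ.≤ p
  2≤p = ℕ.nonTrivial⇒n>1 p {{prime⇒nonTrivial pp}}

  -- A counterexample together with the p elements of the prime field would be too many roots of X ^ p − X.
  abstract
    prime-field : ∀ x → x ^ p ≈ x → ∃ λ n → n ℕ.< p × ι n ≈ x
    prime-field x x^p≈x with any? (λ (i : Fin p) → ι (toℕ i) ≈? x)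
      where
      open import Data.Fin.Properties using (any?)
      open import Data.Fin.Base using (toℕ)
    ... | yes (i , eq) = toℕ i , toℕ<n i , eq
      where
      open import Data.Fin.Properties using (toℕ<n)
      open import Data.Fin.Base using (toℕ)
    ... | no none = ⊥-elim (ℕₚ.<-irrefl ≡.refl (too-many m 2≤p ≡.refl))
      where
      open import Data.Fin.Base using (toℕ)
      open import Data.Fin.Properties using (toℕ<n; toℕ-injective)
      open import Data.List.Relation.Unary.AllPairs using ([]; _∷_)
      import Data.List.Relation.Unary.AllPairs.Properties as AP
      import Data.List.Relation.Unary.All.Properties as AllP
      open import Data.List.Properties using (length-tabulate)
      ι-fixed : ∀ n → ι n ^ p ≈ ι n
      ι-fixed zero    = zeroˡ _
      ι-fixed (suc n) = trans (frobenius-+ 1# (ι n)) (+-cong (1^ p) (ι-fixed n))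
      points : List Carrier
      points = x ∷ List.tabulate (λ (i : Fin p) → ι (toℕ i))
      too-many : ∀ m′ → 2 ℕ.≤ suc m′ → m′ ≡ m → suc m ℕ.< suc m
      too-many (suc j) _ ≡.refl = ≡.subst (ℕ._≤ suc (suc j)) (≡.cong suc (length-tabulate (λ (i : Fin p) → ι (toℕ i))))
        (fixed-points≤ j points
          (AllP.tabulate⁺ (λ i eq → none (i , sym eq)) ∷ AP.tabulate⁺ (λ {i} {k} i≢k eq → i≢k (toℕ-injective (ι-injective (toℕ<n i) (toℕ<n k) eq))))
          (x^p≈x ∷ AllP.tabulate⁺ (λ i → ι-fixed (toℕ i))))
      too-many zero (s≤s ()) _

  abstract
    traceRoot : ∀ x → ∃ λ n → n ℕ.< p × ι n ≈ Tr x
    traceRoot x = prime-field (Tr x) (Tr-fixed x)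

    -- The absolute trace, lifted to 0, ..., p - 1. As an integer function it is additive only
    -- modulo p, which suffices for testing divisibility.
    trace : Carrier → ℤ
    trace x = + proj₁ (traceRoot x)

    fromℤ-trace : ∀ x → fromℤ (trace x) ≈ Tr x
    fromℤ-trace x = trans (fromℤ-pos (proj₁ (traceRoot x))) (proj₂ (proj₂ (traceRoot x)))

    trace-cong : ∀ {x y} → x ≈ y → trace x ≡ trace y
    trace-cong {x} {y} x≈y = ≡.cong +_ (ι-injective (proj₁ (proj₂ (traceRoot x))) (proj₁ (proj₂ (traceRoot y)))
      (trans (proj₂ (proj₂ (traceRoot x))) (trans (Tr-cong x≈y) (sym (proj₂ (proj₂ (traceRoot y)))))))

    trace-0 : ∀ {x} → x ≈ 0# → trace x ≡ + 0
    trace-0 {x} x≈0 = ≡.cong +_ (ι-injective (proj₁ (proj₂ (traceRoot x))) (s≤s z≤n) (trans (proj₂ (proj₂ (traceRoot x))) (Tr-0 x≈0)))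

-- The filtration of ℤ[K] and sums over points

module Teichmuller {q : ℕ} (K : FiniteField q) (m : ℕ) (pp : Prime (suc m)) (r : ℕ) (q≡ : q ≡ suc m ℕ.^ suc r) where
  open FiniteField K hiding (zero)
  open FieldFacts K
  open CharacteristicP K m pp r q≡
  open ListSum commRing using () renaming (∑ to ∑ᴷ)
  open ListSum ℤₚ.+-*-commutativeRing using (∑; ∑-cong; ∑-zero)
  open FormalSums *-commutativeMonoid public
  open ℤD using (_∣_)
  open import Algebra.Properties.Semiring.Exp semiring using () renaming (_^_ to _^ᴷ_)
  open IntegerSolver commRing using (solve; _:=_; _:+_; _:*_; _:-_; :-_; con; fromℤ; fromℤ-+; fromℤ-*; fromℤ--)
  module B = CommutativeRing monoidRing
  open import Algebra.Properties.Semiring.Exp B.semiring using (_^_)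
  open import Algebra.Properties.Ring (CommutativeRing.ring commRing) using (-0#≈0#)

  P : ℤ
  P = + p

  -- The reduction map ℤ[K] → K.
  ε : FormalSum → Carrier
  ε a = ∑ᴷ a (λ t → fromℤ (proj₁ t) * proj₂ t)

  ε-++ : ∀ a b → ε (a ++ b) ≈ ε a + ε b
  ε-++ a b = ListSum.∑-++ commRing a b (λ t → fromℤ (proj₁ t) * proj₂ t)

  ε-⊖ : ∀ a → ε (⊖ a) ≈ - ε a
  ε-⊖ []      = sym -0#≈0#
  ε-⊖ (t ∷ a) = trans (+-cong (*-congʳ (fromℤ-- (proj₁ t))) (ε-⊖ a)) (solve 3 (λ c x e → :- c :* x :+ :- e := :- (c :* x :+ e)) refl _ _ (ε a))

  ε-⊗ : ∀ a b → ε (a ⊗ b) ≈ ε a * ε b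
  ε-⊗ []      b = sym (zeroˡ (ε b))
  ε-⊗ (t ∷ a) b = trans (ε-++ (map (λ s → proj₁ t ℤ.* proj₁ s , proj₂ t * proj₂ s) b) (a ⊗ b))
    (trans (+-cong (go b) (ε-⊗ a b)) (sym (distribʳ (ε b) _ (ε a))))
    where
    go : ∀ b → ε (map (λ s → proj₁ t ℤ.* proj₁ s , proj₂ t * proj₂ s) b) ≈ fromℤ (proj₁ t) * proj₂ t * ε b
    go []      = sym (zeroʳ _)
    go (s ∷ b) = trans (+-cong (*-congʳ (fromℤ-* (proj₁ t) (proj₁ s))) (go b))
      (solve 5 (λ c x d y e → c :* d :* (x :* y) :+ c :* x :* e := c :* x :* (d :* y :+ e)) refl _ _ _ _ (ε b))

  ε-const : ∀ c → ε (const c) ≈ fromℤ c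
  ε-const c = solve 1 (λ c → c :* con (+ 1) :+ con (+ 0) := c) refl (fromℤ c)

  ε-^ : ∀ a n → ε (a ^ n) ≈ ε a ^ᴷ n
  ε-^ a zero    = ε-const (+ 1)
  ε-^ a (suc n) = trans (ε-⊗ a (a ^ n)) (*-congˡ (ε-^ a n))

  [_] : Carrier → FormalSum
  [ x ] = (+ 1 , x) ∷ []

  ε-[] : ∀ x → ε [ x ] ≈ x
  ε-[] x = solve 1 (λ x → con (+ 1) :* x :+ con (+ 0) := x) refl x

  ⟪[]⟫ : ∀ x φ → ⟪ [ x ] ⟫ φ ≡ φ x
  ⟪[]⟫ x φ = ≡.trans (ℤₚ.+-identityʳ _) (ℤₚ.*-identityˡ (φ x))

  []-cong : ∀ {x y} → x ≈ y → [ x ] ∼ [ y ]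
  []-cong {x} {y} x≈y = exact λ φ φ-resp → ≡.trans (⟪[]⟫ x φ) (≡.trans (φ-resp x≈y) (≡.sym (⟪[]⟫ y φ)))

  -- Multiplicative convolution powers of the trace. Pairings with T k detect the k-th power of the kernel of ε.
  T : ℕ → Carrier → ℤ
  T zero    y = trace y
  T (suc l) y = ∑ elems (λ w → trace w ℤ.* T l (inv w * y))

  T-cong : ∀ l {x y} → x ≈ y → T l x ≡ T l y
  T-cong zero    x≈y = trace-cong x≈y
  T-cong (suc l) x≈y = ∑-cong elems (λ w → ≡.cong (trace w ℤ.*_) (T-cong l (*-congˡ x≈y)))

  T-0 : ∀ l {x} → x ≈ 0# → T l x ≡ + 0
  T-0 zero    x≈0 = trace-0 x≈0
  T-0 (suc l) x≈0 = ∑-zero elems (λ w → ≡.trans (≡.cong (trace w ℤ.*_) (T-0 l (trans (*-congˡ x≈0) (zeroʳ _)))) (ℤₚ.*-zeroʳ (trace w)))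

  inv-* : ∀ x y → inv (x * y) ≈ inv x * inv y
  inv-* x y = split (x ≈? 0#) (y ≈? 0#)
    where
    split : Dec (x ≈ 0#) → Dec (y ≈ 0#) → inv (x * y) ≈ inv x * inv y
    split (yes x≈0) _         = trans (inv-0 (trans (*-congʳ x≈0) (zeroˡ y))) (sym (trans (*-congʳ (inv-0 x≈0)) (zeroˡ _)))
    split (no x≉0)  (yes y≈0) = trans (inv-0 (trans (*-congˡ y≈0) (zeroʳ x))) (sym (trans (*-congˡ (inv-0 y≈0)) (zeroʳ _)))
    split (no x≉0)  (no y≉0)  = cancelˡ (*-nonzero x≉0 y≉0) (trans (inv-inverse (*-nonzero x≉0 y≉0)) (sym (trans
      (solve 4 (λ x y i j → x :* y :* (i :* j) := (x :* i) :* (y :* j)) refl x y (inv x) (inv y))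
      (trans (*-cong (inv-inverse x≉0) (inv-inverse y≉0)) (*-identityˡ 1#)))))

  private
    m′ : ℕ
    m′ = ℕ.pred q

    q≢0 : ℕ.NonZero q
    q≢0 = ≡.subst ℕ.NonZero (≡.sym q≡) (ℕₚ.m^n≢0 p (suc r))

  q-1 : ℕ
  q-1 = m′

  suc-q-1 : suc q-1 ≡ q
  suc-q-1 = ℕₚ.suc-pred q {{q≢0}}

  open PowerSums K q-1 suc-q-1

  -- Replace w by x w in the convolution. The point of this form is that x and y are separated, so
  -- pairing with a product of two formal sums factors under the sum over w.
  T-shift : ∀ l x y → T (suc l) (x * y) ≡ ∑ elems (λ w → trace (x * w) ℤ.* T l (inv w * y))
  T-shift l x y = split (x ≈? 0#)
    where
    split : Dec (x ≈ 0#) → T (suc l) (x * y) ≡ ∑ elems (λ w → trace (x * w) ℤ.* T l (inv w * y))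
    split (yes x≈0) = ≡.trans (T-0 (suc l) (trans (*-congʳ x≈0) (zeroˡ y)))
        (≡.sym (∑-zero elems (λ w → ≡.trans (≡.cong (ℤ._* T l (inv w * y)) (trace-0 (trans (*-congʳ x≈0) (zeroˡ w)))) (ℤₚ.*-zeroˡ (T l (inv w * y))))))
    split (no x≉0) = begin
      ∑ elems h
        ≡⟨ multiplicative-substitution ℤₚ.+-*-commutativeRing x≉0 h h-cong ⟨
      ∑ elems (λ w → h (x * w))
        ≡⟨ ∑-cong elems (λ w → ≡.cong (trace (x * w) ℤ.*_) (T-cong l (cancel w))) ⟩
      ∑ elems (λ w → trace (x * w) ℤ.* T l (inv w * y)) ∎
      where
      open ≡.≡-Reasoning
      h : Carrier → ℤ
      h w = trace w ℤ.* T l (inv w * (x * y))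
      h-cong : ∀ {w w′} → w ≈ w′ → h w ≡ h w′
      h-cong w≈w′ = ≡.cong₂ ℤ._*_ (trace-cong w≈w′) (T-cong l (*-congʳ (inv-cong w≈w′)))
      cancel : ∀ w → inv (x * w) * (x * y) ≈ inv w * y
      cancel w = trans (*-congʳ (inv-* x w)) (trans
        (solve 4 (λ i j x y → i :* j :* (x :* y) := (x :* i) :* (j :* y)) refl (inv x) (inv w) x y)
        (trans (*-congʳ (inv-inverse x≉0)) (*-identityˡ (inv w * y))))

  1∣ : ∀ x → (P ℤ.^ 0) ∣ x
  1∣ x = ℤD.divides x (≡.sym (ℤₚ.*-identityʳ x))

  -- A filtration described by tests instead of generators. The free translation y makes each step
  -- an ideal. It contains the n-th power of the kernel of `ε`, and also [0] in every step, since
  -- `T` vanishes at 0.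
  record InF (n : ℕ) (a : FormalSum) : Set where
    constructor mkF
    field div : ∀ k l y → k ℕ.≤ n → (P ℤ.^ k) ∣ ⟪ a ⟫ (λ u → T (k ℕ.+ l) (u * y))
  open InF

  private
    τ-resp : ∀ k y → Respects (λ u → T k (u * y))
    τ-resp k y u≈v = T-cong k (*-congʳ u≈v)

  F-≈ : ∀ {n a b} → a ∼ b → InF n a → InF n b
  F-≈ a∼b h = mkF λ k l y k≤n → ≡.subst ((P ℤ.^ k) ∣_) (apply a∼b _ (τ-resp (k ℕ.+ l) y)) (div h k l y k≤n)

  F-0 : ∀ a → InF 0 a
  F-0 a = mkF λ { zero l y z≤n → 1∣ (⟪ a ⟫ (λ u → T l (u * y))) }

  F-lower : ∀ {k n a} → k ℕ.≤ n → InF n a → InF k a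
  F-lower k≤n h = mkF λ j l y j≤k → div h j l y (ℕₚ.≤-trans j≤k k≤n)

  F-[] : ∀ n → InF n []
  F-[] n = mkF λ k l y k≤n → ℤD.divides (+ 0) ≡.refl

  F-++ : ∀ {n a b} → InF n a → InF n b → InF n (a ++ b)
  F-++ {a = a} {b} h h′ = mkF λ k l y k≤n → ≡.subst ((P ℤ.^ k) ∣_) (≡.sym (⟪++⟫ a b _)) (ℤD.∣m∣n⇒∣m+n (div h k l y k≤n) (div h′ k l y k≤n))

  F-⊖ : ∀ {n a} → InF n a → InF n (⊖ a)
  F-⊖ {a = a} h = mkF λ k l y k≤n → ≡.subst ((P ℤ.^ k) ∣_) (≡.sym (⟪⊖⟫ a _)) (ℤD.∣m⇒∣-m (div h k l y k≤n))

  F-⊗ : ∀ {n a} b → InF n a → InF n (b ⊗ a)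
  F-⊗ {a = a} b h = mkF λ k l y k≤n → ≡.subst ((P ℤ.^ k) ∣_) (≡.sym (⟪⊗⟫ b a _))
    (⟪⟫-div b (λ u → ≡.subst ((P ℤ.^ k) ∣_) (⟪⟫-cong a (λ v → T-cong (k ℕ.+ l) (solve 3 (λ u v y → v :* (u :* y) := u :* v :* y) refl u v y))) (div h k l (u * y) k≤n)))

  private
    pairing-trace : ∀ z w → fromℤ (⟪ z ⟫ (λ u → trace (u * w))) ≈ Tr (ε z * w)
    pairing-trace []      w = sym (Tr-0 (zeroˡ w))
    pairing-trace (t ∷ z) w = trans (fromℤ-+ (proj₁ t ℤ.* trace (proj₂ t * w)) (⟪ z ⟫ (λ u → trace (u * w))))
      (trans (+-cong (trans (fromℤ-* (proj₁ t) (trace (proj₂ t * w))) (trans (*-congˡ (fromℤ-trace (proj₂ t * w))) (sym (Tr-fromℤ (proj₁ t) (proj₂ t * w))))) (pairing-trace z w))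
        (trans (sym (Tr-+ _ _)) (Tr-cong (solve 4 (λ c x w e → c :* (x :* w) :+ e :* w := (c :* x :+ e) :* w) refl _ _ w (ε z)))))

    pairing-div : ∀ z w → ε z ≈ 0# → P ∣ ⟪ z ⟫ (λ u → trace (u * w))
    pairing-div z w εz≈0 = fromℤ-kernel _ (trans (pairing-trace z w) (Tr-0 (trans (*-congʳ εz≈0) (zeroˡ w))))

  -- By `T-shift` the pairing of z ⊗ a with a convolution power is a sum over w of a trace pairing
  -- of z times a lower pairing of a. The first factor reduces to Tr(`ε z` · w) = 0 and so is
  -- divisible by p; the second supplies the remaining powers.
  raise : ∀ {n a} z → ε z ≈ 0# → InF n a → InF (suc n) (z ⊗ a)
  raise {n} {a} z εz≈0 h = mkF go
    where
    ∑-div : ∀ {d} (xs : List Carrier) (f : Carrier → ℤ) → (∀ x → d ∣ f x) → d ∣ ∑ xs f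
    ∑-div []       f h = ℤD.divides (+ 0) ≡.refl
    ∑-div (x ∷ xs) f h = ℤD.∣m∣n⇒∣m+n (h x) (∑-div xs f h)
    go : ∀ k l y → k ℕ.≤ suc n → (P ℤ.^ k) ∣ ⟪ z ⊗ a ⟫ (λ u → T (k ℕ.+ l) (u * y))
    go zero    l y _         = 1∣ (⟪ z ⊗ a ⟫ (λ u → T l (u * y)))
    go (suc k) l y (s≤s k≤n) = ≡.subst ((P ℤ.^ suc k) ∣_) (≡.sym expand)
      (∑-div elems (λ w → Z w ℤ.* A w) (λ w → ℤD.∣-trans (ℤD.*-monoˡ-∣ (P ℤ.^ k) (pairing-div z w εz≈0))
        (ℤD.*-monoʳ-∣ (Z w) (≡.subst ((P ℤ.^ k) ∣_) (⟪⟫-cong a (λ v → T-cong (k ℕ.+ l) (solve 3 (λ v i y → v :* (i :* y) := i :* (v :* y)) refl v (inv w) y)))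
          (div h k l (inv w * y) k≤n)))))
      where
      Z A : Carrier → ℤ
      Z w = ⟪ z ⟫ (λ u → trace (u * w))
      A w = ⟪ a ⟫ (λ v → T (k ℕ.+ l) (inv w * (v * y)))
      inner : ∀ u → ⟪ a ⟫ (λ v → T (suc (k ℕ.+ l)) (u * v * y)) ≡ ∑ elems (λ w → trace (u * w) ℤ.* A w)
      inner u = ≡.trans (⟪⟫-cong a (λ v → ≡.trans (T-cong (suc (k ℕ.+ l)) (*-assoc u v y)) (T-shift (k ℕ.+ l) u (v * y))))
        (≡.trans (⟪⟫-∑ a elems (λ w v → trace (u * w) ℤ.* T (k ℕ.+ l) (inv w * (v * y))))
          (∑-cong elems (λ w → ⟪⟫-* a (trace (u * w)) (λ v → T (k ℕ.+ l) (inv w * (v * y))))))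
      expand : ⟪ z ⊗ a ⟫ (λ u → T (suc k ℕ.+ l) (u * y)) ≡ ∑ elems (λ w → Z w ℤ.* A w)
      expand = ≡.trans (⟪⊗⟫ z a (λ u → T (suc k ℕ.+ l) (u * y))) (≡.trans (⟪⟫-cong z inner)
        (≡.trans (⟪⟫-∑ z elems (λ w u → trace (u * w) ℤ.* A w)) (∑-cong elems (λ w → ⟪⟫-*ʳ z (A w) (λ u → trace (u * w))))))

-- For s = false the indicator of multiples of m, for s = true that of nonzero multiples.
multipleIndicator : ℕ → Bool → ℕ → ℤ
multipleIndicator m s u = indicator s u (m ℕD.∣? u)
  where
  indicator : Bool → (u : ℕ) → Dec (m ℕD.∣ u) → ℤ
  indicator s     u       (no _)  = + 0
  indicator true  zero    (yes _) = + 0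
  indicator true  (suc u) (yes _) = + 1
  indicator false u       (yes _) = + 1

multipleIndicator-∤ : ∀ m s u → ¬ m ℕD.∣ u → multipleIndicator m s u ≡ + 0
multipleIndicator-∤ m s u m∤u with m ℕD.∣? u
... | yes d = ⊥-elim (m∤u d)
... | no _  = ≡.refl

multipleIndicator-false : ∀ m u → m ℕD.∣ u → multipleIndicator m false u ≡ + 1
multipleIndicator-false m u m∣u with m ℕD.∣? u
... | yes _ = ≡.refl
... | no m∤u = ⊥-elim (m∤u m∣u)

multipleIndicator-true : ∀ m u → m ℕD.∣ suc u → multipleIndicator m true (suc u) ≡ + 1
multipleIndicator-true m u m∣u with m ℕD.∣? suc u
... | yes _ = ≡.refl
... | no m∤u = ⊥-elim (m∤u m∣u)

multipleIndicator-0 : ∀ m → multipleIndicator m true 0 ≡ + 0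
multipleIndicator-0 m with m ℕD.∣? 0
... | yes _ = ≡.refl
... | no _  = ≡.refl

module TeichmullerSums {q : ℕ} (K : FiniteField q) (m : ℕ) (pp : Prime (suc m)) (r : ℕ) (q≡ : q ≡ suc m ℕ.^ suc r) where
  open FiniteField K hiding (zero)
  open FieldFacts K
  open CharacteristicP K m pp r q≡
  open Teichmuller K m pp r q≡
  open PowerSums K q-1 suc-q-1
  open ListSum commRing using () renaming (∑ to ∑ᴷ)
  open ListSum ℤₚ.+-*-commutativeRing using (∑)
  private module ∑B = ListSum monoidRing
  open ∑B using () renaming (∑ to ∑ᴮ)
  open ℤD using (_∣_)
  open import Algebra.Properties.CommutativeSemiring.Exp commutativeSemiring using (^-distrib-*)
  open import Algebra.Properties.Semiring.Exp semiring using () renaming (_^_ to _^ᴷ_; ^-congˡ to ^ᴷ-congˡ; ^-congʳ to ^ᴷ-congʳ; ^-homo-* to ^ᴷ-homo-*)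
  open import Algebra.Properties.Semiring.Exp B.semiring using (_^_; ^-congʳ) renaming (^-assocʳ to ^ᴮ-assocʳ)
  private module KS = IntegerSolver commRing
  open KS using (fromℤ; fromℤ-+; fromℤ-*)
  private module BS = IntegerSolver monoidRing
  open import Data.Integer.Tactic.RingSolver using (solve-∀)
  open import Data.Fin.Properties using (¬∀⟶∃¬)
  private
    module GK = GeometricSum commRing
    module GB = GeometricSum monoidRing

    ε-geometric : ∀ n a b → ε (GB.geometric n a b) ≈ GK.geometric n (ε a) (ε b)
    ε-geometric zero    a b = refl
    ε-geometric (suc n) a b = trans (ε-++ (b ⊗ GB.geometric n a b) (a ^ n))
      (+-cong (trans (ε-⊗ b (GB.geometric n a b)) (*-congˡ (ε-geometric n a b))) (ε-^ a n))

    ε-difference : ∀ a b → ε a ≈ ε b → ε (a B.- b) ≈ 0#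
    ε-difference a b eq = trans (ε-++ a (⊖ b)) (trans (+-cong eq (ε-⊖ b)) (-‿inverseʳ (ε b)))

  -- With x and y the p ^ N-th powers, x ^ p - y ^ p is x - y times a geometric sum, which reduces
  -- to p y ^ (p - 1) = 0 in K. Each p-th power thus gains one step.
  power-lift : ∀ N a b → ε a ≈ ε b → InF (suc N) ((a ^ (p ℕ.^ N)) B.- (b ^ (p ℕ.^ N)))
  power-lift zero a b eq = F-≈ (BS.solve 2 (λ a b → (a BS.:- b) BS.:* BS.con (+ 1) BS.:= (a BS.:* BS.con (+ 1)) BS.:- (b BS.:* BS.con (+ 1))) B.refl a b)
    (raise (a B.- b) (ε-difference a b eq) (F-0 B.1#))
  power-lift (suc N) a b eq = F-≈ (B.trans (B.*-comm (GB.geometric p x y) (x B.- y)) (B.trans (GB.geometric-difference p x y) (B.+-cong (collect a) (B.-‿cong (collect b)))))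
    (raise (GB.geometric p x y) ε-geo≈0 (power-lift N a b eq))
    where
    x y : FormalSum
    x = a ^ (p ℕ.^ N)
    y = b ^ (p ℕ.^ N)
    collect : ∀ a → (a ^ (p ℕ.^ N)) ^ p B.≈ a ^ (p ℕ.^ suc N)
    collect a = B.trans (^ᴮ-assocʳ a (p ℕ.^ N) p) (^-congʳ a (ℕₚ.*-comm (p ℕ.^ N) p))
    εx≈εy : ε x ≈ ε y
    εx≈εy = trans (ε-^ a (p ℕ.^ N)) (trans (^ᴷ-congˡ (p ℕ.^ N) eq) (sym (ε-^ b (p ℕ.^ N))))
    ε-geo≈0 : ε (GB.geometric p x y) ≈ 0#
    ε-geo≈0 = trans (ε-geometric p x y) (trans (GK.geometric-diagonal m εx≈εy) (trans (·-ι p _) (trans (*-congʳ ι-p) (zeroˡ _))))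

  -- An element with nonzero reduction is a unit modulo the filtration: for i lifting the inverse, w
  -- = 1 - i u lies in the kernel of `ε`, and a = i (u a) + w a gains a step at each round.
  F-cancel : ∀ {n} u a → ¬ ε u ≈ 0# → InF n (u ⊗ a) → InF n a
  F-cancel {n} u a εu≉0 h = go n ℕₚ.≤-refl
    where
    i w : FormalSum
    i = [ inv (ε u) ]
    w = B.1# B.- (i ⊗ u)
    εw≈0 : ε w ≈ 0#
    εw≈0 = ε-difference B.1# (i ⊗ u) (trans (ε-const (+ 1)) (sym (trans (ε-⊗ i u) (trans (*-congʳ (ε-[] (inv (ε u)))) (trans (*-comm _ _) (inv-inverse εu≉0))))))
    go : ∀ k → k ℕ.≤ n → InF k a
    go zero    _   = F-0 a
    go (suc k) k<n = F-≈ (BS.solve 3 (λ i u a → (i BS.:* (u BS.:* a)) BS.:+ (BS.con (+ 1) BS.:- i BS.:* u) BS.:* a BS.:= a) B.refl i u a)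
      (F-++ (F-⊗ i (F-lower k<n h)) (raise w εw≈0 (go k (ℕₚ.<⇒≤ k<n))))

  private
    -- The Mellin transform of `T l` at the character y ↦ y⁻¹, with values in K. It turns
    -- multiplicative convolution into a product, and so certifies that `T l` is not divisible by p
    -- everywhere.
    N : ℕ → Carrier
    N l = ∑ᴷ elems (λ y → fromℤ (T l y) * inv y)

    q-1>0 : 0 ℕ.< q-1
    q-1>0 = ℕₚ.≤-pred (≡.subst (2 ℕ.≤_) (≡.trans (≡.sym q≡) (≡.sym suc-q-1)) (ℕₚ.≤-trans 2≤p (ℕₚ.m≤m*n p (p ℕ.^ r) {{ℕₚ.m^n≢0 p r}})))

    positive-power : ∀ u y → 0 ℕ.< u → y ^ᴷ suc u * inv y ≈ y ^ᴷ u
    positive-power (suc u) y _ = split (y ≈? 0#)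
      where
      split : Dec (y ≈ 0#) → y ^ᴷ suc (suc u) * inv y ≈ y ^ᴷ suc u
      split (yes y≈0) = trans (*-congʳ (0^suc (suc u) y≈0)) (trans (zeroˡ _) (sym (0^suc u y≈0)))
      split (no y≉0)  = trans (KS.solve 3 (λ y z i → (y KS.:* z) KS.:* i KS.:= (y KS.:* i) KS.:* z) refl y (y ^ᴷ suc u) (inv y)) (trans (*-congʳ (inv-inverse y≉0)) (*-identityˡ _))

    -- Tr(y) y⁻¹ is the sum of the powers y ^ (p ^ j - 1). For 0 < j ≤ r the exponent lies strictly
    -- between 0 and q - 1 and the power sum vanishes; j = 0 counts the nonzero y, giving -1.
    N-0 : N 0 ≈ - 1#
    N-0 = begin
      ∑ᴷ elems (λ y → fromℤ (trace y) * inv y)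
        ≈⟨ ∑K.∑-cong elems (λ y → trans (*-congʳ (fromℤ-trace y)) (sym (∑K.∑-*ʳ (downFrom (suc r)) (inv y) (λ j → y ^ᴷ (p ℕ.^ j))))) ⟩
      ∑ᴷ elems (λ y → ∑ᴷ (downFrom (suc r)) (λ j → y ^ᴷ (p ℕ.^ j) * inv y))
        ≈⟨ ∑K.∑-swap elems (downFrom (suc r)) (λ y j → y ^ᴷ (p ℕ.^ j) * inv y) ⟩
      ∑ᴷ (downFrom (suc r)) (λ j → ∑ᴷ elems (λ y → y ^ᴷ (p ℕ.^ j) * inv y))
        ≈⟨ ∑K.∑<-head r (λ j → ∑ᴷ elems (λ y → y ^ᴷ (p ℕ.^ j) * inv y)) ⟩
      ∑ᴷ (downFrom r) (λ j → ∑ᴷ elems (λ y → y ^ᴷ (p ℕ.^ suc j) * inv y)) + ∑ᴷ elems (λ y → y ^ᴷ 1 * inv y)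
        ≈⟨ +-cong (∑K.∑<-zero r vanish) (trans (∑K.∑-cong elems top) (powerSum-full 1 (≡.subst (0 ℕ.<_) (≡.sym (ℕₚ.+-identityʳ q-1)) q-1>0))) ⟩
      0# + - 1#
        ≈⟨ +-identityˡ _ ⟩
      - 1# ∎
      where
      module ∑K = ListSum commRing
      open import Relation.Binary.Reasoning.Setoid setoid
      vanish : ∀ j → j ℕ.< r → ∑ᴷ elems (λ y → y ^ᴷ (p ℕ.^ suc j) * inv y) ≈ 0#
      vanish j j<r = trans (∑K.∑-cong elems (λ y → trans (*-congʳ (^ᴷ-congʳ y (≡.sym suc-u))) (positive-power u y 0<u)))
          (powerSum-nontrivial u (λ q-1∣u → ℕₚ.<⇒≱ u<q-1 (ℕD.∣⇒≤ {{ℕ.>-nonZero 0<u}} q-1∣u)))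
        where
        u : ℕ
        u = ℕ.pred (p ℕ.^ suc j)
        suc-u : suc u ≡ p ℕ.^ suc j
        suc-u = ℕₚ.suc-pred (p ℕ.^ suc j) {{ℕₚ.m^n≢0 p (suc j)}}
        0<u : 0 ℕ.< u
        0<u = ℕₚ.≤-pred (≡.subst (2 ℕ.≤_) (≡.sym suc-u) (ℕₚ.≤-trans 2≤p (ℕₚ.m≤m*n p (p ℕ.^ j) {{ℕₚ.m^n≢0 p j}})))
        u<q-1 : u ℕ.< q-1
        u<q-1 = ℕₚ.≤-pred (≡.subst₂ ℕ._<_ (≡.sym suc-u) (≡.trans (≡.sym q≡) (≡.sym suc-q-1)) (ℕₚ.^-monoʳ-< p 2≤p (s≤s j<r)))
      top : ∀ y → y ^ᴷ 1 * inv y ≈ y ^ᴷ (1 ℕ.* q-1)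
      top y = trans (split (y ≈? 0#)) (^ᴷ-congʳ y (≡.sym (ℕₚ.*-identityˡ q-1)))
        where
        zero-power : ∀ u → 0 ℕ.< u → y ≈ 0# → y ^ᴷ u ≈ 0#
        zero-power (suc u) _ y≈0 = 0^suc u y≈0
        split : Dec (y ≈ 0#) → y ^ᴷ 1 * inv y ≈ y ^ᴷ q-1
        split (yes y≈0) = trans (*-congʳ (0^suc 0 y≈0)) (trans (zeroˡ _) (sym (zero-power q-1 q-1>0 y≈0)))
        split (no y≉0)  = trans (*-congʳ (*-identityʳ y)) (trans (inv-inverse y≉0) (sym (trans (^ᴷ-congʳ y (≡.sym (ℕₚ.*-identityˡ q-1))) (^-div q-1 1 y≉0 suc-q-1))))

    fromℤ-∑ : ∀ (xs : List Carrier) (f : Carrier → ℤ) → fromℤ (∑ xs f) ≈ ∑ᴷ xs (fromℤ ∘ f)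
    fromℤ-∑ []       f = refl
    fromℤ-∑ (x ∷ xs) f = trans (fromℤ-+ (f x) (∑ xs f)) (+-congˡ (fromℤ-∑ xs f))

    N-suc : ∀ l → N (suc l) ≈ N 0 * N l
    N-suc l = begin
      ∑ᴷ elems (λ y → fromℤ (T (suc l) y) * inv y)
        ≈⟨ ∑K.∑-cong elems (λ y → trans (*-congʳ (fromℤ-∑ elems (λ w → trace w ℤ.* T l (inv w * y)))) (sym (∑K.∑-*ʳ elems (inv y) _))) ⟩
      ∑ᴷ elems (λ y → ∑ᴷ elems (λ w → fromℤ (trace w ℤ.* T l (inv w * y)) * inv y))
        ≈⟨ ∑K.∑-swap elems elems (λ y w → fromℤ (trace w ℤ.* T l (inv w * y)) * inv y) ⟩
      ∑ᴷ elems (λ w → ∑ᴷ elems (λ y → fromℤ (trace w ℤ.* T l (inv w * y)) * inv y))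
        ≈⟨ ∑K.∑-cong elems (λ w → trans (∑K.∑-cong elems (λ y → trans (*-congʳ (fromℤ-* (trace w) (T l (inv w * y)))) (*-assoc _ _ _)))
             (trans (∑K.∑-*ˡ elems (fromℤ (trace w)) (h w)) (inner w (w ≈? 0#)))) ⟩
      ∑ᴷ elems (λ w → fromℤ (trace w) * inv w * N l)
        ≈⟨ ∑K.∑-*ʳ elems (N l) (λ w → fromℤ (trace w) * inv w) ⟩
      N 0 * N l ∎
      where
      module ∑K = ListSum commRing
      open import Relation.Binary.Reasoning.Setoid setoid
      h : Carrier → Carrier → Carrier
      h w y = fromℤ (T l (inv w * y)) * inv y
      h-cong : ∀ w {y y′} → y ≈ y′ → h w y ≈ h w y′
      h-cong w y≈y′ = *-cong (reflexive (≡.cong fromℤ (T-cong l (*-congˡ y≈y′)))) (inv-cong y≈y′)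
      inner : ∀ w → Dec (w ≈ 0#) → fromℤ (trace w) * ∑ᴷ elems (h w) ≈ fromℤ (trace w) * inv w * N l
      inner w (yes w≈0) = trans (*-congʳ (trans (fromℤ-trace w) (Tr-0 w≈0))) (trans (zeroˡ _) (sym (trans (*-congʳ (trans (*-congʳ (trans (fromℤ-trace w) (Tr-0 w≈0))) (zeroˡ _))) (zeroˡ _))))
      inner w (no w≉0) = trans (*-congˡ (begin
        ∑ᴷ elems (h w)
          ≈⟨ multiplicative-substitution commRing w≉0 (h w) (h-cong w) ⟨
        ∑ᴷ elems (λ y → h w (w * y))
          ≈⟨ ∑K.∑-cong elems (λ y → trans (*-cong (reflexive (≡.cong fromℤ (T-cong l (trans (sym (*-assoc (inv w) w y))
               (trans (*-congʳ (trans (*-comm (inv w) w) (inv-inverse w≉0))) (*-identityˡ y)))))) (inv-* w y))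
               (KS.solve 3 (λ t i j → t KS.:* (i KS.:* j) KS.:= i KS.:* (t KS.:* j)) refl (fromℤ (T l y)) (inv w) (inv y))) ⟩
        ∑ᴷ elems (λ y → inv w * (fromℤ (T l y) * inv y))
          ≈⟨ ∑K.∑-*ˡ elems (inv w) (λ y → fromℤ (T l y) * inv y) ⟩
        inv w * N l ∎)) (sym (*-assoc _ _ _))

    N-0≉0 : ¬ N 0 ≈ 0#
    N-0≉0 eq = 1≉0 (trans (sym (KS.solve 1 (λ a → KS.:- (KS.:- a) KS.:= a) refl 1#)) (trans (-‿cong (trans (sym N-0) eq)) (KS.solve 0 (KS.:- KS.con (+ 0) KS.:= KS.con (+ 0)) refl)))

    N≉0 : ∀ l → ¬ N l ≈ 0#
    N≉0 zero    eq = N-0≉0 eq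
    N≉0 (suc l) eq = *-nonzero N-0≉0 (N≉0 l) (trans (sym (N-suc l)) eq)

    T-nonzero : ∀ l → ∃ λ y → ¬ P ∣ T l y
    T-nonzero l = found (¬∀⟶∃¬ q (λ i → P ∣ T l (enum i)) (λ i → P ℤD.∣? T l (enum i)) not-all)
      where
      found : (∃ λ i → ¬ P ∣ T l (enum i)) → ∃ λ y → ¬ P ∣ T l y
      found (i , h) = enum i , h
      not-all : ¬ (∀ i → P ∣ T l (enum i))
      not-all all = N≉0 l (ListSum.∑-zero commRing elems (λ y → trans (*-congʳ (trans (reflexive (≡.cong fromℤ (T-cong l (sym (enum-index y))))) (vanish (all (index y))))) (zeroˡ _)))
        where
        vanish : ∀ {x} → P ∣ x → fromℤ x ≈ 0#
        vanish (ℤD.divides k ≡.refl) = trans (fromℤ-* k P) (trans (*-congˡ fromℤ-p) (zeroʳ _))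

    prime-power-div : ∀ n c t → ¬ P ∣ t → (P ℤ.^ n) ∣ c ℤ.* t → (P ℤ.^ n) ∣ c
    prime-power-div zero    c t P∤t h = 1∣ c
    prime-power-div (suc n) c t P∤t h = extend (euclidsLemma ℤ.∣ c ∣ ℤ.∣ t ∣ pp (≡.subst (p ℕD.∣_) (ℤₚ.abs-* c t) (ℤD.∣⇒∣ᵤ (ℤD.∣-trans P∣P^ h))))
      where
      open import Data.Nat.Primality using (euclidsLemma)
      P∣P^ : P ∣ P ℤ.^ suc n
      P∣P^ = ℤD.∣m⇒∣m*n (P ℤ.^ n) ℤD.∣-refl
      extend : p ℕD.∣ ℤ.∣ c ∣ ⊎ p ℕD.∣ ℤ.∣ t ∣ → (P ℤ.^ suc n) ∣ c
      extend (inj₂ p∣t) = ⊥-elim (P∤t (ℤD.∣ᵤ⇒∣ p∣t))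
      extend (inj₁ p∣c) = descend (ℤD.∣ᵤ⇒∣ p∣c)
        where
        descend : P ∣ c → (P ℤ.^ suc n) ∣ c
        descend (ℤD.divides k eq) = ≡.subst ((P ℤ.^ suc n) ∣_) (≡.trans (ℤₚ.*-comm P k) (≡.sym eq))
          (ℤD.*-monoʳ-∣ P (prime-power-div n k t P∤t (ℤD.*-cancelˡ-∣ P
            (≡.subst ((P ℤ.^ suc n) ∣_) (≡.trans (≡.cong (ℤ._* t) eq) (lemma k P t)) h))))
          where
          lemma : ∀ k P t → k ℤ.* P ℤ.* t ≡ P ℤ.* (k ℤ.* t)
          lemma = solve-∀

  -- The constant c pairs with a translate of `T n` to c times a value of `T n`, and some value is
  -- prime to p. Thus congruences proved in ℤ[K] return to ℤ at full strength.
  faithful : ∀ n c → InF n (const c) → (P ℤ.^ n) ∣ c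
  faithful n c h = use (T-nonzero n)
    where
    use : (∃ λ y → ¬ P ∣ T n y) → (P ℤ.^ n) ∣ c
    use (y , P∤) = prime-power-div n c (T n y) P∤ (≡.subst ((P ℤ.^ n) ∣_)
      (≡.trans (⟪const⟫ c (λ u → T (n ℕ.+ 0) (u * y))) (≡.cong (c ℤ.*_) (≡.trans (≡.cong (λ k → T k (1# * y)) (ℕₚ.+-identityʳ n)) (T-cong n (*-identityˡ y)))))
      (InF.div h n 0 y ℕₚ.≤-refl))

  F-product : ∀ {n} a b c d → InF n (a B.- c) → InF n (b B.- d) → InF n ((a ⊗ b) B.- (c ⊗ d))
  F-product a b c d h h′ = F-≈ (BS.solve 4 (λ a b c d → b BS.:* (a BS.:- c) BS.:+ c BS.:* (b BS.:- d) BS.:= a BS.:* b BS.:- c BS.:* d) B.refl a b c d)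
    (F-++ (F-⊗ b h) (F-⊗ c h′))

  F-sum : ∀ {n} a b c d → InF n (a B.- c) → InF n (b B.- d) → InF n ((a B.+ b) B.- (c B.+ d))
  F-sum a b c d h h′ = F-≈ (BS.solve 4 (λ a b c d → (a BS.:- c) BS.:+ (b BS.:- d) BS.:= (a BS.:+ b) BS.:- (c BS.:+ d)) B.refl a b c d) (F-++ h h′)

  const-+ : ∀ a b → const (a ℤ.+ b) B.≈ const a B.+ const b
  const-+ a b = exact λ φ _ → ≡.trans (⟪const⟫ (a ℤ.+ b) φ) (≡.trans (ℤₚ.*-distribʳ-+ (φ 1#) a b)
    (≡.sym (≡.trans (⟪++⟫ (const a) (const b) φ) (≡.cong₂ ℤ._+_ (⟪const⟫ a φ) (⟪const⟫ b φ)))))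

  const-* : ∀ a b → const (a ℤ.* b) B.≈ const a ⊗ const b
  const-* a b = exact λ φ φ-resp → ≡.trans (⟪const⟫ (a ℤ.* b) φ) (≡.trans (ℤₚ.*-assoc a b (φ 1#))
    (≡.sym (≡.trans (⟪const⊗⟫ a (const b) φ-resp) (≡.cong (a ℤ.*_) (⟪const⟫ b φ)))))

  const-0 : const (+ 0) B.≈ []
  const-0 = exact λ φ _ → ≡.trans (⟪const⟫ (+ 0) φ) (ℤₚ.*-zeroˡ (φ 1#))

  []-* : ∀ x y → [ x ] ⊗ [ y ] B.≈ [ x * y ]
  []-* x y = exact λ φ φ-resp → ≡.trans (⟪⊗⟫ [ x ] [ y ] φ) (≡.trans (⟪[]⟫ x (λ u → ⟪ [ y ] ⟫ (λ v → φ (u * v)))) (≡.trans (⟪[]⟫ y (λ v → φ (x * v))) (≡.sym (⟪[]⟫ (x * y) φ))))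

  F-[0] : ∀ n {x} → x ≈ 0# → InF n [ x ]
  F-[0] n {x} x≈0 = mkF λ k l y k≤n → ≡.subst ((P ℤ.^ k) ∣_) (≡.sym (≡.trans (⟪[]⟫ x (λ u → T (k ℕ.+ l) (u * y))) (T-0 (k ℕ.+ l) (trans (*-congʳ x≈0) (zeroˡ y))))) (ℤD.divides (+ 0) ≡.refl)

  -- The sum of the u-th powers of the Teichmüller representatives: q for u = 0, q - 1 for the other
  -- multiples of q - 1, and 0 otherwise. It is split into two indicators because each of them is a
  -- count of lattice points, hence a trace.
  value : ℕ → ℤ
  value u = + q ℤ.* multipleIndicator q-1 false u ℤ.- multipleIndicator q-1 true u

  σ : ℕ → FormalSum
  σ u = ∑ᴮ elems (λ x → [ x ^ᴷ u ])

  private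
    ∑-one : ∑ᴮ elems (λ _ → B.1#) B.≈ const (+ q)
    ∑-one = go enum
      where
      go : ∀ {n} (f : Fin n → Carrier) → ∑ᴮ (List.tabulate f) (λ _ → B.1#) B.≈ const (+ n)
      go {zero}  f = B.sym const-0
      go {suc n} f = B.trans (B.+-congˡ (go (f ∘ Fin.suc))) (B.sym (const-+ (+ 1) (+ n)))

    const-cong : ∀ {a b} → a ≡ b → const a B.≈ const b
    const-cong ≡.refl = B.refl

  -- If q - 1 divides u > 0, every nonzero x contributes exactly 1 and only [0] is left over.
  -- Otherwise ([g ^ u] - 1) σ(u) = 0 with g ^ u ≠ 1, and the first factor can be cancelled.
  σ-value : ∀ n u → InF n (σ u B.- const (value u))
  σ-value n u = split u (q-1 ℕD.∣? u)
    where
    q-value : ∀ {a b} → a ≡ + 1 → b ≡ + 1 → + q ℤ.* a ℤ.- b ≡ + q ℤ.+ ℤ.- + 1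
    q-value ≡.refl ≡.refl = ≡.cong (ℤ._+ ℤ.- + 1) (ℤₚ.*-identityʳ (+ q))
    split : ∀ u → Dec (q-1 ℕD.∣ u) → InF n (σ u B.- const (value u))
    split zero _ = F-≈ (B.sym (B.trans (B.+-cong ∑-one (B.-‿cong (const-cong
      (≡.trans (≡.cong₂ (λ a b → + q ℤ.* a ℤ.- b) (multipleIndicator-false q-1 0 (q-1 ℕD.∣0)) (multipleIndicator-0 q-1)) (≡.trans (ℤₚ.+-identityʳ _) (ℤₚ.*-identityʳ (+ q))))))) (B.-‿inverseʳ (const (+ q))))) (F-[] n)
    split (suc u) (yes (ℕD.divides k eq)) = F-≈ (B.sym collapse) (F-[0] n (0^suc u refl))
      where
      g : Carrier → FormalSum
      g x = [ x ^ᴷ suc u ] B.- B.1#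
      σ≈ : σ (suc u) B.≈ ([ 0# ^ᴷ suc u ] B.- B.1#) B.+ const (+ q)
      σ≈ = B.trans (∑B.∑-cong elems (λ x → BS.solve 1 (λ a → a BS.:= (a BS.:- BS.con (+ 1)) BS.:+ BS.con (+ 1)) B.refl [ x ^ᴷ suc u ]))
        (B.trans (∑B.∑-+ elems g (λ _ → B.1#)) (B.+-cong (OverRing.single monoidRing 0# g (λ x≈y → B.+-congʳ ([]-cong (^ᴷ-congˡ (suc u) x≈y)))
          (λ x x≉0 → B.trans (B.+-congʳ ([]-cong (trans (^ᴷ-congʳ x eq) (^-div q-1 k x≉0 suc-q-1)))) (B.-‿inverseʳ B.1#))) ∑-one))
      collapse : σ (suc u) B.- const (value (suc u)) B.≈ [ 0# ^ᴷ suc u ]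
      collapse = B.trans (B.+-cong σ≈ (B.-‿cong (B.trans (const-cong (q-value (multipleIndicator-false q-1 (suc u) (ℕD.divides k eq)) (multipleIndicator-true q-1 u (ℕD.divides k eq))))
          (const-+ (+ q) (ℤ.- + 1)))))
        (BS.solve 3 (λ z o c → ((z BS.:- o) BS.:+ c) BS.:- (c BS.:+ (BS.:- o)) BS.:= z) B.refl [ 0# ^ᴷ suc u ] B.1# (const (+ q)))
    split u@(suc _) (no ¬d) = F-≈ (B.sym (B.trans (B.+-congˡ (B.-‿cong (B.trans (const-cong value≡0) const-0))) (B.+-identityʳ (σ u))))
        (cancelled (nontrivial-power q-1 u suc-q-1 ¬d))
      where
      value≡0 : value u ≡ + 0
      value≡0 = ≡.trans (≡.cong₂ (λ a b → + q ℤ.* a ℤ.- b) (multipleIndicator-∤ q-1 false u ¬d) (multipleIndicator-∤ q-1 true u ¬d)) (≡.trans (ℤₚ.+-identityʳ _) (ℤₚ.*-zeroʳ (+ q)))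
      cancelled : (∃ λ g → ¬ g ≈ 0# × ¬ g ^ᴷ u ≈ 1#) → InF n (σ u)
      cancelled (g , g≉0 , g^u≉1) = F-cancel ([ g ^ᴷ u ] B.- B.1#) (σ u)
        (λ eq → g^u≉1 (sub≈0 (trans (sym (trans (ε-++ [ g ^ᴷ u ] (⊖ B.1#)) (+-cong (ε-[] (g ^ᴷ u)) (trans (ε-⊖ B.1#) (-‿cong (ε-const (+ 1))))))) eq)))
        (F-≈ (B.sym (B.trans (BS.solve 3 (λ a o s → (a BS.:- BS.con (+ 1)) BS.:* s BS.:= a BS.:* s BS.:- s) B.refl [ g ^ᴷ u ] B.1# (σ u))
          (B.trans (B.+-congʳ (B.trans (B.sym (∑B.∑-*ˡ elems [ g ^ᴷ u ] (λ x → [ x ^ᴷ u ])))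
              (B.trans (∑B.∑-cong elems (λ x → B.trans ([]-* (g ^ᴷ u) (x ^ᴷ u)) ([]-cong (sym (^-distrib-* g x u)))))
                (multiplicative-substitution monoidRing g≉0 (λ x → [ x ^ᴷ u ]) (λ x≈y → []-cong (^ᴷ-congˡ u x≈y))))))
            (B.-‿inverseʳ (σ u))))) (F-[] n))

  points : ∀ n → List (Vec Carrier n)
  points zero    = [] ∷ []
  points (suc n) = concatMap (λ x → map (x ∷_) (points n)) elems

  monomial : ∀ {n} → Vec Carrier n → Vec ℕ n → Carrier
  monomial []       []       = 1#
  monomial (x ∷ xs) (u ∷ us) = x ^ᴷ u * monomial xs us

  monomial-+ : ∀ {n} (x : Vec Carrier n) u v → monomial x (Vec.zipWith ℕ._+_ u v) ≈ monomial x u * monomial x v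
  monomial-+ []       []       []       = sym (*-identityˡ 1#)
  monomial-+ (x ∷ xs) (u ∷ us) (v ∷ vs) = trans (*-cong (^ᴷ-homo-* x u v) (monomial-+ xs us vs))
    (KS.solve 4 (λ a b c d → (a KS.:* b) KS.:* (c KS.:* d) KS.:= (a KS.:* c) KS.:* (b KS.:* d)) refl (x ^ᴷ u) (x ^ᴷ v) (monomial xs us) (monomial xs vs))

  values : ∀ {n} → Vec ℕ n → ℤ
  values []       = + 1
  values (u ∷ us) = value u ℤ.* values us

  points-monomial : ∀ N {n} (us : Vec ℕ n) → InF N (∑ᴮ (points n) (λ x → [ monomial x us ]) B.- const (values us))
  points-monomial N [] = F-≈ (B.sym (B.trans (B.+-congʳ (B.+-identityʳ B.1#)) (B.-‿inverseʳ B.1#))) (F-[] N)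
  points-monomial N {suc n} (u ∷ us) = F-≈ (B.+-cong (B.sym factor) (B.-‿cong (B.sym (const-* (value u) (values us)))))
    (F-product (σ u) (∑ᴮ (points n) (λ x → [ monomial x us ])) (const (value u)) (const (values us)) (σ-value N u) (points-monomial N us))
    where
    factor : ∑ᴮ (points (suc n)) (λ x → [ monomial x (u ∷ us) ]) B.≈ σ u ⊗ ∑ᴮ (points n) (λ x → [ monomial x us ])
    factor = B.trans (∑B.∑-concatMap (λ x → map (x ∷_) (points n)) elems _) (B.trans
      (∑B.∑-cong elems (λ x → B.trans (∑B.∑-map (x ∷_) (points n) _) (∑B.∑-cong (points n) (λ xs → B.sym ([]-* (x ^ᴷ u) (monomial xs us))))))
      (B.sym (∑B.∑-*∑ elems (points n) (λ x → [ x ^ᴷ u ]) (λ xs → [ monomial xs us ]))))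

  evaluate : ∀ {n} → Vec Carrier n → List (ℤ × Vec ℕ n) → FormalSum
  evaluate x H = map (λ t → proj₁ t , monomial x (proj₂ t)) H

  points-evaluate : ∀ N {n} (H : List (ℤ × Vec ℕ n)) →
    InF N (∑ᴮ (points n) (λ x → evaluate x H) B.- const (∑ H (λ t → proj₁ t ℤ.* values (proj₂ t))))
  points-evaluate N {n} [] = F-≈ (B.sym (B.trans (B.+-cong (∑B.∑-zero (points n) (λ _ → B.refl)) (B.-‿cong const-0)) (B.-‿inverseʳ B.0#))) (F-[] N)
  points-evaluate N {n} ((c , us) ∷ H) = F-≈ (B.+-cong (B.sym left) (B.-‿cong (B.sym (B.trans (const-+ (c ℤ.* values us) rest) (B.+-congʳ (const-* c (values us)))))))
    (F-sum (const c ⊗ M) (∑ᴮ (points n) (λ x → evaluate x H)) (const c ⊗ const (values us)) (const rest)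
      (F-≈ (BS.solve 3 (λ c m v → c BS.:* (m BS.:- v) BS.:= c BS.:* m BS.:- c BS.:* v) B.refl (const c) M (const (values us))) (F-⊗ (const c) (points-monomial N us)))
      (points-evaluate N H))
    where
    M : FormalSum
    M = ∑ᴮ (points n) (λ x → [ monomial x us ])
    rest : ℤ
    rest = ∑ H (λ t → proj₁ t ℤ.* values (proj₂ t))
    single-term : ∀ y → (c , y) ∷ [] B.≈ const c ⊗ [ y ]
    single-term y = exact λ φ φ-resp → ≡.trans (ℤₚ.+-identityʳ (c ℤ.* φ y)) (≡.sym (≡.trans (⟪const⊗⟫ c [ y ] φ-resp) (≡.cong (c ℤ.*_) (⟪[]⟫ y φ))))
    left : ∑ᴮ (points n) (λ x → evaluate x ((c , us) ∷ H)) B.≈ (const c ⊗ M) B.+ ∑ᴮ (points n) (λ x → evaluate x H)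
    left = B.trans (∑B.∑-+ (points n) (λ x → (c , monomial x us) ∷ []) (λ x → evaluate x H))
      (B.+-congʳ (B.trans (∑B.∑-cong (points n) (λ x → single-term (monomial x us))) (∑B.∑-*ˡ (points n) (const c) (λ x → [ monomial x us ]))))

-- Integer polynomials, Frobenius lift and lattice boxes

vecMonoid : ℕ → CommutativeMonoid 0ℓ 0ℓ
vecMonoid n = record
  { Carrier = Vec ℕ n ; _≈_ = _≡_ ; _∙_ = Vec.zipWith ℕ._+_ ; ε = Vec.replicate n 0
  ; isCommutativeMonoid = record
    { isMonoid = record
      { isSemigroup = record
        { isMagma = record { isEquivalence = ≡.isEquivalence ; ∙-cong = ≡.cong₂ (Vec.zipWith ℕ._+_) }
        ; assoc = VecP.zipWith-assoc ℕₚ.+-assoc }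
      ; identity = VecP.zipWith-identityˡ ℕₚ.+-identityˡ , VecP.zipWith-identityʳ ℕₚ.+-identityʳ }
    ; comm = VecP.zipWith-comm ℕₚ.+-comm } }
  where import Data.Vec.Properties as VecP

-- Says that multiplication by the monomial u carries the box of side D into the box of side D′.
Fits : ∀ {n} → ℕ → ℕ → Vec ℕ n → Set
Fits D D′ []       = ⊤
Fits D D′ (u ∷ us) = (u ℕ.+ D ℕ.≤ D′) × Fits D D′ us

module Polynomials (n : ℕ) where
  open FormalSums (vecMonoid n) public
  module 𝒫 = CommutativeRing monoidRing
  open ListSum ℤₚ.+-*-commutativeRing using (∑)
  open import Algebra.Properties.Semiring.Exp 𝒫.semiring using (_^_)
  open import Algebra.Properties.Semiring.Mult 𝒫.semiring using () renaming (_×_ to _·_)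
  open ≡ using (refl; sym; trans; cong; cong₂; subst)

  respects : ∀ φ → Respects φ
  respects φ refl = refl

  -- Phrased through pairings, so that monomials which cancel do not count and the bound combines
  -- directly with the formula for pairings of products.
  Supported : FormalSum → ℕ → ℕ → Set
  Supported a D D′ = ∀ φ → (∀ u → Fits D D′ u → φ u ≡ + 0) → ⟪ a ⟫ φ ≡ + 0

  supported-cong : ∀ a {D D′ φ ψ} → Supported a D D′ → (∀ u → Fits D D′ u → φ u ≡ ψ u) → ⟪ a ⟫ φ ≡ ⟪ a ⟫ ψ
  supported-cong a {φ = φ} {ψ} supp φ≡ψ = ℤₚ.i-j≡0⇒i≡j (⟪ a ⟫ φ) (⟪ a ⟫ ψ) (trans (sym difference)
      (supp (λ u → φ u ℤ.+ ℤ.- + 1 ℤ.* ψ u) (λ u fits → trans (cong₂ ℤ._+_ (φ≡ψ u fits) (ℤₚ.-1*i≡-i (ψ u))) (ℤₚ.+-inverseʳ (ψ u)))))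
    where
    difference : ⟪ a ⟫ (λ u → φ u ℤ.+ ℤ.- + 1 ℤ.* ψ u) ≡ ⟪ a ⟫ φ ℤ.- ⟪ a ⟫ ψ
    difference = trans (⟪⟫-+ a φ (λ u → ℤ.- + 1 ℤ.* ψ u)) (cong (ℤ._+_ (⟪ a ⟫ φ)) (trans (⟪⟫-* a (ℤ.- + 1) ψ) (ℤₚ.-1*i≡-i (⟪ a ⟫ ψ))))

  supported-[] : ∀ {D D′} → Supported [] D D′
  supported-[] φ h = refl

  supported-weaken : ∀ {a D D′ E E′} → (∀ u → u ℕ.+ D ℕ.≤ D′ → u ℕ.+ E ℕ.≤ E′) → Supported a D D′ → Supported a E E′
  supported-weaken {a} {D} {D′} {E} {E′} h supp φ φ≡0 = supp φ (λ u fits → φ≡0 u (go u fits))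
    where
    go : ∀ {n} (u : Vec ℕ n) → Fits D D′ u → Fits E E′ u
    go []       _          = _
    go (u ∷ us) (le , les) = h u le , go us les

  supported-++ : ∀ {a b D D′} → Supported a D D′ → Supported b D D′ → Supported (a ++ b) D D′
  supported-++ {a} {b} supp supp′ φ φ≡0 = trans (⟪++⟫ a b φ) (cong₂ ℤ._+_ (supp φ φ≡0) (supp′ φ φ≡0))

  supported-⊗ : ∀ {a b A A′ B B′} → Supported a A A′ → Supported b B B′ → Supported (a ⊗ b) (A ℕ.+ B) (A′ ℕ.+ B′)
  supported-⊗ {a} {b} {A} {A′} {B} {B′} supp supp′ φ φ≡0 = trans (⟪⊗⟫ a b φ)
      (supp _ (λ u fits → supp′ _ (λ v fits′ → φ≡0 _ (add u v fits fits′))))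
    where
    add : ∀ {n} (u v : Vec ℕ n) → Fits A A′ u → Fits B B′ v → Fits (A ℕ.+ B) (A′ ℕ.+ B′) (Vec.zipWith ℕ._+_ u v)
    add []       []       _          _            = _
    add (u ∷ us) (v ∷ vs) (le , les) (le′ , les′) =
      subst (ℕ._≤ A′ ℕ.+ B′) (lemma u A v B) (ℕₚ.+-mono-≤ le le′) , add us vs les les′
      where
      open import Data.Nat.Tactic.RingSolver using (solve-∀)
      lemma : ∀ u A v B → (u ℕ.+ A) ℕ.+ (v ℕ.+ B) ≡ (u ℕ.+ v) ℕ.+ (A ℕ.+ B)
      lemma = solve-∀

  supported-∑ : {A : Set} (xs : List A) (f : A → FormalSum) {D D′ : ℕ} → (∀ x → x ∈ xs → Supported (f x) D D′) → Supported (ListSum.∑ monoidRing xs f) D D′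
  supported-∑ []       f h = supported-[]
  supported-∑ (x ∷ xs) f h = supported-++ {f x} {ListSum.∑ monoidRing xs f} (h x (here refl)) (supported-∑ xs f (λ y y∈ → h y (there y∈)))

  supported-const : ∀ c → Supported (const c) 0 0
  supported-const c φ φ≡0 = trans (⟪const⟫ c φ) (trans (cong (c ℤ.*_) (φ≡0 (Vec.replicate n 0) (zeros n))) (ℤₚ.*-zeroʳ c))
    where
    zeros : ∀ n → Fits 0 0 (Vec.replicate n 0)
    zeros zero    = _
    zeros (suc n) = z≤n , zeros n

  supported-^ : ∀ {a A} k → Supported a 0 A → Supported (a ^ k) 0 (k ℕ.* A)
  supported-^ zero    supp = supported-const (+ 1)
  supported-^ {a} (suc k) supp = supported-⊗ {a} {a ^ k} supp (supported-^ k supp)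

  supported-· : ∀ {a D D′} k → Supported a D D′ → Supported (k · a) D D′
  supported-· zero    supp = supported-[]
  supported-· {a} (suc k) supp = supported-++ {a} {k · a} supp (supported-· k supp)

  ·-const : ∀ k a → k · a ∼ const (+ k) ⊗ a
  ·-const k a = exact λ φ _ → trans (go k φ) (sym (⟪const⊗⟫ (+ k) a (respects φ)))
    where
    go : ∀ k φ → ⟪ k · a ⟫ φ ≡ + k ℤ.* ⟪ a ⟫ φ
    go zero    φ = sym (ℤₚ.*-zeroˡ (⟪ a ⟫ φ))
    go (suc k) φ = trans (⟪++⟫ a (k · a) φ) (trans (cong (ℤ._+_ (⟪ a ⟫ φ)) (go k φ)) (sym (ℤₚ.suc-* (+ k) (⟪ a ⟫ φ))))

  -- The substitution x ↦ x ^ p in all variables.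
  frobenius : ℕ → FormalSum → FormalSum
  frobenius p a = map (λ t → proj₁ t , Vec.map (p ℕ.*_) (proj₂ t)) a

  ⟪frobenius⟫ : ∀ p a φ → ⟪ frobenius p a ⟫ φ ≡ ⟪ a ⟫ (λ u → φ (Vec.map (p ℕ.*_) u))
  ⟪frobenius⟫ p []      φ = refl
  ⟪frobenius⟫ p (t ∷ a) φ = cong (ℤ._+_ (proj₁ t ℤ.* φ (Vec.map (p ℕ.*_) (proj₂ t)))) (⟪frobenius⟫ p a φ)

  supported-frobenius : ∀ p {a D D′} → Supported a D D′ → Supported (frobenius p a) (p ℕ.* D) (p ℕ.* D′)
  supported-frobenius p {a} {D} {D′} supp φ φ≡0 = trans (⟪frobenius⟫ p a φ) (supp _ (λ u fits → φ≡0 _ (go u fits)))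
    where
    go : ∀ {n} (u : Vec ℕ n) → Fits D D′ u → Fits (p ℕ.* D) (p ℕ.* D′) (Vec.map (p ℕ.*_) u)
    go []       _          = _
    go (u ∷ us) (le , les) = subst (ℕ._≤ p ℕ.* D′) (ℕₚ.*-distribˡ-+ p u D) (ℕₚ.*-monoʳ-≤ p le) , go us les

  -- Coefficients are expressed by repetition of monomials. Then f(x) ^ p and f(x ^ p) agree modulo
  -- p by the binomial theorem alone, and the defect is built one monomial at a time.
  fromMonomials : List (Vec ℕ n) → FormalSum
  fromMonomials = map (λ u → + 1 , u)

  supported-fromMonomials : ∀ {A} us → (∀ u → u ∈ us → Fits 0 A u) → Supported (fromMonomials us) 0 A
  supported-fromMonomials []       h φ φ≡0 = refl
  supported-fromMonomials (u ∷ us) h φ φ≡0 = cong₂ ℤ._+_ (trans (cong (+ 1 ℤ.*_) (φ≡0 u (h u (here refl)))) refl)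
    (supported-fromMonomials us (λ v v∈ → h v (there v∈)) φ φ≡0)

  module FrobeniusDefect {m : ℕ} (pp : Prime (suc m)) where
    private
      p : ℕ
      p = suc m
    open BinomialExpansion monoidRing 𝒫.1# using (horner)
    open FreshmanDream monoidRing m (PrimeCoefficients.coefficient pp) (PrimeCoefficients.coefficient-eq pp)

    defect : List (Vec ℕ n) → FormalSum
    defect []       = []
    defect (u ∷ us) = defect us ++ quotient (fromMonomials (u ∷ [])) (fromMonomials us)

    private
      monomial-^ : ∀ u k → fromMonomials (u ∷ []) ^ k ∼ fromMonomials (Vec.map (k ℕ.*_) u ∷ [])
      monomial-^ u zero = exact λ φ _ → cong (λ v → + 1 ℤ.* φ v ℤ.+ + 0) (sym (map-zero u))
        where
        map-zero : ∀ {n} (u : Vec ℕ n) → Vec.map (0 ℕ.*_) u ≡ Vec.replicate n 0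
        map-zero []       = refl
        map-zero (u ∷ us) = cong (0 ∷_) (map-zero us)
      monomial-^ u (suc k) = 𝒫.trans (𝒫.*-congˡ {fromMonomials (u ∷ [])} (monomial-^ u k)) (exact λ φ _ → cong (λ v → + 1 ℤ.* φ v ℤ.+ + 0) (map-suc k u))
        where
        map-suc : ∀ k {n} (u : Vec ℕ n) → Vec.zipWith ℕ._+_ u (Vec.map (k ℕ.*_) u) ≡ Vec.map (suc k ℕ.*_) u
        map-suc k []       = refl
        map-suc k (u ∷ us) = cong (u ℕ.+ k ℕ.* u ∷_) (map-suc k us)

    defect-relation : ∀ us → frobenius p (fromMonomials us) 𝒫.+ const (+ p) ⊗ defect us ∼ fromMonomials us ^ p
    defect-relation [] = 𝒫.trans (𝒫.zeroʳ (const (+ p))) (𝒫.sym (𝒫.zeroˡ ([] ^ m)))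
    defect-relation (u ∷ us) = 𝒫.sym (𝒫.trans (freshman a b) (𝒫.trans
        (𝒫.+-cong (𝒫.+-cong (monomial-^ u p) (𝒫.sym (defect-relation us))) (·-const p (quotient a b)))
        (IntegerSolver.solve monoidRing 5 (λ x y c d e → (x :+ (y :+ c :* d)) :+ c :* e := (x :+ y) :+ c :* (d :+ e)) 𝒫.refl
          (fromMonomials (Vec.map (p ℕ.*_) u ∷ [])) (frobenius p b) (const (+ p)) (defect us) (quotient a b))))
      where
      open IntegerSolver monoidRing using (_:=_; _:+_; _:*_)
      a b : FormalSum
      a = fromMonomials (u ∷ [])
      b = fromMonomials us

    supported-defect : ∀ {A} us → (∀ u → u ∈ us → Fits 0 A u) → Supported (defect us) 0 (p ℕ.* A)
    supported-defect []           h = supported-[]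
    supported-defect {A} (u ∷ us) h = supported-++ {defect us} {quotient a b} (supported-defect us (λ v v∈ → h v (there v∈)))
        (supported-⊗ {a} {horner a (quotientTerm b) m} supp-a (horner-support m))
      where
      a b : FormalSum
      a = fromMonomials (u ∷ [])
      b = fromMonomials us
      supp-a : Supported a 0 A
      supp-a = supported-fromMonomials (u ∷ []) (λ { v (here eq) → h v (here eq) })
      supp-b : Supported b 0 A
      supp-b = supported-fromMonomials us (λ v v∈ → h v (there v∈))
      term-support : ∀ i → Supported (quotientTerm b i) 0 (i ℕ.* A)
      term-support zero    = supported-[]
      term-support (suc i) = supported-· (PrimeCoefficients.coefficient pp i) (supported-^ {b} (suc i) supp-b)
      horner-support : ∀ j → Supported (horner a (quotientTerm b) j) 0 (j ℕ.* A)
      horner-support zero    = term-support zero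
      horner-support (suc j) = supported-++ {a ⊗ horner a (quotientTerm b) j} {quotientTerm b (suc j)}
        (supported-⊗ {a} {horner a (quotientTerm b) j} supp-a (horner-support j)) (term-support (suc j))

module Boxes where
  open ListSum ℤₚ.+-*-commutativeRing
  open Matrices ℤₚ.+-*-commutativeRing using (δ; δ-refl; δ-≢)
  open ≡ using (refl; sym; trans; cong; cong₂; subst)

  -- The exponents 0, ..., D or 1, ..., D. The two modes lead to counting all multiples of q - 1 and
  -- only the nonzero ones.
  range : Bool → ℕ → List ℕ
  range false D = downFrom (suc D)
  range true  D = map suc (downFrom D)

  AtLeast : Bool → ℕ → Set
  AtLeast s v = s ≡ true → 0 ℕ.< v

  private
    downFrom-< : ∀ {n x} → x ∈ downFrom n → x ℕ.< n
    downFrom-< {suc n} (here refl) = ℕₚ.≤-refl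
    downFrom-< {suc n} (there x∈)  = ℕₚ.m≤n⇒m≤1+n (downFrom-< x∈)

  range-bounds : ∀ s D {v} → v ∈ range s D → v ℕ.≤ D × AtLeast s v
  range-bounds false D v∈ = ℕₚ.≤-pred (downFrom-< v∈) , λ ()
  range-bounds true  D v∈ with ∈-map⁻ suc v∈
    where open import Data.List.Membership.Propositional.Properties using (∈-map⁻)
  ... | w , w∈ , refl = downFrom-< w∈ , λ _ → s≤s z≤n

  range-zero : ∀ s D {g} → (∀ v → g v ≡ + 0) → ∑ (range s D) g ≡ + 0
  range-zero s D h = ∑-zero (range s D) h

  range-single : ∀ s D {g} j → j ℕ.≤ D → AtLeast s j → (∀ v → v ≢ j → g v ≡ + 0) → ∑ (range s D) g ≡ g j
  range-single false D j j≤D _ h = ∑<-single (suc D) j (s≤s j≤D) (λ i _ i≢j → h i i≢j)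
  range-single true D zero j≤D 0<j h with () ← 0<j refl
  range-single true D {g} (suc j) j≤D _ h = trans (∑-map suc (downFrom D) g)
    (∑<-single D j j≤D (λ i _ i≢j → h (suc i) (i≢j ∘ ℕₚ.suc-injective)))

  -- One step of a closed walk: the intermediate vertex is (v + u₁) / p.
  range-step : ∀ s p .{{_ : ℕ.NonZero p}} Q v″ v u₁ u₂ D D′ → u₁ ℕ.+ D ℕ.≤ p ℕ.* D′ → v ℕ.≤ D → AtLeast s v →
    ∑ (range s D′) (λ v′ → δ (Q ℕ.* v″) (v′ ℕ.+ u₂) ℤ.* δ (p ℕ.* v′) (v ℕ.+ u₁)) ≡ δ (p ℕ.* (Q ℕ.* v″)) (v ℕ.+ (p ℕ.* u₂ ℕ.+ u₁))
  range-step s p Q v″ v u₁ u₂ D D′ fits v≤D s≤v with (p ℕ.* (Q ℕ.* v″)) ℕₚ.≟ (v ℕ.+ (p ℕ.* u₂ ℕ.+ u₁))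
  ... | no ≢ = trans (range-zero s D′ vanish) (sym (δ-≢ _ _ ≢))
    where
    lemma : ∀ p v′ u₂ → p ℕ.* (v′ ℕ.+ u₂) ≡ p ℕ.* v′ ℕ.+ p ℕ.* u₂
    lemma p v′ u₂ = ℕₚ.*-distribˡ-+ p v′ u₂
    rearrange : ∀ v u₁ w → (v ℕ.+ u₁) ℕ.+ w ≡ v ℕ.+ (w ℕ.+ u₁)
    rearrange v u₁ w = trans (ℕₚ.+-assoc v u₁ w) (cong (v ℕ.+_) (ℕₚ.+-comm u₁ w))
    vanish : ∀ v′ → δ (Q ℕ.* v″) (v′ ℕ.+ u₂) ℤ.* δ (p ℕ.* v′) (v ℕ.+ u₁) ≡ + 0
    vanish v′ with (Q ℕ.* v″) ℕₚ.≟ (v′ ℕ.+ u₂) | (p ℕ.* v′) ℕₚ.≟ (v ℕ.+ u₁)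
    ... | no ≢₁  | _      = trans (cong (ℤ._* δ (p ℕ.* v′) (v ℕ.+ u₁)) (δ-≢ _ _ ≢₁)) (ℤₚ.*-zeroˡ (δ (p ℕ.* v′) (v ℕ.+ u₁)))
    ... | yes _  | no ≢₂  = trans (cong (δ (Q ℕ.* v″) (v′ ℕ.+ u₂) ℤ.*_) (δ-≢ _ _ ≢₂)) (ℤₚ.*-zeroʳ (δ (Q ℕ.* v″) (v′ ℕ.+ u₂)))
    ... | yes eq₁ | yes eq₂ = ⊥-elim (≢ (trans (cong (p ℕ.*_) eq₁) (trans (lemma p v′ u₂) (trans (cong (ℕ._+ p ℕ.* u₂) eq₂) (rearrange v u₁ (p ℕ.* u₂))))))
  ... | yes eq = trans (range-single s D′ j j≤D′ s≤j others) (trans (cong₂ ℤ._*_ (δ-≡ Qv″≡) (δ-≡ pj≡)) (sym (δ-≡ eq)))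
    where
    δ-≡ : ∀ {a b} → a ≡ b → δ a b ≡ + 1
    δ-≡ {a} refl = δ-refl a
    rearrange : ∀ v u₁ w → v ℕ.+ (w ℕ.+ u₁) ≡ w ℕ.+ (v ℕ.+ u₁)
    rearrange v u₁ w = trans (sym (ℕₚ.+-assoc v w u₁)) (trans (cong (ℕ._+ u₁) (ℕₚ.+-comm v w)) (ℕₚ.+-assoc w v u₁))
    eq′ : p ℕ.* (Q ℕ.* v″) ≡ p ℕ.* u₂ ℕ.+ (v ℕ.+ u₁)
    eq′ = trans eq (rearrange v u₁ (p ℕ.* u₂))
    j : ℕ
    j = Q ℕ.* v″ ℕ.∸ u₂
    pj≡ : p ℕ.* j ≡ v ℕ.+ u₁
    pj≡ = trans (ℕₚ.*-distribˡ-∸ p (Q ℕ.* v″) u₂) (trans (cong (ℕ._∸ p ℕ.* u₂) eq′) (ℕₚ.m+n∸m≡n (p ℕ.* u₂) (v ℕ.+ u₁)))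
    u₂≤ : u₂ ℕ.≤ Q ℕ.* v″
    u₂≤ = ℕₚ.*-cancelˡ-≤ p (subst (p ℕ.* u₂ ℕ.≤_) (sym eq′) (ℕₚ.m≤m+n (p ℕ.* u₂) (v ℕ.+ u₁)))
    Qv″≡ : Q ℕ.* v″ ≡ j ℕ.+ u₂
    Qv″≡ = sym (ℕₚ.m∸n+n≡m u₂≤)
    -- The support condition u₁ + D ≤ p D′ keeps the intermediate vertex inside its box, so cutting
    -- down to finite boxes loses no walk.
    j≤D′ : j ℕ.≤ D′
    j≤D′ = ℕₚ.*-cancelˡ-≤ p (subst (ℕ._≤ p ℕ.* D′) (sym pj≡) (ℕₚ.≤-trans (ℕₚ.+-monoˡ-≤ u₁ v≤D) (subst (ℕ._≤ p ℕ.* D′) (ℕₚ.+-comm u₁ D) fits)))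
    s≤j : AtLeast s j
    s≤j s≡ = ℕₚ.n≢0⇒n>0 (λ j≡0 → ℕₚ.<⇒≢ (ℕₚ.≤-trans (s≤v s≡) (ℕₚ.m≤m+n v u₁)) (trans (sym (ℕₚ.*-zeroʳ p)) (trans (cong (p ℕ.*_) (sym j≡0)) pj≡)))
    others : ∀ v′ → v′ ≢ j → δ (Q ℕ.* v″) (v′ ℕ.+ u₂) ℤ.* δ (p ℕ.* v′) (v ℕ.+ u₁) ≡ + 0
    others v′ v′≢j = trans (cong (δ (Q ℕ.* v″) (v′ ℕ.+ u₂) ℤ.*_) (δ-≢ _ _ (λ eq₂ → v′≢j (ℕₚ.*-cancelˡ-≡ v′ j p (trans eq₂ (sym pj≡)))))) (ℤₚ.*-zeroʳ (δ (Q ℕ.* v″) (v′ ℕ.+ u₂)))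

  -- A closed walk from v needs q v = v + u with q = m + 1, that is m v = u. The bound on u puts
  -- this v into the range, so the sum is 1 or 0.
  range-closed : ∀ s m .{{_ : ℕ.NonZero m}} u D → u ℕ.+ D ℕ.≤ suc m ℕ.* D →
    ∑ (range s D) (λ v → δ (suc m ℕ.* v) (v ℕ.+ u)) ≡ multipleIndicator m s u
  range-closed s m u D fits = split s u fits (m ℕD.∣? u)
    where
    off : ∀ u v → m ℕ.* v ≢ u → δ (suc m ℕ.* v) (v ℕ.+ u) ≡ + 0
    off u v ≢ = δ-≢ _ _ (≢ ∘ ℕₚ.+-cancelˡ-≡ v _ _)
    single : ∀ s u k → u ≡ k ℕ.* m → u ℕ.+ D ℕ.≤ suc m ℕ.* D → AtLeast s k → ∑ (range s D) (λ v → δ (suc m ℕ.* v) (v ℕ.+ u)) ≡ + 1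
    single s u k refl fits s≤k = trans (range-single s D k k≤D s≤k (λ v v≢k → off (k ℕ.* m) v (λ eq → v≢k (ℕₚ.*-cancelˡ-≡ v k m (trans eq (ℕₚ.*-comm k m))))))
        (subst (λ x → δ (suc m ℕ.* k) x ≡ + 1) (cong (k ℕ.+_) (ℕₚ.*-comm m k)) (δ-refl (suc m ℕ.* k)))
      where
      k≤D : k ℕ.≤ D
      k≤D = ℕₚ.*-cancelˡ-≤ m (ℕₚ.+-cancelˡ-≤ D (m ℕ.* k) (m ℕ.* D) (subst (ℕ._≤ D ℕ.+ m ℕ.* D) (trans (ℕₚ.+-comm (k ℕ.* m) D) (cong (D ℕ.+_) (ℕₚ.*-comm k m))) fits))
    split : ∀ s u → u ℕ.+ D ℕ.≤ suc m ℕ.* D → Dec (m ℕD.∣ u) → ∑ (range s D) (λ v → δ (suc m ℕ.* v) (v ℕ.+ u)) ≡ multipleIndicator m s u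
    split s     u       fits (no m∤u) = trans (range-zero s D (λ v → off u v (λ eq → m∤u (ℕD.divides v (trans (sym eq) (ℕₚ.*-comm m v))))))
      (sym (multipleIndicator-∤ m s u m∤u))
    split false u       fits (yes d@(ℕD.divides k eq)) = trans (single false u k eq fits (λ ())) (sym (multipleIndicator-false m u d))
    split true  zero    fits (yes d) = trans (trans (∑-map suc (downFrom D) _) (∑-zero (downFrom D) (λ v → off 0 (suc v) (λ eq → ℕ.≢-nonZero⁻¹ (m ℕ.* suc v) {{ℕₚ.m*n≢0 m (suc v)}} eq))))
      (sym (multipleIndicator-0 m))
    split true  (suc u) fits (yes d@(ℕD.divides k eq)) = trans (single true (suc u) k eq fits (λ _ → positive k eq)) (sym (multipleIndicator-true m u d))
      where
      positive : ∀ k → suc u ≡ k ℕ.* m → 0 ℕ.< k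
      positive (suc k) _ = s≤s z≤n

  box : ∀ {n} → Vec Bool n → ℕ → List (Vec ℕ n)
  box []       D = [] ∷ []
  box (s ∷ S) D = concatMap (λ v → map (v ∷_) (box S D)) (range s D)

  δᵥ : ∀ {n} → Vec ℕ n → Vec ℕ n → ℤ
  δᵥ []       []       = + 1
  δᵥ (u ∷ us) (v ∷ vs) = δ u v ℤ.* δᵥ us vs

  indicators : ∀ {n} → ℕ → Vec Bool n → Vec ℕ n → ℤ
  indicators m []      []       = + 1
  indicators m (s ∷ S) (u ∷ us) = multipleIndicator m s u ℤ.* indicators m S us

  InBox : ∀ {n} → Vec Bool n → ℕ → Vec ℕ n → Set
  InBox []      D []       = ⊤
  InBox (s ∷ S) D (v ∷ vs) = (v ℕ.≤ D × AtLeast s v) × InBox S D vs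

  box-bounds : ∀ {n} (S : Vec Bool n) D {v} → v ∈ box S D → InBox S D v
  box-bounds []      D (here refl) = _
  box-bounds (s ∷ S) D {v} v∈ = go (range s D) id v∈
    where
    open import Data.List.Membership.Propositional.Properties using (∈-map⁻; ∈-++⁻)
    go : ∀ rs → (∀ {w} → w ∈ rs → w ∈ range s D) → v ∈ concatMap (λ v → map (v ∷_) (box S D)) rs → InBox (s ∷ S) D v
    go (w ∷ rs) rs⊆ v∈ with ∈-++⁻ (map (w ∷_) (box S D)) v∈
    ... | inj₂ v∈′ = go rs (rs⊆ ∘ there) v∈′
    ... | inj₁ v∈′ with ∈-map⁻ (w ∷_) v∈′
    ...   | vs , vs∈ , refl = range-bounds s D (rs⊆ (here refl)) , box-bounds S D vs∈

  box-factor : ∀ {n} s (S : Vec Bool n) D (g : ℕ → ℤ) (G : Vec ℕ n → ℤ) (F : Vec ℕ (suc n) → ℤ) →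
    (∀ v vs → F (v ∷ vs) ≡ g v ℤ.* G vs) → ∑ (box (s ∷ S) D) F ≡ ∑ (range s D) g ℤ.* ∑ (box S D) G
  box-factor s S D g G F h = trans (∑-concatMap (λ v → map (v ∷_) (box S D)) (range s D) F)
    (trans (∑-cong (range s D) (λ v → trans (∑-map (v ∷_) (box S D) F) (∑-cong (box S D) (h v)))) (sym (∑-*∑ (range s D) (box S D) g G)))

  box-step : ∀ {n} (S : Vec Bool n) p .{{_ : ℕ.NonZero p}} Q v″ v u₁ u₂ D D′ → Fits D (p ℕ.* D′) u₁ → InBox S D v →
    ∑ (box S D′) (λ v′ → δᵥ (Vec.map (Q ℕ.*_) v″) (Vec.zipWith ℕ._+_ v′ u₂) ℤ.* δᵥ (Vec.map (p ℕ.*_) v′) (Vec.zipWith ℕ._+_ v u₁))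
      ≡ δᵥ (Vec.map (p ℕ.*_) (Vec.map (Q ℕ.*_) v″)) (Vec.zipWith ℕ._+_ v (Vec.zipWith ℕ._+_ (Vec.map (p ℕ.*_) u₂) u₁))
  box-step []      p Q []         []       []         []         D D′ _          _                   = refl
  box-step (s ∷ S) p Q (v″ ∷ vs″) (v ∷ vs) (u₁ ∷ us₁) (u₂ ∷ us₂) D D′ (fit , fits) ((v≤D , s≤v) , inbox) = trans
    (box-factor s S D′ (λ v′ → δ (Q ℕ.* v″) (v′ ℕ.+ u₂) ℤ.* δ (p ℕ.* v′) (v ℕ.+ u₁)) _ _
      (λ v′ vs′ → interchange (δ (Q ℕ.* v″) (v′ ℕ.+ u₂)) (δᵥ (Vec.map (Q ℕ.*_) vs″) (Vec.zipWith ℕ._+_ vs′ us₂)) (δ (p ℕ.* v′) (v ℕ.+ u₁)) (δᵥ (Vec.map (p ℕ.*_) vs′) (Vec.zipWith ℕ._+_ vs us₁))))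
    (cong₂ ℤ._*_ (range-step s p Q v″ v u₁ u₂ D D′ fit v≤D s≤v) (box-step S p Q vs″ vs us₁ us₂ D D′ fits inbox))
    where
    open import Data.Integer.Tactic.RingSolver using (solve-∀)
    interchange : ∀ a b c d → (a ℤ.* b) ℤ.* (c ℤ.* d) ≡ (a ℤ.* c) ℤ.* (b ℤ.* d)
    interchange = solve-∀

  box-closed : ∀ {n} (S : Vec Bool n) m .{{_ : ℕ.NonZero m}} u D → Fits D (suc m ℕ.* D) u →
    ∑ (box S D) (λ v → δᵥ (Vec.map (suc m ℕ.*_) v) (Vec.zipWith ℕ._+_ v u)) ≡ indicators m S u
  box-closed []      m []       D _            = refl
  box-closed (s ∷ S) m (u ∷ us) D (fit , fits) = trans
    (box-factor s S D (λ v → δ (suc m ℕ.* v) (v ℕ.+ u)) _ _ (λ v vs → refl))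
    (cong₂ ℤ._*_ (range-closed s m u D fit) (box-closed S m us D fits))

-- Cartier matrices

-- A matrix of polynomials X acts on (pole order κ, monomial v) by multiplication followed by x ^ (p v) ↦ x ^ v.
module CartierMatrix (e′ n d : ℕ) where
  open PoleOrders e′
  open Polynomials n
  open Boxes
  open ListSum ℤₚ.+-*-commutativeRing
  open Matrices ℤₚ.+-*-commutativeRing using (mul; tr; mul-assoc)
  private module MP = Matrices monoidRing
  open ℤD using (_∣_)
  open ≡ using (refl; sym; trans; cong; cong₂; subst; subst₂)

  P : ℤ
  P = + p

  -- Exponents of f are at most 2 d, and this is 2 d (κ + 1/2). The half makes the degree count
  -- exact: as 2 e + 1 = p, the relation p k + e = κ + c gives 2 d c + `D κ` = p · `D k`.
  D : ℕ → ℕ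
  D κ = d ℕ.* suc (2 ℕ.* κ)

  infixl 6 _⊹_
  _⊹_ : Vec ℕ n → Vec ℕ n → Vec ℕ n
  _⊹_ = Vec.zipWith ℕ._+_

  scale : ℕ → Vec ℕ n → Vec ℕ n
  scale k = Vec.map (k ℕ.*_)

  module FromPolynomials (X : ℕ → ℕ → FormalSum) (M : ℕ)
    (supp : ∀ κ″ κ → Supported (X κ″ κ) (D κ) (p ℕ.* D κ″))
    (divi : ∀ κ″ κ φ → (P ℤ.^ κ″) ∣ ⟪ X κ″ κ ⟫ φ ℤ.* P ℤ.^ kOf κ) where

    -- The (r + 1)-fold composite gathered into one polynomial matrix: moving a multiplication by g
    -- from the left to the right of x ^ (p v) ↦ x ^ v turns g into g(x ^ p).
    iterate : ℕ → ℕ → ℕ → FormalSum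
    iterate zero    = X
    iterate (suc r) = MP.mul (downFrom M) (λ i j → frobenius p (iterate r i j)) X

    iterate-supported : ∀ r κ″ κ → Supported (iterate r κ″ κ) (D κ) (p ℕ.^ suc r ℕ.* D κ″)
    iterate-supported zero    κ″ κ = subst (λ x → Supported (X κ″ κ) (D κ) (x ℕ.* D κ″)) (sym (ℕₚ.*-identityʳ p)) (supp κ″ κ)
    iterate-supported (suc r) κ″ κ = supported-∑ (downFrom M) (λ κ′ → frobenius p (iterate r κ″ κ′) ⊗ X κ′ κ) (λ κ′ _ →
      supported-weaken {frobenius p (iterate r κ″ κ′) ⊗ X κ′ κ} (λ u le → ℕₚ.+-cancelʳ-≤ (p ℕ.* D κ′) (u ℕ.+ D κ) _
          (subst₂ ℕ._≤_ (lemma u (p ℕ.* D κ′) (D κ)) (cong (ℕ._+ p ℕ.* D κ′) (sym (ℕₚ.*-assoc p (p ℕ.^ suc r) (D κ″)))) le))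
        (supported-⊗ {frobenius p (iterate r κ″ κ′)} {X κ′ κ} (supported-frobenius p {iterate r κ″ κ′} (iterate-supported r κ″ κ′)) (supp κ′ κ)))
      where
      open import Data.Nat.Tactic.RingSolver using (solve-∀)
      lemma : ∀ u a b → u ℕ.+ (a ℕ.+ b) ≡ u ℕ.+ b ℕ.+ a
      lemma = solve-∀

    module _ (S : Vec Bool n) where

      Idx : Set
      Idx = ℕ × Vec ℕ n

      _≟_ : DecidableEquality Idx
      _≟_ = ≡-dec ℕₚ._≟_ (VecP.≡-dec ℕₚ._≟_)
        where
        open import Data.Product.Properties using (≡-dec)
        import Data.Vec.Properties as VecP

      indices : ℕ → List Idx
      indices M = concatMap (λ κ → map (κ ,_) (box S (D κ))) (downFrom M)

      mat : Idx → Idx → ℤ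
      mat (κ″ , v″) (κ , v) = ⟪ X κ″ κ ⟫ (λ u → δᵥ (scale p v″) (v ⊹ u))

      box-length : ∀ {n} (S : Vec Bool n) D → length (box S D) ℕ.≤ suc D ℕ.^ n
      box-length []      D = ℕₚ.≤-refl
      box-length (s ∷ S) D = ℕₚ.≤-trans (ℕₚ.≤-reflexive (pairs (range s D))) (ℕₚ.*-mono-≤ (range-length s) (box-length S D))
        where
        open import Data.List.Properties using (length-++; length-map; length-downFrom)
        pairs : ∀ rs → length (concatMap (λ v → map (v ∷_) (box S D)) rs) ≡ length rs ℕ.* length (box S D)
        pairs []       = refl
        pairs (v ∷ rs) = trans (length-++ (map (v ∷_) (box S D))) (cong₂ ℕ._+_ (length-map (v ∷_) (box S D)) (pairs rs))
        range-length : ∀ s → length (range s D) ℕ.≤ suc D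
        range-length false = ℕₚ.≤-reflexive (length-downFrom (suc D))
        range-length true  = ℕₚ.≤-trans (ℕₚ.≤-reflexive (trans (length-map suc (downFrom D)) (length-downFrom D))) (ℕₚ.n≤1+n D)

      indices-length : ∀ w → length (indices (suc w)) ℕ.≤ suc (2 ℕ.* d) ℕ.^ n ℕ.* suc w ℕ.^ suc n
      indices-length w = ℕₚ.≤-trans (go (suc w) ℕₚ.≤-refl) (ℕₚ.≤-reflexive (trans (cong (suc w ℕ.*_) (Growth.^-distrib-* (suc (2 ℕ.* d)) (suc w) n)) (lemma (suc w) (suc (2 ℕ.* d) ℕ.^ n) (suc w ℕ.^ n))))
        where
        open import Data.Nat.Tactic.RingSolver using (solve-∀)
        open import Data.List.Properties using (length-++; length-map)
        lemma : ∀ a b c → a ℕ.* (b ℕ.* c) ≡ b ℕ.* (a ℕ.* c)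
        lemma = solve-∀
        D-bound : ∀ κ → κ ℕ.≤ w → suc (D κ) ℕ.≤ suc (2 ℕ.* d) ℕ.* suc w
        D-bound κ κ≤w = ℕₚ.≤-trans (s≤s (ℕₚ.*-monoʳ-≤ d (s≤s (ℕₚ.*-monoʳ-≤ 2 κ≤w)))) (subst (suc (d ℕ.* suc (2 ℕ.* w)) ℕ.≤_) (sym (expand d w)) (ℕₚ.m≤m+n _ (w ℕ.+ d)))
          where
          expand : ∀ d w → suc (2 ℕ.* d) ℕ.* suc w ≡ suc (d ℕ.* suc (2 ℕ.* w)) ℕ.+ (w ℕ.+ d)
          expand = solve-∀
        go : ∀ M → M ℕ.≤ suc w → length (indices M) ℕ.≤ M ℕ.* (suc (2 ℕ.* d) ℕ.* suc w) ℕ.^ n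
        go zero    _   = z≤n
        go (suc M) M≤w = ℕₚ.≤-trans (ℕₚ.≤-reflexive (trans (length-++ (map (M ,_) (box S (D M)))) (cong (ℕ._+ length (indices M)) (length-map (M ,_) (box S (D M))))))
          (ℕₚ.+-mono-≤ (ℕₚ.≤-trans (box-length S (D M)) (ℕₚ.^-monoˡ-≤ n (D-bound M (ℕₚ.≤-pred M≤w)))) (go M (ℕₚ.<⇒≤ M≤w)))

      indices-cover : ∀ w M i → i ∈ indices M → proj₁ i ℕ.≤ w → i ∈ indices (suc w)
      indices-cover w M i i∈ i≤w with member M i∈
        where
        open import Data.List.Membership.Propositional.Properties using (∈-map⁻; ∈-++⁻)
        member : ∀ M → i ∈ indices M → i ∈ map (proj₁ i ,_) (box S (D (proj₁ i)))
        member (suc M) i∈ with ∈-++⁻ (map (M ,_) (box S (D M))) i∈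
        ... | inj₂ i∈′ = member M i∈′
        ... | inj₁ i∈′ with ∈-map⁻ (M ,_) i∈′
        ...   | v , _ , refl = i∈′
      ... | i∈′ = insert (suc w) (s≤s i≤w)
        where
        open import Data.List.Membership.Propositional.Properties using (∈-++⁺ˡ; ∈-++⁺ʳ)
        insert : ∀ w → proj₁ i ℕ.< w → i ∈ indices w
        insert (suc w) i<w with ℕₚ.m≤n⇒m<n∨m≡n (ℕₚ.≤-pred i<w)
        ... | inj₁ i<w′ = ∈-++⁺ʳ (map (w ,_) (box S (D w))) (insert w i<w′)
        ... | inj₂ refl = ∈-++⁺ˡ i∈′

      -- The constants involve n and d alone. The rows of weight at most w are those of pole order
      -- at most w, however large M is, and the boxes up to that order have polynomially many
      -- points.
      weighted : WeightedMatrix p (suc (2 ℕ.* d) ℕ.^ n) (suc n)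
      weighted = record
        { Idx = Idx ; _≟_ = _≟_ ; elems = indices M ; mat = mat ; wt = proj₁ ; co = kOf ∘ proj₁
        ; co≤ = λ i → twice-kOf≤ (proj₁ i)
        ; mat-div = λ { (κ″ , v″) (κ , v) → divi κ″ κ (λ u → δᵥ (scale p v″) (v ⊹ u)) }
        ; small = λ w → indices (suc w) ; small-length = indices-length ; small-cover = λ w i → indices-cover w M i }

      open FredholmRecursion _≟_ (indices M) mat using (powers; traces)

      private
        powers-commute : ∀ r i j → mul (indices M) mat (powers r) i j ≡ mul (indices M) (powers r) mat i j
        powers-commute zero    i j = refl
        powers-commute (suc r) i j = trans (∑-cong (indices M) (λ k → cong (mat i k ℤ.*_) (powers-commute r k j)))
          (sym (mul-assoc (indices M) mat (powers r) mat i j))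

        scale-scale : ∀ a b {n} (v : Vec ℕ n) → Vec.map (a ℕ.*_) (Vec.map (b ℕ.*_) v) ≡ Vec.map ((a ℕ.* b) ℕ.*_) v
        scale-scale a b []      = refl
        scale-scale a b (x ∷ v) = cong₂ _∷_ (sym (ℕₚ.*-assoc a b x)) (scale-scale a b v)

        product-expand : ∀ a b (c : Vec ℕ n) (Φ Ψ : Vec ℕ n → Vec ℕ n → ℤ) → ⟪ a ⟫ (Φ c) ℤ.* ⟪ b ⟫ (Ψ c) ≡ ⟪ a ⟫ (λ u₂ → ⟪ b ⟫ (λ u₁ → Φ c u₂ ℤ.* Ψ c u₁))
        product-expand a b c Φ Ψ = sym (trans (⟪⟫-cong a {ψ = λ u₂ → Φ c u₂ ℤ.* ⟪ b ⟫ (Ψ c)} (λ u₂ → ⟪⟫-* b (Φ c u₂) (Ψ c))) (⟪⟫-*ʳ a (⟪ b ⟫ (Ψ c)) (Φ c)))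

      -- The product of two entries, summed over the intermediate monomial, is a single entry of the
      -- composite by `box-step`. The support of X restricts attention to exponents for which that
      -- step is exact.
      entries : ∀ r κ″ v″ κ v → InBox S (D κ) v → powers r (κ″ , v″) (κ , v) ≡ ⟪ iterate r κ″ κ ⟫ (λ u → δᵥ (scale (p ℕ.^ suc r) v″) (v ⊹ u))
      entries zero κ″ v″ κ v v∈ = ⟪⟫-cong (X κ″ κ) (λ u → cong (λ k → δᵥ (scale k v″) (v ⊹ u)) (sym (ℕₚ.*-identityʳ p)))
      entries (suc r) κ″ v″ κ v v∈ = begin
        mul (indices M) mat (powers r) (κ″ , v″) (κ , v)
          ≡⟨ powers-commute r (κ″ , v″) (κ , v) ⟩
        mul (indices M) (powers r) mat (κ″ , v″) (κ , v)
          ≡⟨ ∑-pairs (downFrom M) (λ κ′ → box S (D κ′)) (λ k → powers r (κ″ , v″) k ℤ.* mat k (κ , v)) ⟩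
        ∑ (downFrom M) (λ κ′ → ∑ (box S (D κ′)) (λ v′ → powers r (κ″ , v″) (κ′ , v′) ℤ.* mat (κ′ , v′) (κ , v)))
          ≡⟨ ∑-cong (downFrom M) step ⟩
        ∑ (downFrom M) (λ κ′ → ⟪ frobenius p (iterate r κ″ κ′) ⊗ X κ′ κ ⟫ goal)
          ≡⟨ ⟪∑⟫ (downFrom M) (λ κ′ → frobenius p (iterate r κ″ κ′) ⊗ X κ′ κ) goal ⟨
        ⟪ iterate (suc r) κ″ κ ⟫ goal ∎
        where
        open ≡.≡-Reasoning
        goal : Vec ℕ n → ℤ
        goal u = δᵥ (scale (p ℕ.^ suc (suc r)) v″) (v ⊹ u)
        Φ : Vec ℕ n → Vec ℕ n → ℤ
        Φ v′ u₂ = δᵥ (scale (p ℕ.^ suc r) v″) (v′ ⊹ u₂)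
        Ψ : Vec ℕ n → Vec ℕ n → ℤ
        Ψ v′ u₁ = δᵥ (scale p v′) (v ⊹ u₁)
        step : ∀ κ′ → ∑ (box S (D κ′)) (λ v′ → powers r (κ″ , v″) (κ′ , v′) ℤ.* mat (κ′ , v′) (κ , v)) ≡ ⟪ frobenius p (iterate r κ″ κ′) ⊗ X κ′ κ ⟫ goal
        step κ′ = begin
          ∑ (box S (D κ′)) (λ v′ → powers r (κ″ , v″) (κ′ , v′) ℤ.* mat (κ′ , v′) (κ , v))
            ≡⟨ ∑-cong∈ (box S (D κ′)) (λ v′ v′∈ → trans (cong (ℤ._* mat (κ′ , v′) (κ , v)) (entries r κ″ v″ κ′ v′ (box-bounds S (D κ′) v′∈)))
                 (product-expand Q Y v′ Φ Ψ)) ⟩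
          ∑ (box S (D κ′)) (λ v′ → ⟪ Q ⟫ (λ u₂ → ⟪ Y ⟫ (λ u₁ → Φ v′ u₂ ℤ.* Ψ v′ u₁)))
            ≡⟨ trans (⟪⟫-cong Q (λ u₂ → ⟪⟫-∑ Y (box S (D κ′)) (λ v′ u₁ → Φ v′ u₂ ℤ.* Ψ v′ u₁)))
                 (⟪⟫-∑ Q (box S (D κ′)) (λ v′ u₂ → ⟪ Y ⟫ (λ u₁ → Φ v′ u₂ ℤ.* Ψ v′ u₁))) ⟨
          ⟪ Q ⟫ (λ u₂ → ⟪ Y ⟫ (λ u₁ → ∑ (box S (D κ′)) (λ v′ → Φ v′ u₂ ℤ.* Ψ v′ u₁)))
            ≡⟨ ⟪⟫-cong Q (λ u₂ → supported-cong Y (supp κ′ κ) (λ u₁ fits → trans (box-step S p (p ℕ.^ suc r) v″ v u₁ u₂ (D κ) (D κ′) fits v∈)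
                 (cong (λ w → δᵥ w (v ⊹ (scale p u₂ ⊹ u₁))) (scale-scale p (p ℕ.^ suc r) v″)))) ⟩
          ⟪ Q ⟫ (λ u₂ → ⟪ Y ⟫ (λ u₁ → goal (scale p u₂ ⊹ u₁)))
            ≡⟨ trans (⟪⊗⟫ (frobenius p Q) Y goal) (⟪frobenius⟫ p Q (λ u₂ → ⟪ Y ⟫ (λ u₁ → goal (u₂ ⊹ u₁)))) ⟨
          ⟪ frobenius p Q ⊗ Y ⟫ goal ∎
          where
          Q Y : FormalSum
          Q = iterate r κ″ κ′
          Y = X κ′ κ

      traces-iterate : ∀ r q-1 .{{_ : ℕ.NonZero q-1}} → suc q-1 ≡ p ℕ.^ suc r →
        traces r ≡ ⟪ MP.tr (downFrom M) (iterate r) ⟫ (indicators q-1 S)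
      traces-iterate r q-1 q≡ = begin
        ∑ (indices M) (λ i → powers r i i)
          ≡⟨ ∑-pairs (downFrom M) (λ κ → box S (D κ)) (λ i → powers r i i) ⟩
        ∑ (downFrom M) (λ κ → ∑ (box S (D κ)) (λ v → powers r (κ , v) (κ , v)))
          ≡⟨ ∑-cong (downFrom M) (λ κ → trans (∑-cong∈ (box S (D κ)) (λ v v∈ → entries r κ v κ v (box-bounds S (D κ) v∈)))
               (trans (sym (⟪⟫-∑ (iterate r κ κ) (box S (D κ)) (λ v u → δᵥ (scale (p ℕ.^ suc r) v) (v ⊹ u))))
                 (supported-cong (iterate r κ κ) (iterate-supported r κ κ) (closed κ)))) ⟩
        ∑ (downFrom M) (λ κ → ⟪ iterate r κ κ ⟫ (indicators q-1 S))
          ≡⟨ ⟪∑⟫ (downFrom M) (λ κ → iterate r κ κ) (indicators q-1 S) ⟨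
        ⟪ MP.tr (downFrom M) (iterate r) ⟫ (indicators q-1 S) ∎
        where
        open ≡.≡-Reasoning
        closed : ∀ κ u → Fits (D κ) (p ℕ.^ suc r ℕ.* D κ) u → ∑ (box S (D κ)) (λ v → δᵥ (scale (p ℕ.^ suc r) v) (v ⊹ u)) ≡ indicators q-1 S u
        closed κ u fits = subst (λ q → Fits (D κ) (q ℕ.* D κ) u → ∑ (box S (D κ)) (λ v → δᵥ (scale q v) (v ⊹ u)) ≡ indicators q-1 S u) q≡
          (box-closed S q-1 u (D κ)) fits

  module Elimination (pp : Prime p) (us : List (Vec ℕ n)) (us-fit : ∀ u → u ∈ us → Fits 0 (2 ℕ.* d) u) (N : ℕ) where
    π : FormalSum
    π = const (+ p)
    open KernelElimination monoidRing e′ π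
    open BinomialExpansion monoidRing π
    open AtLevel N
    open FrobeniusDefect pp
    open import Algebra.Properties.Semiring.Exp 𝒫.semiring using (_^_)

    f Δ : FormalSum
    f = fromMonomials us
    Δ = defect us

    private
      supp-f : Supported f 0 (2 ℕ.* d)
      supp-f = supported-fromMonomials us us-fit

      supp-Δ : Supported Δ 0 (p ℕ.* (2 ℕ.* d))
      supp-Δ = supported-defect us us-fit

      supp-binomial : ∀ a i → Supported (binomial Δ a i) 0 (i ℕ.* (p ℕ.* (2 ℕ.* d)))
      supp-binomial zero    zero    = supported-const (+ 1)
      supp-binomial zero    (suc i) = supported-[]
      supp-binomial (suc a) zero    = supp-binomial a zero
      supp-binomial (suc a) (suc i) = supported-++ {binomial Δ a (suc i)} {Δ ⊗ binomial Δ a i} (supp-binomial a (suc i))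
        (supported-⊗ {Δ} {binomial Δ a i} supp-Δ (supp-binomial a i))

      supp-term : ∀ a i → Supported (term Δ a i) 0 (i ℕ.* (p ℕ.* (2 ℕ.* d)))
      supp-term a i = subst (λ x → Supported (term Δ a i) 0 (x ℕ.+ i ℕ.* (p ℕ.* (2 ℕ.* d)))) (ℕₚ.*-zeroʳ i)
        (supported-⊗ {π ^ i} {binomial Δ a i} (supported-^ {π} i (supported-const (+ p))) (supp-binomial a i))

      supp-shift : ∀ k g (F : ℕ → ℕ) {E} → (∀ i → Supported (g i) E (F (k ℕ.+ i))) → ∀ j → Supported (shift k g j) E (F j)
      supp-shift zero    g F h j       = h j
      supp-shift (suc k) g F h zero    = supported-[]
      supp-shift (suc k) g F h (suc j) = supp-shift k g (F ∘ suc) h j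

      degree : ∀ κ i → i ℕ.* (p ℕ.* (2 ℕ.* d)) ℕ.+ cOf κ ℕ.* (2 ℕ.* d) ℕ.+ D κ ≡ p ℕ.* D (kOf κ ℕ.+ i)
      degree κ i = trans (collect i p d (cOf κ) κ) (trans (cong (λ x → i ℕ.* (p ℕ.* (2 ℕ.* d)) ℕ.+ 2 ℕ.* d ℕ.* x ℕ.+ d) (sym (state-inv κ)))
          (expand i e d (kOf κ)))
        where
        open import Data.Nat.Tactic.RingSolver using (solve-∀)
        collect : ∀ i p d c κ → i ℕ.* (p ℕ.* (2 ℕ.* d)) ℕ.+ c ℕ.* (2 ℕ.* d) ℕ.+ d ℕ.* suc (2 ℕ.* κ) ≡ i ℕ.* (p ℕ.* (2 ℕ.* d)) ℕ.+ 2 ℕ.* d ℕ.* (κ ℕ.+ c) ℕ.+ d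
        collect = solve-∀
        expand : ∀ i e d k → i ℕ.* (suc (e ℕ.+ e) ℕ.* (2 ℕ.* d)) ℕ.+ 2 ℕ.* d ℕ.* (suc (e ℕ.+ e) ℕ.* k ℕ.+ e) ℕ.+ d ≡ suc (e ℕ.+ e) ℕ.* (d ℕ.* suc (2 ℕ.* (k ℕ.+ i)))
        expand = solve-∀

      weaken-degree : ∀ κ i {a} → Supported a 0 (i ℕ.* (p ℕ.* (2 ℕ.* d)) ℕ.+ cOf κ ℕ.* (2 ℕ.* d)) → Supported a (D κ) (p ℕ.* D (kOf κ ℕ.+ i))
      weaken-degree κ i {a} = supported-weaken {a} (λ u le → subst (u ℕ.+ D κ ℕ.≤_) (degree κ i) (ℕₚ.+-monoˡ-≤ (D κ) (subst (ℕ._≤ _) (ℕₚ.+-identityʳ u) le)))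

      power-div : ∀ i b φ → (P ℤ.^ i) ∣ ⟪ π ^ i ⊗ b ⟫ φ
      power-div zero    b φ = ℤD.divides (⟪ π ^ 0 ⊗ b ⟫ φ) (sym (ℤₚ.*-identityʳ _))
      power-div (suc i) b φ = subst ((P ℤ.^ suc i) ∣_) (sym (trans (apply (𝒫.*-assoc π (π ^ i) b) φ (respects φ)) (⟪const⊗⟫ (+ p) (π ^ i ⊗ b) (respects φ))))
        (ℤD.*-monoʳ-∣ P (power-div i b φ))

      -- Entry j of the shifted column carries π ^ (j - k), and the factor p ^ k on the right makes
      -- up for the shift. This is the source of the co-weight `kOf`.
      div-shift : ∀ k g φ → (∀ i → (P ℤ.^ i) ∣ ⟪ g i ⟫ φ) → ∀ j → (P ℤ.^ j) ∣ ⟪ shift k g j ⟫ φ ℤ.* P ℤ.^ k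
      div-shift zero    g φ h j       = ℤD.∣m⇒∣m*n (P ℤ.^ 0) (h j)
      div-shift (suc k) g φ h zero    = ℤD.divides (+ 0) refl
      div-shift (suc k) g φ h (suc j) = subst ((P ℤ.^ suc j) ∣_) (lemma P (⟪ shift k g j ⟫ φ) (P ℤ.^ k)) (ℤD.*-monoʳ-∣ P (div-shift k g φ h j))
        where
        open import Data.Integer.Tactic.RingSolver using (solve-∀)
        lemma : ∀ p a b → p ℤ.* (a ℤ.* b) ≡ a ℤ.* (p ℤ.* b)
        lemma = solve-∀

      div-0 : ∀ {x y} → x ∣ + 0 ℤ.* y
      div-0 = ℤD.divides (+ 0) refl

    full-supported : ∀ κ″ κ → Supported (full f Δ κ″ κ) (D κ) (p ℕ.* D κ″)
    full-supported κ″ κ with κ ℕₚ.≤? m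
    ... | no _  = supported-[]
    ... | yes _ = supp-shift (kOf κ) _ (λ j → p ℕ.* D j) (λ i → weaken-degree κ i {term Δ (m ℕ.∸ kOf κ) i ⊗ f ^ cOf κ}
          (supported-⊗ {term Δ (m ℕ.∸ kOf κ) i} {f ^ cOf κ} (supp-term (m ℕ.∸ kOf κ) i) (supported-^ {f} (cOf κ) supp-f))) κ″

    full-div : ∀ κ″ κ φ → (P ℤ.^ κ″) ∣ ⟪ full f Δ κ″ κ ⟫ φ ℤ.* P ℤ.^ kOf κ
    full-div κ″ κ φ with κ ℕₚ.≤? m
    ... | no _  = div-0 {P ℤ.^ κ″} {P ℤ.^ kOf κ}
    ... | yes _ = div-shift (kOf κ) _ φ (λ i → subst ((P ℤ.^ i) ∣_) (sym (apply (𝒫.*-assoc (π ^ i) (binomial Δ (m ℕ.∸ kOf κ) i) (f ^ cOf κ)) φ (respects φ)))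
          (power-div i (binomial Δ (m ℕ.∸ kOf κ) i ⊗ f ^ cOf κ) φ)) κ″

    kernel-supported : ∀ κ″ κ → Supported (kernel f Δ κ″ κ) (D κ) (p ℕ.* D κ″)
    kernel-supported κ″ κ with state κ | weaken-degree κ
    ... | k , suc c | _      = supported-[]
    ... | k , zero  | weaken = supp-shift k _ (λ j → p ℕ.* D j) (λ i → weaken i {term Δ (m ℕ.∸ suc k) i}
          (subst (Supported (term Δ (m ℕ.∸ suc k) i) 0) (sym (ℕₚ.+-identityʳ _)) (supp-term (m ℕ.∸ suc k) i))) κ″

    kernel-div : ∀ κ″ κ φ → (P ℤ.^ κ″) ∣ ⟪ kernel f Δ κ″ κ ⟫ φ ℤ.* P ℤ.^ kOf κ
    kernel-div κ″ κ φ with state κ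
    ... | k , suc c = div-0 {P ℤ.^ κ″} {P ℤ.^ k}
    ... | k , zero  = div-shift k _ φ (λ i → power-div i (binomial Δ (m ℕ.∸ suc k) i) φ) κ″

    module Full   = FromPolynomials (full f Δ) (suc m) full-supported full-div
    module Kernel = FromPolynomials (kernel f Δ) m kernel-supported kernel-div

-- Sums and multiples of weighted matrices

module WeightedOperations (p k : ℕ) where
  open ListSum ℤₚ.+-*-commutativeRing
  open ℤD using (_∣_)
  open import Data.Integer.Base using (_+_; _*_; _-_; -_; 0ℤ; 1ℤ; _^_)
  open import Data.Integer.Tactic.RingSolver using (solve-∀)
  open ≡ using (refl; sym; trans; cong; cong₂; subst)

  P : ℤ
  P = + p

  empty : WeightedMatrix p 0 k
  empty = record
    { Idx = ⊥ ; _≟_ = λ () ; elems = [] ; mat = λ () ; wt = λ () ; co = λ () ; co≤ = λ () ; mat-div = λ ()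
    ; small = λ _ → [] ; small-length = λ _ → z≤n ; small-cover = λ _ () }

  module _ {c : ℕ} (A : WeightedMatrix p c k) where
    private module A = WeightedMatrix A

    -- Scaling by p multiplies the trace of the (r + 1)-st power by p ^ (r + 1) = q. A factor q in a
    -- point sum is thus realised by one matrix for all r.
    scaled : WeightedMatrix p c k
    scaled = record
      { Idx = A.Idx ; _≟_ = A._≟_ ; elems = A.elems ; mat = λ i j → P * A.mat i j ; wt = A.wt ; co = A.co ; co≤ = A.co≤
      ; mat-div = λ i j → subst ((P ^ A.wt i) ∣_) (sym (ℤₚ.*-assoc P (A.mat i j) (P ^ A.co j))) (ℤD.∣n⇒∣m*n P (A.mat-div i j))
      ; small = A.small ; small-length = A.small-length ; small-cover = A.small-cover }

    private
      module F = FredholmRecursion A._≟_ A.elems A.mat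
      module F′ = FredholmRecursion A._≟_ A.elems (λ i j → P * A.mat i j)

      powers-scaled : ∀ r i j → F′.powers r i j ≡ P ^ suc r * F.powers r i j
      powers-scaled zero    i j = cong (_* A.mat i j) (sym (ℤₚ.*-identityʳ P))
      powers-scaled (suc r) i j = trans (∑-cong A.elems (λ l → trans (cong (P * A.mat i l *_) (powers-scaled r l j))
          (lemma P (A.mat i l) (P ^ suc r) (F.powers r l j)))) (∑-*ˡ A.elems (P * P ^ suc r) (λ l → A.mat i l * F.powers r l j))
        where
        lemma : ∀ p a q b → (p * a) * (q * b) ≡ (p * q) * (a * b)
        lemma = solve-∀

    traces-scaled : ∀ r → WeightedMatrix.traces scaled r ≡ P ^ suc r * A.traces r
    traces-scaled r = trans (∑-cong A.elems (λ i → powers-scaled r i i)) (∑-*ˡ A.elems (P ^ suc r) (λ i → F.powers r i i))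

  module _ {c c′ : ℕ} (A : WeightedMatrix p c k) (A′ : WeightedMatrix p c′ k) where
    private
      module A = WeightedMatrix A
      module A′ = WeightedMatrix A′
      Idx : Set
      Idx = A.Idx ⊎ A′.Idx
      block : Idx → Idx → ℤ
      block (inj₁ i) (inj₁ j) = A.mat i j
      block (inj₁ i) (inj₂ j) = 0ℤ
      block (inj₂ i) (inj₁ j) = 0ℤ
      block (inj₂ i) (inj₂ j) = A′.mat i j
      wt co : Idx → ℕ
      wt (inj₁ i) = A.wt i
      wt (inj₂ i) = A′.wt i
      co (inj₁ i) = A.co i
      co (inj₂ i) = A′.co i
      both : List A.Idx → List A′.Idx → List Idx
      both xs ys = map inj₁ xs ++ map inj₂ ys
      elems : List Idx
      elems = both A.elems A′.elems
      block-div : ∀ i j → (P ^ wt i) ∣ block i j * P ^ co j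
      block-div (inj₁ i) (inj₁ j) = A.mat-div i j
      block-div (inj₁ i) (inj₂ j) = ℤD.divides 0ℤ refl
      block-div (inj₂ i) (inj₁ j) = ℤD.divides 0ℤ refl
      block-div (inj₂ i) (inj₂ j) = A′.mat-div i j
      both-length : ∀ w → length (both (A.small w) (A′.small w)) ℕ.≤ (c ℕ.+ c′) ℕ.* suc w ℕ.^ k
      both-length w = ℕₚ.≤-trans (ℕₚ.≤-reflexive (trans (length-++ (map inj₁ (A.small w))) (cong₂ ℕ._+_ (length-map inj₁ (A.small w)) (length-map inj₂ (A′.small w)))))
        (ℕₚ.≤-trans (ℕₚ.+-mono-≤ (A.small-length w) (A′.small-length w)) (ℕₚ.≤-reflexive (sym (ℕₚ.*-distribʳ-+ (suc w ℕ.^ k) c c′))))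
        where open import Data.List.Properties using (length-++; length-map)
      both-cover : ∀ w i → i ∈ elems → wt i ℕ.≤ w → i ∈ both (A.small w) (A′.small w)
      both-cover w i i∈ i≤w with ∈-++⁻ (map inj₁ A.elems) i∈
        where open import Data.List.Membership.Propositional.Properties using (∈-++⁻)
      ... | inj₁ i∈₁ with ∈-map⁻ inj₁ i∈₁
        where open import Data.List.Membership.Propositional.Properties using (∈-map⁻)
      ...   | j , j∈ , refl = ∈-++⁺ˡ (∈-map⁺ inj₁ (A.small-cover w j j∈ i≤w))
        where open import Data.List.Membership.Propositional.Properties using (∈-map⁺; ∈-++⁺ˡ)
      both-cover w i i∈ i≤w | inj₂ i∈₂ with ∈-map⁻ inj₂ i∈₂
        where open import Data.List.Membership.Propositional.Properties using (∈-map⁻)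
      ...   | j , j∈ , refl = ∈-++⁺ʳ (map inj₁ (A.small w)) (∈-map⁺ inj₂ (A′.small-cover w j j∈ i≤w))
        where open import Data.List.Membership.Propositional.Properties using (∈-map⁺; ∈-++⁺ʳ)

    infixr 6 _⊕_
    _⊕_ : WeightedMatrix p (c ℕ.+ c′) k
    _⊕_ = record
      { Idx = Idx ; _≟_ = ≡-dec A._≟_ A′._≟_ ; elems = elems ; mat = block ; wt = wt ; co = co
      ; co≤ = λ { (inj₁ i) → A.co≤ i ; (inj₂ i) → A′.co≤ i } ; mat-div = block-div
      ; small = λ w → both (A.small w) (A′.small w) ; small-length = both-length ; small-cover = both-cover }
      where open import Data.Sum.Properties using (≡-dec)

    private
      module F = FredholmRecursion A._≟_ A.elems A.mat
      module F′ = FredholmRecursion A′._≟_ A′.elems A′.mat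
      module G = FredholmRecursion (WeightedMatrix._≟_ _⊕_) elems block

      ∑-both : ∀ f → ∑ elems f ≡ ∑ A.elems (f ∘ inj₁) + ∑ A′.elems (f ∘ inj₂)
      ∑-both f = trans (∑-++ (map inj₁ A.elems) (map inj₂ A′.elems) f) (cong₂ _+_ (∑-map inj₁ A.elems f) (∑-map inj₂ A′.elems f))

      blockPower : ℕ → Idx → Idx → ℤ
      blockPower r (inj₁ i) (inj₁ j) = F.powers r i j
      blockPower r (inj₁ i) (inj₂ j) = 0ℤ
      blockPower r (inj₂ i) (inj₁ j) = 0ℤ
      blockPower r (inj₂ i) (inj₂ j) = F′.powers r i j

      zero-left : ∀ {A : Set} (xs : List A) (f : A → ℤ) → ∑ xs (λ x → 0ℤ * f x) ≡ 0ℤ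
      zero-left xs f = ∑-zero xs (λ x → ℤₚ.*-zeroˡ (f x))

      zero-right : ∀ {A : Set} (xs : List A) (f : A → ℤ) → ∑ xs (λ x → f x * 0ℤ) ≡ 0ℤ
      zero-right xs f = ∑-zero xs (λ x → ℤₚ.*-zeroʳ (f x))

      powers-⊕ : ∀ r i j → G.powers r i j ≡ blockPower r i j
      powers-⊕ zero    (inj₁ i) (inj₁ j) = refl
      powers-⊕ zero    (inj₁ i) (inj₂ j) = refl
      powers-⊕ zero    (inj₂ i) (inj₁ j) = refl
      powers-⊕ zero    (inj₂ i) (inj₂ j) = refl
      powers-⊕ (suc r) i j = trans (trans (∑-cong elems (λ l → cong (block i l *_) (powers-⊕ r l j))) (∑-both (λ l → block i l * blockPower r l j))) (split i j)
        where
        split : ∀ i j → ∑ A.elems (λ l → block i (inj₁ l) * blockPower r (inj₁ l) j) + ∑ A′.elems (λ l → block i (inj₂ l) * blockPower r (inj₂ l) j) ≡ blockPower (suc r) i j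
        split (inj₁ i) (inj₁ j) = trans (cong (_+_ (F.powers (suc r) i j)) (zero-left A′.elems (λ _ → 0ℤ))) (ℤₚ.+-identityʳ _)
        split (inj₁ i) (inj₂ j) = cong₂ _+_ (zero-right A.elems (A.mat i)) (zero-left A′.elems (λ l → F′.powers r l j))
        split (inj₂ i) (inj₁ j) = cong₂ _+_ (zero-left A.elems (λ l → F.powers r l j)) (zero-right A′.elems (A′.mat i))
        split (inj₂ i) (inj₂ j) = trans (cong (_+ F′.powers (suc r) i j) (zero-left A.elems (λ _ → 0ℤ))) (ℤₚ.+-identityˡ _)

    traces-⊕ : ∀ r → WeightedMatrix.traces _⊕_ r ≡ A.traces r + A′.traces r
    traces-⊕ r = trans (∑-cong elems (λ i → powers-⊕ r i i)) (∑-both (λ i → blockPower r i i))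

  -- Formal differences of weighted matrices.
  Pair : ℕ → Set₁
  Pair c = WeightedMatrix p c k × WeightedMatrix p c k

  difference : ∀ {c} → Pair c → ℕ → ℤ
  difference A r = WeightedMatrix.traces (proj₁ A) r - WeightedMatrix.traces (proj₂ A) r

  signWeight : ∀ {n} → Vec Bool n → ℤ → ℤ
  signWeight []          q = 1ℤ
  signWeight (false ∷ S) q = q * signWeight S q
  signWeight (true ∷ S)  q = - signWeight S q

  signedScale : ∀ {n c} → Vec Bool n → Pair c → Pair c
  signedScale []          A = A
  signedScale (false ∷ S) A = scaled (proj₁ (signedScale S A)) , scaled (proj₂ (signedScale S A))
  signedScale (true ∷ S)  A = proj₂ (signedScale S A) , proj₁ (signedScale S A)

  signedScale-difference : ∀ {n c} (S : Vec Bool n) (A : Pair c) r → difference (signedScale S A) r ≡ signWeight S (P ^ suc r) * difference A r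
  signedScale-difference []          A r = sym (ℤₚ.*-identityˡ (difference A r))
  signedScale-difference (false ∷ S) A r = trans (cong₂ _-_ (traces-scaled (proj₁ (signedScale S A)) r) (traces-scaled (proj₂ (signedScale S A)) r))
    (trans (lemma (P ^ suc r) (WeightedMatrix.traces (proj₁ (signedScale S A)) r) (WeightedMatrix.traces (proj₂ (signedScale S A)) r))
      (trans (cong (P ^ suc r *_) (signedScale-difference S A r)) (sym (ℤₚ.*-assoc (P ^ suc r) (signWeight S (P ^ suc r)) (difference A r)))))
    where
    lemma : ∀ q a b → q * a - q * b ≡ q * (a - b)
    lemma = solve-∀
  signedScale-difference (true ∷ S)  A r = trans (lemma (WeightedMatrix.traces (proj₁ (signedScale S A)) r) (WeightedMatrix.traces (proj₂ (signedScale S A)) r))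
    (trans (cong -_ (signedScale-difference S A r)) (ℤₚ.neg-distribˡ-* (signWeight S (P ^ suc r)) (difference A r)))
    where
    lemma : ∀ a b → b - a ≡ - (a - b)
    lemma = solve-∀

  combine : ∀ {c} {T : Set} (ts : List T) → (T → Pair c) → Pair (length ts ℕ.* c)
  combine []       A = empty , empty
  combine (t ∷ ts) A = (proj₁ (A t) ⊕ proj₁ (combine ts A)) , (proj₂ (A t) ⊕ proj₂ (combine ts A))

  combine-difference : ∀ {c} {T : Set} (ts : List T) (A : T → Pair c) r → difference (combine ts A) r ≡ ∑ ts (λ t → difference (A t) r)
  combine-difference []       A r = refl
  combine-difference (t ∷ ts) A r = trans (cong₂ _-_ (traces-⊕ (proj₁ (A t)) (proj₁ (combine ts A)) r) (traces-⊕ (proj₂ (A t)) (proj₂ (combine ts A)) r))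
    (trans (lemma (tr₁ (A t)) (tr₁ (combine ts A)) (tr₂ (A t)) (tr₂ (combine ts A))) (cong (_+_ (difference (A t) r)) (combine-difference ts A r)))
    where
    tr₁ tr₂ : ∀ {c} → Pair c → ℤ
    tr₁ A = WeightedMatrix.traces (proj₁ A) r
    tr₂ A = WeightedMatrix.traces (proj₂ A) r
    lemma : ∀ a b c d → (a + b) - (c + d) ≡ (a - c) + (b - d)
    lemma = solve-∀

  allModes : ∀ n → List (Vec Bool n)
  allModes zero    = [] ∷ []
  allModes (suc n) = map (false ∷_) (allModes n) ++ map (true ∷_) (allModes n)

  pointValue : ∀ {n} → ℕ → ℤ → Vec ℕ n → ℤ
  pointValue m q []       = 1ℤ
  pointValue m q (u ∷ us) = (q * multipleIndicator m false u - multipleIndicator m true u) * pointValue m q us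

  -- Multiply out the coordinatewise differences. Each choice of summands is one mode vector, whose
  -- product of indicators is the trace over the corresponding box and whose weight is a signed
  -- power of q.
  pointValue-modes : ∀ {n} m q (u : Vec ℕ n) → pointValue m q u ≡ ∑ (allModes n) (λ S → signWeight S q * Boxes.indicators m S u)
  pointValue-modes m q []       = refl
  pointValue-modes {suc n} m q (u ∷ us) = sym (trans (∑-++ (map (false ∷_) (allModes n)) (map (true ∷_) (allModes n)) F)
    (trans (cong₂ _+_
        (trans (∑-map (false ∷_) (allModes n) F) (trans (∑-cong (allModes n) (λ S → lemma₁ q (signWeight S q) (multipleIndicator m false u) (Boxes.indicators m S us))) (∑-*ˡ (allModes n) (q * multipleIndicator m false u) G)))
        (trans (∑-map (true ∷_) (allModes n) F) (trans (∑-cong (allModes n) (λ S → lemma₂ (signWeight S q) (multipleIndicator m true u) (Boxes.indicators m S us))) (∑-*ˡ (allModes n) (- multipleIndicator m true u) G))))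
      (trans (lemma₃ q (multipleIndicator m false u) (multipleIndicator m true u) (∑ (allModes n) G)) (cong ((q * multipleIndicator m false u - multipleIndicator m true u) *_) (sym (pointValue-modes m q us))))))
    where
    F : Vec Bool (suc n) → ℤ
    F S = signWeight S q * Boxes.indicators m S (u ∷ us)
    G : Vec Bool n → ℤ
    G S = signWeight S q * Boxes.indicators m S us
    lemma₁ : ∀ q w a b → (q * w) * (a * b) ≡ (q * a) * (w * b)
    lemma₁ = solve-∀
    lemma₂ : ∀ w a b → (- w) * (a * b) ≡ (- a) * (w * b)
    lemma₂ = solve-∀
    lemma₃ : ∀ q a b x → (q * a) * x + (- b) * x ≡ (q * a - b) * x
    lemma₃ = solve-∀

-- The matrices are formed over ℤ[x], where they do not depend on q, but the cyclic condition f(x ^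
-- q) = f(x) holds only after evaluation at a point. The ingredients of the elimination therefore
-- have to commute with ring homomorphisms.
module EliminationHomomorphism (R R′ : CommutativeRing 0ℓ 0ℓ) (e′ : ℕ) (π : CommutativeRing.Carrier R) (π′ : CommutativeRing.Carrier R′)
  (ψ : CommutativeRing.Carrier R → CommutativeRing.Carrier R′)
  (ψ-+ : ∀ a b → CommutativeRing._≈_ R′ (ψ (CommutativeRing._+_ R a b)) (CommutativeRing._+_ R′ (ψ a) (ψ b)))
  (ψ-* : ∀ a b → CommutativeRing._≈_ R′ (ψ (CommutativeRing._*_ R a b)) (CommutativeRing._*_ R′ (ψ a) (ψ b)))
  (ψ-0 : CommutativeRing._≈_ R′ (ψ (CommutativeRing.0# R)) (CommutativeRing.0# R′))
  (ψ-1 : CommutativeRing._≈_ R′ (ψ (CommutativeRing.1# R)) (CommutativeRing.1# R′))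
  (ψ-π : CommutativeRing._≈_ R′ (ψ π) π′) where
  open PoleOrders e′
  private
    module R = CommutativeRing R
    module R′ = CommutativeRing R′
    module E = BinomialExpansion R π
    module E′ = BinomialExpansion R′ π′
    module L = KernelElimination R e′ π
    module L′ = KernelElimination R′ e′ π′
  open R′ using (_≈_)
  open import Algebra.Properties.Semiring.Exp R.semiring using () renaming (_^_ to _^_)
  open import Algebra.Properties.Semiring.Exp R′.semiring using () renaming (_^_ to _^′_)

  ψ-^ : ∀ a k → ψ (a ^ k) ≈ ψ a ^′ k
  ψ-^ a zero    = ψ-1
  ψ-^ a (suc k) = R′.trans (ψ-* a (a ^ k)) (R′.*-congˡ (ψ-^ a k))

  ψ-∑ : {A : Set} (xs : List A) (f : A → R.Carrier) → ψ (ListSum.∑ R xs f) ≈ ListSum.∑ R′ xs (ψ ∘ f)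
  ψ-∑ []       f = ψ-0
  ψ-∑ (x ∷ xs) f = R′.trans (ψ-+ (f x) (ListSum.∑ R xs f)) (R′.+-congˡ (ψ-∑ xs f))

  ψ-shift : ∀ k {g g′} → (∀ i → ψ (g i) ≈ g′ i) → ∀ i → ψ (E.shift k g i) ≈ E′.shift k g′ i
  ψ-shift zero    h i       = h i
  ψ-shift (suc k) h zero    = ψ-0
  ψ-shift (suc k) h (suc i) = ψ-shift k h i

  ψ-binomial : ∀ Δ a i → ψ (E.binomial Δ a i) ≈ E′.binomial (ψ Δ) a i
  ψ-binomial Δ zero    zero    = ψ-1
  ψ-binomial Δ zero    (suc i) = ψ-0
  ψ-binomial Δ (suc a) zero    = ψ-binomial Δ a zero
  ψ-binomial Δ (suc a) (suc i) = R′.trans (ψ-+ (E.binomial Δ a (suc i)) (Δ R.* E.binomial Δ a i))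
    (R′.+-cong (ψ-binomial Δ a (suc i)) (R′.trans (ψ-* Δ (E.binomial Δ a i)) (R′.*-congˡ (ψ-binomial Δ a i))))

  ψ-term : ∀ Δ a i → ψ (E.term Δ a i) ≈ E′.term (ψ Δ) a i
  ψ-term Δ a i = R′.trans (ψ-* (π ^ i) (E.binomial Δ a i)) (R′.*-cong (R′.trans (ψ-^ π i) (power i)) (ψ-binomial Δ a i))
    where
    power : ∀ i → ψ π ^′ i ≈ π′ ^′ i
    power zero    = R′.refl
    power (suc i) = R′.*-cong ψ-π (power i)

  module _ (N : ℕ) where
    private
      module A = L.AtLevel N
      module A′ = L′.AtLevel N

    ψ-full : ∀ f Δ i κ → ψ (A.full f Δ i κ) ≈ A′.full (ψ f) (ψ Δ) i κ
    ψ-full f Δ i κ with κ ℕₚ.≤? A.m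
    ... | no _  = ψ-0
    ... | yes _ = ψ-shift (kOf κ) (λ i → R′.trans (ψ-* (E.term Δ (A.m ℕ.∸ kOf κ) i) (f ^ cOf κ))
          (R′.*-cong (ψ-term Δ (A.m ℕ.∸ kOf κ) i) (ψ-^ f (cOf κ)))) i

    ψ-kernel : ∀ f Δ i κ → ψ (A.kernel f Δ i κ) ≈ A′.kernel (ψ f) (ψ Δ) i κ
    ψ-kernel f Δ i κ with state κ
    ... | k , suc c = ψ-0
    ... | k , zero  = ψ-shift k (ψ-term Δ (A.m ℕ.∸ suc k)) i

cube-power : ∀ c e → c ℤ.* (c ℤ.* c) ≡ c → c ℤ.^ suc (e ℕ.+ e) ≡ c
cube-power c zero    c³ = ℤₚ.*-identityʳ c
cube-power c (suc e) c³ = ≡.trans (≡.cong (λ k → c ℤ.^ suc (suc k)) (ℕₚ.+-suc e e)) (≡.trans (≡.cong (λ x → c ℤ.* (c ℤ.* x)) (cube-power c e c³)) c³)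

-- Comparison of traces with character sums

module PointCount (e′ n d : ℕ) (us : List (Vec ℕ n)) (us-fit : ∀ u → u ∈ us → Fits 0 (2 ℕ.* d) u)
  (pp : Prime (suc (suc e′ ℕ.+ suc e′))) {q : ℕ} (K : FiniteField q) (r : ℕ) (q≡ : q ≡ suc (suc e′ ℕ.+ suc e′) ℕ.^ suc r) where
  open PoleOrders e′ using (e; level)
  open FiniteField K hiding (zero)
  open FieldFacts K
  private
    m-1 : ℕ
    m-1 = suc e′ ℕ.+ suc e′
  open CharacteristicP K m-1 pp r q≡
  open Teichmuller K m-1 pp r q≡
  open TeichmullerSums K m-1 pp r q≡
  open ListSum ℤₚ.+-*-commutativeRing using (∑; ∑-cong)
  private
    module ∑B = ListSum monoidRing
    module Poly = Polynomials n
    module MB = Matrices monoidRing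
    module MP = Matrices Poly.monoidRing
    module BS = IntegerSolver monoidRing
  open ∑B using () renaming (∑ to ∑ᴮ)
  open IntegerSolver commRing using (solve; _:=_; _:+_; _:-_; :-_; fromℤ)
  open import Algebra.Properties.CommutativeSemiring.Exp commutativeSemiring using () renaming (^-distrib-* to ^ᴷ-distrib-*)
  open import Algebra.Properties.Semiring.Exp semiring using () renaming (_^_ to _^ᴷ_; ^-congˡ to ^ᴷ-congˡ; ^-assocʳ to ^ᴷ-assocʳ; ^-congʳ to ^ᴷ-congʳ; ^-homo-* to ^ᴷ-homo-*)
  open import Algebra.Properties.Semiring.Exp B.semiring using (_^_; ^-congʳ) renaming (^-assocʳ to ^ᴮ-assocʳ)
  open import Algebra.Properties.CommutativeSemiring.Exp B.commutativeSemiring using () renaming (^-distrib-* to ^ᴮ-distrib-*)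

  private
    ⟪evaluate⟫ : ∀ x a φ → ⟪ evaluate x a ⟫ φ ≡ Poly.⟪ a ⟫ (λ u → φ (monomial x u))
    ⟪evaluate⟫ x []      φ = ≡.refl
    ⟪evaluate⟫ x (t ∷ a) φ = ≡.cong (ℤ._+_ (proj₁ t ℤ.* φ (monomial x (proj₂ t)))) (⟪evaluate⟫ x a φ)

    monomial-0 : ∀ {n} (x : Vec Carrier n) → monomial x (Vec.replicate n 0) ≈ 1#
    monomial-0 []       = refl
    monomial-0 (x ∷ xs) = trans (*-identityˡ _) (monomial-0 xs)

    evaluate-cong : ∀ x {a b} → a Poly.∼ b → evaluate x a ∼ evaluate x b
    evaluate-cong x {a} {b} a∼b = exact λ φ _ → ≡.trans (⟪evaluate⟫ x a φ) (≡.trans (Poly.apply a∼b _ (Poly.respects _)) (≡.sym (⟪evaluate⟫ x b φ)))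

    evaluate-++ : ∀ x a b → evaluate x (a ++ b) ∼ evaluate x a ++ evaluate x b
    evaluate-++ x a b = exact λ φ _ → ≡.trans (⟪evaluate⟫ x (a ++ b) φ) (≡.trans (Poly.⟪++⟫ a b _)
      (≡.sym (≡.trans (⟪++⟫ (evaluate x a) (evaluate x b) φ) (≡.cong₂ ℤ._+_ (⟪evaluate⟫ x a φ) (⟪evaluate⟫ x b φ)))))

    evaluate-⊗ : ∀ x a b → evaluate x (a Poly.⊗ b) ∼ evaluate x a ⊗ evaluate x b
    evaluate-⊗ x a b = exact λ φ φ-resp → ≡.trans (⟪evaluate⟫ x (a Poly.⊗ b) φ) (≡.trans (Poly.⟪⊗⟫ a b (λ u → φ (monomial x u)))
      (≡.sym (≡.trans (⟪⊗⟫ (evaluate x a) (evaluate x b) φ) (≡.trans (⟪evaluate⟫ x a _)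
        (Poly.⟪⟫-cong a (λ u → ≡.trans (⟪evaluate⟫ x b _) (Poly.⟪⟫-cong b (λ v → φ-resp (sym (monomial-+ x u v))))))))))

    evaluate-const : ∀ x c → evaluate x (Poly.const c) ∼ const c
    evaluate-const x c = exact λ φ φ-resp → ≡.trans (⟪evaluate⟫ x (Poly.const c) φ) (≡.trans (Poly.⟪const⟫ c (λ u → φ (monomial x u)))
      (≡.trans (≡.cong (c ℤ.*_) (φ-resp (monomial-0 x))) (≡.sym (⟪const⟫ c φ))))

    power : ∀ {n} → Vec Carrier n → Vec Carrier n
    power = Vec.map (_^ᴷ p)

    iteratedPower : ∀ {n} → ℕ → Vec Carrier n → Vec Carrier n
    iteratedPower zero    x = x
    iteratedPower (suc j) x = iteratedPower j (power x)

    iteratedPower-power : ∀ {n} j (x : Vec Carrier n) → iteratedPower j (power x) ≡ power (iteratedPower j x)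
    iteratedPower-power zero    x = ≡.refl
    iteratedPower-power (suc j) x = iteratedPower-power j (power x)

    monomial-power : ∀ {n} (x : Vec Carrier n) u → monomial (power x) u ≈ monomial x (Vec.map (p ℕ.*_) u)
    monomial-power []       []       = refl
    monomial-power (x ∷ xs) (u ∷ us) = *-cong (^ᴷ-assocʳ x p u) (monomial-power xs us)

    evaluate-frobenius : ∀ x a → evaluate x (Poly.frobenius p a) ∼ evaluate (power x) a
    evaluate-frobenius x a = exact λ φ φ-resp → ≡.trans (⟪evaluate⟫ x (Poly.frobenius p a) φ) (≡.trans (Poly.⟪frobenius⟫ p a _)
      (≡.sym (≡.trans (⟪evaluate⟫ (power x) a φ) (Poly.⟪⟫-cong a (λ u → φ-resp (monomial-power x u))))))

    data _≈ᵥ_ : ∀ {n} → Vec Carrier n → Vec Carrier n → Set where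
      []  : [] ≈ᵥ []
      _∷_ : ∀ {n x y} {xs ys : Vec Carrier n} → x ≈ y → xs ≈ᵥ ys → (x ∷ xs) ≈ᵥ (y ∷ ys)

    monomial-cong : ∀ {n} {x y : Vec Carrier n} → x ≈ᵥ y → ∀ u → monomial x u ≈ monomial y u
    monomial-cong []         []       = refl
    monomial-cong (x≈y ∷ xs) (u ∷ us) = *-cong (^ᴷ-congˡ u x≈y) (monomial-cong xs us)

    iteratedPower-fixed : ∀ {n} (x : Vec Carrier n) → iteratedPower (suc r) x ≈ᵥ x
    iteratedPower-fixed x = go x
      where
      iterate-∷ : ∀ j {n} (x : Carrier) (xs : Vec Carrier n) → ∃ λ y → y ≈ x ^ᴷ (p ℕ.^ j) × iteratedPower j (x ∷ xs) ≡ y ∷ iteratedPower j xs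
      iterate-∷ zero    x xs = x , sym (*-identityʳ x) , ≡.refl
      iterate-∷ (suc j) x xs with iterate-∷ j (x ^ᴷ p) (power xs)
      ... | y , y≈ , eq = y , trans y≈ (^ᴷ-assocʳ x p (p ℕ.^ j)) , eq
      iterate-[] : ∀ j → iteratedPower j [] ≡ []
      iterate-[] zero    = ≡.refl
      iterate-[] (suc j) = iterate-[] j
      go : ∀ {n} (x : Vec Carrier n) → iteratedPower (suc r) x ≈ᵥ x
      go []       = ≡.subst (_≈ᵥ []) (≡.sym (iterate-[] (suc r))) []
      go (x ∷ xs) with iterate-∷ (suc r) x xs
      ... | y , y≈ , eq = ≡.subst (_≈ᵥ (x ∷ xs)) (≡.sym eq) (trans y≈ (trans (^ᴷ-congʳ x (≡.sym q≡)) (fermat x)) ∷ go xs)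

  module AtPrecision (N : ℕ) where
    private
      module CM = CartierMatrix e′ n d
      module CE = CM.Elimination pp us us-fit N
      π : FormalSum
      π = const (+ p)
      module KB = KernelElimination monoidRing e′ π
      module AB = KB.AtLevel N
      module AP = KernelElimination.AtLevel Poly.monoidRing e′ CE.π N

      fs Δs : Vec Carrier n → ℕ → FormalSum
      fs x j = evaluate (iteratedPower j x) CE.f
      Δs x j = evaluate (iteratedPower j x) CE.Δ

      module Hom (x : Vec Carrier n) = EliminationHomomorphism Poly.monoidRing monoidRing e′ CE.π π (evaluate x)
        (evaluate-++ x) (evaluate-⊗ x) B.refl (evaluate-const x (+ 1)) (evaluate-const x (+ p))

      relation : ∀ x j → fs x (suc j) B.+ π B.* Δs x j B.≈ fs x j ^ p
      relation x j = B.trans (B.+-congʳ (B.trans (B.reflexive (≡.cong (λ y → evaluate y CE.f) (iteratedPower-power j x))) (B.sym (evaluate-frobenius y CE.f))))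
        (B.trans (B.+-congˡ (B.trans (B.*-congʳ {Δs x j} (B.sym (evaluate-const y (+ p)))) (B.sym (evaluate-⊗ y CE.π CE.Δ))))
          (B.trans (B.sym (evaluate-++ y (Poly.frobenius p CE.f) (CE.π Poly.⊗ CE.Δ)))
            (B.trans (evaluate-cong y (Poly.FrobeniusDefect.defect-relation pp us)) (Hom.ψ-^ y CE.f p))))
        where
        y : Vec Carrier n
        y = iteratedPower j x

      cyclic : ∀ x → fs x (suc r) B.≈ fs x 0
      cyclic x = exact λ φ φ-resp → ≡.trans (⟪evaluate⟫ (iteratedPower (suc r) x) CE.f φ)
        (≡.trans (Poly.⟪⟫-cong CE.f (λ u → φ-resp (monomial-cong (iteratedPower-fixed x) u))) (≡.sym (⟪evaluate⟫ x CE.f φ)))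

      module Iterates (M : ℕ) (X : Poly.FormalSum → Poly.FormalSum → ℕ → ℕ → Poly.FormalSum) (X′ : FormalSum → FormalSum → ℕ → ℕ → FormalSum)
        (X-hom : ∀ x i κ → evaluate x (X CE.f CE.Δ i κ) ∼ X′ (evaluate x CE.f) (evaluate x CE.Δ) i κ)
        (iterate : ℕ → ℕ → ℕ → Poly.FormalSum) (iterate-0 : ∀ i κ → iterate 0 i κ ≡ X CE.f CE.Δ i κ)
        (iterate-suc : ∀ r i κ → iterate (suc r) i κ ≡ MP.mul (downFrom M) (λ i j → Poly.frobenius p (iterate r i j)) (X CE.f CE.Δ) i κ) where

        evaluate-iterate : ∀ r x i κ → i ℕ.< M → evaluate x (iterate r i κ) ∼ AB.product X′ M (suc r) (fs x) (Δs x) i κ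
        evaluate-iterate zero x i κ i<M = B.trans (B.reflexive (≡.cong (evaluate x) (iterate-0 i κ))) (B.trans (X-hom x i κ) (B.sym
          (B.trans (∑B.∑<-single M i {λ k → MB.δ i k ⊗ X′ (fs x 0) (Δs x 0) k κ} i<M
              (λ k _ k≢i → B.trans (B.*-congʳ {X′ (fs x 0) (Δs x 0) k κ} (MB.δ-≢ i k (k≢i ∘ ≡.sym))) (B.zeroˡ (X′ (fs x 0) (Δs x 0) k κ))))
            (B.trans (B.*-congʳ {X′ (fs x 0) (Δs x 0) i κ} (MB.δ-refl i)) (B.*-identityˡ (X′ (fs x 0) (Δs x 0) i κ))))))
        evaluate-iterate (suc r) x i κ i<M = B.trans (B.reflexive (≡.cong (evaluate x) (iterate-suc r i κ)))
          (B.trans (Hom.ψ-∑ x (downFrom M) (λ k → Poly.frobenius p (iterate r i k) Poly.⊗ X CE.f CE.Δ k κ))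
            (∑B.∑-cong (downFrom M) (λ k → B.trans (evaluate-⊗ x (Poly.frobenius p (iterate r i k)) (X CE.f CE.Δ k κ))
              (B.*-cong (B.trans (evaluate-frobenius x (iterate r i k)) (evaluate-iterate r (power x) i k i<M)) (X-hom x k κ)))))

        evaluate-trace : ∀ r x → evaluate x (MP.tr (downFrom M) (iterate r)) ∼ MB.tr (downFrom M) (AB.product X′ M (suc r) (fs x) (Δs x))
        evaluate-trace r x = B.trans (Hom.ψ-∑ x (downFrom M) (λ i → iterate r i i)) (∑B.∑<-cong M (λ i i<M → evaluate-iterate r x i i i<M))

      module IF = Iterates (suc AB.m) AP.full AB.full (λ x → Hom.ψ-full x N CE.f CE.Δ) CE.Full.iterate (λ _ _ → ≡.refl) (λ _ _ _ → ≡.refl)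
      module IK = Iterates AB.m AP.kernel AB.kernel (λ x → Hom.ψ-kernel x N CE.f CE.Δ) CE.Kernel.iterate (λ _ _ → ≡.refl) (λ _ _ _ → ≡.refl)

      fullTrace kernelTrace : Poly.FormalSum
      fullTrace   = MP.tr (downFrom (suc AB.m)) (CE.Full.iterate r)
      kernelTrace = MP.tr (downFrom AB.m) (CE.Kernel.iterate r)

      trace-identity : ∀ x → evaluate x fullTrace B.≈ evaluate x kernelTrace B.+ AB.powers (suc r) (fs x)
      trace-identity x = B.trans (IF.evaluate-trace r x) (B.trans (AB.trace-reduction (suc r) (fs x) (Δs x) (relation x) (cyclic x))
        (B.+-congʳ (B.sym (IK.evaluate-trace r x))))

      -- The product of f(x ^ (p ^ i)) ^ e over i < j. Its p ^ (N + 1)-st power is the corner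
      -- product of the elimination, and for j = r + 1 it reduces to f(x) ^ ((q - 1) / 2).
      normRoot : ℕ → Vec Carrier n → FormalSum
      normRoot zero    x = B.1#
      normRoot (suc j) x = normRoot j (power x) ⊗ (evaluate x CE.f ^ e)

      powers-normRoot : ∀ j x → AB.powers j (fs x) B.≈ normRoot j x ^ (p ℕ.^ suc N)
      powers-normRoot zero    x = B.sym (1^ᴮ (p ℕ.^ suc N))
        where
        1^ᴮ : ∀ k → B.1# ^ k B.≈ B.1#
        1^ᴮ zero    = B.refl
        1^ᴮ (suc k) = B.trans (B.*-identityˡ (B.1# ^ k)) (1^ᴮ k)
      powers-normRoot (suc j) x = B.trans (B.*-cong (powers-normRoot j (power x)) (B.trans (^-congʳ (fs x 0) exponents) (B.sym (^ᴮ-assocʳ (fs x 0) e (p ℕ.^ suc N)))))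
        (B.sym (^ᴮ-distrib-* (normRoot j (power x)) (fs x 0 ^ e) (p ℕ.^ suc N)))
        where
        exponents : p ℕ.* (e ℕ.* p ℕ.^ N) ≡ e ℕ.* p ℕ.^ suc N
        exponents = lemma p e (p ℕ.^ N)
          where
          open import Data.Nat.Tactic.RingSolver using (solve-∀)
          lemma : ∀ p e x → p ℕ.* (e ℕ.* x) ≡ e ℕ.* (p ℕ.* x)
          lemma = solve-∀

      reduction : Vec Carrier n → Carrier
      reduction x = ε (evaluate x CE.f)

      reduction-power : ∀ x → reduction (power x) ≈ reduction x ^ᴷ p
      reduction-power x = go us
        where
        monomial-^ : ∀ {n} (x : Vec Carrier n) u → monomial (power x) u ≈ monomial x u ^ᴷ p
        monomial-^ []       []       = sym (1^ p)
        monomial-^ (x ∷ xs) (u ∷ us) = trans (*-cong (trans (^ᴷ-assocʳ x p u) (trans (^ᴷ-congʳ x (ℕₚ.*-comm p u)) (sym (^ᴷ-assocʳ x u p)))) (monomial-^ xs us))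
          (sym (^ᴷ-distrib-* (x ^ᴷ u) (monomial xs us) p))
        go : ∀ us → ε (evaluate (power x) (Poly.fromMonomials us)) ≈ ε (evaluate x (Poly.fromMonomials us)) ^ᴷ p
        go []       = sym (zeroˡ _)
        go (u ∷ us) = trans (+-cong (trans (*-identityˡ _) (trans (monomial-^ x u) (^ᴷ-congˡ p (sym (*-identityˡ _))))) (go us))
          (sym (frobenius-+ (1# * monomial x u) (ε (evaluate x (Poly.fromMonomials us)))))

      ε-normRoot : ∀ j x → ε (normRoot j x) ≈ reduction x ^ᴷ level j
      ε-normRoot zero    x = ε-const (+ 1)
      ε-normRoot (suc j) x = begin
        ε (normRoot j (power x) ⊗ (evaluate x CE.f ^ e))
          ≈⟨ trans (ε-⊗ (normRoot j (power x)) (evaluate x CE.f ^ e)) (*-cong (ε-normRoot j (power x)) (ε-^ (evaluate x CE.f) e)) ⟩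
        reduction (power x) ^ᴷ level j * reduction x ^ᴷ e
          ≈⟨ *-congʳ (trans (^ᴷ-congˡ (level j) (reduction-power x)) (^ᴷ-assocʳ (reduction x) p (level j))) ⟩
        reduction x ^ᴷ (p ℕ.* level j) * reduction x ^ᴷ e
          ≈⟨ trans (*-comm _ _) (sym (^ᴷ-homo-* (reduction x) e (p ℕ.* level j))) ⟩
        reduction x ^ᴷ level (suc j) ∎
        where open import Relation.Binary.Reasoning.Setoid setoid

      const-power : ∀ c k → c ℤ.* (c ℤ.* c) ≡ c → const c ^ (p ℕ.^ k) B.≈ const c
      const-power c k c³ = B.trans (const-^ (p ℕ.^ k)) (B.reflexive (≡.cong const (fixed k)))
        where
        const-^ : ∀ k → const c ^ k B.≈ const (c ℤ.^ k)
        const-^ zero    = B.refl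
        const-^ (suc k) = B.trans (B.*-congˡ {const c} (const-^ k)) (B.sym (const-* c (c ℤ.^ k)))
        fixed : ∀ k → c ℤ.^ (p ℕ.^ k) ≡ c
        fixed zero    = ℤₚ.*-identityʳ c
        fixed (suc k) = ≡.trans (≡.sym (ℤₚ.^-*-assoc c p (p ℕ.^ k))) (≡.trans (≡.cong (ℤ._^ (p ℕ.^ k)) (cube-power c e c³)) (fixed k))

    module _ (χ : Vec Carrier n → ℤ) (χ³ : ∀ x → χ x ℤ.* (χ x ℤ.* χ x) ≡ χ x)
      (χ-reduction : ∀ x → fromℤ (χ x) ≈ ε (evaluate x (Poly.fromMonomials us)) ^ᴷ level (suc r)) where
      private
        -- The root of the corner product and χ(x) have equal reductions in K. Raising both to the p
        -- ^ (N + 1)-st power gains the precision and leaves χ(x) unchanged, because χ(x) ^ 3 = χ(x)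
        -- and p is odd.
        powers-χ : ∀ x → InF (suc (suc N)) (AB.powers (suc r) (fs x) B.- const (χ x))
        powers-χ x = F-≈ (B.+-cong (B.sym (powers-normRoot (suc r) x)) (B.-‿cong (const-power (χ x) (suc N) (χ³ x))))
          (power-lift (suc N) (normRoot (suc r) x) (const (χ x)) (trans (ε-normRoot (suc r) x) (trans (sym (χ-reduction x)) (sym (ε-const (χ x))))))

        F-∑ : ∀ {l} {A : Set} (xs : List A) (f g : A → FormalSum) → (∀ x → InF l (f x B.- g x)) → InF l (∑ᴮ xs f B.- ∑ᴮ xs g)
        F-∑ {l} []       f g h = F-≈ (B.sym (B.-‿inverseʳ B.0#)) (F-[] l)
        F-∑ {l} (x ∷ xs) f g h = F-sum (f x) (∑ᴮ xs f) (g x) (∑ᴮ xs g) (h x) (F-∑ xs f g h)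

        const-∑ : {A : Set} (xs : List A) (f : A → ℤ) → ∑ᴮ xs (const ∘ f) B.≈ const (∑ xs f)
        const-∑ []       f = B.sym const-0
        const-∑ (x ∷ xs) f = B.trans (B.+-congˡ {const (f x)} (const-∑ xs f)) (B.sym (const-+ (f x) (∑ xs f)))

        total valF valK : ℤ
        total = ∑ (points n) χ
        valF = ∑ fullTrace (λ t → proj₁ t ℤ.* values (proj₂ t))
        valK = ∑ kernelTrace (λ t → proj₁ t ℤ.* values (proj₂ t))

        SP SF SK : FormalSum
        SP = ∑ᴮ (points n) (λ x → AB.powers (suc r) (fs x))
        SF = ∑ᴮ (points n) (λ x → evaluate x fullTrace)
        SK = ∑ᴮ (points n) (λ x → evaluate x kernelTrace)

        SF≈ : SF B.≈ SK B.+ SP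
        SF≈ = B.trans (∑B.∑-cong (points n) trace-identity) (∑B.∑-+ (points n) (λ x → evaluate x kernelTrace) (λ x → AB.powers (suc r) (fs x)))

        total-congruence : InF (suc (suc N)) (const (total ℤ.- (valF ℤ.- valK)))
        total-congruence = F-≈ (B.trans (BS.solve 5 (λ k p t f v → ((k BS.:+ p) BS.:- f) BS.:+ ((BS.:- (k BS.:- v)) BS.:+ (BS.:- (p BS.:- t))) BS.:= t BS.:- (f BS.:- v)) B.refl SK SP (const total) (const valF) (const valK))
            (B.sym (B.trans (const-+ total (ℤ.- (valF ℤ.- valK))) (B.+-congˡ {const total} (B.-‿cong (const-+ valF (ℤ.- valK)))))))
          (F-++ (F-≈ (B.+-congʳ {⊖ const valF} SF≈) (points-evaluate (suc (suc N)) fullTrace))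
            (F-++ (F-⊖ (points-evaluate (suc (suc N)) kernelTrace))
              (F-⊖ (F-≈ (B.+-congˡ {SP} (B.-‿cong (const-∑ (points n) χ))) (F-∑ (points n) (λ x → AB.powers (suc r) (fs x)) (const ∘ χ) powers-χ)))))

      -- Summed over all points, the trace identity becomes a relation between three constants
      -- modulo the filtration: monomials give Teichmüller power sums and the corner products give
      -- χ. `faithful` brings it down to ℤ.
      count-congruence : (P ℤ.^ suc (suc N)) ℤD.∣ total ℤ.- (valF ℤ.- valK)
      count-congruence = faithful (suc (suc N)) (total ℤ.- (valF ℤ.- valK)) total-congruence

module PointCountApproximation (e′ n d : ℕ) (us : List (Vec ℕ n)) (us-fit : ∀ u → u ∈ us → Fits 0 (2 ℕ.* d) u)
  (pp : Prime (suc (suc e′ ℕ.+ suc e′))) where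
  open PoleOrders e′ using (p; level)
  open WeightedOperations p (suc n)
  open ListSum ℤₚ.+-*-commutativeRing
  open import Data.Integer.Tactic.RingSolver using (solve-∀)
  open ≡ using (refl; sym; trans; cong; cong₂; subst)
  private
    module Poly = Polynomials n
    module MP = Matrices Poly.monoidRing

  module _ (N : ℕ) where
    private
      module CE = CartierMatrix.Elimination e′ n d pp us us-fit N
      m : ℕ
      m = level (suc N)

    modePair : Vec Bool n → Pair (suc (2 ℕ.* d) ℕ.^ n)
    modePair S = signedScale S (CE.Full.weighted S , CE.Kernel.weighted S)

    abstract
      approximation : Pair (length (allModes n) ℕ.* suc (2 ℕ.* d) ℕ.^ n)
      approximation = combine (allModes n) modePair

      approximation-sum : ∀ r → difference approximation r ≡ ∑ (allModes n) (λ S → difference (modePair S) r)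
      approximation-sum = combine-difference (allModes n) modePair

    module _ {q : ℕ} (K : FiniteField q) (r : ℕ) (q≡ : q ≡ p ℕ.^ suc r) where
      open FiniteField K using (Carrier; _≈_)
      open IntegerSolver (FiniteField.commRing K) using (fromℤ)
      open import Algebra.Properties.Semiring.Exp (FiniteField.semiring K) using () renaming (_^_ to _^ᴷ_)
      open Teichmuller K (suc e′ ℕ.+ suc e′) pp r q≡ using (q-1; suc-q-1; ε)
      open CharacteristicP K (suc e′ ℕ.+ suc e′) pp r q≡ using (2≤p)
      open TeichmullerSums K (suc e′ ℕ.+ suc e′) pp r q≡
      private
        fullTrace kernelTrace : Poly.FormalSum
        fullTrace   = MP.tr (downFrom (suc m)) (CE.Full.iterate r)
        kernelTrace = MP.tr (downFrom m) (CE.Kernel.iterate r)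

        instance
          q-1≢0 : ℕ.NonZero q-1
          q-1≢0 = ℕ.>-nonZero (ℕₚ.≤-pred (subst (2 ℕ.≤_) (trans (sym q≡) (sym suc-q-1)) (ℕₚ.≤-trans 2≤p (ℕₚ.m≤m*n p (p ℕ.^ r) {{ℕₚ.m^n≢0 p r}}))))

        +q : + q ≡ P ℤ.^ suc r
        +q = trans (cong +_ q≡) (pos-^ (suc r))
          where
          pos-^ : ∀ k → + (p ℕ.^ k) ≡ P ℤ.^ k
          pos-^ zero    = refl
          pos-^ (suc k) = trans (ℤₚ.pos-* p (p ℕ.^ k)) (cong (P ℤ.*_) (pos-^ k))

        values-point : ∀ {n} (u : Vec ℕ n) → values u ≡ pointValue q-1 (P ℤ.^ suc r) u
        values-point []       = refl
        values-point (u ∷ us) = cong₂ ℤ._*_ (cong (λ x → x ℤ.* multipleIndicator q-1 false u ℤ.- multipleIndicator q-1 true u) +q) (values-point us)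

        weighted-sum : ∀ (a : Poly.FormalSum) → ∑ a (λ t → proj₁ t ℤ.* values (proj₂ t)) ≡
          ∑ (allModes n) (λ S → signWeight S (P ℤ.^ suc r) ℤ.* Poly.⟪ a ⟫ (Boxes.indicators q-1 S))
        weighted-sum a = trans (Poly.⟪⟫-cong a (λ u → trans (values-point u) (pointValue-modes q-1 (P ℤ.^ suc r) u)))
          (trans (Poly.⟪⟫-∑ a (allModes n) (λ S u → signWeight S (P ℤ.^ suc r) ℤ.* Boxes.indicators q-1 S u))
            (∑-cong (allModes n) (λ S → Poly.⟪⟫-* a (signWeight S (P ℤ.^ suc r)) (Boxes.indicators q-1 S))))

        approximation-difference : ∑ fullTrace (λ t → proj₁ t ℤ.* values (proj₂ t)) ℤ.- ∑ kernelTrace (λ t → proj₁ t ℤ.* values (proj₂ t)) ≡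
          difference approximation r
        approximation-difference = trans (cong₂ ℤ._-_ (weighted-sum fullTrace) (weighted-sum kernelTrace))
          (trans (sym (∑-- (allModes n) (term fullTrace) (term kernelTrace)))
            (sym (trans (approximation-sum r) (∑-cong (allModes n) mode))))
          where
          term : Poly.FormalSum → Vec Bool n → ℤ
          term a S = signWeight S (P ℤ.^ suc r) ℤ.* Poly.⟪ a ⟫ (Boxes.indicators q-1 S)
          distribute : ∀ w a b → w ℤ.* (a ℤ.- b) ≡ w ℤ.* a ℤ.- w ℤ.* b
          distribute = solve-∀
          mode : ∀ S → difference (modePair S) r ≡ term fullTrace S ℤ.- term kernelTrace S
          mode S = trans (signedScale-difference S (CE.Full.weighted S , CE.Kernel.weighted S) r)
            (trans (distribute (signWeight S (P ℤ.^ suc r)) (WeightedMatrix.traces (CE.Full.weighted S) r) (WeightedMatrix.traces (CE.Kernel.weighted S) r))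
              (cong₂ (λ a b → signWeight S (P ℤ.^ suc r) ℤ.* a ℤ.- signWeight S (P ℤ.^ suc r) ℤ.* b)
                (CE.Full.traces-iterate S r q-1 (trans suc-q-1 q≡)) (CE.Kernel.traces-iterate S r q-1 (trans suc-q-1 q≡))))

      approximation-congruence : (χ : Vec Carrier n → ℤ) → (∀ x → χ x ℤ.* (χ x ℤ.* χ x) ≡ χ x) →
        (∀ x → fromℤ (χ x) ≈ (ε (evaluate x (Poly.fromMonomials us)) ^ᴷ level (suc r))) →
        (P ℤ.^ N) ℤD.∣ ∑ (points n) χ ℤ.- difference approximation r
      approximation-congruence χ χ³ χ-reduction = subst (λ x → (P ℤ.^ N) ℤD.∣ ∑ (points n) χ ℤ.- x) approximation-difference
        (ℤD.∣-trans (ℤD.∣n⇒∣m*n P (ℤD.∣n⇒∣m*n P ℤD.∣-refl)) (PointCount.AtPrecision.count-congruence e′ n d us us-fit pp K r q≡ N χ χ³ χ-reduction))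

-- The second moment as a character sum

module SecondMomentSum {q : ℕ} (K : FiniteField q) (P Q : ZPoly) where
  open FiniteField K hiding (zero; _+_; _*_; -_; _-_)
  private module 𝕂 = FiniteField K
  open FieldFacts K
  open ListSum ℤₚ.+-*-commutativeRing
  open import Data.Integer.Base using (_+_; _*_; _-_; -_; 1ℤ; ∣_∣)
  open import Data.Integer.Tactic.RingSolver using (solve-∀)
  open ≡ using (cong; cong₂; subst)
  private
    module E = ≡

  rhs : Carrier → Carrier → Carrier
  rhs k x = (evalK K P x 𝕂.* k) 𝕂.+ evalK K Q x

  -- The quadratic character of the right-hand side.
  residual : Carrier → Carrier → ℤ
  residual k x = + length (squareRoots (rhs k x)) - 1ℤ

  private
    sumFinℤ-∑ : ∀ {n} (enum : Fin n → Carrier) (f : Fin n → ℤ) (g : Carrier → ℤ) → (∀ i → f i ≡ g (enum i)) → sumFinℤ n f ≡ ∑ (List.tabulate enum) g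
    sumFinℤ-∑ {zero}  enum f g h = E.refl
    sumFinℤ-∑ {suc n} enum f g h = cong₂ _+_ (h Fin.zero) (sumFinℤ-∑ (enum ∘ Fin.suc) (f ∘ Fin.suc) g (h ∘ Fin.suc))

    sumFinℕ-∑ : ∀ {n} (enum : Fin n → Carrier) (f : Fin n → ℕ) (g : Carrier → ℤ) → (∀ i → + f i ≡ g (enum i)) → + sumFinℕ n f ≡ ∑ (List.tabulate enum) g
    sumFinℕ-∑ {zero}  enum f g h = E.refl
    sumFinℕ-∑ {suc n} enum f g h = E.trans (ℤₚ.pos-+ (f Fin.zero) (sumFinℕ n (f ∘ Fin.suc)))
      (cong₂ _+_ (h Fin.zero) (sumFinℕ-∑ (enum ∘ Fin.suc) (f ∘ Fin.suc) g (h ∘ Fin.suc)))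

    sumFinℕ-filter : ∀ {n} (enum : Fin n → Carrier) {R : Carrier → Set} (R? : ∀ y → Dec (R y)) →
      sumFinℕ n (λ j → if does (R? (enum j)) then 1 else 0) ≡ length (List.filter R? (List.tabulate enum))
    sumFinℕ-filter {zero}  enum R? = E.refl
    sumFinℕ-filter {suc n} enum R? with does (R? (enum Fin.zero))
    ... | true  = cong suc (sumFinℕ-filter (enum ∘ Fin.suc) R?)
    ... | false = sumFinℕ-filter (enum ∘ Fin.suc) R?

    ∑-one : ∀ {n} (enum : Fin n → Carrier) → ∑ (List.tabulate enum) (λ _ → 1ℤ) ≡ + n
    ∑-one {zero}  enum = E.refl
    ∑-one {suc n} enum = cong (_+_ 1ℤ) (∑-one (enum ∘ Fin.suc))

  aCoeff-∑ : ∀ k → aCoeff K P Q k ≡ - ∑ elems (residual k)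
  aCoeff-∑ k = E.trans (cong₂ _-_ (E.sym (∑-one enum)) (sumFinℕ-∑ enum _ (λ x → + length (squareRoots (rhs k x)))
      (λ i → cong +_ (sumFinℕ-filter enum (λ y → (y 𝕂.* y) ≈? rhs k (enum i))))))
    (E.trans (lemma (∑ elems (λ _ → 1ℤ)) (∑ elems (λ x → + length (squareRoots (rhs k x)))))
      (cong -_ (E.sym (∑-- elems (λ x → + length (squareRoots (rhs k x))) (λ _ → 1ℤ)))))
    where
    lemma : ∀ a b → a - b ≡ - (b - a)
    lemma = solve-∀

  secondMoment-∑ : secondMoment K P Q ≡ ∑ elems (λ k → ∑ elems (λ x → ∑ elems (λ x′ → residual k x * residual k x′)))
  secondMoment-∑ = E.trans (sumFinℤ-∑ enum _ (λ k → aCoeff K P Q k * aCoeff K P Q k) (λ i → E.refl))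
    (∑-cong elems (λ k → E.trans (cong₂ _*_ (aCoeff-∑ k) (aCoeff-∑ k)) (E.trans (lemma (∑ elems (residual k))) (∑-*∑ elems elems (residual k) (residual k)))))
    where
    lemma : ∀ a → (- a) * (- a) ≡ a * a
    lemma = solve-∀

  private
    ∣∑∣≤ : ∀ {n} (enum : Fin n → Carrier) (f : Carrier → ℤ) B → (∀ x → ∣ f x ∣ ℕ.≤ B) → ∣ ∑ (List.tabulate enum) f ∣ ℕ.≤ n ℕ.* B
    ∣∑∣≤ {zero}  enum f B h = z≤n
    ∣∑∣≤ {suc n} enum f B h = ℕₚ.≤-trans (ℤₚ.∣i+j∣≤∣i∣+∣j∣ (f (enum Fin.zero)) (∑ (List.tabulate (enum ∘ Fin.suc)) f))
      (ℕₚ.+-mono-≤ (h (enum Fin.zero)) (∣∑∣≤ (enum ∘ Fin.suc) f B h))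

  ∣secondMoment∣≤ : (∀ k x → ∣ residual k x ∣ ℕ.≤ 1) → ∣ secondMoment K P Q ∣ ℕ.≤ q ℕ.^ 3
  ∣secondMoment∣≤ h = subst (λ s → ∣ s ∣ ℕ.≤ q ℕ.^ 3) (E.sym secondMoment-∑)
    (∣∑∣≤ enum _ (q ℕ.^ 2) (λ k → ∣∑∣≤ enum _ (q ℕ.^ 1) (λ x → ∣∑∣≤ enum _ 1 (λ x′ →
      subst (ℕ._≤ 1) (E.sym (ℤₚ.abs-* (residual k x) (residual k x′))) (ℕₚ.*-mono-≤ (h k x) (h k x′))))))

module ResidueMonomials (p : ℕ) .{{_ : ℕ.NonZero p}} where
  open import Data.Integer.DivMod using (_%ℕ_)
  open import Data.List.Membership.Propositional.Properties using (∈-++⁻; ∈-map⁻; ∈-concatMap⁻)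

  -- A coefficient c becomes c mod p copies of its monomial. Only values in fields of characteristic
  -- p are compared, so the residue is enough, and it is nonnegative.
  exponents : List ℤ → List ℕ
  exponents []       = []
  exponents (c ∷ cs) = List.replicate (c %ℕ p) 0 ++ map suc (exponents cs)

  private
    ∈-replicate : ∀ k {u} → u ∈ List.replicate k 0 → u ≡ 0
    ∈-replicate (suc k) (here eq)  = eq
    ∈-replicate (suc k) (there u∈) = ∈-replicate k u∈

  ∈-exponents : ∀ cs {u} → u ∈ exponents cs → u ℕ.≤ length cs
  ∈-exponents (c ∷ cs) u∈ with ∈-++⁻ (List.replicate (c %ℕ p) 0) u∈
  ... | inj₁ u∈zeros rewrite ∈-replicate (c %ℕ p) u∈zeros = z≤n
  ... | inj₂ u∈map with ∈-map⁻ suc u∈map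
  ...   | v , v∈ , ≡.refl = s≤s (∈-exponents cs v∈)

  family₁ family₂ : List ℤ → List ℤ → List (Vec ℕ 3)
  family₁ P Q = map (λ i → 1 ∷ i ∷ 0 ∷ []) (exponents P) ++ map (λ i → 0 ∷ i ∷ 0 ∷ []) (exponents Q)
  family₂ P Q = map (λ i → 1 ∷ 0 ∷ i ∷ []) (exponents P) ++ map (λ i → 0 ∷ 0 ∷ i ∷ []) (exponents Q)

  -- The monomials of (k P(x) + Q(x)) (k P(x′) + Q(x′)) in the variables (k, x, x′).
  product : List ℤ → List ℤ → List (Vec ℕ 3)
  product P Q = concatMap (λ u → map (Vec.zipWith ℕ._+_ u) (family₂ P Q)) (family₁ P Q)

  degree : List ℤ → List ℤ → ℕ
  degree P Q = suc (length P ℕ.+ length Q)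

  product-fits : ∀ P Q u → u ∈ product P Q → Fits 0 (2 ℕ.* degree P Q) u
  product-fits P Q w w∈ = combined (∈-concatMap⁻ (λ u → map (Vec.zipWith ℕ._+_ u) (family₂ P Q)) {xs = family₁ P Q} w∈)
    where
    d : ℕ
    d = degree P Q
    low : ∀ {i} → i ℕ.≤ length P ⊎ i ℕ.≤ length Q → i ℕ.+ 0 ℕ.≤ d
    low {i} h rewrite ℕₚ.+-identityʳ i with h
    ... | inj₁ i≤ = ℕₚ.m≤n⇒m≤1+n (ℕₚ.≤-trans i≤ (ℕₚ.m≤m+n (length P) (length Q)))
    ... | inj₂ i≤ = ℕₚ.m≤n⇒m≤1+n (ℕₚ.≤-trans i≤ (ℕₚ.m≤n+m (length Q) (length P)))
    fits₁ : ∀ u → u ∈ family₁ P Q → Fits 0 d u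
    fits₁ u u∈ with ∈-++⁻ (map (λ i → 1 ∷ i ∷ 0 ∷ []) (exponents P)) u∈
    ... | inj₁ h with ∈-map⁻ (λ i → 1 ∷ i ∷ 0 ∷ []) h
    ...   | i , i∈ , ≡.refl = s≤s z≤n , low (inj₁ (∈-exponents P i∈)) , z≤n , tt
    fits₁ u u∈ | inj₂ h with ∈-map⁻ (λ i → 0 ∷ i ∷ 0 ∷ []) h
    ...   | i , i∈ , ≡.refl = z≤n , low (inj₂ (∈-exponents Q i∈)) , z≤n , tt
    fits₂ : ∀ u → u ∈ family₂ P Q → Fits 0 d u
    fits₂ u u∈ with ∈-++⁻ (map (λ i → 1 ∷ 0 ∷ i ∷ []) (exponents P)) u∈
    ... | inj₁ h with ∈-map⁻ (λ i → 1 ∷ 0 ∷ i ∷ []) h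
    ...   | i , i∈ , ≡.refl = s≤s z≤n , z≤n , low (inj₁ (∈-exponents P i∈)) , tt
    fits₂ u u∈ | inj₂ h with ∈-map⁻ (λ i → 0 ∷ 0 ∷ i ∷ []) h
    ...   | i , i∈ , ≡.refl = z≤n , z≤n , low (inj₂ (∈-exponents Q i∈)) , tt
    add : ∀ {n} (u v : Vec ℕ n) → Fits 0 d u → Fits 0 d v → Fits 0 (2 ℕ.* d) (Vec.zipWith ℕ._+_ u v)
    add []       []       _          _          = tt
    add (a ∷ u) (b ∷ v) (a≤ , hu) (b≤ , hv) = ℕₚ.≤-trans (ℕₚ.≤-reflexive (lemma a b)) (ℕₚ.≤-trans (ℕₚ.+-mono-≤ a≤ b≤) (ℕₚ.≤-reflexive (≡.cong (d ℕ.+_) (≡.sym (ℕₚ.+-identityʳ d))))) , add u v hu hv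
      where
      open import Data.Nat.Tactic.RingSolver using (solve-∀)
      lemma : ∀ a b → a ℕ.+ b ℕ.+ 0 ≡ (a ℕ.+ 0) ℕ.+ (b ℕ.+ 0)
      lemma = solve-∀
    combined : Any.Any (λ u → w ∈ map (Vec.zipWith ℕ._+_ u) (family₂ P Q)) (family₁ P Q) → Fits 0 (2 ℕ.* d) w
    combined any with find any
      where open import Data.List.Membership.Propositional using (find)
    ... | u , u∈ , w∈map with ∈-map⁻ (Vec.zipWith ℕ._+_ u) w∈map
    ...   | v , v∈ , ≡.refl = add u v (fits₁ u u∈) (fits₂ v v∈)

module MomentCharacter (e′ : ℕ) (pp : Prime (suc (suc e′ ℕ.+ suc e′))) {q : ℕ} (K : FiniteField q) (r : ℕ) (q≡ : q ≡ suc (suc e′ ℕ.+ suc e′) ℕ.^ suc r) (P Q : ZPoly) where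
  open PoleOrders e′ using (level)
  open FiniteField K hiding (zero)
  open FieldFacts K
  private
    m : ℕ
    m = suc e′ ℕ.+ suc e′
  open CharacteristicP K m pp r q≡
  open Teichmuller K m pp r q≡ using (ε)
  open TeichmullerSums K m pp r q≡
  open ListSum commRing
  open ListSum ℤₚ.+-*-commutativeRing using () renaming (∑ to ∑ᶻ)
  open IntegerSolver commRing using (solve; _:=_; _:+_; _:*_; _:-_; :-_; con; fromℤ; fromℤ-+; fromℤ-*; fromℤ--)
  open import Algebra.Properties.CommutativeSemiring.Exp commutativeSemiring using (^-distrib-*)
  open import Algebra.Properties.Semiring.Exp semiring using (_^_; ^-congˡ)
  open import Data.Integer.DivMod using (_%ℕ_; _/ℕ_; a≡a%ℕn+[a/ℕn]*n)
  open import Relation.Binary.Reasoning.Setoid setoid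
  open ResidueMonomials p
  open SecondMomentSum K P Q
  private module Poly = Polynomials 3

  -- One less than (q - 1) / 2, written so that `suc E′` computes to `level (suc r)`.
  E′ : ℕ
  E′ = e′ ℕ.+ p ℕ.* level r

  level-double : ∀ N → suc (level N ℕ.+ level N) ≡ p ℕ.^ N
  level-double zero    = ≡.refl
  level-double (suc N) = ≡.trans (lemma (suc e′) (level N)) (≡.cong (p ℕ.*_) (level-double N))
    where
    open import Data.Nat.Tactic.RingSolver using (solve-∀)
    lemma : ∀ e l → suc ((e ℕ.+ suc (e ℕ.+ e) ℕ.* l) ℕ.+ (e ℕ.+ suc (e ℕ.+ e) ℕ.* l)) ≡ suc (e ℕ.+ e) ℕ.* suc (l ℕ.+ l)
    lemma = solve-∀

  open QuadraticCharacter K E′ (≡.trans (level-double (suc r)) (≡.sym q≡))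

  private
    small : ∀ n → n ℕ.≤ 2 → + n ℤ.- + 1 ≡ -[1+ 0 ] ⊎ + n ℤ.- + 1 ≡ + 0 ⊎ + n ℤ.- + 1 ≡ + 1
    small 0 _ = inj₁ ≡.refl
    small 1 _ = inj₂ (inj₁ ≡.refl)
    small 2 _ = inj₂ (inj₂ ≡.refl)
    small (suc (suc (suc _))) (s≤s (s≤s ()))

    cases : ∀ k x → residual k x ≡ -[1+ 0 ] ⊎ residual k x ≡ + 0 ⊎ residual k x ≡ + 1
    cases k x = small (length (squareRoots (rhs k x))) (squareRoots≤2 (rhs k x))

  ∣residual∣≤1 : ∀ k x → ℤ.∣ residual k x ∣ ℕ.≤ 1
  ∣residual∣≤1 k x = go (cases k x)
    where
    go : ∀ {a} → a ≡ -[1+ 0 ] ⊎ a ≡ + 0 ⊎ a ≡ + 1 → ℤ.∣ a ∣ ℕ.≤ 1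
    go (inj₁ ≡.refl)        = ℕₚ.≤-refl
    go (inj₂ (inj₁ ≡.refl)) = z≤n
    go (inj₂ (inj₂ ≡.refl)) = ℕₚ.≤-refl

  residual-reduction : ∀ k x → fromℤ (residual k x) ≈ rhs k x ^ level (suc r)
  residual-reduction k x = begin
    fromℤ (residual k x)         ≈⟨ fromℤ-+ (+ n) (ℤ.- + 1) ⟩
    fromℤ (+ n) + fromℤ (ℤ.- + 1)   ≈⟨ +-cong (trans (fromℤ-pos n) (ι-squareRoots (rhs k x))) (fromℤ-- (+ 1)) ⟩
    (1# + z) + - 1#              ≈⟨ solve 1 (λ z → (con (+ 1) :+ z) :+ (:- con (+ 1)) := z) refl z ⟩
    z ∎
    where
    n : ℕ
    n = length (squareRoots (rhs k x))
    z : Carrier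
    z = rhs k x ^ level (suc r)

  χ : Vec Carrier 3 → ℤ
  χ (k ∷ x ∷ x′ ∷ []) = residual k x ℤ.* residual k x′

  χ³ : ∀ v → χ v ℤ.* (χ v ℤ.* χ v) ≡ χ v
  χ³ (k ∷ x ∷ x′ ∷ []) = ≡.trans (lemma (residual k x) (residual k x′)) (≡.cong₂ ℤ._*_ (cube (cases k x)) (cube (cases k x′)))
    where
    open import Data.Integer.Tactic.RingSolver using (solve-∀)
    lemma : ∀ a b → (a ℤ.* b) ℤ.* ((a ℤ.* b) ℤ.* (a ℤ.* b)) ≡ (a ℤ.* (a ℤ.* a)) ℤ.* (b ℤ.* (b ℤ.* b))
    lemma = solve-∀
    cube : ∀ {a} → a ≡ -[1+ 0 ] ⊎ a ≡ + 0 ⊎ a ≡ + 1 → a ℤ.* (a ℤ.* a) ≡ a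
    cube (inj₁ ≡.refl)        = ≡.refl
    cube (inj₂ (inj₁ ≡.refl)) = ≡.refl
    cube (inj₂ (inj₂ ≡.refl)) = ≡.refl

  ∑-χ : ∑ᶻ (points 3) χ ≡ secondMoment K P Q
  ∑-χ = ≡.trans (split 2 χ) (≡.trans (Z.∑-cong elems (λ k → ≡.trans (split 1 (χ ∘ (k ∷_))) (Z.∑-cong elems (λ x → ≡.trans (split 0 (λ v → χ (k ∷ x ∷ v)))
      (Z.∑-cong elems (λ x′ → ℤₚ.+-identityʳ (residual k x ℤ.* residual k x′))))))) (≡.sym secondMoment-∑))
    where
    module Z = ListSum ℤₚ.+-*-commutativeRing
    split : ∀ n (f : Vec Carrier (suc n) → ℤ) → ∑ᶻ (points (suc n)) f ≡ ∑ᶻ elems (λ x → ∑ᶻ (points n) (f ∘ (x ∷_)))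
    split n f = ≡.trans (Z.∑-concatMap (λ x → map (x ∷_) (points n)) elems f) (Z.∑-cong elems (λ x → Z.∑-map (x ∷_) (points n) f))

  private
    ℤ→K-residue : ∀ c → ℤ→K K c ≈ ι (c %ℕ p)
    ℤ→K-residue c = begin
      ℤ→K K c                                         ≈⟨ ℤ→K-fromℤ c ⟩
      fromℤ c                                         ≈⟨ reflexive (≡.cong fromℤ (a≡a%ℕn+[a/ℕn]*n c p)) ⟩
      fromℤ (+ (c %ℕ p) ℤ.+ (c /ℕ p) ℤ.* + p)         ≈⟨ fromℤ-+ (+ (c %ℕ p)) ((c /ℕ p) ℤ.* + p) ⟩
      fromℤ (+ (c %ℕ p)) + fromℤ ((c /ℕ p) ℤ.* + p)   ≈⟨ +-cong (fromℤ-pos (c %ℕ p)) (trans (fromℤ-* (c /ℕ p) (+ p)) (trans (*-congˡ fromℤ-p) (zeroʳ _))) ⟩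
      ι (c %ℕ p) + 0#                                 ≈⟨ +-identityʳ _ ⟩
      ι (c %ℕ p)                                      ∎
      where
      ℤ→K-fromℤ : ∀ c → ℤ→K K c ≈ fromℤ c
      ℤ→K-fromℤ (+ n)    = sym (fromℤ-pos n)
      ℤ→K-fromℤ -[1+ n ] = trans (-‿cong (sym (fromℤ-pos (suc n)))) (sym (fromℤ-- (+ suc n)))

    ∑-exponents : ∀ cs x → ∑ (exponents cs) (x ^_) ≈ evalK K cs x
    ∑-exponents []       x = refl
    ∑-exponents (c ∷ cs) x = begin
      ∑ (List.replicate (c %ℕ p) 0 ++ map suc (exponents cs)) (x ^_)
        ≈⟨ ∑-++ (List.replicate (c %ℕ p) 0) (map suc (exponents cs)) (x ^_) ⟩
      ∑ (List.replicate (c %ℕ p) 0) (x ^_) + ∑ (map suc (exponents cs)) (x ^_)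
        ≈⟨ +-cong (trans (ones (c %ℕ p)) (sym (ℤ→K-residue c))) (trans (∑-map suc (exponents cs) (x ^_)) (∑-*ˡ (exponents cs) x (x ^_))) ⟩
      ℤ→K K c + x * ∑ (exponents cs) (x ^_)
        ≈⟨ +-congˡ (*-congˡ (∑-exponents cs x)) ⟩
      ℤ→K K c + x * evalK K cs x ∎
      where
      ones : ∀ k → ∑ (List.replicate k 0) (x ^_) ≈ ι k
      ones zero    = refl
      ones (suc k) = +-congˡ (ones k)

    ∑-family : ∀ (k x : Carrier) (g h : ℕ → Vec ℕ 3) (v : Vec Carrier 3) → (∀ i → monomial v (g i) ≈ k * x ^ i) → (∀ i → monomial v (h i) ≈ x ^ i) →
      ∑ (map g (exponents P) ++ map h (exponents Q)) (monomial v) ≈ rhs k x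
    ∑-family k x g h v eq-g eq-h = trans (∑-++ (map g (exponents P)) (map h (exponents Q)) (monomial v)) (+-cong
      (trans (∑-map g (exponents P) (monomial v)) (trans (∑-cong (exponents P) eq-g) (trans (∑-*ˡ (exponents P) k (x ^_)) (trans (*-comm k _) (*-congʳ (∑-exponents P x))))))
      (trans (∑-map h (exponents Q) (monomial v)) (trans (∑-cong (exponents Q) eq-h) (∑-exponents Q x))))

    ∑-product : ∀ k x x′ → ∑ (product P Q) (monomial (k ∷ x ∷ x′ ∷ [])) ≈ rhs k x * rhs k x′
    ∑-product k x x′ = begin
      ∑ (product P Q) (monomial v)
        ≈⟨ ∑-concatMap (λ u → map (Vec.zipWith ℕ._+_ u) (family₂ P Q)) (family₁ P Q) (monomial v) ⟩
      ∑ (family₁ P Q) (λ u → ∑ (map (Vec.zipWith ℕ._+_ u) (family₂ P Q)) (monomial v))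
        ≈⟨ ∑-cong (family₁ P Q) (λ u → trans (∑-map (Vec.zipWith ℕ._+_ u) (family₂ P Q) (monomial v)) (∑-cong (family₂ P Q) (monomial-+ v u))) ⟩
      ∑ (family₁ P Q) (λ u → ∑ (family₂ P Q) (λ w → monomial v u * monomial v w))
        ≈⟨ ∑-*∑ (family₁ P Q) (family₂ P Q) (monomial v) (monomial v) ⟨
      ∑ (family₁ P Q) (monomial v) * ∑ (family₂ P Q) (monomial v)
        ≈⟨ *-cong
             (∑-family k x _ _ v
               (λ i → solve 2 (λ k y → (k :* con (+ 1)) :* (y :* (con (+ 1) :* con (+ 1))) := k :* y) refl k (x ^ i))
               (λ i → solve 1 (λ y → con (+ 1) :* (y :* (con (+ 1) :* con (+ 1))) := y) refl (x ^ i)))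
             (∑-family k x′ _ _ v
               (λ i → solve 2 (λ k y → (k :* con (+ 1)) :* (con (+ 1) :* (y :* con (+ 1))) := k :* y) refl k (x′ ^ i))
               (λ i → solve 1 (λ y → con (+ 1) :* (con (+ 1) :* (y :* con (+ 1))) := y) refl (x′ ^ i))) ⟩
      rhs k x * rhs k x′ ∎
      where
      v : Vec Carrier 3
      v = k ∷ x ∷ x′ ∷ []

    ε-evaluate : ∀ {n} (v : Vec Carrier n) us → ε (evaluate v (Polynomials.fromMonomials n us)) ≈ ∑ us (monomial v)
    ε-evaluate v []       = refl
    ε-evaluate v (u ∷ us) = +-cong (*-identityˡ (monomial v u)) (ε-evaluate v us)

  χ-reduction : ∀ v → fromℤ (χ v) ≈ ε (evaluate v (Poly.fromMonomials (product P Q))) ^ level (suc r)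
  χ-reduction v@(k ∷ x ∷ x′ ∷ []) = begin
    fromℤ (residual k x ℤ.* residual k x′)
      ≈⟨ trans (fromℤ-* (residual k x) (residual k x′)) (*-cong (residual-reduction k x) (residual-reduction k x′)) ⟩
    rhs k x ^ level (suc r) * rhs k x′ ^ level (suc r)
      ≈⟨ ^-distrib-* (rhs k x) (rhs k x′) (level (suc r)) ⟨
    (rhs k x * rhs k x′) ^ level (suc r)
      ≈⟨ ^-congˡ (level (suc r)) (trans (sym (∑-product k x x′)) (sym (ε-evaluate v (product P Q)))) ⟩
    ε (evaluate v (Poly.fromMonomials (product P Q))) ^ level (suc r) ∎

-- Characteristic two and the conclusion

module EvenOrder {q : ℕ} (K : FiniteField q) (h : ℕ) (q≡ : q ≡ h ℕ.+ h) where
  open FiniteField K hiding (zero)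
  open FieldFacts K
  open ListSum ℤₚ.+-*-commutativeRing
  open OverRing ℤₚ.+-*-commutativeRing using (single)
  open import Algebra.Properties.Semiring.Exp semiring using (_^_; ^-congˡ; ^-congʳ; ^-homo-*)
  open import Algebra.Properties.CommutativeSemiring.Exp commutativeSemiring using (^-distrib-*)

  private
    -- For q = 2 h one has y = y ^ q = (y ^ 2) ^ h.
    root-unique : ∀ {y z} → y * y ≈ z → y ≈ z ^ h
    root-unique {y} {z} yy≈z = trans (sym (trans (^-congʳ y (≡.sym q≡)) (fermat y)))
      (trans (^-homo-* y h h) (trans (sym (^-distrib-* y y h)) (^-congˡ h yy≈z)))

    root-exists : ∀ z → z ^ h * z ^ h ≈ z
    root-exists z = trans (sym (^-homo-* z h h)) (trans (^-congʳ z (≡.sym q≡)) (fermat z))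

    indicator : Carrier → Carrier → ℤ
    indicator z y = if does ((y * y) ≈? z) then + 1 else + 0

    indicator-root : ∀ {z y} → y * y ≈ z → indicator z y ≡ + 1
    indicator-root {z} {y} eq with (y * y) ≈? z
    ... | yes _ = ≡.refl
    ... | no ne = ⊥-elim (ne eq)

    indicator-other : ∀ {z y} → ¬ y * y ≈ z → indicator z y ≡ + 0
    indicator-other {z} {y} ne with (y * y) ≈? z
    ... | yes eq = ⊥-elim (ne eq)
    ... | no _   = ≡.refl

    indicator-cong : ∀ {z x y} → x ≈ y → indicator z x ≡ indicator z y
    indicator-cong {z} {x} {y} x≈y with (x * x) ≈? z
    ... | yes eq = ≡.sym (indicator-root (trans (*-cong (sym x≈y) (sym x≈y)) eq))
    ... | no ne  = ≡.sym (indicator-other (λ eq → ne (trans (*-cong x≈y x≈y) eq)))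

    counted : ∀ z ys → + length (List.filter (λ y → (y * y) ≈? z) ys) ≡ ∑ ys (indicator z)
    counted z []       = ≡.refl
    counted z (y ∷ ys) with does ((y * y) ≈? z)
    ... | true  = ≡.cong (ℤ._+_ (+ 1)) (counted z ys)
    ... | false = ≡.trans (counted z ys) (≡.sym (ℤₚ.+-identityˡ _))

  one-squareRoot : ∀ z → + length (squareRoots z) ≡ + 1
  one-squareRoot z = ≡.trans (counted z elems) (≡.trans
    (single (z ^ h) (indicator z) indicator-cong (λ y y≉ → indicator-other (λ eq → y≉ (root-unique eq)))) (indicator-root (root-exists z)))

  secondMoment-even : ∀ P Q → secondMoment K P Q ≡ + 0
  secondMoment-even P Q = ≡.trans secondMoment-∑ (∑-zero elems (λ k → ∑-zero elems (λ x → ∑-zero elems (λ x′ →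
      ≡.trans (≡.cong (ℤ._* residual k x′) (≡.cong (ℤ._- + 1) (one-squareRoot (rhs k x)))) (ℤₚ.*-zeroˡ (residual k x′))))))
    where open SecondMomentSum K P Q

parity : ∀ n → (∃ λ k → n ≡ k ℕ.+ k) ⊎ (∃ λ k → n ≡ suc (k ℕ.+ k))
parity zero    = inj₁ (0 , ≡.refl)
parity (suc n) with parity n
... | inj₁ (k , ≡.refl) = inj₂ (k , ≡.refl)
... | inj₂ (k , ≡.refl) = inj₁ (suc k , ≡.cong suc (≡.sym (ℕₚ.+-suc k k)))

prime-parity : ∀ {p} → Prime p → p ≡ 2 ⊎ (∃ λ e′ → p ≡ suc (suc e′ ℕ.+ suc e′))
prime-parity {p} pp = split (parity p)
  where
  split : (∃ λ k → p ≡ k ℕ.+ k) ⊎ (∃ λ k → p ≡ suc (k ℕ.+ k)) → p ≡ 2 ⊎ (∃ λ e′ → p ≡ suc (suc e′ ℕ.+ suc e′))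
  split (inj₂ (zero , eq))   = ⊥-elim (ℕ.nonTrivial⇒≢1 {{prime⇒nonTrivial pp}} eq)
  split (inj₂ (suc e′ , eq)) = inj₂ (e′ , eq)
  split (inj₁ (k , eq)) with prime⇒irreducible pp {2} (ℕD.divides k (≡.trans eq (≡.trans (≡.cong (k ℕ.+_) (≡.sym (ℕₚ.+-identityʳ k))) (ℕₚ.*-comm 2 k))))
  ... | inj₁ ()
  ... | inj₂ 2≡p = inj₁ (≡.sym 2≡p)

module _ (P Q : ZPoly) where
  private
    zeta-rational : ∀ {c k} p → 2 ℕ.≤ p → (K : (r : ℕ) → FiniteField (p ℕ.^ suc r)) → Approximable p c k (λ r → secondMoment (K r) P Q) →
      (∀ r → ℤ.∣ secondMoment (K r) P Q ∣ ℕ.≤ (p ℕ.^ suc r) ℕ.^ 3) → IsRationalSeries (zetaSeries p K P Q)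
    zeta-rational {c} {k} p 2≤p K approx bound = ExponentialSeries.rational-of-annihilator (λ r → secondMoment (K r) P Q) _ ≡.refl (λ _ → ≡.refl)
      -- The criterion wants a bound by powers of a power of 2. Here q ^ 3 = (p ^ 3) ^ (r + 1), and
      -- p ^ 3 < 2 ^ (p ^ 3) is good enough.
      (RationalityCriterion.annihilator p c k (p ℕ.^ 3) 2≤p (λ r → secondMoment (K r) P Q) approx (λ r → ℕₚ.≤-trans (bound r) (exponential r)))
      where
      exponential : ∀ r → (p ℕ.^ suc r) ℕ.^ 3 ℕ.≤ (2 ℕ.^ (p ℕ.^ 3)) ℕ.^ suc r
      exponential r = ℕₚ.≤-trans (ℕₚ.≤-reflexive (≡.trans (ℕₚ.^-*-assoc p (suc r) 3) (≡.trans (≡.cong (p ℕ.^_) (ℕₚ.*-comm (suc r) 3)) (≡.sym (ℕₚ.^-*-assoc p 3 (suc r))))))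
        (ℕₚ.^-monoˡ-≤ (suc r) (ℕₚ.<⇒≤ (Growth.n<2^n (p ℕ.^ 3))))

  rational-at-2 : (K : (r : ℕ) → FiniteField (2 ℕ.^ suc r)) → IsRationalSeries (zetaSeries 2 K P Q)
  -- All moments are zero, so a pair of empty matrices approximates them exactly at every precision.
  rational-at-2 K = zeta-rational {0} {0} 2 ℕₚ.≤-refl K
    (λ N → WeightedOperations.empty 2 0 , WeightedOperations.empty 2 0 , λ r → ≡.subst (λ s → ((+ 2) ℤ.^ N) ℤD.∣ s ℤ.- + 0) (≡.sym (vanish r)) (ℤD.divides (+ 0) ≡.refl))
    (λ r → ≡.subst (λ s → ℤ.∣ s ∣ ℕ.≤ (2 ℕ.^ suc r) ℕ.^ 3) (≡.sym (vanish r)) z≤n)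
    where
    vanish : ∀ r → secondMoment (K r) P Q ≡ + 0
    vanish r = EvenOrder.secondMoment-even (K r) (2 ℕ.^ r) (≡.cong (2 ℕ.^ r ℕ.+_) (ℕₚ.+-identityʳ (2 ℕ.^ r))) P Q

  rational-at-odd : ∀ e′ → Prime (suc (suc e′ ℕ.+ suc e′)) → (K : (r : ℕ) → FiniteField (suc (suc e′ ℕ.+ suc e′) ℕ.^ suc r)) →
    IsRationalSeries (zetaSeries (suc (suc e′ ℕ.+ suc e′)) K P Q)
  rational-at-odd e′ pp K = zeta-rational p (s≤s (s≤s z≤n)) K
    (λ N → proj₁ (Count.approximation N) , proj₂ (Count.approximation N) , congruence N)
    (λ r → SecondMomentSum.∣secondMoment∣≤ (K r) P Q (MomentCharacter.∣residual∣≤1 e′ pp (K r) r ≡.refl P Q))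
    where
    p : ℕ
    p = suc (suc e′ ℕ.+ suc e′)
    open ResidueMonomials p
    module Count = PointCountApproximation e′ 3 (degree P Q) (product P Q) (product-fits P Q) pp
    congruence : ∀ N r → ((+ p) ℤ.^ N) ℤD.∣ secondMoment (K r) P Q ℤ.- WeightedOperations.difference p 4 (Count.approximation N) r
    congruence N r = ≡.subst (λ s → ((+ p) ℤ.^ N) ℤD.∣ s ℤ.- WeightedOperations.difference p 4 (Count.approximation N) r) ∑-χ
      (Count.approximation-congruence N (K r) r ≡.refl χ χ³ χ-reduction)
      where open MomentCharacter e′ pp (K r) r ≡.refl P Q

open import Data.Nat using (_^_)

theorem1p4 : (P Q : ZPoly) (p : ℕ) → Prime p →
    (K : (r : ℕ) → FiniteField (p ^ suc r)) →
    IsRationalSeries (zetaSeries p K P Q)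
theorem1p4 P Q p pp K = split (prime-parity pp) pp K
  where
  split : ∀ {p} → p ≡ 2 ⊎ (∃ λ e′ → p ≡ suc (suc e′ ℕ.+ suc e′)) → Prime p → (K : (r : ℕ) → FiniteField (p ^ suc r)) →
    IsRationalSeries (zetaSeries p K P Q)
  split (inj₁ ≡.refl)        pp K = rational-at-2 P Q K
  split (inj₂ (e′ , ≡.refl)) pp K = rational-at-odd P Q e′ pp K
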